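{- Let $p$ be a prime number, let $s$ be an even positive divisor of $p-1$ such that $\frac{p-1}{s}$ is odd, and let $\mathbb{K}$ be the unique subfield of $\mathbb{Q}(\zeta_p)$ with $[\mathbb{K}:\mathbb{Q}]=s$. Let $\mathcal{M}_p\subseteq\mathcal{O}_{\mathbb{K}}$ be the $\mathbb{Z}$-submodule and $\sigma$ the canonical embedding defined in the context. Then the center density of the lattice $\sigma(\mathcal{M}_p)\subset\mathbb{R}^s$ satisfies $$\delta(\sigma(\mathcal{M}_p))\geq\frac{1}{2^{s/2}\sqrt{p}}.$$
   Context: Here $\zeta_p$ is a primitive $p$-th root of unity, $\mathbb{L}=\mathbb{Q}(\zeta_p)$, and $\mathcal{O}_{\mathbb{K}}$ is the ring of algebraic integers of $\mathbb{K}$. Let $u$ be an integer whose class generates $(\mathbb{Z}/p\mathbb{Z})^{\star}$, let $\sigma_u$ be the automorphism of $\mathbb{L}$ with $\sigma_u(\zeta_p)=\zeta_p^u$, let $\theta=\sigma_u|_{\mathbb{K}}$ (a generator of $\mathrm{Gal}(\mathbb{K}/\mathbb{Q})$), and let $t=\mathrm{Tr}_{\mathbb{L}/\mathbb{K}}(\zeta_p)$. The map $(a_0,\ldots,a_{s-1})\mapsto\sum_{i=0}^{s-1}a_i\theta^i(t)$ is an isomorphism of $\mathbb{Z}$-modules $\mathbb{Z}^s\to\mathcal{O}_{\mathbb{K}}$, and through it elements ${\bf x}\in\mathcal{O}_{\mathbb{K}}$ are identified with their coordinate vectors ${\bf x}=(a_0,\ldots,a_{s-1})\in\mathbb{Z}^s$.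 Let $\beta\in\mathbb{Z}$ be a primitive root modulo $p$ (of multiplicative order $p-1$ modulo $p$), and put $\alpha=\beta^{(p-1)/s}$. For $i=0,1,\ldots,s-1$ let $\mu_i=(1,\alpha^i,\alpha^{2i},\ldots,\alpha^{(s-1)i})\in\mathbb{Z}^s$, and let $\cdot$ denote the usual dot product on $\mathbb{Z}^s$. For $s$ even, $\mathcal{M}_p=\{{\bf x}\in\mathcal{O}_{\mathbb{K}}:{\bf x}\cdot\mu_i\equiv 0\pmod p\text{ for all } i=0,1,\ldots,\frac{s}{2}\}$. Canonical embedding: let $\sigma_1,\ldots,\sigma_s$ be the embeddings $\mathbb{K}\to\mathbb{C}$, with $\sigma_1,\ldots,\sigma_{r_1}$ real and $\sigma_{r_1+1},\ldots,\sigma_{r_1+r_2}$ representatives of the $r_2$ complex-conjugate pairs of non-real ones ($s=r_1+2r_2$). Then $\sigma:\mathbb{K}\to\mathbb{R}^s$ is $\sigma(x)=(\sigma_1(x),\ldots,\sigma_{r_1}(x),\mathrm{Re}\,\sigma_{r_1+1}(x),\mathrm{Im}\,\sigma_{r_1+1}(x),\ldots,\mathrm{Re}\,\sigma_{r_1+r_2}(x),\mathrm{Im}\,\sigma_{r_1+r_2}(x))$. For a full-rank lattice $\Lambda\subset\mathbb{R}^n$, the packing radius is $\rho=\frac12\min\{\|v\|:v\in\Lambda\setminus\{0\}\}$, the volume $\mathrm{vol}(\Lambda)$ is the square root of the determinant of a Gram matrix of a $\mathbb{Z}$-basis of $\Lambda$, and the center density is $\delta(\Lambda)=\rho^n/\mathrm{vol}(\Lambda)$.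 -}

module Defs where

open import Level using (0ℓ)
open import Algebra.Bundles.Raw using (RawRing)
open import Algebra.Morphism.Structures using (module RingMorphisms)
import Algebra.Definitions.RawSemiring as RawSemiringDefs
open import Data.Nat.Base as ℕ using (ℕ; zero; suc; _⊔_)
import Data.Nat.Properties as ℕ
open import Data.Nat.DivMod using () renaming (_/_ to _/ℕ_)
open import Data.Nat.GeneralisedArithmetic using (iterate)
open import Data.Integer.Base as ℤ using (ℤ; +_; -[1+_]; 0ℤ; 1ℤ)
import Data.Integer.Divisibility as ℤ
open import Data.Rational.Base as ℚ using (ℚ; 0ℚ; 1ℚ; ½)
import Data.Rational.Properties as ℚ
import Data.Rational.Solver as ℚ
open import Data.Fin.Base using (Fin; zero; suc; toℕ; punchIn)
open import Data.Vec.Functional using (Vector; _∷_; []; _++_; concat)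
open import Data.Product.Base using (Σ; ∃; _×_; _,_; proj₁; proj₂)
open import Data.Sum.Base using (_⊎_)
open import Function.Bundles using (_⇔_)
open import Relation.Nullary using (¬_)
open import Relation.Binary.PropositionalEquality
  using (_≡_; refl; sym; cong; cong₂; subst; module ≡-Reasoning)

-- Real numbers are Cauchy sequences of rationals, with the setoid equality
-- "the difference tends to 0".

IsCauchy : (ℕ → ℚ) → Set
IsCauchy f = ∀ ε → 0ℚ ℚ.< ε → ∃ λ N → ∀ m n → N ℕ.≤ m → N ℕ.≤ n →
             ℚ.∣ f m ℚ.- f n ∣ ℚ.< ε

record ℝ : Set where
  constructor mkℝ
  field
    seq    : ℕ → ℚ
    cauchy : IsCauchy seq

open ℝ public

infix 4 _≈ᵣ_ _≤ᵣ_ _<ᵣ_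

_≈ᵣ_ : ℝ → ℝ → Set
x ≈ᵣ y = ∀ ε → 0ℚ ℚ.< ε → ∃ λ N → ∀ n → N ℕ.≤ n → ℚ.∣ seq x n ℚ.- seq y n ∣ ℚ.< ε

_≤ᵣ_ : ℝ → ℝ → Set
x ≤ᵣ y = ∀ ε → 0ℚ ℚ.< ε → ∃ λ N → ∀ n → N ℕ.≤ n → seq x n ℚ.< seq y n ℚ.+ ε

_<ᵣ_ : ℝ → ℝ → Set
x <ᵣ y = ∃ λ ε → 0ℚ ℚ.< ε × ∃ λ N → ∀ n → N ℕ.≤ n → seq x n ℚ.+ ε ℚ.< seq y n

private
  ⊔≤ˡ : ∀ {a b c} → a ⊔ b ℕ.≤ c → a ℕ.≤ c
  ⊔≤ˡ {a} {b} = ℕ.m⊔n≤o⇒m≤o a b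

  ⊔≤ʳ : ∀ {a b c} → a ⊔ b ℕ.≤ c → b ℕ.≤ c
  ⊔≤ʳ {a} {b} = ℕ.m⊔n≤o⇒n≤o a b

  half+half : ∀ ε → ½ ℚ.* ε ℚ.+ ½ ℚ.* ε ≡ ε
  half+half ε = begin
    ½ ℚ.* ε ℚ.+ ½ ℚ.* ε  ≡⟨ sym (ℚ.*-distribʳ-+ ε ½ ½) ⟩
    1ℚ ℚ.* ε             ≡⟨ ℚ.*-identityˡ ε ⟩
    ε                    ∎
    where open ≡-Reasoning

  0<* : ∀ {a b} → 0ℚ ℚ.< a → 0ℚ ℚ.< b → 0ℚ ℚ.< a ℚ.* b
  0<* {a} {b} 0<a 0<b =
    ℚ.positive⁻¹ (a ℚ.* b)
      {{ℚ.pos*pos⇒pos a {{ℚ.positive 0<a}} b {{ℚ.positive 0<b}}}}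

  abstract
    0<½ : 0ℚ ℚ.< ½
    0<½ = ℚ.positive⁻¹ ½

    0<1 : 0ℚ ℚ.< 1ℚ
    0<1 = ℚ.positive⁻¹ 1ℚ

  +-split : ∀ a b c d → (a ℚ.+ b) ℚ.- (c ℚ.+ d) ≡ (a ℚ.- c) ℚ.+ (b ℚ.- d)
  +-split = solve 4 (λ a b c d → (a :+ b) :- (c :+ d) := (a :- c) :+ (b :- d)) refl
    where open ℚ.+-*-Solver

  *-split : ∀ a b c d → (a ℚ.* b) ℚ.- (c ℚ.* d) ≡ a ℚ.* (b ℚ.- d) ℚ.+ d ℚ.* (a ℚ.- c)
  *-split = solve 4 (λ a b c d → (a :* b) :- (c :* d) := a :* (b :- d) :+ d :* (a :- c)) refl
    where open ℚ.+-*-Solver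

  neg-split : ∀ a c → (ℚ.- a) ℚ.- (ℚ.- c) ≡ ℚ.- (a ℚ.- c)
  neg-split = solve 2 (λ a c → (:- a) :- (:- c) := :- (a :- c)) refl
    where open ℚ.+-*-Solver

  recover : ∀ a b → a ≡ (a ℚ.- b) ℚ.+ b
  recover = solve 2 (λ a b → a := (a :- b) :+ b) refl
    where open ℚ.+-*-Solver

  eventually-bounded : ∀ x → ∃ λ B → 0ℚ ℚ.< B × ∃ λ N → ∀ n → N ℕ.≤ n → ℚ.∣ seq x n ∣ ℚ.< B
  eventually-bounded x with cauchy x 1ℚ 0<1
  ... | N , close = 1ℚ ℚ.+ ℚ.∣ seq x N ∣ ,
      ℚ.+-mono-<-≤ 0<1 (ℚ.0≤∣p∣ (seq x N)) , N , bound
    where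
    open ℚ.≤-Reasoning
    bound : ∀ n → N ℕ.≤ n → ℚ.∣ seq x n ∣ ℚ.< 1ℚ ℚ.+ ℚ.∣ seq x N ∣
    bound n N≤n = begin-strict
      ℚ.∣ seq x n ∣                                  ≡⟨ cong ℚ.∣_∣ (recover (seq x n) (seq x N)) ⟩
      ℚ.∣ (seq x n ℚ.- seq x N) ℚ.+ seq x N ∣        ≤⟨ ℚ.∣p+q∣≤∣p∣+∣q∣ (seq x n ℚ.- seq x N) (seq x N) ⟩
      ℚ.∣ seq x n ℚ.- seq x N ∣ ℚ.+ ℚ.∣ seq x N ∣    <⟨ ℚ.+-monoˡ-< ℚ.∣ seq x N ∣ (close n N N≤n ℕ.≤-refl) ⟩
      1ℚ ℚ.+ ℚ.∣ seq x N ∣                           ∎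

  Shrinks : ℚ → ℚ → ℚ → Set
  Shrinks B ε δ = ∀ a b → ℚ.∣ a ∣ ℚ.< B → ℚ.∣ b ∣ ℚ.< δ → ℚ.∣ a ℚ.* b ∣ ℚ.< ½ ℚ.* ε

  abstract
    shrink : ∀ B ε → 0ℚ ℚ.< B → 0ℚ ℚ.< ε → ∃ λ δ → 0ℚ ℚ.< δ × Shrinks B ε δ
    shrink B ε 0<B 0<ε = 1/B ℚ.* (½ ℚ.* ε) , 0<* 0<1/B (0<* 0<½ 0<ε) , small
      where
      open ℚ.≤-Reasoning
      1/B : ℚ
      1/B = (ℚ.1/ B) {{ℚ.>-nonZero 0<B}}
      0<1/B : 0ℚ ℚ.< 1/B
      0<1/B = ℚ.positive⁻¹ 1/B {{ℚ.1/pos⇒pos B {{ℚ.positive 0<B}}}}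
      small : Shrinks B ε (1/B ℚ.* (½ ℚ.* ε))
      small a b a<B b<δ = begin-strict
        ℚ.∣ a ℚ.* b ∣              ≡⟨ ℚ.∣p*q∣≡∣p∣*∣q∣ a b ⟩
        ℚ.∣ a ∣ ℚ.* ℚ.∣ b ∣        ≤⟨ ℚ.*-monoʳ-≤-nonNeg ℚ.∣ b ∣ {{ℚ.∣-∣-nonNeg b}} (ℚ.<⇒≤ a<B) ⟩
        B ℚ.* ℚ.∣ b ∣              <⟨ ℚ.*-monoʳ-<-pos B {{ℚ.positive 0<B}} b<δ ⟩
        B ℚ.* (1/B ℚ.* (½ ℚ.* ε))  ≡⟨ sym (ℚ.*-assoc B 1/B (½ ℚ.* ε)) ⟩
        (B ℚ.* 1/B) ℚ.* (½ ℚ.* ε)  ≡⟨ cong (ℚ._* (½ ℚ.* ε)) (ℚ.*-inverseʳ B {{ℚ.>-nonZero 0<B}}) ⟩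
        1ℚ ℚ.* (½ ℚ.* ε)           ≡⟨ ℚ.*-identityˡ (½ ℚ.* ε) ⟩
        ½ ℚ.* ε                    ∎

  <-sum : ∀ {ε a b} → ℚ.∣ a ∣ ℚ.< ½ ℚ.* ε → ℚ.∣ b ∣ ℚ.< ½ ℚ.* ε → ℚ.∣ a ℚ.+ b ∣ ℚ.< ε
  <-sum {ε} {a} {b} a< b< =
    subst (ℚ.∣ a ℚ.+ b ∣ ℚ.<_) (half+half ε)
      (ℚ.≤-<-trans (ℚ.∣p+q∣≤∣p∣+∣q∣ a b) (ℚ.+-mono-< a< b<))

infixl 6 _+ᵣ_
infixl 7 _*ᵣ_
infix  8 -ᵣ_

-- The Cauchy proofs are abstract so that they are never normalised.
abstract
  const-cauchy : ∀ q → IsCauchy (λ _ → q)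
  const-cauchy q ε 0<ε = 0 , λ _ _ _ _ →
    subst (λ d → ℚ.∣ d ∣ ℚ.< ε) (sym (ℚ.+-inverseʳ q)) 0<ε

  +-cauchy : ∀ x y → IsCauchy (λ n → seq x n ℚ.+ seq y n)
  +-cauchy x y ε 0<ε with cauchy x (½ ℚ.* ε) (0<* 0<½ 0<ε) | cauchy y (½ ℚ.* ε) (0<* 0<½ 0<ε)
  ... | N₁ , h₁ | N₂ , h₂ = N₁ ⊔ N₂ , λ m n N≤m N≤n →
    subst (λ d → ℚ.∣ d ∣ ℚ.< ε) (sym (+-split (seq x m) (seq y m) (seq x n) (seq y n)))
      (<-sum {ε} {seq x m ℚ.- seq x n} {seq y m ℚ.- seq y n}
        (h₁ m n (⊔≤ˡ {N₁} {N₂} N≤m) (⊔≤ˡ {N₁} {N₂} N≤n))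
        (h₂ m n (⊔≤ʳ {N₁} {N₂} N≤m) (⊔≤ʳ {N₁} {N₂} N≤n)))

  neg-cauchy : ∀ x → IsCauchy (λ n → ℚ.- seq x n)
  neg-cauchy x ε 0<ε with cauchy x ε 0<ε
  ... | N , h = N , λ m n N≤m N≤n →
    subst (ℚ._< ε)
      (begin
        ℚ.∣ seq x m ℚ.- seq x n ∣              ≡⟨ sym (ℚ.∣-p∣≡∣p∣ (seq x m ℚ.- seq x n)) ⟩
        ℚ.∣ ℚ.- (seq x m ℚ.- seq x n) ∣        ≡⟨ cong ℚ.∣_∣ (sym (neg-split (seq x m) (seq x n))) ⟩
        ℚ.∣ (ℚ.- seq x m) ℚ.- (ℚ.- seq x n) ∣  ∎)
      (h m n N≤m N≤n)
    where open ≡-Reasoning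

  *-close : ∀ {A B ε δ₁ δ₂} → Shrinks A ε δ₂ → Shrinks B ε δ₁ → ∀ a b c d →
            ℚ.∣ a ∣ ℚ.< A → ℚ.∣ d ∣ ℚ.< B →
            ℚ.∣ a ℚ.- c ∣ ℚ.< δ₁ → ℚ.∣ b ℚ.- d ∣ ℚ.< δ₂ →
            ℚ.∣ (a ℚ.* b) ℚ.- (c ℚ.* d) ∣ ℚ.< ε
  *-close {ε = ε} shrinkA shrinkB a b c d a<A d<B a-c b-d =
    subst (λ q → ℚ.∣ q ∣ ℚ.< ε) (sym (*-split a b c d))
      (<-sum {ε} {a ℚ.* (b ℚ.- d)} {d ℚ.* (a ℚ.- c)}
        (shrinkA a (b ℚ.- d) a<A b-d)
        (shrinkB d (a ℚ.- c) d<B a-c))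

  *-cauchy : ∀ x y → IsCauchy (λ n → seq x n ℚ.* seq y n)
  *-cauchy x y ε 0<ε =
    combine (eventually-bounded x) (eventually-bounded y)
    where
    combine : (∃ λ B → 0ℚ ℚ.< B × ∃ λ N → ∀ n → N ℕ.≤ n → ℚ.∣ seq x n ∣ ℚ.< B) →
              (∃ λ B → 0ℚ ℚ.< B × ∃ λ N → ∀ n → N ℕ.≤ n → ℚ.∣ seq y n ∣ ℚ.< B) →
              ∃ λ N → ∀ m n → N ℕ.≤ m → N ℕ.≤ n →
              ℚ.∣ (seq x m ℚ.* seq y m) ℚ.- (seq x n ℚ.* seq y n) ∣ ℚ.< ε
    combine (A , 0<A , N₁ , x<A) (B , 0<B , N₂ , y<B) =
      finish (shrink A ε 0<A 0<ε) (shrink B ε 0<B 0<ε)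
      where
      finish : (∃ λ δ → 0ℚ ℚ.< δ × Shrinks A ε δ) → (∃ λ δ → 0ℚ ℚ.< δ × Shrinks B ε δ) →
               ∃ λ N → ∀ m n → N ℕ.≤ m → N ℕ.≤ n →
               ℚ.∣ (seq x m ℚ.* seq y m) ℚ.- (seq x n ℚ.* seq y n) ∣ ℚ.< ε
      finish (δ₂ , 0<δ₂ , shrinkA) (δ₁ , 0<δ₁ , shrinkB) =
        let N₃ , h₃ = cauchy x δ₁ 0<δ₁
            N₄ , h₄ = cauchy y δ₂ 0<δ₂
            ₁₂ = λ {k} → ⊔≤ˡ {N₁ ⊔ N₂} {N₃ ⊔ N₄} {k}
            ₃₄ = λ {k} → ⊔≤ʳ {N₁ ⊔ N₂} {N₃ ⊔ N₄} {k}
        in (N₁ ⊔ N₂) ⊔ (N₃ ⊔ N₄) , λ m n N≤m N≤n →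
          *-close {A} {B} {ε} {δ₁} {δ₂} shrinkA shrinkB (seq x m) (seq y m) (seq x n) (seq y n)
            (x<A m (⊔≤ˡ {N₁} {N₂} (₁₂ N≤m)))
            (y<B n (⊔≤ʳ {N₁} {N₂} (₁₂ N≤n)))
            (h₃ m n (⊔≤ˡ {N₃} {N₄} (₃₄ N≤m)) (⊔≤ˡ {N₃} {N₄} (₃₄ N≤n)))
            (h₄ m n (⊔≤ʳ {N₃} {N₄} (₃₄ N≤m)) (⊔≤ʳ {N₃} {N₄} (₃₄ N≤n)))

fromℚ : ℚ → ℝ
fromℚ q = mkℝ (λ _ → q) (const-cauchy q)

_+ᵣ_ : ℝ → ℝ → ℝ
x +ᵣ y = mkℝ (λ n → seq x n ℚ.+ seq y n) (+-cauchy x y)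

-ᵣ_ : ℝ → ℝ
-ᵣ x = mkℝ (λ n → ℚ.- seq x n) (neg-cauchy x)

_*ᵣ_ : ℝ → ℝ → ℝ
x *ᵣ y = mkℝ (λ n → seq x n ℚ.* seq y n) (*-cauchy x y)

ℝ-rawRing : RawRing 0ℓ 0ℓ
ℝ-rawRing = record
  { Carrier = ℝ
  ; _≈_     = _≈ᵣ_
  ; _+_     = _+ᵣ_
  ; _*_     = _*ᵣ_
  ; -_      = -ᵣ_
  ; 0#      = fromℚ 0ℚ
  ; 1#      = fromℚ 1ℚ
  }

fromℤ : ℤ → ℝ
fromℤ z = fromℚ (z ℚ./ 1)

fromℕ : ℕ → ℝ
fromℕ n = fromℤ (+ n)

IsSqrt : ℝ → ℝ → Set
IsSqrt a r = fromℕ 0 ≤ᵣ r × r *ᵣ r ≈ᵣ a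

-- q = a / b, for a positive denominator b.
IsQuotient : ℝ → ℝ → ℝ → Set
IsQuotient a b q = fromℕ 0 <ᵣ b × q *ᵣ b ≈ᵣ a

module RingOperations (R : RawRing 0ℓ 0ℓ) where
  open RawRing R
  open RawSemiringDefs rawSemiring public using (sum; _^_) renaming (_×_ to _×ℕ_)

  infixr 8 _·_

  _·_ : ℤ → Carrier → Carrier
  (+ n)    · x = n ×ℕ x
  -[1+ n ] · x = - (suc n ×ℕ x)

  alternatingSum : ∀ {n} → Vector Carrier n → Carrier
  alternatingSum {zero}  v = 0#
  alternatingSum {suc n} v = v zero + - alternatingSum (λ i → v (suc i))

  -- Laplace expansion along the first row
  det : ∀ {n} → (Fin n → Fin n → Carrier) → Carrier
  det {zero}  A = 1#
  det {suc n} A = alternatingSum λ j → A zero j * det (λ i k → A (suc i) (punchIn j k))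

module ℝ-Ops = RingOperations ℝ-rawRing

infix 4 _≋_

_≋_ : ∀ {n} → Vector ℝ n → Vector ℝ n → Set
v ≋ w = ∀ i → v i ≈ᵣ w i

dot : ∀ {n} → Vector ℝ n → Vector ℝ n → ℝ
dot v w = ℝ-Ops.sum λ i → v i *ᵣ w i

combination : ∀ {m n} → Vector ℝ m → Vector (Vector ℝ n) m → Vector ℝ n
combination c b j = ℝ-Ops.sum λ i → c i *ᵣ b i j

IsNonZero : ∀ {n} → Vector ℝ n → Set
IsNonZero v = ¬ (v ≋ λ _ → fromℕ 0)

IsNorm : ∀ {n} → Vector ℝ n → ℝ → Set
IsNorm v r = IsSqrt (dot v v) r

gram : ∀ {m n} → Vector (Vector ℝ n) m → Fin m → Fin m → ℝ
gram b i j = dot (b i) (b j)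

-- b is a ℤ-basis of Λ and is linearly independent over ℝ, i.e. Λ is a
-- full-rank lattice with basis b.
record IsLatticeBasis {n} (Λ : Vector ℝ n → Set) (b : Vector (Vector ℝ n) n) : Set where
  field
    generates   : ∀ v → Λ v ⇔ (∃ λ (c : Vector ℤ n) → v ≋ combination (λ i → fromℤ (c i)) b)
    independent : ∀ (c : Vector ℝ n) → (combination c b ≋ λ _ → fromℕ 0) → ∀ i → c i ≈ᵣ fromℕ 0

IsMinimalNorm : ∀ {n} → (Vector ℝ n → Set) → ℝ → Set
IsMinimalNorm Λ m =
    (∃ λ v → Λ v × IsNonZero v × IsNorm v m)
  × (∀ w r → Λ w → IsNonZero w → IsNorm w r → m ≤ᵣ r)

IsPackingRadius : ∀ {n} → (Vector ℝ n → Set) → ℝ → Set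
IsPackingRadius Λ ρ = ∃ λ m → IsMinimalNorm Λ m × ρ ≈ᵣ fromℚ ½ *ᵣ m

IsVolume : ∀ {n} → (Vector ℝ n → Set) → ℝ → Set
IsVolume Λ vol = ∃ λ b → IsLatticeBasis Λ b × IsSqrt (ℝ-Ops.det (gram b)) vol

-- Norm, packing radius, volume and center density are relations because
-- the minimum and the square roots are not total functions here; each
-- relation determines its last argument up to _≈ᵣ_.
IsCenterDensity : ∀ {n} → (Vector ℝ n → Set) → ℝ → Set
IsCenterDensity {n} Λ δ =
  ∃ λ ρ → ∃ λ vol → IsPackingRadius Λ ρ × IsVolume Λ vol × IsQuotient (ρ ℝ-Ops.^ n) vol δ

record ℂ : Set where
  constructor _+i_
  field
    re im : ℝ

open ℂ public

infix 4 _≈ᶜ_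

record _≈ᶜ_ (x y : ℂ) : Set where
  constructor mk≈
  field
    re≈ : re x ≈ᵣ re y
    im≈ : im x ≈ᵣ im y

open _≈ᶜ_ public

ℂ-rawRing : RawRing 0ℓ 0ℓ
ℂ-rawRing = record
  { Carrier = ℂ
  ; _≈_     = _≈ᶜ_
  ; _+_     = λ x y → (re x +ᵣ re y) +i (im x +ᵣ im y)
  ; _*_     = λ x y → (re x *ᵣ re y +ᵣ -ᵣ (im x *ᵣ im y)) +i (re x *ᵣ im y +ᵣ im x *ᵣ re y)
  ; -_      = λ x → (-ᵣ re x) +i (-ᵣ im x)
  ; 0#      = fromℕ 0 +i fromℕ 0
  ; 1#      = fromℕ 1 +i fromℕ 0
  }

open RawRing ℂ-rawRing public using ()
  renaming (_+_ to _+ᶜ_; _*_ to _*ᶜ_; -_ to -ᶜ_; 0# to 0ᶜ; 1# to 1ᶜ)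

module ℂ-Ops = RingOperations ℂ-rawRing

conjugate : ℂ → ℂ
conjugate x = re x +i (-ᵣ im x)

-- w = z ^ u for an integer exponent u
IsIntegerPower : ℂ → ℤ → ℂ → Set
IsIntegerPower z (+ n)    w = w ≈ᶜ (z ℂ-Ops.^ n)
IsIntegerPower z -[1+ n ] w = (w *ᶜ (z ℂ-Ops.^ suc n)) ≈ᶜ 1ᶜ

IsPrimitiveRootOfUnity : ℕ → ℂ → Set
IsPrimitiveRootOfUnity p ζ =
  (ζ ℂ-Ops.^ p) ≈ᶜ 1ᶜ × (∀ j → 0 ℕ.< j → j ℕ.< p → ¬ ((ζ ℂ-Ops.^ j) ≈ᶜ 1ᶜ))

IsAlgebraicInteger : ℂ → Set
IsAlgebraicInteger x =
  ∃ λ n → ∃ λ (c : Vector ℤ n) →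
    ((x ℂ-Ops.^ n) +ᶜ ℂ-Ops.sum (λ i → c i ℂ-Ops.· (x ℂ-Ops.^ toℕ i))) ≈ᶜ 0ᶜ

record Subfield : Set₁ where
  field
    Member : ℂ → Set
    resp   : ∀ {x y} → x ≈ᶜ y → Member x → Member y
    0∈     : Member 0ᶜ
    1∈     : Member 1ᶜ
    +∈     : ∀ {x y} → Member x → Member y → Member (x +ᶜ y)
    *∈     : ∀ {x y} → Member x → Member y → Member (x *ᶜ y)
    -∈     : ∀ {x} → Member x → Member (-ᶜ x)
    inv∈   : ∀ {x y} → Member x → (x *ᶜ y) ≈ᶜ 1ᶜ → Member y

  rawRing : RawRing 0ℓ 0ℓ
  rawRing = record
    { Carrier = Σ ℂ Member
    ; _≈_     = λ x y → proj₁ x ≈ᶜ proj₁ y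
    ; _+_     = λ x y → (proj₁ x +ᶜ proj₁ y) , +∈ (proj₂ x) (proj₂ y)
    ; _*_     = λ x y → (proj₁ x *ᶜ proj₁ y) , *∈ (proj₂ x) (proj₂ y)
    ; -_      = λ x → (-ᶜ proj₁ x) , -∈ (proj₂ x)
    ; 0#      = 0ᶜ , 0∈
    ; 1#      = 1ᶜ , 1∈
    }

  Element : Set
  Element = Σ ℂ Member

infix 4 _⊆_

_⊆_ : Subfield → Subfield → Set
K ⊆ L = ∀ {x} → Subfield.Member K x → Subfield.Member L x

-- Membership in the smallest subfield of ℂ containing z
data Generated (z : ℂ) : ℂ → Set where
  gen  : Generated z z
  resp : ∀ {x y} → x ≈ᶜ y → Generated z x → Generated z y
  0∈   : Generated z 0ᶜ
  1∈   : Generated z 1ᶜ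
  +∈   : ∀ {x y} → Generated z x → Generated z y → Generated z (x +ᶜ y)
  *∈   : ∀ {x y} → Generated z x → Generated z y → Generated z (x *ᶜ y)
  -∈   : ∀ {x} → Generated z x → Generated z (-ᶜ x)
  inv∈ : ∀ {x y} → Generated z x → (x *ᶜ y) ≈ᶜ 1ᶜ → Generated z y

ℚ⟨_⟩ : ℂ → Subfield
ℚ⟨ z ⟩ = record
  { Member = Generated z
  ; resp   = resp
  ; 0∈     = 0∈
  ; 1∈     = 1∈
  ; +∈     = +∈
  ; *∈     = *∈
  ; -∈     = -∈
  ; inv∈   = inv∈
  }

generator : ∀ z → Subfield.Element ℚ⟨ z ⟩
generator z = z , gen

ℚ→ℂ : ℚ → ℂ
ℚ→ℂ q = fromℚ q +i fromℕ 0

record IsℚBasis (K : Subfield) {n} (b : Vector ℂ n) : Set where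
  private
    lin : Vector ℚ n → ℂ
    lin c = ℂ-Ops.sum λ i → ℚ→ℂ (c i) *ᶜ b i
  field
    members     : ∀ i → Subfield.Member K (b i)
    spanning    : ∀ x → Subfield.Member K x → ∃ λ c → x ≈ᶜ lin c
    independent : ∀ c → lin c ≈ᶜ 0ᶜ → ∀ i → c i ≡ 0ℚ

HasDegree : Subfield → ℕ → Set
HasDegree K n = ∃ λ (b : Vector ℂ n) → IsℚBasis K b

module _ (K : Subfield) where
  open Subfield K using (Element; rawRing)

  IsAutomorphism : (Element → Element) → Set
  IsAutomorphism = RingMorphisms.IsRingIsomorphism rawRing rawRing

  IsEmbedding : (Element → ℂ) → Set
  IsEmbedding = RingMorphisms.IsRingMonomorphism rawRing ℂ-rawRing

  infix 4 _≗_

  _≗_ : (Element → ℂ) → (Element → ℂ) → Set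
  φ ≗ ψ = ∀ x → φ x ≈ᶜ ψ x

IsRestriction : ∀ L K → (Subfield.Element L → Subfield.Element L) →
                (Subfield.Element K → Subfield.Element K) → Set
IsRestriction L K σ θ = ∀ x y → proj₁ x ≈ᶜ proj₁ y → proj₁ (σ x) ≈ᶜ proj₁ (θ y)

IsRelativeEmbedding : ∀ L (K : Subfield) → (Subfield.Element L → ℂ) → Set
IsRelativeEmbedding L K φ = IsEmbedding L φ × (∀ x → Subfield.Member K (proj₁ x) → φ x ≈ᶜ proj₁ x)

-- Tr_{L/K}(x) is the sum of φ(x) over the distinct embeddings φ of L into
-- ℂ that fix K pointwise.
record IsTrace (L K : Subfield) (x : Subfield.Element L) (t : ℂ) : Set where
  field
    m        : ℕ
    φ        : Vector (Subfield.Element L → ℂ) m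
    relative : ∀ i → IsRelativeEmbedding L K (φ i)
    distinct : ∀ i j → _≗_ L (φ i) (φ j) → i ≡ j
    complete : ∀ ψ → IsRelativeEmbedding L K ψ → ∃ λ i → _≗_ L ψ (φ i)
    trace    : t ≈ᶜ ℂ-Ops.sum (λ i → φ i x)

-- A choice of the data defining the canonical embedding of a number field
-- K of degree s: the real embeddings, and one embedding out of each
-- complex-conjugate pair of non-real ones.
record CanonicalEmbedding (K : Subfield) (s : ℕ) : Set where
  open Subfield K using (Element)
  field
    r₁ r₂        : ℕ
    degree       : s ≡ r₁ ℕ.+ 2 ℕ.* r₂
    real         : Vector (Element → ℂ) r₁
    complex      : Vector (Element → ℂ) r₂
    real-emb     : ∀ i → IsEmbedding K (real i)
    complex-emb  : ∀ i → IsEmbedding K (complex i)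
    real-real    : ∀ i x → im (real i x) ≈ᵣ fromℕ 0
    complex-not  : ∀ i → ¬ (∀ x → im (complex i x) ≈ᵣ fromℕ 0)
    real-inj     : ∀ i j → _≗_ K (real i) (real j) → i ≡ j
    complex-inj  : ∀ i j → _≗_ K (complex i) (complex j) → i ≡ j
    complex-pair : ∀ i j → ¬ (_≗_ K (complex i) (λ x → conjugate (complex j x)))
    complete     : ∀ ψ → IsEmbedding K ψ →
                   (∃ λ i → _≗_ K ψ (real i))
                   ⊎ (∃ λ i → _≗_ K ψ (complex i))
                   ⊎ (∃ λ i → _≗_ K ψ (λ x → conjugate (complex i x)))

  σ : Element → Vector ℝ (r₁ ℕ.+ r₂ ℕ.* 2)
  σ x = (λ i → re (real i x)) ++ concat (λ i → re (complex i x) ∷ im (complex i x) ∷ [])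

  image : (Element → Set) → Vector ℝ (r₁ ℕ.+ r₂ ℕ.* 2) → Set
  image M v = ∃ λ x → M x × v ≋ σ x

GeneratesUnits : ℕ → ℤ → Set
GeneratesUnits p u =
  ¬ (+ p ℤ.∣ u) × (∀ a → ¬ (+ p ℤ.∣ a) → ∃ λ j → + p ℤ.∣ (a ℤ.- u ℤ.^ j))

HasOrderModulo : ℕ → ℤ → ℕ → Set
HasOrderModulo p β n =
  + p ℤ.∣ (β ℤ.^ n ℤ.- 1ℤ) × (∀ j → 0 ℕ.< j → j ℕ.< n → ¬ (+ p ℤ.∣ (β ℤ.^ j ℤ.- 1ℤ)))

dotℤ : ∀ {n} → Vector ℤ n → Vector ℤ n → ℤ
dotℤ a b = RingOperations.sum ℤ.+-*-rawRing λ i → a i ℤ.* b i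

-- μ s α i = (1 , αⁱ , α²ⁱ , … , α⁽ˢ⁻¹⁾ⁱ)
μ : ∀ s → ℤ → ℕ → Vector ℤ s
μ s α i j = α ℤ.^ (toℕ j ℕ.* i)

fromCoordinates : ∀ K (θ : Subfield.Element K → Subfield.Element K) (t : Subfield.Element K) {s} →
                  Vector ℤ s → Subfield.Element K
fromCoordinates K θ t a = sum λ i → a i · iterate θ t (toℕ i)
  where open RingOperations (Subfield.rawRing K)

𝓜 : ∀ (p s : ℕ) K (θ : Subfield.Element K → Subfield.Element K) (t : Subfield.Element K) (α : ℤ) →
    Subfield.Element K → Set
𝓜 p s K θ t α x =
  IsAlgebraicInteger (proj₁ x) ×
  ∃ λ (a : Vector ℤ s) →
      proj₁ x ≈ᶜ proj₁ (fromCoordinates K θ t a)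
    × (∀ i → i ℕ.≤ s /ℕ 2 → + p ℤ.∣ dotℤ a (μ s α i))

{-# OPTIONS --safe #-}
module Submission where

-- Let m = (p - 1) / s and let η_i be the Gaussian periods θⁱ(t).  The trace form is
-- Σ_k η_{a+k} conj η_{b+k} = p [a = b] - m, and K has no real embedding because complex
-- conjugation shifts the periods by s/2 (m is odd); so the element with coordinates a has
-- squared length Q(a)/2, where Q(a) = p Σ a_i² - m (Σ a_i)².
-- On 𝓜 the discrete Fourier transform of a modulo p vanishes at one of k, -k for each k, hence
-- p ∣ Σ a_i² by Parseval, p ∣ Σ a_i, and by parity 2p² ∣ Q(a); as Q is positive definite, the
-- minimal norm is at least p.  The volume is computed in a basis of multiples of the Newton
-- polynomials Π_{i<k} (X - αⁱ): it is p^s √p / 2^{s/2}.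
-- The existence of σᵤ replaces the irreducibility of the cyclotomic polynomial, and decisions
-- about complex numbers are reduced to the decidability of idempotents.

open import Defs
open import Algebra.Bundles using (CommutativeRing; RawRing)
open import Algebra.Morphism.Structures using (module RingMorphisms)
open import Data.Empty using (⊥)
open import Data.Fin.Base as Fin using (Fin; zero; suc; toℕ; punchIn)
import Data.Fin.Properties as Fin
open import Data.Integer.Base as ℤ using (ℤ; +_; -[1+_]; 0ℤ; 1ℤ)
import Data.Integer.Divisibility as ℤ
import Data.Integer.Divisibility.Signed as ℤˢ
import Data.Integer.DivMod as ℤ
import Data.Integer.Properties as ℤ
open import Data.Maybe.Base using (Maybe; just; nothing)
open import Data.Nat.Base as ℕ using (ℕ; zero; suc; z≤n; s≤s; NonZero; _∸_)
import Data.Nat.Divisibility as ℕ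
import Data.Nat.DivMod as ℕ
open import Data.Nat.GeneralisedArithmetic using (iterate)
open import Data.Nat.Primality using (Prime; prime⇒nonZero; prime⇒nonTrivial; euclidsLemma)
import Data.Nat.Properties as ℕ
import Data.Nat.Solver as ℕ
open import Data.Product.Base using (∃; _×_; _,_; proj₁; proj₂)
open import Data.Rational.Base as ℚ using (ℚ; 0ℚ; 1ℚ; ½)
import Data.Rational.Properties as ℚ
import Data.Rational.Solver as ℚ
import Data.Rational.Unnormalised.Base as ℚᵘ
import Data.Rational.Unnormalised.Properties as ℚᵘ
open import Data.Sum.Base using (_⊎_; inj₁; inj₂; [_,_]′)
open import Data.Vec.Functional using (Vector; _∷_; [])
open import Function.Base using (_∘_; id)
open import Function.Bundles using (mk⇔)
open import Level using (0ℓ)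
open import Relation.Binary.Definitions using (tri<; tri≈; tri>)
import Relation.Binary.PropositionalEquality as ≡
open ≡ using (_≡_; _≢_)
open import Relation.Nullary using (¬_; ¬?; Dec; yes; no; contradiction)

-- Alternating forms and determinants

-- Equality of real numbers is a limit statement that cannot be tested, so a proof cannot simply ask
-- whether a complex number vanishes. What can be asked: if z^p = 1 and Φ = 1 + z + ... + z^(p-1),
-- then Φ/p is idempotent, hence 0 or 1. This finds the exponent of a p-th root of unity and shows
-- that ζ times its conjugate is 1. K is given only by a membership predicate. The finite complete
-- list of embeddings inside `IsTrace` makes it decidable whether the k-th power of `σᵤ` fixes K;
-- the least such k > 0 is `d`, the d periods span K, and d = s follows by comparing dimensions.
-- Origin of the constant: the periods have Gram matrix (p I - m J)/2 with J the all-ones matrix, of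
-- determinant p^(s-1)/2^s because p - m s = 1. The s/2 + 1 congruences cut out a sublattice of
-- index p^(s/2+1), which gives the volume. Minimal norm at least p means packing radius at least
-- p/2, and (p/2)^s over the volume is 1/(2^(s/2) √p).

data Adjacent : ∀ {n} → Fin n → Fin n → Set where
  here  : ∀ {n} → Adjacent {suc (suc n)} zero (suc zero)
  there : ∀ {n} {i j : Fin n} → Adjacent i j → Adjacent (suc i) (suc j)

-- Carries alternation through the Laplace expansion: after a third column is deleted, the two equal
-- columns are still adjacent and the induction hypothesis applies to the minor.
adjacent-punchIn : ∀ {n} {i j k : Fin (suc n)} → Adjacent i j → k ≢ i → k ≢ j →
                   ∃ λ i′ → ∃ λ j′ → Adjacent i′ j′ × punchIn k i′ ≡ i × punchIn k j′ ≡ j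
adjacent-punchIn {k = zero}        here        k≢i k≢j = contradiction ≡.refl k≢i
adjacent-punchIn {k = suc zero}    here        k≢i k≢j = contradiction ≡.refl k≢j
adjacent-punchIn {suc (suc n)} {k = suc (suc k)} here k≢i k≢j = zero , suc zero , here , ≡.refl , ≡.refl
adjacent-punchIn {suc n} {k = zero} (there adj) k≢i k≢j = _ , _ , adj , ≡.refl , ≡.refl
adjacent-punchIn {suc n} {k = suc k} (there adj) k≢i k≢j
  with adjacent-punchIn adj (k≢i ∘ ≡.cong suc) (k≢j ∘ ≡.cong suc)
... | i′ , j′ , adj′ , ei , ej = suc i′ , suc j′ , there adj′ , ≡.cong suc ei , ≡.cong suc ej

≡⊎punchIn : ∀ {n} (l j : Fin (suc n)) → (l ≡ j) ⊎ (∃ λ j′ → punchIn l j′ ≡ j)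
≡⊎punchIn l j with l Fin.≟ j
... | yes l≡j = inj₁ l≡j
... | no  l≢j = inj₂ (Fin.punchOut l≢j , Fin.punchIn-punchOut l≢j)

module RingTheory (R : CommutativeRing 0ℓ 0ℓ) where
  open CommutativeRing R public hiding (zero)
  open import Algebra.Properties.Ring ring public
    using (-‿distribˡ-*; -‿distribʳ-*; -0#≈0#)
  open import Algebra.Properties.AbelianGroup +-abelianGroup public using (⁻¹-∙-comm)
  open import Algebra.Properties.Semiring.Sum semiring public
    using (sum; sum-cong-≋; sum-cong-≗; ∑-distrib-+; ∑-comm; sum-permute; sum-remove
          ; *-distribˡ-sum; *-distribʳ-sum; sum-replicate-zero)
  open import Algebra.Properties.Semiring.Exp semiring public
  open import Algebra.Properties.Semiring.Mult semiring public using (×1-homo-*; ×-homo-+)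
  open import Algebra.Definitions.RawSemiring (RawRing.rawSemiring rawRing) public using (product)
  open RingOperations rawRing public using (alternatingSum; det; _·_)
  open import Relation.Binary.Reasoning.Setoid setoid public

  ι : ℤ → Carrier
  ι z = z · 1#

  x-x≈0 : ∀ x → x + - x ≈ 0#
  x-x≈0 = -‿inverseʳ

  private
    ι-⊖ : ∀ m n → ι (m ℤ.⊖ n) ≈ ι (+ m) + - ι (+ n)
    ι-⊖ m       zero    = sym (trans (+-congˡ -0#≈0#) (+-identityʳ _))
    ι-⊖ zero    (suc n) = sym (+-identityˡ _)
    ι-⊖ (suc m) (suc n) = begin
      ι (suc m ℤ.⊖ suc n)                     ≡⟨ ≡.cong ι (ℤ.[1+m]⊖[1+n]≡m⊖n m n) ⟩
      ι (m ℤ.⊖ n)                             ≈⟨ ι-⊖ m n ⟩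
      a + - b                                 ≈⟨ sym (+-identityˡ _) ⟩
      0# + (a + - b)                          ≈⟨ +-congʳ (sym (x-x≈0 1#)) ⟩
      1# + - 1# + (a + - b)                   ≈⟨ +-assoc _ _ _ ⟩
      1# + (- 1# + (a + - b))                 ≈⟨ +-congˡ (sym (+-assoc _ _ _)) ⟩
      1# + (- 1# + a + - b)                   ≈⟨ +-congˡ (+-congʳ (+-comm _ _)) ⟩
      1# + (a + - 1# + - b)                   ≈⟨ +-congˡ (+-assoc _ _ _) ⟩
      1# + (a + (- 1# + - b))                 ≈⟨ sym (+-assoc _ _ _) ⟩
      1# + a + (- 1# + - b)                   ≈⟨ +-congˡ (⁻¹-∙-comm 1# b) ⟩
      1# + a + - (1# + b)                     ∎
      where
      a = ι (+ m)
      b = ι (+ n)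

    ι-pos-+ : ∀ m n → ι (+ (m ℕ.+ n)) ≈ ι (+ m) + ι (+ n)
    ι-pos-+ m n = ×-homo-+ 1# m n

  ι-homo-- : ∀ a → ι (ℤ.- a) ≈ - ι a
  ι-homo-- (+ zero)  = sym -0#≈0#
  ι-homo-- (+ suc n) = refl
  ι-homo-- -[1+ n ]  = begin
    x                ≈⟨ sym (+-identityʳ x) ⟩
    x + 0#           ≈⟨ +-congˡ (sym (x-x≈0 (- x))) ⟩
    x + (- x + - - x) ≈⟨ sym (+-assoc _ _ _) ⟩
    x + - x + - - x  ≈⟨ +-congʳ (x-x≈0 x) ⟩
    0# + - - x       ≈⟨ +-identityˡ _ ⟩
    - - x            ∎
    where x = ι (+ suc n)

  ι-homo-+ : ∀ a b → ι (a ℤ.+ b) ≈ ι a + ι b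
  ι-homo-+ (+ m)    (+ n)    = ι-pos-+ m n
  ι-homo-+ (+ m)    -[1+ n ] = ι-⊖ m (suc n)
  ι-homo-+ -[1+ m ] (+ n)    = trans (ι-⊖ n (suc m)) (+-comm _ _)
  ι-homo-+ -[1+ m ] -[1+ n ] = begin
    - ι (+ suc (suc (m ℕ.+ n)))      ≡⟨ ≡.cong (λ k → - ι (+ suc k)) (≡.sym (ℕ.+-suc m n)) ⟩
    - ι (+ (suc m ℕ.+ suc n))        ≈⟨ -‿cong (ι-pos-+ (suc m) (suc n)) ⟩
    - (ι (+ suc m) + ι (+ suc n))    ≈⟨ sym (⁻¹-∙-comm _ _) ⟩
    - ι (+ suc m) + - ι (+ suc n)    ∎

  private
    ι-pos-* : ∀ m n → ι (+ m ℤ.* + n) ≈ ι (+ m) * ι (+ n)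
    ι-pos-* m n = trans (reflexive (≡.cong ι (≡.sym (ℤ.pos-* m n)))) (×1-homo-* m n)

    ι-posˡ-* : ∀ m b → ι (+ m ℤ.* b) ≈ ι (+ m) * ι b
    ι-posˡ-* m (+ n)    = ι-pos-* m n
    ι-posˡ-* m -[1+ n ] = begin
      ι (+ m ℤ.* (ℤ.- + suc n))   ≡⟨ ≡.cong ι (≡.sym (ℤ.neg-distribʳ-* (+ m) (+ suc n))) ⟩
      ι (ℤ.- (+ m ℤ.* + suc n))   ≈⟨ ι-homo-- (+ m ℤ.* + suc n) ⟩
      - ι (+ m ℤ.* + suc n)       ≈⟨ -‿cong (ι-pos-* m (suc n)) ⟩
      - (ι (+ m) * ι (+ suc n))   ≈⟨ -‿distribʳ-* _ _ ⟩
      ι (+ m) * - ι (+ suc n)     ∎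

  ι-homo-* : ∀ a b → ι (a ℤ.* b) ≈ ι a * ι b
  ι-homo-* (+ m)    b = ι-posˡ-* m b
  ι-homo-* -[1+ m ] b = begin
    ι ((ℤ.- + suc m) ℤ.* b)   ≡⟨ ≡.cong ι (≡.sym (ℤ.neg-distribˡ-* (+ suc m) b)) ⟩
    ι (ℤ.- (+ suc m ℤ.* b))   ≈⟨ ι-homo-- (+ suc m ℤ.* b) ⟩
    - ι (+ suc m ℤ.* b)       ≈⟨ -‿cong (ι-posˡ-* (suc m) b) ⟩
    - (ι (+ suc m) * ι b)     ≈⟨ -‿distribˡ-* _ _ ⟩
    - ι (+ suc m) * ι b       ∎

  ι-1 : ι 1ℤ ≈ 1#
  ι-1 = +-identityʳ 1#

  open import Algebra.Solver.Ring.AlmostCommutativeRing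
    using (AlmostCommutativeRing; fromCommutativeRing; _-Raw-AlmostCommutative⟶_)

  private
    almostRing : AlmostCommutativeRing 0ℓ 0ℓ
    almostRing = fromCommutativeRing R

    ι-morphism : ℤ.+-*-rawRing -Raw-AlmostCommutative⟶ almostRing
    ι-morphism = record
      { ⟦_⟧    = ι
      ; +-homo = ι-homo-+
      ; *-homo = ι-homo-*
      ; -‿homo = ι-homo--
      ; 0-homo = refl
      ; 1-homo = ι-1
      }

    ι≟ : ∀ a b → Maybe (ι a ≈ ι b)
    ι≟ a b with a ℤ.≟ b
    ... | yes a≡b = just (reflexive (≡.cong ι a≡b))
    ... | no  _   = nothing

  -- Coefficients are integers read through `ι`, so one solver serves every commutative ring here,
  -- including those whose equality is undecidable.
  open import Algebra.Solver.Ring ℤ.+-*-rawRing almostRing ι-morphism ι≟ public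
    using (solve; _:+_; _:*_; _:-_; :-_; _:=_; con)

  x≈y⇒x-y≈0 : ∀ {x y} → x ≈ y → x + - y ≈ 0#
  x≈y⇒x-y≈0 {x} {y} x≈y = trans (+-congʳ x≈y) (x-x≈0 y)

  x-y≈0⇒x≈y : ∀ {x y} → x + - y ≈ 0# → x ≈ y
  x-y≈0⇒x≈y {x} {y} e = begin
    x              ≈⟨ solve 2 (λ x y → x := (x :+ :- y) :+ y) refl x y ⟩
    x + - y + y    ≈⟨ +-congʳ e ⟩
    0# + y         ≈⟨ +-identityˡ y ⟩
    y              ∎

  x*-1≈-x : ∀ x → x * - 1# ≈ - x
  x*-1≈-x x = trans (sym (-‿distribʳ-* x 1#)) (-‿cong (*-identityʳ x))

  x+y≈0⇒x≈-y : ∀ {x y} → x + y ≈ 0# → x ≈ - y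
  x+y≈0⇒x≈-y {x} {y} e = x-y≈0⇒x≈y (trans (solve 2 (λ x y → x :+ :- (:- y) := x :+ y) refl x y) e)

  -- An explicit inverse replaces a proof of being nonzero, which over ℝ or ℂ would not allow
  -- cancellation by itself.
  unitˡ-cancel : ∀ {u v x} → u * v ≈ 1# → v * x ≈ 0# → x ≈ 0#
  unitˡ-cancel {u} {v} {x} uv vx = begin
    x            ≈⟨ sym (*-identityˡ x) ⟩
    1# * x       ≈⟨ *-congʳ (sym uv) ⟩
    u * v * x    ≈⟨ *-assoc u v x ⟩
    u * (v * x)  ≈⟨ *-congˡ vx ⟩
    u * 0#       ≈⟨ zeroʳ u ⟩
    0#           ∎

  *-^ : ∀ x y n → (x * y) ^ n ≈ x ^ n * y ^ n
  *-^ x y zero    = sym (*-identityˡ 1#)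
  *-^ x y (suc n) = trans (*-congˡ {x * y} (*-^ x y n))
    (solve 4 (λ x y a b → x :* y :* (a :* b) := x :* a :* (y :* b)) refl x y (x ^ n) (y ^ n))

  1^ : ∀ n → 1# ^ n ≈ 1#
  1^ zero    = refl
  1^ (suc n) = trans (*-identityˡ _) (1^ n)

  sum-zero : ∀ {n} (f : Vector Carrier n) → (∀ i → f i ≈ 0#) → sum f ≈ 0#
  sum-zero {n} f f≈0 = trans (sum-cong-≋ f≈0) (sum-replicate-zero n)

  sum-neg : ∀ {n} (f : Vector Carrier n) → sum (λ i → - f i) ≈ - sum f
  sum-neg {zero}  f = sym -0#≈0#
  sum-neg {suc n} f = trans (+-congˡ (sum-neg (f ∘ suc))) (⁻¹-∙-comm _ _)

  sum-linear : ∀ {n} a b (f g : Vector Carrier n) →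
               sum (λ i → a * f i + b * g i) ≈ a * sum f + b * sum g
  sum-linear a b f g =
    trans (∑-distrib-+ (λ i → a * f i) (λ i → b * g i))
          (+-cong (sym (*-distribˡ-sum a f)) (sym (*-distribˡ-sum b g)))

  sum-single : ∀ {n} (i : Fin n) (f : Vector Carrier n) → (∀ j → j ≢ i → f j ≈ 0#) → sum f ≈ f i
  sum-single zero    f h = trans (+-congˡ (sum-zero (f ∘ suc) (λ j → h (suc j) (λ ())))) (+-identityʳ _)
  sum-single (suc i) f h =
    trans (+-cong (h zero (λ ())) (sum-single i (f ∘ suc) (λ j j≢i → h (suc j) (j≢i ∘ Fin.suc-injective))))
          (+-identityˡ _)

  alternatingSum-cong : ∀ {n} {v w : Vector Carrier n} → (∀ i → v i ≈ w i) →
                        alternatingSum v ≈ alternatingSum w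
  alternatingSum-cong {zero}  h = refl
  alternatingSum-cong {suc n} h = +-cong (h zero) (-‿cong (alternatingSum-cong (h ∘ suc)))

  alternatingSum-zero : ∀ {n} (v : Vector Carrier n) → (∀ i → v i ≈ 0#) → alternatingSum v ≈ 0#
  alternatingSum-zero {zero}  v h = refl
  alternatingSum-zero {suc n} v h =
    trans (+-cong (h zero) (-‿cong (alternatingSum-zero (v ∘ suc) (h ∘ suc)))) (x-x≈0 0#)

  alternatingSum-linear : ∀ {n} a b (v w : Vector Carrier n) →
    alternatingSum (λ i → a * v i + b * w i) ≈ a * alternatingSum v + b * alternatingSum w
  alternatingSum-linear {zero}  a b v w = sym (trans (+-cong (zeroʳ a) (zeroʳ b)) (+-identityˡ 0#))
  alternatingSum-linear {suc n} a b v w =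
    trans (+-congˡ (-‿cong (alternatingSum-linear a b (v ∘ suc) (w ∘ suc))))
      (solve 6 (λ a b x y s t → (a :* x :+ b :* y) :+ :- (a :* s :+ b :* t)
                             := a :* (x :+ :- s) :+ b :* (y :+ :- t)) refl
        a b (v zero) (w zero) (alternatingSum (v ∘ suc)) (alternatingSum (w ∘ suc)))

  -- Neighbouring terms carry opposite signs, so the two surviving terms cancel.
  alternatingSum-adjacent : ∀ {n} {i j : Fin n} → Adjacent i j → (v : Vector Carrier n) →
    v i ≈ v j → (∀ k → k ≢ i → k ≢ j → v k ≈ 0#) → alternatingSum v ≈ 0#
  alternatingSum-adjacent here v e h = begin
    v zero + - (v (suc zero) + - r)    ≈⟨ +-cong e (-‿cong (+-congˡ (-‿cong r≈0))) ⟩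
    v (suc zero) + - (v (suc zero) + - 0#)  ≈⟨ solve 1 (λ x → x :+ :- (x :+ :- con 0ℤ) := con 0ℤ) refl (v (suc zero)) ⟩
    0#                                 ∎
    where
    r = alternatingSum (λ i → v (suc (suc i)))
    r≈0 = alternatingSum-zero (λ i → v (suc (suc i))) (λ i → h (suc (suc i)) (λ ()) (λ ()))
  alternatingSum-adjacent (there adj) v e h =
    trans (+-cong (h zero (λ ()) (λ ()))
                  (-‿cong (alternatingSum-adjacent adj (v ∘ suc) e
                    (λ k k≢i k≢j → h (suc k) (k≢i ∘ Fin.suc-injective) (k≢j ∘ Fin.suc-injective)))))
          (x-x≈0 0#)

  det-cong : ∀ {n} {A B : Fin n → Fin n → Carrier} → (∀ i j → A i j ≈ B i j) → det A ≈ det B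
  det-cong {zero}  h = refl
  det-cong {suc n} h =
    alternatingSum-cong λ j → *-cong (h zero j) (det-cong λ i k → h (suc i) (punchIn j k))

  det-lower : ∀ {n} (T : Fin n → Fin n → Carrier) → (∀ {i j} → i Fin.< j → T i j ≈ 0#) →
              det T ≈ product (λ i → T i i)
  det-lower {zero}  T h = refl
  det-lower {suc n} T h = begin
    T zero zero * d + - alternatingSum rest  ≈⟨ +-congˡ (-‿cong (alternatingSum-zero rest
                                                  λ j → trans (*-congʳ (h (s≤s z≤n))) (zeroˡ _))) ⟩
    T zero zero * d + - 0#                   ≈⟨ solve 1 (λ x → x :+ :- con 0ℤ := x) refl _ ⟩
    T zero zero * d                          ≈⟨ *-congˡ (det-lower T′ (λ i<j → h (s≤s i<j))) ⟩
    T zero zero * product (λ i → T′ i i)     ∎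
    where
    T′ : Fin n → Fin n → Carrier
    T′ i k = T (suc i) (suc k)
    d = det T′
    rest : Vector Carrier n
    rest j = T zero (suc j) * det (λ i k → T (suc i) (punchIn (suc j) k))

  -- Linearity compares three whole families that agree outside position j, which avoids updating a
  -- family at an index. Vanishing is demanded for adjacent positions only, the case that Laplace
  -- expansion proves directly. The coordinate type X is independent of k, so the notion covers
  -- forms such as the determinant of the products of fixed vectors with the arguments.
  record Alternating {X : Set} {k} (F : (Fin k → X → Carrier) → Carrier) : Set where
    field
      cong     : ∀ {c c′} → (∀ j x → c j x ≈ c′ j x) → F c ≈ F c′
      linear   : ∀ j c c′ c″ a b → (∀ x → c j x ≈ a * c′ j x + b * c″ j x) →
                 (∀ i → i ≢ j → ∀ x → c i x ≈ c′ i x) → (∀ i → i ≢ j → ∀ x → c i x ≈ c″ i x) →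
                 F c ≈ a * F c′ + b * F c″
      adjacent : ∀ {i j} → Adjacent i j → ∀ c → (∀ x → c i x ≈ c j x) → F c ≈ 0#

  columns : ∀ {n} → (Fin n → Fin n → Carrier) → Carrier
  columns c = det λ i j → c j i

  private
    minor : ∀ {n} → (Fin (suc n) → Fin (suc n) → Carrier) → Fin (suc n) → Fin n → Fin n → Carrier
    minor c l j i = c (punchIn l j) (suc i)

    -- In the Laplace term of column l, column j enters through the entry when l = j and through the
    -- minor otherwise, never through both.
    columns-linear : ∀ {n} (j : Fin n) (c c′ c″ : Fin n → Fin n → Carrier) a b →
      (∀ x → c j x ≈ a * c′ j x + b * c″ j x) →
      (∀ i → i ≢ j → ∀ x → c i x ≈ c′ i x) → (∀ i → i ≢ j → ∀ x → c i x ≈ c″ i x) →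
      columns c ≈ a * columns c′ + b * columns c″
    columns-linear {suc n} j c c′ c″ a b hj h′ h″ =
      trans (alternatingSum-cong {suc n} term)
        (alternatingSum-linear a b (λ l → c′ l zero * columns (minor c′ l)) (λ l → c″ l zero * columns (minor c″ l)))
      where
      term : ∀ l → c l zero * columns (minor c l) ≈
                   a * (c′ l zero * columns (minor c′ l)) + b * (c″ l zero * columns (minor c″ l))
      term l with ≡⊎punchIn l j
      ... | inj₁ ≡.refl = begin
        c l zero * columns (minor c l)  ≈⟨ *-congʳ (hj zero) ⟩
        (a * c′ l zero + b * c″ l zero) * columns (minor c l)
          ≈⟨ solve 5 (λ a x b y d → (a :* x :+ b :* y) :* d := a :* (x :* d) :+ b :* (y :* d)) refl
               a (c′ l zero) b (c″ l zero) (columns (minor c l)) ⟩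
        a * (c′ l zero * columns (minor c l)) + b * (c″ l zero * columns (minor c l))
          ≈⟨ +-cong (*-congˡ (*-congˡ (det-cong λ i k → h′ _ (Fin.punchInᵢ≢i l k) (suc i))))
                    (*-congˡ (*-congˡ (det-cong λ i k → h″ _ (Fin.punchInᵢ≢i l k) (suc i)))) ⟩
        a * (c′ l zero * columns (minor c′ l)) + b * (c″ l zero * columns (minor c″ l)) ∎
      ... | inj₂ (j′ , ≡.refl) = begin
        c l zero * columns (minor c l)
          ≈⟨ *-congˡ (columns-linear j′ (minor c l) (minor c′ l) (minor c″ l) a b (hj ∘ suc)
               (λ i i≢j′ x → h′ _ (i≢j′ ∘ Fin.punchIn-injective l i j′) (suc x))
               (λ i i≢j′ x → h″ _ (i≢j′ ∘ Fin.punchIn-injective l i j′) (suc x))) ⟩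
        c l zero * (a * columns (minor c′ l) + b * columns (minor c″ l))
          ≈⟨ solve 5 (λ x a d b e → x :* (a :* d :+ b :* e) := a :* (x :* d) :+ b :* (x :* e)) refl
               (c l zero) a (columns (minor c′ l)) b (columns (minor c″ l)) ⟩
        a * (c l zero * columns (minor c′ l)) + b * (c l zero * columns (minor c″ l))
          ≈⟨ +-cong (*-congˡ (*-congʳ (h′ l (λ e → Fin.punchInᵢ≢i l j′ (≡.sym e)) zero)))
                    (*-congˡ (*-congʳ (h″ l (λ e → Fin.punchInᵢ≢i l j′ (≡.sym e)) zero))) ⟩
        a * (c′ l zero * columns (minor c′ l)) + b * (c″ l zero * columns (minor c″ l)) ∎

    -- Removing either of two neighbours with equal entries leaves the same list; hence the two
    -- surviving Laplace minors coincide.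
    punchIn-adjacent : ∀ {n} {i j : Fin (suc n)} → Adjacent i j → (P : Fin (suc n) → Carrier) →
                       P i ≈ P j → ∀ k → P (punchIn i k) ≈ P (punchIn j k)
    punchIn-adjacent here        P e zero    = sym e
    punchIn-adjacent here        P e (suc k) = refl
    punchIn-adjacent {suc n} (there adj) P e zero    = refl
    punchIn-adjacent {suc n} (there adj) P e (suc k) = punchIn-adjacent adj (P ∘ suc) e k

    columns-adjacent : ∀ {n} {i j : Fin n} → Adjacent i j → (c : Fin n → Fin n → Carrier) →
                       (∀ x → c i x ≈ c j x) → columns c ≈ 0#
    columns-adjacent {suc n} {i} {j} adj c e =
      alternatingSum-adjacent adj _
        (*-cong (e zero) (det-cong λ x k → punchIn-adjacent adj (λ l → c l (suc x)) (e (suc x)) k))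
        λ k k≢i k≢j →
          let i′ , j′ , adj′ , ei , ej = adjacent-punchIn adj k≢i k≢j
              same x = trans (reflexive (≡.cong (λ l → c l (suc x)) ei))
                        (trans (e (suc x)) (reflexive (≡.cong (λ l → c l (suc x)) (≡.sym ej))))
          in trans (*-congˡ (columns-adjacent adj′ (minor c k) same)) (zeroʳ _)

  columns-alternating : ∀ {n} → Alternating (columns {n})
  columns-alternating = record
    { cong     = λ h → det-cong λ i j → h j i
    ; linear   = columns-linear
    ; adjacent = columns-adjacent
    }

  module _ {X : Set} where

    private
      V : Set
      V = X → Carrier

    ∷-cong : ∀ {k} {v w : V} {c d : Fin k → V} → (∀ x → v x ≈ w x) → (∀ j x → c j x ≈ d j x) →
             ∀ j x → (v ∷ c) j x ≈ (w ∷ d) j x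
    ∷-cong v≈w c≈d zero    = v≈w
    ∷-cong v≈w c≈d (suc j) = c≈d j

    fix-first : ∀ {k} {F : (Fin (suc k) → V) → Carrier} → Alternating F → ∀ v →
                Alternating (λ c → F (v ∷ c))
    fix-first {k} {F} alt v = record
      { cong     = λ h → cong (∷-cong (λ x → refl) h)
      ; linear   = λ j c c′ c″ a b hj h′ h″ →
                     linear (suc j) (v ∷ c) (v ∷ c′) (v ∷ c″) a b hj (away h′) (away h″)
      ; adjacent = λ adj c → adjacent (there adj) (v ∷ c)
      }
      where
      open Alternating alt
      away : ∀ {j} {c d : Fin k → V} → (∀ i → i ≢ j → ∀ x → c i x ≈ d i x) →
             ∀ i → i ≢ suc j → ∀ x → (v ∷ c) i x ≈ (v ∷ d) i x
      away h zero    _   x = refl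
      away h (suc i) i≢j x = h i (i≢j ∘ ≡.cong suc) x

    first-linear : ∀ {k} {F : (Fin (suc k) → V) → Carrier} → Alternating F →
                   ∀ {u v w : V} {d : Fin k → V} a b → (∀ x → u x ≈ a * v x + b * w x) →
                   F (u ∷ d) ≈ a * F (v ∷ d) + b * F (w ∷ d)
    first-linear alt {u} {v} {w} {d} a b h =
      Alternating.linear alt zero (u ∷ d) (v ∷ d) (w ∷ d) a b h away away
      where
      away : ∀ {v w : V} i → i ≢ zero → ∀ x → (v ∷ d) i x ≈ (w ∷ d) i x
      away zero    i≢0 x = contradiction ≡.refl i≢0
      away (suc i) _   x = refl

    first-sum : ∀ {k} {F : (Fin (suc k) → V) → Carrier} → Alternating F →
                ∀ {n} {u : V} (a : Fin n → Carrier) (w : Fin n → V) {d : Fin k → V} →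
                (∀ x → u x ≈ sum (λ i → a i * w i x)) →
                F (u ∷ d) ≈ sum (λ i → a i * F (w i ∷ d))
    -- The first vector is zero, being an empty sum. Writing it as 0 u + 0 u lets linearity produce
    -- the value 0.
    first-sum {F = F} alt {zero} {u} a w {d} h = begin
      F (u ∷ d)                        ≈⟨ first-linear alt 0# 0# (λ x → trans (h x)
                                            (solve 1 (λ y → con 0ℤ := con 0ℤ :* y :+ con 0ℤ :* y) refl (u x))) ⟩
      0# * F (u ∷ d) + 0# * F (u ∷ d)  ≈⟨ solve 1 (λ y → con 0ℤ :* y :+ con 0ℤ :* y := con 0ℤ) refl (F (u ∷ d)) ⟩
      0#                               ∎
    first-sum {F = F} alt {suc n} {u} a w {d} h = begin
      F (u ∷ d)                                  ≈⟨ first-linear alt (a zero) 1# (λ x → trans (h x) (+-congˡ (sym (*-identityˡ _)))) ⟩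
      a zero * F (w zero ∷ d) + 1# * F (u′ ∷ d)  ≈⟨ +-congˡ (*-identityˡ _) ⟩
      a zero * F (w zero ∷ d) + F (u′ ∷ d)       ≈⟨ +-congˡ (first-sum alt (a ∘ suc) (w ∘ suc) (λ x → refl)) ⟩
      a zero * F (w zero ∷ d) + sum (λ i → a (suc i) * F (w (suc i) ∷ d)) ∎
      where
      u′ : V
      u′ x = sum (λ i → a (suc i) * w (suc i) x)

    -- Polarisation: F vanishes at (v + w, v + w), and of the four terms of its expansion those with
    -- a repeated vector vanish too. The coefficients are `ι 1ℤ`, the meaning of `con 1ℤ` in the
    -- solver, so that the solver recognises the expansion.
    swap-first : ∀ {k} {F : (Fin (suc (suc k)) → V) → Carrier} → Alternating F →
                 ∀ v w (d : Fin k → V) → F (v ∷ w ∷ d) ≈ - F (w ∷ v ∷ d)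
    swap-first {F = F} alt v w d = x+y≈0⇒x≈-y (begin
      F (v ∷ w ∷ d) + F (w ∷ v ∷ d)
        ≈⟨ solve 2 (λ x y → x :+ y := con 1ℤ :* (con 1ℤ :* con 0ℤ :+ con 1ℤ :* x) :+ con 1ℤ :* (con 1ℤ :* y :+ con 1ℤ :* con 0ℤ)) refl _ _ ⟩
      ι 1ℤ * (ι 1ℤ * 0# + ι 1ℤ * F (v ∷ w ∷ d)) + ι 1ℤ * (ι 1ℤ * F (w ∷ v ∷ d) + ι 1ℤ * 0#)
        ≈⟨ +-cong (*-congˡ (+-congʳ (*-congˡ (sym (adjacent here (v ∷ v ∷ d) (λ x → refl))))))
                  (*-congˡ (+-congˡ (*-congˡ (sym (adjacent here (w ∷ w ∷ d) (λ x → refl)))))) ⟩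
      ι 1ℤ * (ι 1ℤ * F (v ∷ v ∷ d) + ι 1ℤ * F (v ∷ w ∷ d)) + ι 1ℤ * (ι 1ℤ * F (w ∷ v ∷ d) + ι 1ℤ * F (w ∷ w ∷ d))
        ≈⟨ sym (+-cong (*-congˡ (first-linear (fix-first alt v) (ι 1ℤ) (ι 1ℤ) s))
                       (*-congˡ (first-linear (fix-first alt w) (ι 1ℤ) (ι 1ℤ) s))) ⟩
      ι 1ℤ * F (v ∷ v+w ∷ d) + ι 1ℤ * F (w ∷ v+w ∷ d)
        ≈⟨ sym (first-linear alt (ι 1ℤ) (ι 1ℤ) s) ⟩
      F (v+w ∷ v+w ∷ d)
        ≈⟨ adjacent here (v+w ∷ v+w ∷ d) (λ x → refl) ⟩
      0# ∎)
      where
      open Alternating alt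
      v+w : V
      v+w x = v x + w x
      s : ∀ x → v+w x ≈ ι 1ℤ * v x + ι 1ℤ * w x
      s x = solve 2 (λ a b → a :+ b := con 1ℤ :* a :+ con 1ℤ :* b) refl (v x) (w x)

    -- The first vector is moved towards its copy by swaps, each at the price of a sign, until the
    -- two are adjacent.
    first-repeated : ∀ {k} {F : (Fin (suc k) → V) → Carrier} → Alternating F →
                     ∀ v (d : Fin k → V) j → (∀ x → d j x ≈ v x) → F (v ∷ d) ≈ 0#
    first-repeated alt v d zero    h = Alternating.adjacent alt here (v ∷ d) (λ x → sym (h x))
    first-repeated {suc k} {F} alt v d (suc j) h = begin
      F (v ∷ d)             ≈⟨ cong (∷-cong (λ x → refl) η) ⟩
      F (v ∷ w ∷ d′)        ≈⟨ swap-first alt v w d′ ⟩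
      - F (w ∷ v ∷ d′)      ≈⟨ -‿cong (first-repeated (fix-first alt w) v d′ j h) ⟩
      - 0#                  ≈⟨ -0#≈0# ⟩
      0#                    ∎
      where
      open Alternating alt
      w = d zero
      d′ : Fin k → V
      d′ = d ∘ suc
      η : ∀ j x → d j x ≈ (w ∷ d′) j x
      η zero    x = refl
      η (suc j) x = refl

    private
      -- Column clearing: each multiple of v splits off a form with v among its arguments, which
      -- `vanish` kills.
      clear : ∀ {k} {G : (Fin k → V) → Carrier} → Alternating G → ∀ (v : V) →
              (∀ d j → (∀ x → d j x ≈ v x) → G d ≈ 0#) →
              ∀ (d d′ : Fin k → V) (a : Fin k → Carrier) → (∀ j x → d j x ≈ d′ j x + a j * v x) →
              G d ≈ G d′
      clear {zero}  alt v vanish d d′ a h = Alternating.cong alt λ ()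
      clear {suc k} {G} alt v vanish d d′ a h = begin
        G d                                     ≈⟨ cong (λ { zero x → refl ; (suc j) x → refl }) ⟩
        G (d zero ∷ d ∘ suc)                    ≈⟨ first-linear alt 1# (a zero) (λ x → trans (h zero x) (+-congʳ (sym (*-identityˡ _)))) ⟩
        1# * G (d′ zero ∷ d ∘ suc) + a zero * G (v ∷ d ∘ suc)
          ≈⟨ +-cong (*-identityˡ _) (trans (*-congˡ (vanish (v ∷ d ∘ suc) zero (λ x → refl))) (zeroʳ _)) ⟩
        G (d′ zero ∷ d ∘ suc) + 0#              ≈⟨ +-identityʳ _ ⟩
        G (d′ zero ∷ d ∘ suc)                   ≈⟨ clear (fix-first alt (d′ zero)) v
                                                     (λ d j → vanish (d′ zero ∷ d) (suc j)) (d ∘ suc) (d′ ∘ suc) (a ∘ suc) (h ∘ suc) ⟩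
        G (d′ zero ∷ d′ ∘ suc)                  ≈⟨ cong (λ { zero x → refl ; (suc j) x → refl }) ⟩
        G d′                                    ∎
        where open Alternating alt

    -- A form of multiplicativity for triangular matrices. The first vector contributes its diagonal
    -- coefficient; once `A zero` stands in front, its multiples can be cleared from the later
    -- vectors, and the induction continues on the remaining block.
    triangular-substitution : ∀ {k} {F : (Fin k → V) → Carrier} → Alternating F →
      ∀ (A c : Fin k → V) (u : Fin k → Fin k → Carrier) → (∀ {i j} → j Fin.< i → u i j ≈ 0#) →
      (∀ j x → c j x ≈ sum (λ i → u i j * A i x)) →
      F c ≈ product (λ j → u j j) * F A
    triangular-substitution {zero}  alt A c u tri h =
      trans (Alternating.cong alt (λ ())) (sym (*-identityˡ _))
    triangular-substitution {suc k} {F} alt A c u tri h = begin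
      F c                              ≈⟨ cong (λ { zero x → c₀ x ; (suc j) x → refl }) ⟩
      F ((λ x → u₀₀ * A zero x) ∷ c ∘ suc)
        ≈⟨ first-linear alt u₀₀ 0# (λ x → sym (trans (+-congˡ (zeroˡ (A zero x))) (+-identityʳ _))) ⟩
      u₀₀ * F (A zero ∷ c ∘ suc) + 0# * F (A zero ∷ c ∘ suc)
        ≈⟨ trans (+-congˡ (zeroˡ _)) (+-identityʳ _) ⟩
      u₀₀ * F (A zero ∷ c ∘ suc)       ≈⟨ *-congˡ (clear (fix-first alt (A zero)) (A zero)
                                            (first-repeated alt (A zero)) (c ∘ suc) d (λ j → u zero (suc j))
                                            (λ j x → trans (h (suc j) x) (+-comm _ _))) ⟩
      u₀₀ * F (A zero ∷ d)             ≈⟨ *-congˡ (triangular-substitution (fix-first alt (A zero)) (A ∘ suc) d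
                                            (λ i j → u (suc i) (suc j)) (λ j<i → tri (s≤s j<i)) (λ j x → refl)) ⟩
      u₀₀ * (product (λ j → u (suc j) (suc j)) * F (A zero ∷ A ∘ suc))
                                       ≈⟨ sym (*-assoc _ _ _) ⟩
      product (λ j → u j j) * F (A zero ∷ A ∘ suc)
                                       ≈⟨ *-congˡ (cong (λ { zero x → refl ; (suc j) x → refl })) ⟩
      product (λ j → u j j) * F A      ∎
      where
      open Alternating alt
      u₀₀ = u zero zero
      d : Fin k → V
      d j x = sum (λ i → u (suc i) (suc j) * A (suc i) x)
      c₀ : ∀ x → c zero x ≈ u₀₀ * A zero x
      c₀ x = trans (h zero x) (trans (+-congˡ (sum-zero {k} _ (λ i → trans (*-congʳ (tri (s≤s z≤n))) (zeroˡ _)))) (+-identityʳ _))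

  -- The first column is a combination of the others, so expanding it linearly gives only
  -- determinants with a repeated column.
  column-dependence : ∀ {n} (M : Fin (suc n) → Fin (suc n) → Carrier) (v : Fin n → Carrier) →
    (∀ i → M i zero + sum (λ j → v j * M i (suc j)) ≈ 0#) → det M ≈ 0#
  column-dependence {n} M v h = begin
    det M                           ≈⟨ det-cong {suc n} {M} {λ i j → (col zero ∷ col ∘ suc) j i} (λ { i zero → refl ; i (suc j) → refl }) ⟩
    columns (col zero ∷ col ∘ suc)  ≈⟨ first-sum columns-alternating (λ j → - v j) (col ∘ suc) col₀ ⟩
    sum (λ j → - v j * columns (col (suc j) ∷ col ∘ suc))
      ≈⟨ sum-zero {n} _ (λ j → trans (*-congˡ (first-repeated columns-alternating (col (suc j)) (col ∘ suc) j (λ x → refl))) (zeroʳ _)) ⟩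
    0#                              ∎
    where
    col : Fin (suc n) → Fin (suc n) → Carrier
    col j i = M i j
    col₀ : ∀ i → M i zero ≈ sum (λ j → - v j * M i (suc j))
    col₀ i = trans (x+y≈0⇒x≈-y (h i))
      (trans (sym (sum-neg (λ j → v j * M i (suc j)))) (sum-cong-≋ (λ j → -‿distribˡ-* (v j) (M i (suc j)))))

-- Integer polynomials in a ring element, and characteristic polynomials

module Polynomials (R : CommutativeRing 0ℓ 0ℓ) (x : CommutativeRing.Carrier R) where
  open RingTheory R

  -- Horner form of a polynomial of degree less than k with integer coefficients.
  Poly : ℕ → Carrier → Set
  Poly zero    y = y ≈ 0#
  Poly (suc k) y = ∃ λ (c : ℤ) → ∃ λ y′ → Poly k y′ × y ≈ ι c + x * y′

  Poly-resp : ∀ k {y z} → y ≈ z → Poly k y → Poly k z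
  Poly-resp zero    e y≈0               = trans (sym e) y≈0
  Poly-resp (suc k) e (c , y′ , P , eq) = c , y′ , P , trans (sym e) eq

  Poly-0 : ∀ k → Poly k 0#
  Poly-0 zero    = refl
  Poly-0 (suc k) = 0ℤ , 0# , Poly-0 k , solve 1 (λ x → con 0ℤ := con 0ℤ :+ x :* con 0ℤ) refl x

  Poly-+ : ∀ k {y z} → Poly k y → Poly k z → Poly k (y + z)
  Poly-+ zero    y≈0 z≈0 = trans (+-cong y≈0 z≈0) (+-identityˡ 0#)
  Poly-+ (suc k) {y} {z} (c , y′ , P , e) (d , z′ , Q , e′) =
    c ℤ.+ d , y′ + z′ , Poly-+ k P Q , (begin
      y + z                            ≈⟨ +-cong e e′ ⟩
      ι c + x * y′ + (ι d + x * z′)    ≈⟨ solve 5 (λ c d x y z → c :+ x :* y :+ (d :+ x :* z) := c :+ d :+ x :* (y :+ z)) refl (ι c) (ι d) x y′ z′ ⟩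
      ι c + ι d + x * (y′ + z′)        ≈⟨ +-congʳ (sym (ι-homo-+ c d)) ⟩
      ι (c ℤ.+ d) + x * (y′ + z′)      ∎)

  Poly-scale : ∀ k a {y} → Poly k y → Poly k (ι a * y)
  Poly-scale zero    a y≈0 = trans (*-congˡ y≈0) (zeroʳ _)
  Poly-scale (suc k) a {y} (c , y′ , P , e) = a ℤ.* c , ι a * y′ , Poly-scale k a P , (begin
      ι a * y                          ≈⟨ *-congˡ e ⟩
      ι a * (ι c + x * y′)             ≈⟨ solve 4 (λ a c x y → a :* (c :+ x :* y) := a :* c :+ x :* (a :* y)) refl (ι a) (ι c) x y′ ⟩
      ι a * ι c + x * (ι a * y′)       ≈⟨ +-congʳ (sym (ι-homo-* a c)) ⟩
      ι (a ℤ.* c) + x * (ι a * y′)     ∎)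

  Poly-neg : ∀ k {y} → Poly k y → Poly k (- y)
  Poly-neg k {y} P = Poly-resp k (solve 1 (λ y → con (ℤ.- 1ℤ) :* y := :- y) refl y) (Poly-scale k (ℤ.- 1ℤ) P)

  Poly-shift : ∀ k {y} → Poly k y → Poly (suc k) (x * y)
  Poly-shift k {y} P = 0ℤ , y , P , sym (+-identityˡ _)

  Poly-weaken : ∀ k {y} → Poly k y → Poly (suc k) y
  Poly-weaken zero    y≈0              = Poly-resp 1 (sym y≈0) (Poly-0 1)
  Poly-weaken (suc k) (c , y′ , P , e) = c , y′ , Poly-weaken k P , e

  Poly-const : ∀ k c → Poly (suc k) (ι c)
  Poly-const k c = c , 0# , Poly-0 k , solve 2 (λ c x → c := c :+ x :* con 0ℤ) refl (ι c) x

  Poly-^ : ∀ k → Poly (suc k) (x ^ k)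
  Poly-^ zero    = Poly-resp 1 ι-1 (Poly-const 0 1ℤ)
  Poly-^ (suc k) = Poly-shift (suc k) (Poly-^ k)

  Poly-*₁ : ∀ k {y z} → Poly 1 y → Poly k z → Poly k (y * z)
  Poly-*₁ k {y} {z} (c , y′ , y′≈0 , e) Q = Poly-resp k (*-congʳ (sym y≈c)) (Poly-scale k c Q)
    where
    y≈c : y ≈ ι c
    y≈c = trans e (trans (+-congˡ (trans (*-congˡ y′≈0) (zeroʳ x))) (+-identityʳ _))

  Poly-*₂ : ∀ k {y z} → Poly 2 y → Poly k z → Poly (suc k) (y * z)
  Poly-*₂ k {y} {z} (c , y′ , P , e) Q =
    Poly-resp (suc k)
      (sym (trans (*-congʳ e) (solve 4 (λ c x y z → (c :+ x :* y) :* z := c :* z :+ x :* (y :* z)) refl (ι c) x y′ z)))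
      (Poly-+ (suc k) (Poly-weaken k (Poly-scale k c Q)) (Poly-shift k (Poly-*₁ k P Q)))

  Poly-alternatingSum : ∀ k {n} (v : Vector Carrier n) → (∀ i → Poly k (v i)) → Poly k (alternatingSum v)
  Poly-alternatingSum k {zero}  v P = Poly-0 k
  Poly-alternatingSum k {suc n} v P =
    Poly-+ k (P zero) (Poly-neg k (Poly-alternatingSum k (v ∘ suc) (P ∘ suc)))

  det-degree : ∀ {n} (M : Fin n → Fin n → Carrier) → (∀ i j → Poly 2 (M i j)) → Poly (suc n) (det M)
  det-degree {zero}  M P = Poly-resp 1 ι-1 (Poly-const 0 1ℤ)
  det-degree {suc n} M P = Poly-alternatingSum (suc (suc n)) _ λ j →
    Poly-*₂ (suc n) (P zero j) (det-degree (λ i k → M (suc i) (punchIn j k)) (λ i k → P (suc i) (punchIn j k)))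

  -- Every Laplace term takes one factor from the row r, which is free of x; this lowers the bound
  -- of `det-degree` by one.
  det-degree-constant-row : ∀ {n} (M : Fin n → Fin n → Carrier) → (∀ i j → Poly 2 (M i j)) →
                            ∀ r → (∀ j → Poly 1 (M r j)) → Poly n (det M)
  det-degree-constant-row {suc n} M P zero Q = Poly-alternatingSum (suc n) _ λ j →
    Poly-*₁ (suc n) (Q j) (det-degree (λ i k → M (suc i) (punchIn j k)) (λ i k → P (suc i) (punchIn j k)))
  det-degree-constant-row {suc n} M P (suc r) Q = Poly-alternatingSum (suc n) _ λ j →
    Poly-*₂ n (P zero j) (det-degree-constant-row (λ i k → M (suc i) (punchIn j k))
      (λ i k → P (suc i) (punchIn j k)) r (λ k → Q (punchIn j k)))

  δ : ∀ {n} → Fin n → Fin n → ℤ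
  δ zero    zero    = 1ℤ
  δ zero    (suc j) = 0ℤ
  δ (suc i) zero    = 0ℤ
  δ (suc i) (suc j) = δ i j

  δ-≢ : ∀ {n} (i j : Fin n) → i ≢ j → δ i j ≡ 0ℤ
  δ-≢ zero    zero    i≢j = contradiction ≡.refl i≢j
  δ-≢ zero    (suc j) i≢j = ≡.refl
  δ-≢ (suc i) zero    i≢j = ≡.refl
  δ-≢ (suc i) (suc j) i≢j = δ-≢ i j (i≢j ∘ ≡.cong suc)

  δ-refl : ∀ {n} (i : Fin n) → δ i i ≡ 1ℤ
  δ-refl zero    = ≡.refl
  δ-refl (suc i) = δ-refl i

  xI- : ∀ {n} → (Fin n → Fin n → ℤ) → Fin n → Fin n → Carrier
  xI- A i j = ι (δ i j) * x + - ι (A i j)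

  -- Only the corner entry times the smaller characteristic polynomial reaches degree n + 1. In each
  -- other term the row entry is constant, and the minor has lost the diagonal entry of one further
  -- row. `Poly n` means degree below n, so y collects everything under the leading term.
  charpoly-monic : ∀ {n} (A : Fin n → Fin n → ℤ) → ∃ λ y → Poly n y × det (xI- A) ≈ x ^ n + y
  charpoly-monic {zero}  A = 0# , refl , sym (+-identityʳ 1#)
  charpoly-monic {suc n} A =
    let y , P , e = charpoly-monic A′
        z = x * y + (ι (ℤ.- a) * x ^ n + ι (ℤ.- a) * y) + - alternatingSum rest
    in z ,
       Poly-+ (suc n) (Poly-+ (suc n) (Poly-shift n P) (Poly-+ (suc n) (Poly-scale (suc n) (ℤ.- a) (Poly-^ n))
         (Poly-weaken n (Poly-scale n (ℤ.- a) P)))) (Poly-neg (suc n) (Poly-alternatingSum (suc n) rest rest-degree)) ,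
       trans (+-congʳ (trans (*-congˡ e) (corner y)))
         (+-assoc _ _ _)
    where
    a = A zero zero
    A′ : Fin n → Fin n → ℤ
    A′ i j = A (suc i) (suc j)
    rest : Vector Carrier n
    rest j = xI- A zero (suc j) * det (λ i k → xI- A (suc i) (punchIn (suc j) k))
    corner : ∀ y → xI- A zero zero * (x ^ n + y) ≈ x ^ suc n + (x * y + (ι (ℤ.- a) * x ^ n + ι (ℤ.- a) * y))
    corner y = begin
      (ι 1ℤ * x + - ι a) * (x ^ n + y)
        ≈⟨ solve 4 (λ x a t y → (con 1ℤ :* x :+ :- a) :* (t :+ y) := x :* t :+ (x :* y :+ (:- a :* t :+ :- a :* y)))
             refl x (ι a) (x ^ n) y ⟩
      x * x ^ n + (x * y + (- ι a * x ^ n + - ι a * y))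
        ≈⟨ +-congˡ (+-congˡ (+-cong (*-congʳ (sym (ι-homo-- a))) (*-congʳ (sym (ι-homo-- a))))) ⟩
      x ^ suc n + (x * y + (ι (ℤ.- a) * x ^ n + ι (ℤ.- a) * y)) ∎
    entry-degree : ∀ i j → Poly 2 (xI- A i j)
    entry-degree i j = Poly-+ 2
      (Poly-scale 2 (δ i j) (Poly-resp 2 (*-identityʳ x) (Poly-shift 1 (Poly-resp 1 ι-1 (Poly-const 0 1ℤ)))))
      (Poly-neg 2 (Poly-const 1 (A i j)))
    constant-entry : ∀ i j → i ≢ j → Poly 1 (xI- A i j)
    constant-entry i j i≢j = Poly-resp 1
      (trans (ι-homo-- (A i j)) (trans (solve 2 (λ x a → :- a := con 0ℤ :* x :+ :- a) refl x (ι (A i j)))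
        (+-congʳ (*-congʳ (reflexive (≡.cong ι (≡.sym (δ-≢ i j i≢j))))))))
      (Poly-const 0 (ℤ.- A i j))
    rest-degree : ∀ j → Poly (suc n) (rest j)
    rest-degree j = Poly-*₁ (suc n) (constant-entry zero (suc j) (λ ()))
      (Poly-weaken n (det-degree-constant-row {n} _ (λ i k → entry-degree (suc i) (punchIn (suc j) k)) j
        (λ k → constant-entry (suc j) (punchIn (suc j) k) (λ e → Fin.punchInᵢ≢i (suc j) k (≡.sym e)))))

  Poly⇒coefficients : ∀ k {y} → Poly k y →
    ∃ λ (c : Vector ℤ k) → y ≈ sum (λ i → c i · (x ^ toℕ i))
  Poly⇒coefficients zero    y≈0 = (λ ()) , y≈0
  Poly⇒coefficients (suc k) {y} (c , y′ , P , e) with Poly⇒coefficients k P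
  ... | d , e′ = c ∷ d , (begin
    y                                               ≈⟨ e ⟩
    ι c + x * y′                                    ≈⟨ +-congˡ (*-congˡ e′) ⟩
    ι c + x * sum (λ i → d i · (x ^ toℕ i))         ≈⟨ +-congˡ (*-distribˡ-sum x (λ i → d i · (x ^ toℕ i))) ⟩
    ι c + sum (λ i → x * (d i · (x ^ toℕ i)))       ≈⟨ +-congˡ (sum-cong-≋ {k} (λ i → shift-· (d i) (x ^ toℕ i))) ⟩
    ι c + sum (λ i → d i · (x ^ suc (toℕ i)))       ∎)
    where
    open import Algebra.Properties.Semiring.Mult semiring using (×-comm-*)
    shift-· : ∀ z w → x * (z · w) ≈ z · (x * w)
    shift-· (+ n)    w = ×-comm-* n x w
    shift-· -[1+ n ] w = trans (sym (-‿distribʳ-* _ _)) (-‿cong (×-comm-* (suc n) x w))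

  -- If x acts on the span of v by an integer matrix and v₀ = 1, then v₀ · det (x I - A) = 0.
  integral : ∀ {n} (v : Vector Carrier (suc n)) → v zero ≈ 1# → (A : Fin (suc n) → Fin (suc n) → ℤ) →
    (∀ i → x * v i ≈ sum (λ j → ι (A i j) * v j)) →
    ∃ λ k → ∃ λ (c : Vector ℤ k) → x ^ k + sum (λ i → c i · (x ^ toℕ i)) ≈ 0#
  integral {n} v v₀ A h =
    let y , P , e = charpoly-monic A
        c , e′ = Poly⇒coefficients (suc n) P
    in suc n , c , trans (+-congˡ (sym e′)) (trans (sym e) (column-dependence (xI- A) (v ∘ suc) dependence))
    where
    dependence : ∀ i → xI- A i zero + sum (λ j → v (suc j) * xI- A i (suc j)) ≈ 0#
    dependence i = begin
      xI- A i zero + sum (λ j → v (suc j) * xI- A i (suc j))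
        ≈⟨ +-congʳ (trans (sym (*-identityˡ _)) (*-congʳ (sym v₀))) ⟩
      sum (λ j → v j * xI- A i j)
        ≈⟨ sum-cong-≋ {suc n} (λ j → solve 4 (λ v d x a → v :* (d :* x :+ :- a) := x :* (d :* v) :+ con (ℤ.- 1ℤ) :* (a :* v)) refl
             (v j) (ι (δ i j)) x (ι (A i j))) ⟩
      sum (λ j → x * (ι (δ i j) * v j) + ι (ℤ.- 1ℤ) * (ι (A i j) * v j))
        ≈⟨ sum-linear {suc n} x (ι (ℤ.- 1ℤ)) (λ j → ι (δ i j) * v j) (λ j → ι (A i j) * v j) ⟩
      x * sum (λ j → ι (δ i j) * v j) + ι (ℤ.- 1ℤ) * sum (λ j → ι (A i j) * v j)
        ≈⟨ +-cong (*-congˡ δ-sum) (*-congˡ (sym (h i))) ⟩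
      x * v i + ι (ℤ.- 1ℤ) * (x * v i)
        ≈⟨ solve 1 (λ t → t :+ con (ℤ.- 1ℤ) :* t := con 0ℤ) refl (x * v i) ⟩
      0# ∎
      where
      δ-sum : sum (λ j → ι (δ i j) * v j) ≈ v i
      δ-sum = trans (sum-single i (λ j → ι (δ i j) * v j) (λ j j≢i →
                trans (*-congʳ (reflexive (≡.cong ι (δ-≢ i j (λ e → j≢i (≡.sym e)))))) (zeroˡ _)))
              (trans (*-congʳ (trans (reflexive (≡.cong ι (δ-refl i))) ι-1)) (*-identityˡ _))

-- Rational numbers

module ℚR = RingTheory ℚ.+-*-commutativeRing

-- Inequalities are moved to one side, so that what remains to check is a ring identity between the
-- difference and a visibly nonnegative expression.
0≤⇒≤ : ∀ {a b} → 0ℚ ℚ.≤ b ℚ.- a → a ℚ.≤ b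
0≤⇒≤ {a} {b} h = ≡.subst₂ ℚ._≤_ (ℚ.+-identityˡ a) (solve 2 (λ a b → b :- a :+ a := b) ≡.refl a b) (ℚ.+-monoˡ-≤ a h)
  where open ℚ.+-*-Solver

0<⇒< : ∀ {a b} → 0ℚ ℚ.< b ℚ.- a → a ℚ.< b
0<⇒< {a} {b} h = ≡.subst₂ ℚ._<_ (ℚ.+-identityˡ a) (solve 2 (λ a b → b :- a :+ a := b) ≡.refl a b) (ℚ.+-monoˡ-< a h)
  where open ℚ.+-*-Solver

≤⇒0≤ : ∀ {a b} → a ℚ.≤ b → 0ℚ ℚ.≤ b ℚ.- a
≤⇒0≤ {a} {b} h = ≡.subst (ℚ._≤ b ℚ.- a) (ℚ.+-inverseʳ a) (ℚ.+-monoˡ-≤ (ℚ.- a) h)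

<⇒0< : ∀ {a b} → a ℚ.< b → 0ℚ ℚ.< b ℚ.- a
<⇒0< {a} {b} h = ≡.subst (ℚ._< b ℚ.- a) (ℚ.+-inverseʳ a) (ℚ.+-monoˡ-< (ℚ.- a) h)

0≤-+ : ∀ {a b} → 0ℚ ℚ.≤ a → 0ℚ ℚ.≤ b → 0ℚ ℚ.≤ a ℚ.+ b
0≤-+ = ℚ.+-mono-≤

0<-+ : ∀ {a b} → 0ℚ ℚ.< a → 0ℚ ℚ.≤ b → 0ℚ ℚ.< a ℚ.+ b
0<-+ = ℚ.+-mono-<-≤

0≤-* : ∀ {a b} → 0ℚ ℚ.≤ a → 0ℚ ℚ.≤ b → 0ℚ ℚ.≤ a ℚ.* b
0≤-* {a} {b} 0≤a 0≤b = ℚ.nonNegative⁻¹ (a ℚ.* b)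
  {{ℚ.nonNeg*nonNeg⇒nonNeg a {{ℚ.nonNegative 0≤a}} b {{ℚ.nonNegative 0≤b}}}}

0<-* : ∀ {a b} → 0ℚ ℚ.< a → 0ℚ ℚ.< b → 0ℚ ℚ.< a ℚ.* b
0<-* {a} {b} 0<a 0<b = ℚ.positive⁻¹ (a ℚ.* b)
  {{ℚ.pos*pos⇒pos a {{ℚ.positive 0<a}} b {{ℚ.positive 0<b}}}}

0≤-square : ∀ a → 0ℚ ℚ.≤ a ℚ.* a
0≤-square a with ℚ.≤-total 0ℚ a
... | inj₁ 0≤a = 0≤-* 0≤a 0≤a
... | inj₂ a≤0 = ≡.subst (0ℚ ℚ.≤_) (solve 1 (λ a → (con 0ℚ :- a) :* (con 0ℚ :- a) := a :* a) ≡.refl a)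
                   (0≤-* (≤⇒0≤ a≤0) (≤⇒0≤ a≤0))
  where open ℚ.+-*-Solver

∣∣<⇒< : ∀ {a b} → ℚ.∣ a ∣ ℚ.< b → a ℚ.< b
∣∣<⇒< {a} {b} h with ℚ.≤-total 0ℚ a
... | inj₁ 0≤a = ≡.subst (ℚ._< b) (ℚ.0≤p⇒∣p∣≡p 0≤a) h
... | inj₂ a≤0 = ℚ.≤-<-trans a≤0 (ℚ.≤-<-trans (ℚ.0≤∣p∣ a) h)

<⇒∣∣< : ∀ a {b} → a ℚ.< b → ℚ.- a ℚ.< b → ℚ.∣ a ∣ ℚ.< b
<⇒∣∣< a {b} h h′ with ℚ.∣p∣≡p∨∣p∣≡-p a
... | inj₁ e = ≡.subst (ℚ._< b) (≡.sym e) h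
... | inj₂ e = ≡.subst (ℚ._< b) (≡.sym e) h′

abstract
  0<½ : 0ℚ ℚ.< ½
  0<½ = ℚ.positive⁻¹ ½

  0<1ℚ : 0ℚ ℚ.< 1ℚ
  0<1ℚ = ℚ.positive⁻¹ 1ℚ

½+½ : ∀ a → ½ ℚ.* a ℚ.+ ½ ℚ.* a ≡ a
½+½ = solve 1 (λ a → con ½ :* a :+ con ½ :* a := a) ≡.refl
  where open ℚ.+-*-Solver

recip : ∀ a → 0ℚ ℚ.< a → ∃ λ b → 0ℚ ℚ.< b × a ℚ.* b ≡ 1ℚ
recip a 0<a = (ℚ.1/ a) {{ℚ.>-nonZero 0<a}}
            , ℚ.positive⁻¹ _ {{ℚ.1/pos⇒pos a {{ℚ.positive 0<a}}}}
            , ℚ.*-inverseʳ a {{ℚ.>-nonZero 0<a}}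

ιℚ : ℤ → ℚ
ιℚ = ℚR.ι

/-cancel : ∀ z n → (z ℚ./ suc n) ℚ.* (+ suc n ℚ./ 1) ≡ z ℚ./ 1
/-cancel z n = ℚ.toℚᵘ-injective (begin-equality
  ℚ.toℚᵘ ((z ℚ./ suc n) ℚ.* (+ suc n ℚ./ 1))            ≃⟨ ℚ.toℚᵘ-homo-* (z ℚ./ suc n) (+ suc n ℚ./ 1) ⟩
  ℚ.toℚᵘ (z ℚ./ suc n) ℚᵘ.* ℚ.toℚᵘ (+ suc n ℚ./ 1)      ≃⟨ ℚᵘ.*-cong (ℚ.toℚᵘ-fromℚᵘ (ℚᵘ.mkℚᵘ z n)) (ℚ.toℚᵘ-fromℚᵘ (ℚᵘ.mkℚᵘ (+ suc n) 0)) ⟩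
  ℚᵘ.mkℚᵘ z n ℚᵘ.* ℚᵘ.mkℚᵘ (+ suc n) 0                  ≃⟨ ℚᵘ.*≡* e ⟩
  ℚᵘ.mkℚᵘ z 0                                           ≃⟨ ℚᵘ.≃-sym (ℚ.toℚᵘ-fromℚᵘ (ℚᵘ.mkℚᵘ z 0)) ⟩
  ℚ.toℚᵘ (z ℚ./ 1)                                      ∎)
  where
  open ℚᵘ.≤-Reasoning
  e : (z ℤ.* + suc n) ℤ.* 1ℤ ≡ z ℤ.* + (suc n ℕ.* 1)
  e = ≡.trans (ℤ.*-identityʳ _) (≡.cong (λ k → z ℤ.* + k) (≡.sym (ℕ.*-identityʳ (suc n))))

/1-suc : ∀ n → + suc n ℚ./ 1 ≡ 1ℚ ℚ.+ (+ n ℚ./ 1)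
/1-suc n = ℚ.toℚᵘ-injective (begin-equality
  ℚ.toℚᵘ (+ suc n ℚ./ 1)                  ≃⟨ ℚ.toℚᵘ-fromℚᵘ (ℚᵘ.mkℚᵘ (+ suc n) 0) ⟩
  ℚᵘ.mkℚᵘ (+ suc n) 0                     ≃⟨ ℚᵘ.*≡* e ⟩
  ℚᵘ.mkℚᵘ 1ℤ 0 ℚᵘ.+ ℚᵘ.mkℚᵘ (+ n) 0       ≃⟨ ℚᵘ.+-cong {x = ℚᵘ.mkℚᵘ 1ℤ 0} ℚᵘ.≃-refl (ℚᵘ.≃-sym (ℚ.toℚᵘ-fromℚᵘ (ℚᵘ.mkℚᵘ (+ n) 0))) ⟩
  ℚ.toℚᵘ 1ℚ ℚᵘ.+ ℚ.toℚᵘ (+ n ℚ./ 1)       ≃⟨ ℚᵘ.≃-sym (ℚ.toℚᵘ-homo-+ 1ℚ (+ n ℚ./ 1)) ⟩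
  ℚ.toℚᵘ (1ℚ ℚ.+ (+ n ℚ./ 1))             ∎)
  where
  open ℚᵘ.≤-Reasoning
  e : + suc n ℤ.* + 1 ≡ (1ℤ ℤ.* 1ℤ ℤ.+ + n ℤ.* 1ℤ) ℤ.* 1ℤ
  e = ≡.cong (ℤ._* 1ℤ) (≡.cong (λ k → 1ℤ ℤ.+ k) (≡.sym (ℤ.*-identityʳ (+ n))))

private
  /1≡ι⁺ : ∀ n → + n ℚ./ 1 ≡ ιℚ (+ n)
  /1≡ι⁺ zero    = ≡.refl
  /1≡ι⁺ (suc n) = ≡.trans (/1-suc n) (≡.cong (1ℚ ℚ.+_) (/1≡ι⁺ n))

-- Bridge between two embeddings of ℤ in ℚ: the quotient `z / 1` of the definitions, which
-- normalises a fraction, and the recursive `ι`, which the solver and the ring lemmas understand.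
/1≡ι : ∀ z → z ℚ./ 1 ≡ ιℚ z
/1≡ι (+ n)    = /1≡ι⁺ n
/1≡ι -[1+ n ] = ≡.cong ℚ.-_ (/1≡ι⁺ (suc n))

/-ι : ∀ z n → (z ℚ./ suc n) ℚ.* ιℚ (+ suc n) ≡ ιℚ z
/-ι z n = ≡.trans (≡.cong ((z ℚ./ suc n) ℚ.*_) (≡.sym (/1≡ι (+ suc n)))) (≡.trans (/-cancel z n) (/1≡ι z))

0≤ι : ∀ n → 0ℚ ℚ.≤ ιℚ (+ n)
0≤ι zero    = ℚ.≤-refl
0≤ι (suc n) = 0≤-+ (ℚ.<⇒≤ 0<1ℚ) (0≤ι n)

0<ι : ∀ n → 0ℚ ℚ.< ιℚ (+ suc n)
0<ι n = 0<-+ 0<1ℚ (0≤ι n)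

0<ι′ : ∀ n → .{{NonZero n}} → 0ℚ ℚ.< ιℚ (+ n)
0<ι′ (suc n) = 0<ι n

ι-mono-≤ : ∀ {i j} → i ℤ.≤ j → ιℚ i ℚ.≤ ιℚ j
ι-mono-≤ {i} {j} i≤j = 0≤⇒≤ (≡.subst (0ℚ ℚ.≤_) e (0≤ι ℤ.∣ j ℤ.- i ∣))
  where
  e : ιℚ (+ ℤ.∣ j ℤ.- i ∣) ≡ ιℚ j ℚ.- ιℚ i
  e = ≡.trans (≡.cong ιℚ (ℤ.0≤i⇒+∣i∣≡i (ℤ.i≤j⇒0≤j-i i≤j)))
       (≡.trans (ℚR.ι-homo-+ j (ℤ.- i)) (≡.cong (ιℚ j ℚ.+_) (ℚR.ι-homo-- i)))

-- The denominator of ε serves as N: multiplied by it, ε becomes its numerator, an integer that is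
-- at least 1.
archimedean : ∀ ε → 0ℚ ℚ.< ε → ∃ λ N → 1ℚ ℚ.≤ ιℚ (+ N) ℚ.* ε
archimedean ε@(ℚ.mkℚ z d _) 0<ε = suc d , ≡.subst (1ℚ ℚ.≤_) e (ι-mono-≤ 1≤z)
  where
  e : ιℚ z ≡ ιℚ (+ suc d) ℚ.* ε
  e = ≡.trans (≡.sym (/-ι z d)) (≡.trans (ℚ.*-comm (z ℚ./ suc d) (ιℚ (+ suc d))) (≡.cong (ιℚ (+ suc d) ℚ.*_) (ℚ.↥p/↧p≡p ε)))
  1≤z : 1ℤ ℤ.≤ z
  1≤z = ℤ.i<j⇒suc[i]≤j (≡.subst₂ ℤ._<_ ≡.refl (ℤ.*-identityʳ z) (ℚ.drop-*<* 0<ε))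

-- Real numbers

Null : (ℕ → ℚ) → Set
Null f = ∀ ε → 0ℚ ℚ.< ε → ∃ λ N → ∀ n → N ℕ.≤ n → ℚ.∣ f n ∣ ℚ.< ε

EventuallyBounded : (ℕ → ℚ) → Set
EventuallyBounded f = ∃ λ B → 0ℚ ℚ.< B × ∃ λ N → ∀ n → N ℕ.≤ n → ℚ.∣ f n ∣ ℚ.< B

null-resp : ∀ {f g} → (∀ n → f n ≡ g n) → Null f → Null g
null-resp e h ε 0<ε with h ε 0<ε
... | N , b = N , λ n N≤n → ≡.subst (λ q → ℚ.∣ q ∣ ℚ.< ε) (e n) (b n N≤n)

null-0 : Null (λ _ → 0ℚ)
null-0 ε 0<ε = 0 , λ _ _ → 0<ε

null-+ : ∀ {f g} → Null f → Null g → Null (λ n → f n ℚ.+ g n)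
null-+ {f} {g} h k ε 0<ε with h (½ ℚ.* ε) (0<-* 0<½ 0<ε) | k (½ ℚ.* ε) (0<-* 0<½ 0<ε)
... | N , a | M , b = N ℕ.⊔ M , λ n N⊔M≤n →
  ≡.subst (ℚ.∣ f n ℚ.+ g n ∣ ℚ.<_) (½+½ ε)
    (ℚ.≤-<-trans (ℚ.∣p+q∣≤∣p∣+∣q∣ (f n) (g n))
      (ℚ.+-mono-< (a n (ℕ.m⊔n≤o⇒m≤o N M N⊔M≤n)) (b n (ℕ.m⊔n≤o⇒n≤o N M N⊔M≤n))))

null-* : ∀ {f g} → EventuallyBounded f → Null g → Null (λ n → f n ℚ.* g n)
null-* {f} {g} (B , 0<B , N , b) h ε 0<ε with recip B 0<B
... | B⁻¹ , 0<B⁻¹ , BB⁻¹ with h (B⁻¹ ℚ.* ε) (0<-* 0<B⁻¹ 0<ε)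
... | M , s = N ℕ.⊔ M , λ n N⊔M≤n → begin-strict
  ℚ.∣ f n ℚ.* g n ∣              ≡⟨ ℚ.∣p*q∣≡∣p∣*∣q∣ (f n) (g n) ⟩
  ℚ.∣ f n ∣ ℚ.* ℚ.∣ g n ∣        ≤⟨ ℚ.*-monoʳ-≤-nonNeg ℚ.∣ g n ∣ {{ℚ.∣-∣-nonNeg (g n)}} (ℚ.<⇒≤ (b n (ℕ.m⊔n≤o⇒m≤o N M N⊔M≤n))) ⟩
  B ℚ.* ℚ.∣ g n ∣                <⟨ ℚ.*-monoʳ-<-pos B {{ℚ.positive 0<B}} (s n (ℕ.m⊔n≤o⇒n≤o N M N⊔M≤n)) ⟩
  B ℚ.* (B⁻¹ ℚ.* ε)              ≡⟨ ≡.sym (ℚ.*-assoc B B⁻¹ ε) ⟩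
  B ℚ.* B⁻¹ ℚ.* ε                ≡⟨ ≡.cong (ℚ._* ε) BB⁻¹ ⟩
  1ℚ ℚ.* ε                       ≡⟨ ℚ.*-identityˡ ε ⟩
  ε                              ∎
  where open ℚ.≤-Reasoning

null-neg : ∀ {f} → Null f → Null (λ n → ℚ.- f n)
null-neg {f} h ε 0<ε with h ε 0<ε
... | N , b = N , λ n N≤n → ≡.subst (ℚ._< ε) (≡.sym (ℚ.∣-p∣≡∣p∣ (f n))) (b n N≤n)

bounded : ∀ x → EventuallyBounded (seq x)
bounded x with cauchy x 1ℚ 0<1ℚ
... | N , close = 1ℚ ℚ.+ ℚ.∣ seq x N ∣ , 0<-+ 0<1ℚ (ℚ.0≤∣p∣ (seq x N)) , N , λ n N≤n → begin-strict
  ℚ.∣ seq x n ∣                                ≡⟨ ≡.cong ℚ.∣_∣ (solve 2 (λ a b → a := (a :- b) :+ b) ≡.refl (seq x n) (seq x N)) ⟩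
  ℚ.∣ (seq x n ℚ.- seq x N) ℚ.+ seq x N ∣      ≤⟨ ℚ.∣p+q∣≤∣p∣+∣q∣ (seq x n ℚ.- seq x N) (seq x N) ⟩
  ℚ.∣ seq x n ℚ.- seq x N ∣ ℚ.+ ℚ.∣ seq x N ∣  <⟨ ℚ.+-monoˡ-< ℚ.∣ seq x N ∣ (close n N N≤n ℕ.≤-refl) ⟩
  1ℚ ℚ.+ ℚ.∣ seq x N ∣                         ∎
  where
  open ℚ.≤-Reasoning
  open ℚ.+-*-Solver using (solve; _:+_; _:-_; _:=_)

-- _≈ᵣ_ is a function type, from which x and y cannot be inferred; the record can.
infix 4 _≃_

record _≃_ (x y : ℝ) : Set where
  constructor wrap
  field
    unwrap : x ≈ᵣ y

open _≃_ public

pointwise : ∀ {x y} → (∀ n → seq x n ≡ seq y n) → x ≃ y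
pointwise {x} {y} e = wrap (null-resp (λ n → ≡.sym (≡.trans (≡.cong (ℚ._- seq y n) (e n)) (ℚ.+-inverseʳ (seq y n)))) null-0)

private
  ≃-sym : ∀ {x y} → x ≃ y → y ≃ x
  ≃-sym {x} {y} (wrap e) = wrap (null-resp (λ n → solve 2 (λ a b → :- (a :- b) := b :- a) ≡.refl (seq x n) (seq y n)) (null-neg e))
    where open ℚ.+-*-Solver using (solve; :-_; _:-_; _:=_)

  ≃-trans : ∀ {x y z} → x ≃ y → y ≃ z → x ≃ z
  ≃-trans {x} {y} {z} (wrap e) (wrap f) = wrap
    (null-resp (λ n → solve 3 (λ a b c → (a :- b) :+ (b :- c) := a :- c) ≡.refl (seq x n) (seq y n) (seq z n)) (null-+ e f))
    where open ℚ.+-*-Solver using (solve; _:+_; _:-_; _:=_)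

  +ᵣ-cong : ∀ {x y z w} → x ≃ y → z ≃ w → x +ᵣ z ≃ y +ᵣ w
  +ᵣ-cong {x} {y} {z} {w} (wrap e) (wrap f) = wrap
    (null-resp (λ n → solve 4 (λ a b c d → (a :- b) :+ (c :- d) := (a :+ c) :- (b :+ d)) ≡.refl
                (seq x n) (seq y n) (seq z n) (seq w n)) (null-+ e f))
    where open ℚ.+-*-Solver using (solve; _:+_; _:-_; _:=_)

  *ᵣ-cong : ∀ {x y z w} → x ≃ y → z ≃ w → x *ᵣ z ≃ y *ᵣ w
  *ᵣ-cong {x} {y} {z} {w} (wrap e) (wrap f) = wrap
    (null-resp (λ n → solve 4 (λ a b c d → a :* (c :- d) :+ d :* (a :- b) := a :* c :- b :* d) ≡.refl
                (seq x n) (seq y n) (seq z n) (seq w n)) (null-+ (null-* (bounded x) f) (null-* (bounded w) e)))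
    where open ℚ.+-*-Solver using (solve; _:+_; _:*_; _:-_; _:=_)

  -ᵣ-cong : ∀ {x y} → x ≃ y → -ᵣ x ≃ -ᵣ y
  -ᵣ-cong {x} {y} (wrap e) = wrap (null-resp (λ n → solve 2 (λ a b → :- (a :- b) := (:- a) :- (:- b)) ≡.refl (seq x n) (seq y n)) (null-neg e))
    where open ℚ.+-*-Solver using (solve; :-_; _:-_; _:=_)

ℝ-commutativeRing : CommutativeRing 0ℓ 0ℓ
ℝ-commutativeRing = record
  { Carrier = ℝ
  ; _≈_     = _≃_
  ; _+_     = _+ᵣ_
  ; _*_     = _*ᵣ_
  ; -_      = -ᵣ_
  ; 0#      = fromℚ 0ℚ
  ; 1#      = fromℚ 1ℚ
  ; isCommutativeRing = record
    { isRing = record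
      { +-isAbelianGroup = record
        { isGroup = record
          { isMonoid = record
            { isSemigroup = record
              { isMagma = record
                { isEquivalence = record
                  { refl  = pointwise (λ _ → ≡.refl)
                  ; sym   = ≃-sym
                  ; trans = ≃-trans
                  }
                ; ∙-cong = +ᵣ-cong
                }
              ; assoc = λ x y z → pointwise (λ n → ℚ.+-assoc (seq x n) (seq y n) (seq z n))
              }
            ; identity = (λ x → pointwise (λ n → ℚ.+-identityˡ (seq x n)))
                       , (λ x → pointwise (λ n → ℚ.+-identityʳ (seq x n)))
            }
          ; inverse = (λ x → pointwise (λ n → ℚ.+-inverseˡ (seq x n)))
                    , (λ x → pointwise (λ n → ℚ.+-inverseʳ (seq x n)))
          ; ⁻¹-cong = -ᵣ-cong
          }
        ; comm = λ x y → pointwise (λ n → ℚ.+-comm (seq x n) (seq y n))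
        }
      ; *-cong = *ᵣ-cong
      ; *-assoc = λ x y z → pointwise (λ n → ℚ.*-assoc (seq x n) (seq y n) (seq z n))
      ; *-identity = (λ x → pointwise (λ n → ℚ.*-identityˡ (seq x n)))
                   , (λ x → pointwise (λ n → ℚ.*-identityʳ (seq x n)))
      ; distrib = (λ x y z → pointwise (λ n → ℚ.*-distribˡ-+ (seq x n) (seq y n) (seq z n)))
                , (λ x y z → pointwise (λ n → ℚ.*-distribʳ-+ (seq x n) (seq y n) (seq z n)))
      }
    ; *-comm = λ x y → pointwise (λ n → ℚ.*-comm (seq x n) (seq y n))
    }
  }

module ℝR = RingTheory ℝ-commutativeRing

-- The raw rings behind `ℝ-Ops` and `ℝR` differ only in their equality relation, so the determinants
-- built on them agree propositionally, by recursion.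
det-ℝ : ∀ {n} (A : Fin n → Fin n → ℝ) → ℝ-Ops.det A ≡ ℝR.det A
det-ℝ {zero}  A = ≡.refl
det-ℝ {suc n} A = alternate (λ j → A zero j *ᵣ ℝ-Ops.det (minor j)) (λ j → A zero j *ᵣ ℝR.det (minor j))
                    (λ j → ≡.cong (A zero j *ᵣ_) (det-ℝ (minor j)))
  where
  minor : Fin (suc n) → Fin n → Fin n → ℝ
  minor j i k = A (suc i) (punchIn j k)
  alternate : ∀ {n} (v w : Vector ℝ n) → (∀ i → v i ≡ w i) → ℝ-Ops.alternatingSum v ≡ ℝR.alternatingSum w
  alternate {zero}  v w e = ≡.refl
  alternate {suc n} v w e = ≡.cong₂ (λ a b → a +ᵣ (-ᵣ b)) (e zero) (alternate (v ∘ suc) (w ∘ suc) (e ∘ suc))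

-- Order and square roots of real numbers

-- The one-sided companion of `Null`: the upper limit is at most 0. Applied to a difference it is
-- `_≤ᵣ_`.
EventuallyBelow : (ℕ → ℚ) → Set
EventuallyBelow f = ∀ ε → 0ℚ ℚ.< ε → ∃ λ N → ∀ n → N ℕ.≤ n → f n ℚ.< ε

below-resp : ∀ {f g} → (∀ n → f n ≡ g n) → EventuallyBelow f → EventuallyBelow g
below-resp e h ε 0<ε with h ε 0<ε
... | N , b = N , λ n N≤n → ≡.subst (ℚ._< ε) (e n) (b n N≤n)

null⇒below : ∀ {f} → Null f → EventuallyBelow f
null⇒below h ε 0<ε with h ε 0<ε
... | N , b = N , λ n N≤n → ∣∣<⇒< (b n N≤n)

below-+ : ∀ {f g} → EventuallyBelow f → EventuallyBelow g → EventuallyBelow (λ n → f n ℚ.+ g n)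
below-+ {f} {g} h k ε 0<ε with h (½ ℚ.* ε) (0<-* 0<½ 0<ε) | k (½ ℚ.* ε) (0<-* 0<½ 0<ε)
... | N , a | M , b = N ℕ.⊔ M , λ n N⊔M≤n →
  ≡.subst (f n ℚ.+ g n ℚ.<_) (½+½ ε)
    (ℚ.+-mono-< (a n (ℕ.m⊔n≤o⇒m≤o N M N⊔M≤n)) (b n (ℕ.m⊔n≤o⇒n≤o N M N⊔M≤n)))

≤ᵣ⇒below : ∀ {x y} → x ≤ᵣ y → EventuallyBelow (λ n → seq x n ℚ.- seq y n)
≤ᵣ⇒below {x} {y} h ε 0<ε with h ε 0<ε
... | N , b = N , λ n N≤n → 0<⇒< (≡.subst (0ℚ ℚ.<_)
  (solve 3 (λ a b e → (b :+ e) :- a := e :- (a :- b)) ≡.refl (seq x n) (seq y n) ε) (<⇒0< (b n N≤n)))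
  where open ℚ.+-*-Solver using (solve; _:+_; _:-_; _:=_)

below⇒≤ᵣ : ∀ {x y} → EventuallyBelow (λ n → seq x n ℚ.- seq y n) → x ≤ᵣ y
below⇒≤ᵣ {x} {y} h ε 0<ε with h ε 0<ε
... | N , b = N , λ n N≤n → 0<⇒< (≡.subst (0ℚ ℚ.<_)
  (solve 3 (λ a b e → e :- (a :- b) := (b :+ e) :- a) ≡.refl (seq x n) (seq y n) ε) (<⇒0< (b n N≤n)))
  where open ℚ.+-*-Solver using (solve; _:+_; _:-_; _:=_)

≤ᵣ-resp : ∀ {x x′ y y′} → x ≃ x′ → y ≃ y′ → x ≤ᵣ y → x′ ≤ᵣ y′
≤ᵣ-resp {x} {x′} {y} {y′} (wrap e) (wrap f) h = below⇒≤ᵣ {x′} {y′}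
  (below-resp (λ n → solve 4 (λ a a′ b b′ → (:- (a :- a′) :+ (a :- b)) :+ (b :- b′) := a′ :- b′) ≡.refl
                (seq x n) (seq x′ n) (seq y n) (seq y′ n))
    (below-+ (below-+ (null⇒below (null-neg e)) (≤ᵣ⇒below {x} {y} h)) (null⇒below f)))
  where open ℚ.+-*-Solver using (solve; _:+_; _:-_; :-_; _:=_)

swap-difference : ∀ a b → b ℚ.- a ≡ ℚ.- (a ℚ.- b)
swap-difference = solve 2 (λ a b → b :- a := :- (a :- b)) ≡.refl
  where open ℚ.+-*-Solver using (solve; _:-_; :-_; _:=_)

≤ᵣ-antisym : ∀ {x y} → x ≤ᵣ y → y ≤ᵣ x → x ≃ y
≤ᵣ-antisym {x} {y} h k = wrap λ ε 0<ε →
  let N , a = ≤ᵣ⇒below {x} {y} h ε 0<ε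
      M , b = ≤ᵣ⇒below {y} {x} k ε 0<ε
  in N ℕ.⊔ M , λ n N⊔M≤n →
    <⇒∣∣< (seq x n ℚ.- seq y n) (a n (ℕ.m⊔n≤o⇒m≤o N M N⊔M≤n))
      (≡.subst (ℚ._< ε) (swap-difference (seq x n) (seq y n)) (b n (ℕ.m⊔n≤o⇒n≤o N M N⊔M≤n)))

≤ᵣ-pointwise : ∀ {x y} → (∀ n → seq x n ℚ.≤ seq y n) → x ≤ᵣ y
≤ᵣ-pointwise {x} {y} h ε 0<ε = 0 , λ n _ → ℚ.≤-<-trans (h n)
  (≡.subst (ℚ._< seq y n ℚ.+ ε) (ℚ.+-identityʳ (seq y n)) (ℚ.+-monoʳ-< (seq y n) 0<ε))

-- The terms of r are only known to exceed -vε for a chosen v. With v = 1/(1 + b - a) the possible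
-- loss (b - a)vε equals ε - vε, which is less than ε.
≤ᵣ-scale : ∀ {a b r} → a ℚ.≤ b → fromℕ 0 ≤ᵣ r → fromℚ a *ᵣ r ≤ᵣ fromℚ b *ᵣ r
≤ᵣ-scale {a} {b} {r} a≤b 0≤r ε 0<ε with recip (1ℚ ℚ.+ (b ℚ.- a)) (0<-+ 0<1ℚ (≤⇒0≤ a≤b))
... | v , 0<v , kv with 0≤r (v ℚ.* ε) (0<-* 0<v 0<ε)
... | N , h = N , λ n N≤n → 0<⇒< (≡.subst (0ℚ ℚ.<_) (cert (seq r n))
    (0<-+ (0<-* 0<v 0<ε) (0≤-* (≤⇒0≤ a≤b) (ℚ.<⇒≤ (h n N≤n)))))
  where
  open ℚ.+-*-Solver using (solve; _:+_; _:*_; _:-_; _:=_; con)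
  cert : ∀ s → v ℚ.* ε ℚ.+ (b ℚ.- a) ℚ.* (s ℚ.+ v ℚ.* ε) ≡ (b ℚ.* s ℚ.+ ε) ℚ.- a ℚ.* s
  cert s = ≡.trans (solve 5 (λ a b s v e → v :* e :+ (b :- a) :* (s :+ v :* e)
                                        := (b :* s :+ ((con 1ℚ :+ (b :- a)) :* v) :* e) :- a :* s) ≡.refl a b s v ε)
    (≡.trans (≡.cong (λ t → (b ℚ.* s ℚ.+ t ℚ.* ε) ℚ.- a ℚ.* s) kv)
      (≡.cong (λ t → (b ℚ.* s ℚ.+ t) ℚ.- a ℚ.* s) (ℚ.*-identityˡ ε)))

-- If x were at least y + ε, put d = x - y - ε and e = y + ε/4, so that d ≥ 0 and e > 0. Then x² -
-- y² - ε²/2 = (ε + d)(2e + d) + dε/2 is nonnegative, against the choice of the index. This is where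
-- the tolerances ε/4 and ε²/2 come from.
square-mono : ∀ {x y} → fromℕ 0 ≤ᵣ y → x *ᵣ x ≤ᵣ y *ᵣ y → x ≤ᵣ y
square-mono {x} {y} 0≤y h ε 0<ε
  with 0≤y (½ ℚ.* (½ ℚ.* ε)) (0<-* 0<½ (0<-* 0<½ 0<ε)) | h (½ ℚ.* (ε ℚ.* ε)) (0<-* 0<½ (0<-* 0<ε 0<ε))
... | N , p | M , q = N ℕ.⊔ M , λ n N⊔M≤n →
  close (seq x n) (seq y n) (p n (ℕ.m⊔n≤o⇒m≤o N M N⊔M≤n)) (q n (ℕ.m⊔n≤o⇒n≤o N M N⊔M≤n))
  where
  open ℚ.+-*-Solver using (solve; _:+_; _:*_; _:-_; _:=_; con)
  close : ∀ x y → 0ℚ ℚ.< y ℚ.+ ½ ℚ.* (½ ℚ.* ε) → x ℚ.* x ℚ.< y ℚ.* y ℚ.+ ½ ℚ.* (ε ℚ.* ε) → x ℚ.< y ℚ.+ ε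
  close x y 0<e x²< with x ℚ.<? y ℚ.+ ε
  ... | yes x<y+ε = x<y+ε
  ... | no  x≮y+ε = contradiction x²< (ℚ.<-irrefl ≡.refl ∘ λ l → ℚ.<-≤-trans l (0≤⇒≤ (≡.subst (0ℚ ℚ.≤_) cert nonneg)))
    where
    d = x ℚ.- (y ℚ.+ ε)
    e = y ℚ.+ ½ ℚ.* (½ ℚ.* ε)
    0≤d : 0ℚ ℚ.≤ d
    0≤d = ≤⇒0≤ (ℚ.≮⇒≥ x≮y+ε)
    nonneg : 0ℚ ℚ.≤ (ε ℚ.+ d) ℚ.* (e ℚ.+ e ℚ.+ d) ℚ.+ ½ ℚ.* (d ℚ.* ε)
    nonneg = 0≤-+ (0≤-* (0≤-+ (ℚ.<⇒≤ 0<ε) 0≤d) (0≤-+ (0≤-+ (ℚ.<⇒≤ 0<e) (ℚ.<⇒≤ 0<e)) 0≤d))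
                  (0≤-* (ℚ.<⇒≤ 0<½) (0≤-* 0≤d (ℚ.<⇒≤ 0<ε)))
    cert : (ε ℚ.+ d) ℚ.* (e ℚ.+ e ℚ.+ d) ℚ.+ ½ ℚ.* (d ℚ.* ε) ≡ x ℚ.* x ℚ.- (y ℚ.* y ℚ.+ ½ ℚ.* (ε ℚ.* ε))
    cert = solve 3 (λ x y ε → let d = x :- (y :+ ε); e = y :+ con ½ :* (con ½ :* ε) in
             (ε :+ d) :* (e :+ e :+ d) :+ con ½ :* (d :* ε) := x :* x :- (y :* y :+ con ½ :* (ε :* ε))) ≡.refl x y ε

sqrt-mono : ∀ {a b r r′} → a ≤ᵣ b → IsSqrt a r → IsSqrt b r′ → r ≤ᵣ r′
sqrt-mono {a} {b} {r} {r′} a≤b (_ , e) (0≤r′ , e′) =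
  square-mono {r} {r′} 0≤r′ (≤ᵣ-resp {a} {r *ᵣ r} {b} {r′ *ᵣ r′} (ℝR.sym (wrap e)) (ℝR.sym (wrap e′)) a≤b)

≤ᵣ-refl : ∀ {x} → x ≤ᵣ x
≤ᵣ-refl {x} = ≤ᵣ-pointwise {x} {x} (λ _ → ℚ.≤-refl)

sqrt-unique : ∀ {a r r′} → IsSqrt a r → IsSqrt a r′ → r ≃ r′
sqrt-unique {a} {r} {r′} h h′ = ≤ᵣ-antisym {r} {r′}
  (sqrt-mono {a} {a} {r} {r′} (≤ᵣ-refl {a}) h h′) (sqrt-mono {a} {a} {r′} {r} (≤ᵣ-refl {a}) h′ h)

abstract
  reciprocal : ℕ → ℚ
  reciprocal n = 1ℤ ℚ./ suc n

  reciprocal-inverse : ∀ n → reciprocal n ℚ.* ιℚ (+ suc n) ≡ 1ℚ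
  reciprocal-inverse n = /-ι 1ℤ n

  0<reciprocal : ∀ n → 0ℚ ℚ.< reciprocal n
  0<reciprocal n = ℚ.positive⁻¹ (reciprocal n) {{ℚ.normalize-pos 1 (suc n)}}

reciprocal-null : EventuallyBelow reciprocal
reciprocal-null ε 0<ε = N , λ n N≤n → begin-strict
  reciprocal n                                   ≡⟨ ≡.sym (ℚ.*-identityʳ _) ⟩
  reciprocal n ℚ.* 1ℚ                            ≤⟨ ℚ.*-monoˡ-≤-nonNeg (reciprocal n) {{ℚ.nonNegative (ℚ.<⇒≤ (0<reciprocal n))}} 1≤Nε ⟩
  reciprocal n ℚ.* (ιℚ (+ N) ℚ.* ε)              ≡⟨ ≡.sym (ℚ.*-assoc (reciprocal n) (ιℚ (+ N)) ε) ⟩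
  reciprocal n ℚ.* ιℚ (+ N) ℚ.* ε                <⟨ ℚ.*-monoˡ-<-pos ε {{ℚ.positive 0<ε}} (ℚ.*-monoʳ-<-pos (reciprocal n) {{ℚ.positive (0<reciprocal n)}} (N<1+n n N≤n)) ⟩
  reciprocal n ℚ.* ιℚ (+ suc n) ℚ.* ε            ≡⟨ ≡.cong (ℚ._* ε) (reciprocal-inverse n) ⟩
  1ℚ ℚ.* ε                                       ≡⟨ ℚ.*-identityˡ ε ⟩
  ε                                              ∎
  where
  open ℚ.≤-Reasoning
  N = proj₁ (archimedean ε 0<ε)
  1≤Nε = proj₂ (archimedean ε 0<ε)
  N<1+n : ∀ n → N ℕ.≤ n → ιℚ (+ N) ℚ.< ιℚ (+ suc n)
  N<1+n n N≤n = ℚ.≤-<-trans (ι-mono-≤ (ℤ.+≤+ N≤n))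
    (≡.subst (ℚ._< ιℚ (+ suc n)) (ℚ.+-identityˡ _) (ℚ.+-monoˡ-< (ιℚ (+ n)) 0<1ℚ))

square-cancel-< : ∀ {a b} → 0ℚ ℚ.≤ b → a ℚ.* a ℚ.< b ℚ.* b → a ℚ.< b
square-cancel-< {a} {b} 0≤b h with a ℚ.<? b
... | yes a<b = a<b
... | no  a≮b = contradiction h (ℚ.<-irrefl ≡.refl ∘ λ l → ℚ.<-≤-trans l (0≤⇒≤ (≡.subst (0ℚ ℚ.≤_)
    (solve 2 (λ a b → (a :- b) :* ((a :- b) :+ (b :+ b)) := a :* a :- b :* b) ≡.refl a b)
    (0≤-* (≤⇒0≤ (ℚ.≮⇒≥ a≮b)) (0≤-+ (≤⇒0≤ (ℚ.≮⇒≥ a≮b)) (0≤-+ 0≤b 0≤b))))))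
  where open ℚ.+-*-Solver using (solve; _:+_; _:*_; _:-_; _:=_)

abstract
  isqrt : ∀ n → ∃ λ a → a ℕ.* a ℕ.≤ n × n ℕ.< suc a ℕ.* suc a
  isqrt zero = 0 , z≤n , s≤s z≤n
  isqrt (suc n) with isqrt n
  ... | a , a²≤n , n<[1+a]² with suc a ℕ.* suc a ℕ.≤? suc n
  ...   | yes l = suc a , l , ℕ.≤-<-trans n<[1+a]² (ℕ.*-mono-< (ℕ.n<1+n (suc a)) (ℕ.n<1+n (suc a)))
  ...   | no  l = a , ℕ.m≤n⇒m≤1+n a²≤n , ℕ.≰⇒> l

module _ (k : ℕ) where
  private
    K = ιℚ (+ k)
    root : ℕ → ℕ
    root n = proj₁ (isqrt (k ℕ.* (suc n ℕ.* suc n)))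
    V = reciprocal
    M : ℕ → ℚ
    M n = ιℚ (+ suc n)
    -- The integer part of (n + 1)√k, divided by n + 1.
    x : ℕ → ℚ
    x n = ιℚ (+ root n) ℚ.* V n

    ι-square : ∀ a → ιℚ (+ (a ℕ.* a)) ≡ ιℚ (+ a) ℚ.* ιℚ (+ a)
    ι-square a = ≡.trans (≡.cong ιℚ (ℤ.pos-* a a)) (ℚR.ι-homo-* (+ a) (+ a))

    ι-k : ∀ n → ιℚ (+ (k ℕ.* (suc n ℕ.* suc n))) ≡ K ℚ.* (M n ℚ.* M n)
    ι-k n = ≡.trans (≡.cong ιℚ (ℤ.pos-* k (suc n ℕ.* suc n)))
      (≡.trans (ℚR.ι-homo-* (+ k) (+ (suc n ℕ.* suc n))) (≡.cong (K ℚ.*_) (ι-square (suc n))))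

    0≤x : ∀ n → 0ℚ ℚ.≤ x n
    0≤x n = 0≤-* (0≤ι (root n)) (ℚ.<⇒≤ (0<reciprocal n))

    open ℚ.+-*-Solver using (solve; _:+_; _:*_; _:-_; :-_; _:=_; con)

    unscale : ∀ n → K ℚ.* (M n ℚ.* M n) ℚ.* (V n ℚ.* V n) ≡ K
    unscale n = ≡.trans (solve 3 (λ K M V → K :* (M :* M) :* (V :* V) := K :* ((V :* M) :* (V :* M))) ≡.refl K (M n) (V n))
      (≡.trans (≡.cong (λ t → K ℚ.* (t ℚ.* t)) (reciprocal-inverse n)) (ℚ.*-identityʳ K))

    0<V² : ∀ n → 0ℚ ℚ.< V n ℚ.* V n
    0<V² n = 0<-* (0<reciprocal n) (0<reciprocal n)

    x²≤K : ∀ n → x n ℚ.* x n ℚ.≤ K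
    x²≤K n = ≡.subst₂ ℚ._≤_
      (≡.trans (≡.cong (ℚ._* (V n ℚ.* V n)) (ι-square (root n)))
        (solve 2 (λ a v → a :* a :* (v :* v) := a :* v :* (a :* v)) ≡.refl (ιℚ (+ root n)) (V n)))
      (≡.trans (≡.cong (ℚ._* (V n ℚ.* V n)) (ι-k n)) (unscale n))
      (ℚ.*-monoʳ-≤-nonNeg (V n ℚ.* V n) {{ℚ.nonNegative (ℚ.<⇒≤ (0<V² n))}}
        (ι-mono-≤ (ℤ.+≤+ (proj₁ (proj₂ (isqrt (k ℕ.* (suc n ℕ.* suc n))))))))

    K<[x+V]² : ∀ n → K ℚ.< (x n ℚ.+ V n) ℚ.* (x n ℚ.+ V n)
    K<[x+V]² n = ≡.subst₂ ℚ._<_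
      (≡.trans (≡.cong (ℚ._* (V n ℚ.* V n)) (ι-k n)) (unscale n))
      (≡.trans (≡.cong (ℚ._* (V n ℚ.* V n)) (ι-square (suc (root n))))
        (solve 2 (λ a v → (con 1ℚ :+ a) :* (con 1ℚ :+ a) :* (v :* v) := (a :* v :+ v) :* (a :* v :+ v)) ≡.refl (ιℚ (+ root n)) (V n)))
      (ℚ.*-monoˡ-<-pos (V n ℚ.* V n) {{ℚ.positive (0<V² n)}} (ι<ι (proj₂ (proj₂ (isqrt (k ℕ.* (suc n ℕ.* suc n)))))))
      where
      ι<ι : ∀ {a b} → a ℕ.< b → ιℚ (+ a) ℚ.< ιℚ (+ b)
      ι<ι {a} a<b = ℚ.<-≤-trans
        (≡.subst (ℚ._< ιℚ (+ suc a)) (ℚ.+-identityˡ _) (ℚ.+-monoˡ-< (ιℚ (+ a)) 0<1ℚ)) (ι-mono-≤ (ℤ.+≤+ a<b))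

    -- Every x m has square at most K and every x n + V n has square above K, so any two indices
    -- compare directly. Convergence follows from this without monotonicity.
    x<x+V : ∀ m n → x m ℚ.< x n ℚ.+ V n
    x<x+V m n = square-cancel-< (0≤-+ (0≤x n) (ℚ.<⇒≤ (0<reciprocal n))) (ℚ.≤-<-trans (x²≤K m) (K<[x+V]² n))

    x-cauchy : IsCauchy x
    x-cauchy ε 0<ε = N , λ m n N≤m N≤n →
      <⇒∣∣< (x m ℚ.- x n) (close m n (small n N≤n)) (≡.subst (ℚ._< ε) (swap-difference (x m) (x n))
        (close n m (small m N≤m)))
      where
      N = proj₁ (reciprocal-null ε 0<ε)
      small = proj₂ (reciprocal-null ε 0<ε)
      close : ∀ m n → V n ℚ.< ε → x m ℚ.- x n ℚ.< ε
      close m n V<ε = ℚ.<-trans (0<⇒< (≡.subst (0ℚ ℚ.<_)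
        (solve 3 (λ a b v → (b :+ v) :- a := v :- (a :- b)) ≡.refl (x m) (x n) (V n)) (<⇒0< (x<x+V m n)))) V<ε

  √ : ℝ
  √ = mkℝ x x-cauchy

  √-isSqrt : IsSqrt (fromℕ k) √
  √-isSqrt = ≤ᵣ-pointwise {fromℕ 0} {√} 0≤x , √²≈k
    where
    x≤K+1 : ∀ n → x n ℚ.< K ℚ.+ 1ℚ
    x≤K+1 n = square-cancel-< (0≤-+ (0≤ι k) (ℚ.<⇒≤ 0<1ℚ)) (ℚ.≤-<-trans (x²≤K n) (0<⇒< (≡.subst (0ℚ ℚ.<_)
      (solve 1 (λ K → con 1ℚ :+ (K :+ K :* K) := (K :+ con 1ℚ) :* (K :+ con 1ℚ) :- K) ≡.refl K)
      (0<-+ 0<1ℚ (0≤-+ (0≤ι k) (0≤-* (0≤ι k) (0≤ι k)))))))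
    -- An eventual bound for x n + x n + V n, the second factor of (x n + V n)² - (x n)².
    B = K ℚ.+ 1ℚ ℚ.+ (K ℚ.+ 1ℚ) ℚ.+ 1ℚ
    0<B : 0ℚ ℚ.< B
    0<B = ≡.subst (0ℚ ℚ.<_) (ℚ.+-comm 1ℚ (K ℚ.+ 1ℚ ℚ.+ (K ℚ.+ 1ℚ))) (0<-+ 0<1ℚ (0≤-+ 0≤K+1 0≤K+1))
      where
      0≤K+1 : 0ℚ ℚ.≤ K ℚ.+ 1ℚ
      0≤K+1 = 0≤-+ (0≤ι k) (ℚ.<⇒≤ 0<1ℚ)
    square-limit : Null (λ n → x n ℚ.* x n ℚ.- K)
    square-limit ε 0<ε = N ℕ.⊔ N′ , λ n l → <⇒∣∣< (x n ℚ.* x n ℚ.- K)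
      (ℚ.≤-<-trans (0≤⇒≤ (≡.subst (0ℚ ℚ.≤_) (solve 2 (λ K y → K :- y := con 0ℚ :- (y :- K)) ≡.refl K (x n ℚ.* x n)) (≤⇒0≤ (x²≤K n)))) 0<ε)
      (begin-strict
        ℚ.- (x n ℚ.* x n ℚ.- K)        ≡⟨ ≡.sym (swap-difference (x n ℚ.* x n) K) ⟩
        K ℚ.- x n ℚ.* x n              <⟨ ℚ.+-monoˡ-< (ℚ.- (x n ℚ.* x n)) (K<[x+V]² n) ⟩
        (x n ℚ.+ V n) ℚ.* (x n ℚ.+ V n) ℚ.- x n ℚ.* x n
                                       ≡⟨ solve 2 (λ x v → (x :+ v) :* (x :+ v) :- x :* x := v :* (x :+ x :+ v)) ≡.refl (x n) (V n) ⟩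
        V n ℚ.* (x n ℚ.+ x n ℚ.+ V n)  <⟨ ℚ.*-monoʳ-<-pos (V n) {{ℚ.positive (0<reciprocal n)}}
                                            (ℚ.+-mono-< (ℚ.+-mono-< (x≤K+1 n) (x≤K+1 n)) (small′ n (ℕ.m⊔n≤o⇒n≤o N N′ l))) ⟩
        V n ℚ.* B                      <⟨ ℚ.*-monoˡ-<-pos B {{ℚ.positive 0<B}} (small n (ℕ.m⊔n≤o⇒m≤o N N′ l)) ⟩
        v ℚ.* ε ℚ.* B                  ≡⟨ solve 3 (λ v e B → v :* e :* B := B :* v :* e) ≡.refl v ε B ⟩
        B ℚ.* v ℚ.* ε                  ≡⟨ ≡.cong (ℚ._* ε) Bv ⟩
        1ℚ ℚ.* ε                       ≡⟨ ℚ.*-identityˡ ε ⟩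
        ε                              ∎)
      where
      open ℚ.≤-Reasoning
      v = proj₁ (recip B 0<B)
      0<v = proj₁ (proj₂ (recip B 0<B))
      Bv = proj₂ (proj₂ (recip B 0<B))
      N = proj₁ (reciprocal-null (v ℚ.* ε) (0<-* 0<v 0<ε))
      small = proj₂ (reciprocal-null (v ℚ.* ε) (0<-* 0<v 0<ε))
      N′ = proj₁ (reciprocal-null 1ℚ 0<1ℚ)
      small′ = proj₂ (reciprocal-null 1ℚ 0<1ℚ)
    √²≈k : √ *ᵣ √ ≈ᵣ fromℕ k
    √²≈k = null-resp (λ n → ≡.cong (λ q → x n ℚ.* x n ℚ.- q) (≡.sym (/1≡ι (+ k)))) square-limit

-- Complex numbers

re≃ : ∀ {x y} → x ≈ᶜ y → re x ≃ re y
re≃ e = wrap (re≈ e)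

im≃ : ∀ {x y} → x ≈ᶜ y → im x ≃ im y
im≃ e = wrap (im≈ e)

mk≃ : ∀ {x y} → re x ≃ re y → im x ≃ im y → x ≈ᶜ y
mk≃ (wrap e) (wrap f) = mk≈ e f

private
  module _ where
    open ℝR

    ℂ-*-assoc : ∀ x y z → ((x *ᶜ y) *ᶜ z) ≈ᶜ (x *ᶜ (y *ᶜ z))
    ℂ-*-assoc (a +i b) (c +i d) (e +i f) = mk≃
      (solve 6 (λ a b c d e f → (a :* c :+ :- (b :* d)) :* e :+ :- ((a :* d :+ b :* c) :* f)
                             := a :* (c :* e :+ :- (d :* f)) :+ :- (b :* (c :* f :+ d :* e))) refl a b c d e f)
      (solve 6 (λ a b c d e f → (a :* c :+ :- (b :* d)) :* f :+ (a :* d :+ b :* c) :* e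
                             := a :* (c :* f :+ d :* e) :+ b :* (c :* e :+ :- (d :* f))) refl a b c d e f)

    ℂ-*-comm : ∀ x y → (x *ᶜ y) ≈ᶜ (y *ᶜ x)
    ℂ-*-comm (a +i b) (c +i d) = mk≃
      (solve 4 (λ a b c d → a :* c :+ :- (b :* d) := c :* a :+ :- (d :* b)) refl a b c d)
      (solve 4 (λ a b c d → a :* d :+ b :* c := c :* b :+ d :* a) refl a b c d)

    ℂ-*-identityˡ : ∀ x → (1ᶜ *ᶜ x) ≈ᶜ x
    ℂ-*-identityˡ (a +i b) = mk≃
      (pointwise λ n → Q.solve 2 (λ a b → Q.con 1ℚ Q.:* a Q.:- Q.con 0ℚ Q.:* b Q.:= a) ≡.refl (seq a n) (seq b n))
      (pointwise λ n → Q.solve 2 (λ a b → Q.con 1ℚ Q.:* b Q.:+ Q.con 0ℚ Q.:* a Q.:= b) ≡.refl (seq a n) (seq b n))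
      where module Q = ℚ.+-*-Solver

    ℂ-distribˡ : ∀ x y z → (x *ᶜ (y +ᶜ z)) ≈ᶜ ((x *ᶜ y) +ᶜ (x *ᶜ z))
    ℂ-distribˡ (a +i b) (c +i d) (e +i f) = mk≃
      (solve 6 (λ a b c d e f → a :* (c :+ e) :+ :- (b :* (d :+ f))
                             := (a :* c :+ :- (b :* d)) :+ (a :* e :+ :- (b :* f))) refl a b c d e f)
      (solve 6 (λ a b c d e f → a :* (d :+ f) :+ b :* (c :+ e)
                             := (a :* d :+ b :* c) :+ (a :* f :+ b :* e)) refl a b c d e f)

    ℂ-trans : ∀ {x y z} → x ≈ᶜ y → y ≈ᶜ z → x ≈ᶜ z
    ℂ-trans e f = mk≃ (trans (re≃ e) (re≃ f)) (trans (im≃ e) (im≃ f))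

    ℂ-+-cong : ∀ {x y z w} → x ≈ᶜ y → z ≈ᶜ w → (x +ᶜ z) ≈ᶜ (y +ᶜ w)
    ℂ-+-cong e f = mk≃ (+-cong (re≃ e) (re≃ f)) (+-cong (im≃ e) (im≃ f))

    ℂ-*-cong : ∀ {x y z w} → x ≈ᶜ y → z ≈ᶜ w → (x *ᶜ z) ≈ᶜ (y *ᶜ w)
    ℂ-*-cong e f = mk≃
      (+-cong (*-cong (re≃ e) (re≃ f)) (-‿cong (*-cong (im≃ e) (im≃ f))))
      (+-cong (*-cong (re≃ e) (im≃ f)) (*-cong (im≃ e) (re≃ f)))

ℂ-commutativeRing : CommutativeRing 0ℓ 0ℓ
ℂ-commutativeRing = record
  { Carrier = ℂ
  ; _≈_     = _≈ᶜ_
  ; _+_     = _+ᶜ_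
  ; _*_     = _*ᶜ_
  ; -_      = -ᶜ_
  ; 0#      = 0ᶜ
  ; 1#      = 1ᶜ
  ; isCommutativeRing = record
    { isRing = record
      { +-isAbelianGroup = record
        { isGroup = record
          { isMonoid = record
            { isSemigroup = record
              { isMagma = record
                { isEquivalence = record
                  { refl  = mk≃ ℝR.refl ℝR.refl
                  ; sym   = λ e → mk≃ (ℝR.sym (re≃ e)) (ℝR.sym (im≃ e))
                  ; trans = ℂ-trans
                  }
                ; ∙-cong = ℂ-+-cong
                }
              ; assoc = λ x y z → mk≃ (ℝR.+-assoc (re x) (re y) (re z)) (ℝR.+-assoc (im x) (im y) (im z))
              }
            ; identity = (λ x → mk≃ (ℝR.+-identityˡ (re x)) (ℝR.+-identityˡ (im x)))
                       , (λ x → mk≃ (ℝR.+-identityʳ (re x)) (ℝR.+-identityʳ (im x)))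
            }
          ; inverse = (λ x → mk≃ (ℝR.-‿inverseˡ (re x)) (ℝR.-‿inverseˡ (im x)))
                    , (λ x → mk≃ (ℝR.-‿inverseʳ (re x)) (ℝR.-‿inverseʳ (im x)))
          ; ⁻¹-cong = λ e → mk≃ (ℝR.-‿cong (re≃ e)) (ℝR.-‿cong (im≃ e))
          }
        ; comm = λ x y → mk≃ (ℝR.+-comm (re x) (re y)) (ℝR.+-comm (im x) (im y))
        }
      ; *-cong = ℂ-*-cong
      ; *-assoc = ℂ-*-assoc
      ; *-identity = ℂ-*-identityˡ
                   , (λ x → ℂ-trans (ℂ-*-comm x 1ᶜ) (ℂ-*-identityˡ x))
      ; distrib = ℂ-distribˡ
                , (λ x y z → ℂ-trans (ℂ-*-comm (y +ᶜ z) x) (ℂ-trans (ℂ-distribˡ x y z)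
                    (ℂ-+-cong (ℂ-*-comm x y) (ℂ-*-comm x z))))
      }
    ; *-comm = ℂ-*-comm
    }
  }

module ℂR = RingTheory ℂ-commutativeRing

-- Deciding idempotents

-- Division by a sequence that stays above 1 can only shrink the terms; this replaces an inverse in
-- ℝ.
null-cancel : ∀ {f u : ℕ → ℚ} → (∃ λ N → ∀ n → N ℕ.≤ n → 1ℚ ℚ.≤ u n) → Null (λ n → f n ℚ.* u n) → Null f
null-cancel {f} {u} (M , 1≤u) h ε 0<ε = M ℕ.⊔ N , λ n l → ℚ.≤-<-trans (f≤fu n (ℕ.m⊔n≤o⇒m≤o M N l)) (small n (ℕ.m⊔n≤o⇒n≤o M N l))
  where
  N = proj₁ (h ε 0<ε)
  small = proj₂ (h ε 0<ε)
  f≤fu : ∀ n → M ℕ.≤ n → ℚ.∣ f n ∣ ℚ.≤ ℚ.∣ f n ℚ.* u n ∣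
  f≤fu n M≤n = begin
    ℚ.∣ f n ∣                ≡⟨ ≡.sym (ℚ.*-identityʳ _) ⟩
    ℚ.∣ f n ∣ ℚ.* 1ℚ         ≤⟨ ℚ.*-monoˡ-≤-nonNeg ℚ.∣ f n ∣ {{ℚ.∣-∣-nonNeg (f n)}} (1≤u n M≤n) ⟩
    ℚ.∣ f n ∣ ℚ.* u n        ≡⟨ ≡.cong (ℚ.∣ f n ∣ ℚ.*_) (≡.sym (ℚ.0≤p⇒∣p∣≡p (ℚ.≤-trans (ℚ.<⇒≤ 0<1ℚ) (1≤u n M≤n)))) ⟩
    ℚ.∣ f n ∣ ℚ.* ℚ.∣ u n ∣  ≡⟨ ≡.sym (ℚ.∣p*q∣≡∣p∣*∣q∣ (f n) (u n)) ⟩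
    ℚ.∣ f n ℚ.* u n ∣        ∎
    where open ℚ.≤-Reasoning

≃0⇒null : ∀ {x} → x ≃ fromℚ 0ℚ → Null (seq x)
≃0⇒null {x} (wrap e) = null-resp (λ n → ℚ.+-identityʳ (seq x n)) e

null⇒≃0 : ∀ {x} → Null (seq x) → x ≃ fromℚ 0ℚ
null⇒≃0 {x} h = wrap (null-resp (λ n → ≡.sym (ℚ.+-identityʳ (seq x n))) h)

cancel-≥1 : ∀ {x u} → (∃ λ N → ∀ n → N ℕ.≤ n → 1ℚ ℚ.≤ seq u n) → x *ᵣ u ≃ fromℚ 0ℚ → x ≃ fromℚ 0ℚ
cancel-≥1 {x} {u} 1≤u h = null⇒≃0 (null-cancel {seq x} {seq u} 1≤u (≃0⇒null h))

-- The sign of w is decided by an approximation to within ½, as ∣w∣ = 1.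
sqrt-of-1 : ∀ w → w *ᵣ w ≃ fromℚ 1ℚ → w ≃ fromℚ 1ℚ ⊎ w ≃ -ᵣ fromℚ 1ℚ
sqrt-of-1 w w² = decide (ℚ.≤-total 0ℚ (seq w N))
  where
  open ℝR using (solve; _:+_; _:*_; :-_; _:=_; con; refl; trans; *-congˡ; zeroʳ; x≈y⇒x-y≈0; x-y≈0⇒x≈y)
  module Q = ℚ.+-*-Solver
  N = proj₁ (cauchy w ½ 0<½)
  close : ∀ n → N ℕ.≤ n → ℚ.∣ seq w n ℚ.- seq w N ∣ ℚ.< ½
  close n N≤n = proj₂ (cauchy w ½ 0<½) n N N≤n ℕ.≤-refl
  1ᵣ : ℝ
  1ᵣ = fromℚ 1ℚ
  vanish : ∀ c → c *ᵣ (w *ᵣ w +ᵣ -ᵣ 1ᵣ) ≃ fromℚ 0ℚ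
  vanish c = trans (*-congˡ (x≈y⇒x-y≈0 w²)) (zeroʳ c)
  2x : ∀ a → ½ ℚ.< a → 1ℚ ℚ.≤ a ℚ.+ a
  2x a ½<a = ℚ.<⇒≤ (ℚ.+-mono-< ½<a ½<a)
  decide : 0ℚ ℚ.≤ seq w N ⊎ seq w N ℚ.≤ 0ℚ → w ≃ 1ᵣ ⊎ w ≃ -ᵣ 1ᵣ
  decide (inj₁ 0≤w) = inj₁ (x-y≈0⇒x≈y (cancel-≥1 (N , λ n l → 2x (seq w n ℚ.+ 1ℚ) (½< n l))
      (trans (solve 2 (λ w o → (w :+ :- o) :* ((w :+ o) :+ (w :+ o)) := con (+ 2) :* (w :* w :+ :- (o :* o))) refl w 1ᵣ)
        (trans (*-congˡ (pointwise λ n → ≡.refl)) (vanish (ℝR.ι (+ 2)))))))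
    where
    ½< : ∀ n → N ℕ.≤ n → ½ ℚ.< seq w n ℚ.+ 1ℚ
    ½< n l = 0<⇒< (≡.subst (0ℚ ℚ.<_)
      (Q.solve 2 (λ a b → (Q.con ½ Q.:- (b Q.:- a)) Q.:+ b Q.:= (a Q.:+ Q.con 1ℚ) Q.:- Q.con ½) ≡.refl (seq w n) (seq w N))
      (0<-+ (<⇒0< {seq w N ℚ.- seq w n} (ℚ.≤-<-trans (ℚ.≤-reflexive (swap-difference (seq w n) (seq w N)))
        (∣∣<⇒< (≡.subst (ℚ._< ½) (≡.sym (ℚ.∣-p∣≡∣p∣ (seq w n ℚ.- seq w N))) (close n l))))) 0≤w))
  decide (inj₂ w≤0) = inj₂ (x-y≈0⇒x≈y (cancel-≥1 (N , λ n l → 2x (1ℚ ℚ.- seq w n) (½< n l))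
      (trans (solve 2 (λ w o → (w :+ :- (:- o)) :* ((o :+ :- w) :+ (o :+ :- w)) := con (ℤ.- + 2) :* (w :* w :+ :- (o :* o))) refl w 1ᵣ)
        (trans (*-congˡ (pointwise λ n → ≡.refl)) (vanish (ℝR.ι (ℤ.- + 2)))))))
    where
    ½< : ∀ n → N ℕ.≤ n → ½ ℚ.< 1ℚ ℚ.- seq w n
    ½< n l = 0<⇒< (≡.subst (0ℚ ℚ.<_)
      (Q.solve 2 (λ a b → (Q.con ½ Q.:- (a Q.:- b)) Q.:+ (Q.con 0ℚ Q.:- b) Q.:= (Q.con 1ℚ Q.:- a) Q.:- Q.con ½) ≡.refl (seq w n) (seq w N))
      (0<-+ (<⇒0< {seq w n ℚ.- seq w N} (∣∣<⇒< (close n l))) (≤⇒0≤ w≤0)))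

-- For e = a + ib put w = 2a - 1. The equation e² = e gives b w = 0 from the imaginary part and w² =
-- 1 + 4b² from the real part. Hence b (1 + 4b²) = 0, so b = 0 because `u` = 1 + 4b² is at least 1,
-- and then w² = 1 leaves the two signs of w.
idempotent : ∀ e → (e *ᶜ e) ≈ᶜ e → e ≈ᶜ 0ᶜ ⊎ e ≈ᶜ 1ᶜ
idempotent e@(a +i b) h = conclude (sqrt-of-1 w w²≃1)
  where
  open ℝR using (solve; _:+_; _:*_; :-_; _:=_; con; refl; trans; +-cong; *-congˡ; zeroʳ; +-congʳ; x≈y⇒x-y≈0; x-y≈0⇒x≈y)
  module Q = ℚ.+-*-Solver
  1ᵣ 0ᵣ w u : ℝ
  1ᵣ = fromℚ 1ℚ
  0ᵣ = fromℚ 0ℚ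
  w = (a +ᵣ a) +ᵣ -ᵣ 1ᵣ
  u = 1ᵣ +ᵣ (b +ᵣ b) *ᵣ (b +ᵣ b)
  re-defect : ℝ
  re-defect = (a *ᵣ a +ᵣ -ᵣ (b *ᵣ b)) +ᵣ -ᵣ a
  combine : ∀ c d {y} → c *ᵣ re-defect +ᵣ d *ᵣ y ≃ (c *ᵣ 0ᵣ) +ᵣ d *ᵣ y
  combine c d = +-congʳ (*-congˡ (x≈y⇒x-y≈0 (re≃ h)))
  both-vanish : ∀ c d {y} → y ≃ 0ᵣ → c *ᵣ re-defect +ᵣ d *ᵣ y ≃ 0ᵣ
  both-vanish c d y≃0 = trans (combine c d) (trans (+-cong (zeroʳ c) (trans (*-congˡ y≃0) (zeroʳ d))) (ℝR.+-identityʳ 0ᵣ))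
  four : ℝ
  four = ℝR.ι (+ 4)
  b≃0 : b ≃ 0ᵣ
  b≃0 = cancel-≥1 {b} {u} (0 , λ n _ → ≡.subst (ℚ._≤ seq u n) (ℚ.+-identityʳ 1ℚ) (ℚ.+-monoʳ-≤ 1ℚ (0≤-square (seq b n ℚ.+ seq b n))))
    (trans (pointwise λ n → Q.solve 2 (λ a b → b Q.:* (Q.con 1ℚ Q.:+ (b Q.:+ b) Q.:* (b Q.:+ b))
         Q.:= Q.:- (Q.con (ιℚ (+ 4)) Q.:* b) Q.:* ((a Q.:* a Q.:- b Q.:* b) Q.:- a)
           Q.:+ ((a Q.:+ a) Q.:- Q.con 1ℚ) Q.:* ((a Q.:* b Q.:+ b Q.:* a) Q.:- b)) ≡.refl (seq a n) (seq b n))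
      (both-vanish (-ᵣ (four *ᵣ b)) w (x≈y⇒x-y≈0 (im≃ h))))
  w²≃1 : w *ᵣ w ≃ 1ᵣ
  w²≃1 = x-y≈0⇒x≈y (trans (pointwise λ n → Q.solve 2 (λ a b →
            ((a Q.:+ a) Q.:- Q.con 1ℚ) Q.:* ((a Q.:+ a) Q.:- Q.con 1ℚ) Q.:- Q.con 1ℚ
         Q.:= Q.con (ιℚ (+ 4)) Q.:* ((a Q.:* a Q.:- b Q.:* b) Q.:- a) Q.:+ (Q.con (ιℚ (+ 4)) Q.:* b) Q.:* b) ≡.refl (seq a n) (seq b n))
      (both-vanish four (four *ᵣ b) b≃0))
  half : ∀ c → w ≃ c → a ≃ fromℚ ½ *ᵣ (c +ᵣ 1ᵣ)
  half c w≃c = trans (pointwise λ n → Q.solve 1 (λ a → a Q.:= Q.con ½ Q.:* (((a Q.:+ a) Q.:- Q.con 1ℚ) Q.:+ Q.con 1ℚ)) ≡.refl (seq a n))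
    (*-congˡ {fromℚ ½} {w +ᵣ 1ᵣ} (+-congʳ w≃c))
  conclude : w ≃ 1ᵣ ⊎ w ≃ -ᵣ 1ᵣ → e ≈ᶜ 0ᶜ ⊎ e ≈ᶜ 1ᶜ
  conclude (inj₁ w≃1)  = inj₂ (mk≃ (trans (half 1ᵣ w≃1) (pointwise λ n → ≡.refl)) b≃0)
  conclude (inj₂ w≃-1) = inj₁ (mk≃ (trans (half (-ᵣ 1ᵣ) w≃-1) (pointwise λ n → ≡.refl)) b≃0)

-- Finite sums and permutations

module RangeSums (R : CommutativeRing 0ℓ 0ℓ) where
  open RingTheory R

  -- Summands are indexed by natural numbers, so that shifts, block decompositions and periodicity
  -- are plain arithmetic on the argument of f.
  Σ< : ℕ → (ℕ → Carrier) → Carrier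
  Σ< n f = sum {n} (λ i → f (toℕ i))

  Σ<-cong : ∀ n {f g} → (∀ i → i ℕ.< n → f i ≈ g i) → Σ< n f ≈ Σ< n g
  Σ<-cong n h = sum-cong-≋ {n} (λ i → h (toℕ i) (Fin.toℕ<n i))

  Σ<-+ : ∀ m n f → Σ< (m ℕ.+ n) f ≈ Σ< m f + Σ< n (λ i → f (m ℕ.+ i))
  Σ<-+ zero    n f = sym (+-identityˡ _)
  Σ<-+ (suc m) n f = trans (+-congˡ (Σ<-+ m n (f ∘ suc))) (sym (+-assoc _ _ _))

  Σ<-* : ∀ m s f → Σ< (m ℕ.* s) f ≈ Σ< m (λ j → Σ< s (λ k → f (k ℕ.+ j ℕ.* s)))
  Σ<-* zero    s f = refl
  Σ<-* (suc m) s f = trans (Σ<-+ s (m ℕ.* s) f)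
    (+-cong (Σ<-cong s (λ k _ → reflexive (≡.cong f (≡.sym (ℕ.+-identityʳ k)))))
      (trans (Σ<-* m s (λ i → f (s ℕ.+ i)))
        (Σ<-cong m λ j _ → Σ<-cong s λ k _ → reflexive (≡.cong f (index j k)))))
    where
    index : ∀ j k → s ℕ.+ (k ℕ.+ j ℕ.* s) ≡ k ℕ.+ (s ℕ.+ j ℕ.* s)
    index j k = ≡.trans (≡.sym (ℕ.+-assoc s k _)) (≡.trans (≡.cong (ℕ._+ j ℕ.* s) (ℕ.+-comm s k)) (ℕ.+-assoc k s _))

  Σ<-last : ∀ n f → Σ< (suc n) f ≈ Σ< n f + f n
  Σ<-last zero    f = +-comm _ _
  Σ<-last (suc n) f = trans (+-congˡ (Σ<-last n (f ∘ suc))) (sym (+-assoc _ _ _))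

  Σ<-rotate : ∀ n f → (∀ i → f (n ℕ.+ i) ≈ f i) → ∀ a → Σ< n (λ i → f (a ℕ.+ i)) ≈ Σ< n f
  Σ<-rotate n f periodic zero    = refl
  Σ<-rotate n f periodic (suc a) = trans step (Σ<-rotate n f periodic a)
    where
    g : ℕ → Carrier
    g i = f (a ℕ.+ i)
    gn≈g0 : g n ≈ g 0
    gn≈g0 = trans (reflexive (≡.cong f (≡.trans (ℕ.+-comm a n) (≡.cong (n ℕ.+_) (≡.sym (ℕ.+-identityʳ a)))))) (periodic (a ℕ.+ 0))
    step : Σ< n (λ i → f (suc a ℕ.+ i)) ≈ Σ< n g
    step = begin
      Σ< n (λ i → f (suc a ℕ.+ i))   ≈⟨ Σ<-cong n (λ i _ → reflexive (≡.cong f (≡.sym (ℕ.+-suc a i)))) ⟩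
      Σ< n (g ∘ suc)                 ≈⟨ solve 2 (λ x y → x := (y :+ x) :+ :- y) refl (Σ< n (g ∘ suc)) (g 0) ⟩
      Σ< (suc n) g + - g 0           ≈⟨ +-cong (Σ<-last n g) (-‿cong (sym gn≈g0)) ⟩
      Σ< n g + g n + - g n           ≈⟨ solve 2 (λ x y → (x :+ y) :+ :- y := x) refl (Σ< n g) (g n) ⟩
      Σ< n g                         ∎

  Σ<-const : ∀ n x → Σ< n (λ _ → x) ≈ ι (+ n) * x
  Σ<-const zero    x = sym (zeroˡ x)
  Σ<-const (suc n) x = trans (+-congˡ (Σ<-const n x))
    (sym (trans (distribʳ x 1# (ι (+ n))) (+-congʳ (*-identityˡ x))))

  sum-reindex : ∀ {m n} (κ : Fin m → Fin n) → (∀ {i j} → κ i ≡ κ j → i ≡ j) → (∀ y → ∃ λ x → κ x ≡ y) →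
                ∀ f → sum (λ i → f (κ i)) ≈ sum f
  sum-reindex κ inj surj f = sym (sum-permute f
    (Perm.permutation κ (λ y → proj₁ (surj y)) (λ y → proj₂ (surj y)) (λ x → inj (proj₂ (surj (κ x))))))
    where import Data.Fin.Permutation as Perm

injective⇒surjective : ∀ {n} (κ : Fin n → Fin n) → (∀ {i j} → κ i ≡ κ j → i ≡ j) → ∀ y → ∃ λ x → κ x ≡ y
injective⇒surjective {suc n} κ inj y with Fin.any? (λ x → κ x Fin.≟ y)
... | yes found = found
... | no  none  = contradiction (Fin.injective⇒≤ {f = κ′} κ′-injective) (ℕ.<⇒≱ (ℕ.n<1+n n))
  where
  κ′ : Fin (suc n) → Fin n
  κ′ x = Fin.punchOut {i = y} {j = κ x} (λ e → none (x , ≡.sym e))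
  κ′-injective : ∀ {i j} → κ′ i ≡ κ′ j → i ≡ j
  κ′-injective {i} {j} e = inj (Fin.punchOut-injective {i = y} (λ e → none (i , ≡.sym e)) (λ e → none (j , ≡.sym e)) e)

-- Linear algebra over the rationals

module _ where
  open ℚR using (sum; sum-remove; sum-cong-≋; solve; _:+_; _:*_; :-_; _:=_; con)
  open import Data.Vec.Functional using (insertAt)
  open import Data.Vec.Functional.Properties using (insertAt-lookup; insertAt-punchIn)

  -- Gaussian elimination on the rows: equality in ℚ is decidable, so either the first column is
  -- zero and is dropped, or a pivot row clears it and is removed together with it.
  kernel : ∀ {m n} → m ℕ.< n → (A : Fin n → Fin m → ℚ) →
           ∃ λ (c : Fin n → ℚ) → (∃ λ i → c i ≢ 0ℚ) × (∀ j → sum (λ i → c i ℚ.* A i j) ≡ 0ℚ)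
  kernel {zero}  {suc n} _ A = (λ _ → 1ℚ) , (zero , ℚ.1≢0) , λ ()
  kernel {suc m} {suc n} (s≤s m<n) A = pivot (Fin.any? (λ i → ¬? (A i zero ℚ.≟ 0ℚ)))
    where
    Kernel : Set
    Kernel = ∃ λ (c : Fin (suc n) → ℚ) → (∃ λ i → c i ≢ 0ℚ) × (∀ j → sum (λ i → c i ℚ.* A i j) ≡ 0ℚ)
    pivot : Dec (∃ λ i → ¬ A i zero ≡ 0ℚ) → Kernel
    pivot (no none) = c , nonzero , λ { zero → column₀ ; (suc j) → relation j }
      where
      rest = kernel (ℕ.m<n⇒m<1+n m<n) (λ i j → A i (suc j))
      c = proj₁ rest
      nonzero = proj₁ (proj₂ rest)
      relation = proj₂ (proj₂ rest)
      column₀ : sum (λ i → c i ℚ.* A i zero) ≡ 0ℚ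
      column₀ = ℚR.sum-zero {suc n} _ λ i → ≡.trans (≡.cong (c i ℚ.*_) (A≡0 i)) (ℚ.*-zeroʳ (c i))
        where
        A≡0 : ∀ i → A i zero ≡ 0ℚ
        A≡0 i with A i zero ℚ.≟ 0ℚ
        ... | yes e = e
        ... | no ¬e = contradiction (i , ¬e) none
    pivot (yes (r , Ar≢0)) = c , nonzero , column
      where
      v = (ℚ.1/ A r zero) {{ℚ.≢-nonZero Ar≢0}}
      Av : A r zero ℚ.* v ≡ 1ℚ
      Av = ℚ.*-inverseʳ (A r zero) {{ℚ.≢-nonZero Ar≢0}}
      A′ : Fin n → Fin (suc m) → ℚ
      A′ i = A (punchIn r i)
      rest = kernel m<n (λ i j → A′ i (suc j) ℚ.+ ℚ.- (A′ i zero ℚ.* (v ℚ.* A r (suc j))))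
      c′ = proj₁ rest
      S = sum (λ i → c′ i ℚ.* A′ i zero)
      -- Each reduced row is a row of A′ minus (its first entry times v) times row r, so a relation
      -- among reduced rows uses row r with total coefficient -S v.
      c : Fin (suc n) → ℚ
      c = insertAt c′ r (ℚ.- (S ℚ.* v))
      c-r : c r ≡ ℚ.- (S ℚ.* v)
      c-r = insertAt-lookup c′ r _
      c-i : ∀ i → c (punchIn r i) ≡ c′ i
      c-i = insertAt-punchIn c′ r _
      nonzero : ∃ λ i → c i ≢ 0ℚ
      nonzero = let i , c′i≢0 = proj₁ (proj₂ rest) in punchIn r i , λ e → c′i≢0 (≡.trans (≡.sym (c-i i)) e)
      split : ∀ j → sum (λ i → c i ℚ.* A i j) ≡ ℚ.- (S ℚ.* v) ℚ.* A r j ℚ.+ sum (λ i → c′ i ℚ.* A′ i j)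
      split j = ≡.trans (sum-remove {i = r} (λ i → c i ℚ.* A i j))
        (≡.cong₂ ℚ._+_ (≡.cong (ℚ._* A r j) c-r) (sum-cong-≋ {n} (λ i → ≡.cong (ℚ._* A′ i j) (c-i i))))
      column : ∀ j → sum (λ i → c i ℚ.* A i j) ≡ 0ℚ
      column zero = ≡.trans (split zero)
        (≡.trans (solve 3 (λ S v a → :- (S :* v) :* a :+ S := S :+ :- (S :* (a :* v))) ≡.refl S v (A r zero))
          (≡.trans (≡.cong (λ t → S ℚ.+ ℚ.- (S ℚ.* t)) Av)
            (≡.trans (≡.cong (λ t → S ℚ.+ ℚ.- t) (ℚ.*-identityʳ S)) (ℚ.+-inverseʳ S))))
      column (suc j) = ≡.trans (split (suc j)) (≡.trans (≡.sym expand) (proj₂ (proj₂ rest) j))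
        where
        w = v ℚ.* A r (suc j)
        expand : sum (λ i → c′ i ℚ.* (A′ i (suc j) ℚ.+ ℚ.- (A′ i zero ℚ.* w)))
               ≡ ℚ.- (S ℚ.* v) ℚ.* A r (suc j) ℚ.+ sum (λ i → c′ i ℚ.* A′ i (suc j))
        expand = ≡.trans (sum-cong-≋ {n} (λ i → solve 4 (λ c a b w → c :* (a :+ :- (b :* w)) := :- w :* (c :* b) :+ con 1ℤ :* (c :* a)) ≡.refl
                    (c′ i) (A′ i (suc j)) (A′ i zero) w))
          (≡.trans (ℚR.sum-linear {n} (ℚ.- w) (ιℚ 1ℤ) (λ i → c′ i ℚ.* A′ i zero) (λ i → c′ i ℚ.* A′ i (suc j)))
            (solve 4 (λ v a S T → :- (v :* a) :* S :+ con 1ℤ :* T := :- (S :* v) :* a :+ T) ≡.refl v (A r (suc j)) S _))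

-- Congruences

module ℤR = RingTheory ℤ.+-*-commutativeRing

module Congruence (p : ℕ) where
  infix 4 _≡ₚ_

  -- The quotient is kept as data, so compatibility with each ring operation is one identity for the
  -- solver; as a record, the type also determines x and y for inference.
  record _≡ₚ_ (x y : ℤ) : Set where
    constructor congruent
    field
      quotient : ℤ
      equality : x ≡ y ℤ.+ quotient ℤ.* + p

  private
    open ℤR using (solve; _:+_; _:*_; :-_; _:=_; con)

    lift : ∀ {x y} → x ≡ y → x ≡ₚ y
    lift {x} ≡.refl = congruent 0ℤ (solve 2 (λ x p → x := x :+ con 0ℤ :* p) ≡.refl x (+ p))

    ≡ₚ-sym : ∀ {x y} → x ≡ₚ y → y ≡ₚ x
    ≡ₚ-sym {x} {y} (congruent q ≡.refl) = congruent (ℤ.- q)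
      (solve 3 (λ y q p → y := (y :+ q :* p) :+ :- q :* p) ≡.refl y q (+ p))

    ≡ₚ-trans : ∀ {x y z} → x ≡ₚ y → y ≡ₚ z → x ≡ₚ z
    ≡ₚ-trans {z = z} (congruent q ≡.refl) (congruent r ≡.refl) = congruent (q ℤ.+ r)
      (solve 4 (λ z q r p → (z :+ r :* p) :+ q :* p := z :+ (q :+ r) :* p) ≡.refl z q r (+ p))

    +-congₚ : ∀ {x y z w} → x ≡ₚ y → z ≡ₚ w → x ℤ.+ z ≡ₚ y ℤ.+ w
    +-congₚ {y = y} {w = w} (congruent q ≡.refl) (congruent r ≡.refl) = congruent (q ℤ.+ r)
      (solve 5 (λ y w q r p → (y :+ q :* p) :+ (w :+ r :* p) := (y :+ w) :+ (q :+ r) :* p) ≡.refl y w q r (+ p))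

    *-congₚ : ∀ {x y z w} → x ≡ₚ y → z ≡ₚ w → x ℤ.* z ≡ₚ y ℤ.* w
    *-congₚ {y = y} {w = w} (congruent q ≡.refl) (congruent r ≡.refl) = congruent (q ℤ.* w ℤ.+ r ℤ.* y ℤ.+ q ℤ.* r ℤ.* + p)
      (solve 5 (λ y w q r p → (y :+ q :* p) :* (w :+ r :* p) := y :* w :+ (q :* w :+ r :* y :+ q :* r :* p) :* p) ≡.refl y w q r (+ p))

    -‿congₚ : ∀ {x y} → x ≡ₚ y → ℤ.- x ≡ₚ ℤ.- y
    -‿congₚ {y = y} (congruent q ≡.refl) = congruent (ℤ.- q)
      (solve 3 (λ y q p → :- (y :+ q :* p) := :- y :+ :- q :* p) ≡.refl y q (+ p))

  ℤ/p : CommutativeRing 0ℓ 0ℓ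
  ℤ/p = record
    { Carrier = ℤ
    ; _≈_     = _≡ₚ_
    ; _+_     = ℤ._+_
    ; _*_     = ℤ._*_
    ; -_      = ℤ.-_
    ; 0#      = 0ℤ
    ; 1#      = 1ℤ
    ; isCommutativeRing = record
      { isRing = record
        { +-isAbelianGroup = record
          { isGroup = record
            { isMonoid = record
              { isSemigroup = record
                { isMagma = record
                  { isEquivalence = record { refl = lift ≡.refl ; sym = ≡ₚ-sym ; trans = ≡ₚ-trans }
                  ; ∙-cong = +-congₚ
                  }
                ; assoc = λ x y z → lift (ℤ.+-assoc x y z)
                }
              ; identity = (λ x → lift (ℤ.+-identityˡ x)) , (λ x → lift (ℤ.+-identityʳ x))
              }
            ; inverse = (λ x → lift (ℤ.+-inverseˡ x)) , (λ x → lift (ℤ.+-inverseʳ x))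
            ; ⁻¹-cong = -‿congₚ
            }
          ; comm = λ x y → lift (ℤ.+-comm x y)
          }
        ; *-cong = *-congₚ
        ; *-assoc = λ x y z → lift (ℤ.*-assoc x y z)
        ; *-identity = (λ x → lift (ℤ.*-identityˡ x)) , (λ x → lift (ℤ.*-identityʳ x))
        ; distrib = (λ x y z → lift (ℤ.*-distribˡ-+ x y z)) , (λ x y z → lift (ℤ.*-distribʳ-+ x y z))
        }
      ; *-comm = λ x y → lift (ℤ.*-comm x y)
      }
    }

  module ℤ/pR = RingTheory ℤ/p

  ∣⇒≡ₚ : ∀ {x y} → + p ℤ.∣ (x ℤ.- y) → x ≡ₚ y
  ∣⇒≡ₚ {x} {y} d with ℤˢ.∣ᵤ⇒∣ {+ p} {x ℤ.- y} d
  ... | ℤˢ.divides q e = congruent q (≡.trans (solve 2 (λ x y → x := y :+ (x :+ :- y)) ≡.refl x y) (≡.cong (λ t → y ℤ.+ t) e))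

  ≡ₚ⇒∣ : ∀ {x y} → x ≡ₚ y → + p ℤ.∣ (x ℤ.- y)
  ≡ₚ⇒∣ {x} {y} (congruent q e) = ℤˢ.∣⇒∣ᵤ (ℤˢ.divides q (≡.trans (≡.cong (λ t → t ℤ.- y) e)
    (solve 2 (λ y t → (y :+ t) :+ :- y := t) ≡.refl y (q ℤ.* + p))))

  ∣⇒≡ₚ0 : ∀ {x} → + p ℤ.∣ x → x ≡ₚ 0ℤ
  ∣⇒≡ₚ0 {x} d = ∣⇒≡ₚ (≡.subst (+ p ℤ.∣_) (≡.sym (ℤ.+-identityʳ x)) d)

  ≡ₚ0⇒∣ : ∀ {x} → x ≡ₚ 0ℤ → + p ℤ.∣ x
  ≡ₚ0⇒∣ {x} e = ≡.subst (+ p ℤ.∣_) (ℤ.+-identityʳ x) (≡ₚ⇒∣ e)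

  _≡ₚ?_ : ∀ x y → Dec (x ≡ₚ y)
  x ≡ₚ? y = Relation.Nullary.Decidable.map′ ∣⇒≡ₚ ≡ₚ⇒∣ (p ℕ.∣? ℤ.∣ x ℤ.- y ∣)
    where import Relation.Nullary.Decidable

  %-≡ₚ : .{{_ : NonZero p}} → ∀ x → x ≡ₚ + (x ℤ.%ℕ p)
  %-≡ₚ x = congruent (x ℤ./ℕ p) (ℤ.a≡a%ℕn+[a/ℕn]*n x p)

  private
    below-divisible : ∀ {a} → a ℕ.< p → p ℕ.∣ a → a ≡ 0
    below-divisible {zero}  _   _   = ≡.refl
    below-divisible {suc a} a<p p∣a = contradiction (ℕ.∣⇒≤ p∣a) (ℕ.<⇒≱ a<p)

  ≡ₚ-below : ∀ {a b} → a ℕ.< p → b ℕ.< p → + a ≡ₚ + b → a ≡ b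
  ≡ₚ-below {a} {b} a<p b<p e with ℕ.≤-total a b
  ... | inj₁ a≤b = ℕ.≤-antisym a≤b (ℕ.m∸n≡0⇒m≤n (below-divisible (ℕ.≤-<-trans (ℕ.m∸n≤m b a) b<p)
        (≡.subst (p ℕ.∣_) (≡.trans (≡.cong ℤ.∣_∣ (ℤ.[+m]-[+n]≡m⊖n b a)) (≡.cong ℤ.∣_∣ (ℤ.⊖-≥ a≤b))) (≡ₚ⇒∣ (≡ₚ-sym e)))))
  ... | inj₂ b≤a = ℕ.≤-antisym (ℕ.m∸n≡0⇒m≤n (below-divisible (ℕ.≤-<-trans (ℕ.m∸n≤m a b) a<p)
        (≡.subst (p ℕ.∣_) (≡.trans (≡.cong ℤ.∣_∣ (ℤ.[+m]-[+n]≡m⊖n a b)) (≡.cong ℤ.∣_∣ (ℤ.⊖-≥ b≤a))) (≡ₚ⇒∣ e)))) b≤a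

  ≡ₚ⇒%≡ : .{{_ : NonZero p}} → ∀ {x y} → x ≡ₚ y → x ℤ.%ℕ p ≡ y ℤ.%ℕ p
  ≡ₚ⇒%≡ {x} {y} e = ≡ₚ-below (ℤ.n%ℕd<d x p) (ℤ.n%ℕd<d y p)
    (≡ₚ-trans (≡ₚ-sym (%-≡ₚ x)) (≡ₚ-trans e (%-≡ₚ y)))

-- Units modulo a prime

module Units (p : ℕ) (pr : Prime p) where
  open Congruence p public
  open ℤ/pR using (_^_; ^-homo-*; ^-assocʳ; ^-congˡ; ^-congʳ; 1^)
  private
    module M = ℤ/pR

  instance
    p-nonZero : NonZero p
    p-nonZero = prime⇒nonZero pr

  p>1 : 1 ℕ.< p
  p>1 = ℕ.nonTrivial⇒n>1 p {{prime⇒nonTrivial pr}}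

  p≡1+[p-1] : p ≡ suc (p ∸ 1)
  p≡1+[p-1] = ≡.sym (ℕ.m+[n∸m]≡n (ℕ.<⇒≤ p>1))

  instance
    p-1-nonZero : NonZero (p ∸ 1)
    p-1-nonZero = ℕ.>-nonZero (ℕ.m<n⇒0<n∸m p>1)

  p≡ₚ0 : + p ≡ₚ 0ℤ
  p≡ₚ0 = congruent 1ℤ (≡.sym (≡.trans (ℤ.+-identityˡ _) (ℤ.*-identityˡ (+ p))))

  Unit : ℤ → Set
  Unit x = ¬ x ≡ₚ 0ℤ

  zero-divisor : ∀ x y → x ℤ.* y ≡ₚ 0ℤ → x ≡ₚ 0ℤ ⊎ y ≡ₚ 0ℤ
  zero-divisor x y e with euclidsLemma ℤ.∣ x ∣ ℤ.∣ y ∣ pr (≡.subst (p ℕ.∣_) (ℤ.abs-* x y) (≡ₚ0⇒∣ {x ℤ.* y} e))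
  ... | inj₁ d = inj₁ (∣⇒≡ₚ0 {x} d)
  ... | inj₂ d = inj₂ (∣⇒≡ₚ0 {y} d)

  unit-* : ∀ {x y} → Unit x → Unit y → Unit (x ℤ.* y)
  unit-* {x} {y} ux uy e with zero-divisor x y e
  ... | inj₁ x≡0 = ux x≡0
  ... | inj₂ y≡0 = uy y≡0

  unit-1 : Unit 1ℤ
  unit-1 e = contradiction (≡ₚ-below p>1 (ℕ.<⇒≤ p>1) e) (λ ())

  unit-^ : ∀ {x} n → Unit x → Unit (x ^ n)
  unit-^ zero    ux = unit-1
  unit-^ {x} (suc n) ux = unit-* {x} {x ^ n} ux (unit-^ n ux)

  unit-cancel : ∀ {x y z} → Unit x → x ℤ.* y ≡ₚ x ℤ.* z → y ≡ₚ z
  unit-cancel {x} {y} {z} ux e = M.x-y≈0⇒x≈y ([ (λ x≡0 → contradiction x≡0 ux) , id ]′ (zero-divisor x (y ℤ.+ ℤ.- z)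
    (M.trans (M.solve 3 (λ x y z → x M.:* (y M.:+ M.:- z) M.:= x M.:* y M.:+ M.:- (x M.:* z)) M.refl x y z) (M.x≈y⇒x-y≈0 e))))

  ^≡ : ∀ x n → x ℤ.^ n ≡ x ^ n
  ^≡ x zero    = ≡.refl
  ^≡ x (suc n) = ≡.cong (x ℤ.*_) (^≡ x n)

  HasOrder : ℤ → ℕ → Set
  HasOrder x n = x ^ n ≡ₚ 1ℤ × (∀ j → 0 ℕ.< j → j ℕ.< n → ¬ x ^ j ≡ₚ 1ℤ)

  ^-multiple : ∀ {x n} → x ^ n ≡ₚ 1ℤ → ∀ k → x ^ (k ℕ.* n) ≡ₚ 1ℤ
  ^-multiple {x} {n} e k = M.trans (^-congʳ x (ℕ.*-comm k n)) (M.trans (M.sym (^-assocʳ x n k)) (M.trans (^-congˡ k e) (1^ k)))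

  order-divides : ∀ {x n} .{{_ : NonZero n}} → HasOrder x n → ∀ {i} → x ^ i ≡ₚ 1ℤ → n ℕ.∣ i
  order-divides {x} {n} (xⁿ , minimal) {i} e = ℕ.m%n≡0⇒n∣m i n (zero-remainder (i ℕ.% n) (ℕ.m%n<n i n) x^r)
    where
    x^r : x ^ (i ℕ.% n) ≡ₚ 1ℤ
    x^r = M.begin
      x ^ r                      M.≈⟨ M.sym (M.*-identityʳ (x ^ r)) ⟩
      x ^ r ℤ.* 1ℤ               M.≈⟨ M.*-congˡ {x ^ r} (M.sym (^-multiple {x} {n} xⁿ q)) ⟩
      x ^ r ℤ.* x ^ (q ℕ.* n)    M.≈⟨ M.sym (^-homo-* x r (q ℕ.* n)) ⟩
      x ^ (r ℕ.+ q ℕ.* n)        M.≈⟨ ^-congʳ x (≡.sym (ℕ.m≡m%n+[m/n]*n i n)) ⟩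
      x ^ i                      M.≈⟨ e ⟩
      1ℤ                         M.∎
      where
      r = i ℕ.% n
      q = i ℕ./ n
    zero-remainder : ∀ r → r ℕ.< n → x ^ r ≡ₚ 1ℤ → r ≡ 0
    zero-remainder zero    _   _ = ≡.refl
    zero-remainder (suc r) r<n e = contradiction e (minimal (suc r) (s≤s z≤n) r<n)

  private
    order-%≡-≤ : ∀ {x n} .{{_ : NonZero n}} → Unit x → HasOrder x n → ∀ {i j} → i ℕ.≤ j → x ^ j ≡ₚ x ^ i → j ℕ.% n ≡ i ℕ.% n
    order-%≡-≤ {x} {n} ux ord {i} {j} i≤j e = same-remainder (order-divides ord {j ∸ i} (unit-cancel {x ^ i} (unit-^ i ux)
      (M.trans (M.sym (^-homo-* x i (j ∸ i))) (M.trans (^-congʳ x (ℕ.m+[n∸m]≡n i≤j)) (M.trans e (M.sym (M.*-identityʳ _)))))))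
      where
      same-remainder : n ℕ.∣ j ∸ i → j ℕ.% n ≡ i ℕ.% n
      same-remainder (ℕ.divides k eq) =
        ≡.trans (≡.cong (ℕ._% n) (≡.trans (≡.sym (ℕ.m+[n∸m]≡n i≤j)) (≡.cong (i ℕ.+_) eq))) (ℕ.[m+kn]%n≡m%n i k n)

  order-%≡ : ∀ {x n} .{{_ : NonZero n}} → Unit x → HasOrder x n → ∀ {i j} → x ^ i ≡ₚ x ^ j → i ℕ.% n ≡ j ℕ.% n
  order-%≡ ux ord {i} {j} e with ℕ.≤-total i j
  ... | inj₁ i≤j = ≡.sym (order-%≡-≤ ux ord i≤j (M.sym e))
  ... | inj₂ j≤i = order-%≡-≤ ux ord j≤i e

  residue : ∀ x → Unit x → ∃ λ (a : Fin (p ∸ 1)) → x ≡ₚ + suc (toℕ a)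
  residue x ux with x ℤ.%ℕ p | %-≡ₚ x | ℤ.n%ℕd<d x p
  ... | zero  | e | _   = contradiction e ux
  ... | suc r | e | r<p = Fin.fromℕ< r<p-1 , M.trans e (M.reflexive (≡.cong (λ k → + suc k) (≡.sym (Fin.toℕ-fromℕ< r<p-1))))
    where
    r<p-1 : r ℕ.< p ∸ 1
    r<p-1 = ℕ.s≤s⁻¹ (≡.subst (suc r ℕ.<_) p≡1+[p-1] r<p)

  suc<p : (a : Fin (p ∸ 1)) → suc (toℕ a) ℕ.< p
  suc<p a = ≡.subst (suc (toℕ a) ℕ.<_) (≡.sym p≡1+[p-1]) (s≤s (Fin.toℕ<n a))

  module PrimitiveRoot (x : ℤ) (ux : Unit x) (ord : HasOrder x (p ∸ 1)) where

    -- An index a stands for the residue a + 1. The p - 1 powers of x are distinct units, so this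
    -- self-map of a finite set is injective, hence surjective, and its preimages are the discrete
    -- logarithms.
    log-index : Fin (p ∸ 1) → Fin (p ∸ 1)
    log-index i = proj₁ (residue (x ^ toℕ i) (unit-^ (toℕ i) ux))

    log-index-≡ₚ : ∀ i → x ^ toℕ i ≡ₚ + suc (toℕ (log-index i))
    log-index-≡ₚ i = proj₂ (residue (x ^ toℕ i) (unit-^ (toℕ i) ux))

    log-index-injective : ∀ {i j} → log-index i ≡ log-index j → i ≡ j
    log-index-injective {i} {j} e = Fin.toℕ-injective (≡.trans (≡.sym (ℕ.m<n⇒m%n≡m (Fin.toℕ<n i)))
      (≡.trans (order-%≡ ux ord {toℕ i} {toℕ j} (M.trans (log-index-≡ₚ i) (M.trans (M.reflexive (≡.cong (λ a → + suc (toℕ a)) e)) (M.sym (log-index-≡ₚ j)))))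
        (ℕ.m<n⇒m%n≡m (Fin.toℕ<n j))))

    log-index-surjective : ∀ y → ∃ λ i → log-index i ≡ y
    log-index-surjective = injective⇒surjective log-index log-index-injective

    logarithm : ∀ y → Unit y → ∃ λ (i : Fin (p ∸ 1)) → x ^ toℕ i ≡ₚ y
    logarithm y uy =
      let a , y≡ = residue y uy
          i , e  = log-index-surjective a
      in i , M.trans (log-index-≡ₚ i) (M.trans (M.reflexive (≡.cong (λ a → + suc (toℕ a)) e)) (M.sym y≡))

    module _ (R : CommutativeRing 0ℓ 0ℓ) where
      open RingTheory R
      open RangeSums R

      sum-over-units : (f : ℤ → Carrier) → (∀ {a b} → a ≡ₚ b → f a ≈ f b) →
                       Σ< (p ∸ 1) (λ i → f (x M.^ i)) ≈ Σ< (p ∸ 1) (λ a → f (+ suc a))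
      sum-over-units f f-cong = trans (sum-cong-≋ {p ∸ 1} (λ i → f-cong (log-index-≡ₚ i)))
        (sum-reindex log-index log-index-injective log-index-surjective (λ a → f (+ suc (toℕ a))))

  -- u and β are powers of each other: u = β^a gives u^(p-1) = 1, and β = u^b turns any smaller
  -- exponent killing u into one killing β.
  generator-order : ∀ {β u} → Unit β → HasOrder β (p ∸ 1) → Unit u → (∀ a → Unit a → ∃ λ j → a ≡ₚ u ^ j) → HasOrder u (p ∸ 1)
  generator-order {β} {u} uβ ord uu generates = power-1 , minimal
    where
    open PrimitiveRoot β uβ ord using (logarithm)
    a = toℕ (proj₁ (logarithm u uu))
    power-1 : u ^ (p ∸ 1) ≡ₚ 1ℤ
    power-1 = M.trans (^-congˡ (p ∸ 1) (M.sym (proj₂ (logarithm u uu))))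
      (M.trans (^-assocʳ β a (p ∸ 1)) (^-multiple (proj₁ ord) a))
    minimal : ∀ j → 0 ℕ.< j → j ℕ.< p ∸ 1 → ¬ u ^ j ≡ₚ 1ℤ
    minimal j 0<j j<n e = proj₂ ord j 0<j j<n (M.trans (^-congˡ j β≡) (M.trans (^-assocʳ u b j) (^-multiple {u} {j} e b)))
      where
      b = proj₁ (generates β uβ)
      β≡ = proj₂ (generates β uβ)

  order-unit : ∀ {x n} .{{_ : NonZero n}} → x ^ n ≡ₚ 1ℤ → Unit x
  order-unit {x} {suc n} e x≡0 = unit-1 (M.trans (M.sym e) (M.trans (M.*-congʳ x≡0) (M.zeroˡ (x ^ n))))

-- Rational and conjugate complex numbers

fromℚ-zero : ∀ {q} → fromℚ q ≃ fromℚ 0ℚ → q ≡ 0ℚ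
fromℚ-zero {q} e with q ℚ.≟ 0ℚ
... | yes q≡0 = q≡0
... | no  q≢0 = contradiction ∣q∣<∣q∣ (ℚ.<-irrefl ≡.refl)
  where
  0<∣q∣ : 0ℚ ℚ.< ℚ.∣ q ∣
  0<∣q∣ = ℚ.≰⇒> λ l → q≢0 (ℚ.∣p∣≡0⇒p≡0 q (ℚ.≤-antisym l (ℚ.0≤∣p∣ q)))
  ∣q∣<∣q∣ : ℚ.∣ q ∣ ℚ.< ℚ.∣ q ∣
  ∣q∣<∣q∣ = let N , h = ≃0⇒null e ℚ.∣ q ∣ 0<∣q∣ in h N ℕ.≤-refl

ℚ→ℂ-+ : ∀ a b → ℚ→ℂ (a ℚ.+ b) ≈ᶜ (ℚ→ℂ a +ᶜ ℚ→ℂ b)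
ℚ→ℂ-+ a b = mk≃ (pointwise λ n → ≡.refl) (pointwise λ n → ≡.refl)

ℚ→ℂ-* : ∀ a b → ℚ→ℂ (a ℚ.* b) ≈ᶜ (ℚ→ℂ a *ᶜ ℚ→ℂ b)
ℚ→ℂ-* a b = mk≃ (pointwise λ n → solve 2 (λ a b → a :* b := a :* b :- con 0ℚ :* con 0ℚ) ≡.refl a b)
               (pointwise λ n → solve 2 (λ a b → con 0ℚ := a :* con 0ℚ :+ con 0ℚ :* b) ≡.refl a b)
  where open ℚ.+-*-Solver

ℚ→ℂ-neg : ∀ a → ℚ→ℂ (ℚ.- a) ≈ᶜ (-ᶜ ℚ→ℂ a)
ℚ→ℂ-neg a = mk≃ (pointwise λ n → ≡.refl) (pointwise λ n → ≡.refl)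

ℚ→ℂ-ι : ∀ z → ℚ→ℂ (ιℚ z) ≈ᶜ ℂR.ι z
ℚ→ℂ-ι (+ n)    = natural n
  where
  natural : ∀ n → ℚ→ℂ (ιℚ (+ n)) ≈ᶜ ℂR.ι (+ n)
  natural zero    = ℂR.refl
  natural (suc n) = ℂR.trans (ℚ→ℂ-+ 1ℚ (ιℚ (+ n))) (ℂR.+-congˡ (natural n))
ℚ→ℂ-ι -[1+ n ] = ℂR.trans (ℚ→ℂ-neg (ιℚ (+ suc n))) (ℂR.-‿cong (ℚ→ℂ-ι (+ suc n)))

ℚ→ℂ-zero : ∀ {q} → ℚ→ℂ q ≈ᶜ 0ᶜ → q ≡ 0ℚ
ℚ→ℂ-zero e = fromℚ-zero (re≃ e)

ℚ→ℂ-cong : ∀ {a b} → a ≡ b → ℚ→ℂ a ≈ᶜ ℚ→ℂ b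
ℚ→ℂ-cong e = ℂR.reflexive (≡.cong ℚ→ℂ e)

ℚ→ℂ-sum : ∀ {n} (f : Fin n → ℚ) → ℚ→ℂ (ℚR.sum f) ≈ᶜ ℂR.sum (λ i → ℚ→ℂ (f i))
ℚ→ℂ-sum {zero}  f = ℂR.refl
ℚ→ℂ-sum {suc n} f = ℂR.trans (ℚ→ℂ-+ (f zero) (ℚR.sum (f ∘ suc))) (ℂR.+-congˡ (ℚ→ℂ-sum (f ∘ suc)))

ℂ-nonzero : ∀ n → .{{NonZero n}} → ¬ ℂR.ι (+ n) ≈ᶜ 0ᶜ
ℂ-nonzero n e = ℚ.<⇒≢ (0<ι′ n) (≡.sym (ℚ→ℂ-zero (ℂR.trans (ℚ→ℂ-ι (+ n)) e)))

ℂ-invertible : ∀ n → .{{NonZero n}} → ∃ λ v → (v *ᶜ ℂR.ι (+ n)) ≈ᶜ 1ᶜ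
ℂ-invertible n =
  let v , _ , nv = recip (ιℚ (+ n)) (0<ι′ n)
  in ℚ→ℂ v , ℂR.trans (ℂR.*-congˡ {ℚ→ℂ v} (ℂR.sym (ℚ→ℂ-ι (+ n))))
       (ℂR.trans (ℂR.sym (ℚ→ℂ-* v (ιℚ (+ n)))) (ℚ→ℂ-cong (≡.trans (ℚ.*-comm v (ιℚ (+ n))) nv)))

ℂ-cancel : ∀ n → .{{_ : NonZero n}} → ∀ {x} → (ℂR.ι (+ n) *ᶜ x) ≈ᶜ 0ᶜ → x ≈ᶜ 0ᶜ
ℂ-cancel n {x} e = ℂR.unitˡ-cancel {proj₁ (ℂ-invertible n)} {ℂR.ι (+ n)} {x} (proj₂ (ℂ-invertible n)) e

conjugate-cong : ∀ {x y} → x ≈ᶜ y → conjugate x ≈ᶜ conjugate y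
conjugate-cong e = mk≃ (re≃ e) (ℝR.-‿cong (im≃ e))

conjugate-+ : ∀ x y → conjugate (x +ᶜ y) ≈ᶜ (conjugate x +ᶜ conjugate y)
conjugate-+ x y = mk≃ ℝR.refl (ℝR.sym (ℝR.⁻¹-∙-comm (im x) (im y)))

conjugate-* : ∀ x y → conjugate (x *ᶜ y) ≈ᶜ (conjugate x *ᶜ conjugate y)
conjugate-* (a +i b) (c +i d) = mk≃
  (solve 4 (λ a b c d → a :* c :+ :- (b :* d) := a :* c :+ :- (:- b :* :- d)) refl a b c d)
  (solve 4 (λ a b c d → :- (a :* d :+ b :* c) := a :* :- d :+ :- b :* c) refl a b c d)
  where open ℝR

conjugate-1 : conjugate 1ᶜ ≈ᶜ 1ᶜ
conjugate-1 = mk≃ ℝR.refl (pointwise λ n → ≡.refl)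

conjugate-0 : conjugate 0ᶜ ≈ᶜ 0ᶜ
conjugate-0 = mk≃ ℝR.refl (pointwise λ n → ≡.refl)

conjugate-^ : ∀ x n → conjugate (x ℂ-Ops.^ n) ≈ᶜ (conjugate x ℂ-Ops.^ n)
conjugate-^ x zero    = conjugate-1
conjugate-^ x (suc n) = ℂR.trans (conjugate-* x (x ℂ-Ops.^ n)) (ℂR.*-congˡ {conjugate x} (conjugate-^ x n))

conjugate-sum : ∀ {n} (f : Vector ℂ n) → conjugate (ℂR.sum f) ≈ᶜ ℂR.sum (λ i → conjugate (f i))
conjugate-sum {zero}  f = conjugate-0
conjugate-sum {suc n} f = ℂR.trans (conjugate-+ (f zero) (ℂR.sum (f ∘ suc))) (ℂR.+-congˡ (conjugate-sum (f ∘ suc)))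

module _ where
  open RangeSums ℂ-commutativeRing

  -- A sum of powers of ∣z∣² has real part at least 1.
  norm-powers-nonzero : ∀ z n → ¬ Σ< (suc n) (λ k → (z *ᶜ conjugate z) ℂ-Ops.^ k) ≈ᶜ 0ᶜ
  norm-powers-nonzero z n e = ℚ.<-irrefl ≡.refl (ℚ.<-≤-trans (∣∣<⇒< (proj₂ small N ℕ.≤-refl)) (1≤s N))
    where
    r : ℝ
    r = re z *ᵣ re z +ᵣ im z *ᵣ im z
    norm : (z *ᶜ conjugate z) ≈ᶜ (r +i fromℚ 0ℚ)
    norm = mk≃ (solve 2 (λ a b → a :* a :+ :- (b :* :- b) := a :* a :+ b :* b) refl (re z) (im z))
               (solve 2 (λ a b → a :* :- b :+ b :* a := con 0ℤ) refl (re z) (im z))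
      where open ℝR
    powers : ∀ k → ((z *ᶜ conjugate z) ℂ-Ops.^ k) ≈ᶜ ((r ℝ-Ops.^ k) +i fromℚ 0ℚ)
    powers zero    = mk≃ ℝR.refl ℝR.refl
    powers (suc k) = ℂR.trans (ℂR.*-cong norm (powers k))
      (mk≃ (solve 2 (λ a b → a :* b :+ :- (con 0ℤ :* con 0ℤ) := a :* b) refl r (r ℝ-Ops.^ k))
           (solve 2 (λ a b → a :* con 0ℤ :+ con 0ℤ :* b := con 0ℤ) refl r (r ℝ-Ops.^ k)))
      where open ℝR
    0≤r^ : ∀ k n → 0ℚ ℚ.≤ seq (r ℝ-Ops.^ k) n
    0≤r^ zero    n = ℚ.<⇒≤ 0<1ℚ
    0≤r^ (suc k) n = 0≤-* {seq r n} (0≤-+ (0≤-square (seq (re z) n)) (0≤-square (seq (im z) n))) (0≤r^ k n)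
    0≤sum : ∀ {m} (f : Fin m → ℕ) n → 0ℚ ℚ.≤ seq (ℝ-Ops.sum (λ i → r ℝ-Ops.^ f i)) n
    0≤sum {zero}  f n = ℚ.≤-refl
    0≤sum {suc m} f n = 0≤-+ {seq (r ℝ-Ops.^ f zero) n} (0≤r^ (f zero) n) (0≤sum (f ∘ suc) n)
    re-sum : ∀ {m} (f : Fin m → ℕ) →
             re (ℂR.sum (λ i → (z *ᶜ conjugate z) ℂ-Ops.^ f i)) ≃ ℝ-Ops.sum (λ i → r ℝ-Ops.^ f i)
    re-sum {zero}  f = ℝR.refl
    re-sum {suc m} f = ℝR.+-cong (re≃ (powers (f zero))) (re-sum (f ∘ suc))
    s : ℝ
    s = ℝ-Ops.sum {suc n} (λ i → r ℝ-Ops.^ toℕ i)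
    1≤s : ∀ k → 1ℚ ℚ.≤ seq s k
    1≤s k = ≡.subst (ℚ._≤ seq s k) (ℚ.+-identityʳ 1ℚ) (ℚ.+-monoʳ-≤ 1ℚ (0≤sum {n} (λ i → suc (toℕ i)) k))
    small = ≃0⇒null {s} (ℝR.trans (ℝR.sym (re-sum {suc n} toℕ)) (re≃ e)) 1ℚ 0<1ℚ
    N = proj₁ small

-- Roots of unity

module Cyclotomic (p : ℕ) (pr : Prime p) (ζ : ℂ) (primitiveζ : IsPrimitiveRootOfUnity p ζ) where
  open Units p pr public
  open RingTheory ℂ-commutativeRing
  open RangeSums ℂ-commutativeRing
  private
    module M = ℤ/pR

  -- The sum Φ of the powers satisfies zΦ = Φ, hence Φ² = pΦ, and Φ/p is idempotent. If it is 1 then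
  -- Φ = p, and zΦ = Φ reads zp = p.
  geometric : ∀ z → z ^ p ≈ 1# → Σ< p (λ k → z ^ k) ≈ 0# ⊎ z ≈ 1#
  geometric z zᵖ = [ (λ e≈0 → inj₁ (Φ-from e≈0 (zeroʳ n))) , (λ e≈1 → inj₂ (z≈1 (Φ-from e≈1 (*-identityʳ n)))) ]′ (idempotent e e²)
    where
    Φ n v e : ℂ
    Φ = Σ< p (λ k → z ^ k)
    n = ι (+ p)
    v = proj₁ (ℂ-invertible p)
    vn : v * n ≈ 1#
    vn = proj₂ (ℂ-invertible p)
    e = v * Φ
    zΦ : z * Φ ≈ Φ
    zΦ = trans (*-distribˡ-sum {p} z (λ i → z ^ toℕ i))
      (Σ<-rotate p (z ^_) (λ i → trans (^-homo-* z p i) (trans (*-congʳ zᵖ) (*-identityˡ _))) 1)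
    z^Φ : ∀ k → z ^ k * Φ ≈ Φ
    z^Φ zero    = *-identityˡ Φ
    z^Φ (suc k) = trans (*-assoc z (z ^ k) Φ) (trans (*-congˡ {z} (z^Φ k)) zΦ)
    Φ² : Φ * Φ ≈ n * Φ
    Φ² = trans (*-distribʳ-sum {p} Φ (λ i → z ^ toℕ i)) (trans (Σ<-cong p (λ k _ → z^Φ k)) (Σ<-const p Φ))
    e² : e * e ≈ e
    e² = begin
      v * Φ * (v * Φ)    ≈⟨ solve 2 (λ v f → v :* f :* (v :* f) := v :* v :* (f :* f)) refl v Φ ⟩
      v * v * (Φ * Φ)    ≈⟨ *-congˡ {v * v} Φ² ⟩
      v * v * (n * Φ)    ≈⟨ solve 3 (λ v n f → v :* v :* (n :* f) := v :* n :* (v :* f)) refl v n Φ ⟩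
      v * n * e          ≈⟨ *-congʳ vn ⟩
      1# * e             ≈⟨ *-identityˡ e ⟩
      e                  ∎
    Φ-from : ∀ {x y} → e ≈ x → n * x ≈ y → Φ ≈ y
    Φ-from {x} {y} e≈x nx≈y = begin
      Φ              ≈⟨ sym (*-identityˡ Φ) ⟩
      1# * Φ         ≈⟨ *-congʳ (sym vn) ⟩
      v * n * Φ      ≈⟨ solve 3 (λ v n f → v :* n :* f := n :* (v :* f)) refl v n Φ ⟩
      n * e          ≈⟨ *-congˡ {n} e≈x ⟩
      n * x          ≈⟨ nx≈y ⟩
      y              ∎
    z≈1 : Φ ≈ n → z ≈ 1#
    z≈1 Φ≈n = x-y≈0⇒x≈y (ℂ-cancel p (begin
      n * (z + - 1#)           ≈⟨ distribˡ n z (- 1#) ⟩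
      n * z + n * - 1#         ≈⟨ +-cong (*-comm n z) (trans (sym (-‿distribʳ-* n 1#)) (-‿cong (*-identityʳ n))) ⟩
      z * n + - n              ≈⟨ +-congʳ (trans (*-congˡ {z} (sym Φ≈n)) (trans zΦ Φ≈n)) ⟩
      n + - n                  ≈⟨ x-x≈0 n ⟩
      0#                       ∎))

  ^-mod : ∀ n → ζ ^ n ≈ ζ ^ (n ℕ.% p)
  ^-mod n = begin
    ζ ^ n                                     ≈⟨ ^-congʳ ζ (ℕ.m≡m%n+[m/n]*n n p) ⟩
    ζ ^ (n ℕ.% p ℕ.+ n ℕ./ p ℕ.* p)           ≈⟨ ^-homo-* ζ (n ℕ.% p) (n ℕ./ p ℕ.* p) ⟩
    ζ ^ (n ℕ.% p) * ζ ^ (n ℕ./ p ℕ.* p)       ≈⟨ *-congˡ {ζ ^ (n ℕ.% p)} (trans (^-congʳ ζ (ℕ.*-comm (n ℕ./ p) p))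
                                                   (trans (sym (^-assocʳ ζ p (n ℕ./ p))) (trans (^-congˡ (n ℕ./ p) (proj₁ primitiveζ)) (1^ (n ℕ./ p))))) ⟩
    ζ ^ (n ℕ.% p) * 1#                        ≈⟨ *-identityʳ _ ⟩
    ζ ^ (n ℕ.% p)                             ∎

  -- The additive character of ℤ/p attached to ζ. Reducing the exponent first gives negative
  -- integers a meaning without inverting ζ.
  E : ℤ → ℂ
  E z = ζ ^ (z ℤ.%ℕ p)

  E-cong : ∀ {x y} → x ≡ₚ y → E x ≈ E y
  E-cong e = ^-congʳ ζ (≡ₚ⇒%≡ e)

  E-nat : ∀ n → E (+ n) ≈ ζ ^ n
  E-nat n = sym (^-mod n)

  E-+ : ∀ x y → E (x ℤ.+ y) ≈ E x * E y
  E-+ x y = trans (E-cong (M.+-cong (%-≡ₚ x) (%-≡ₚ y)))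
    (trans (E-nat (x ℤ.%ℕ p ℕ.+ y ℤ.%ℕ p)) (^-homo-* ζ (x ℤ.%ℕ p) (y ℤ.%ℕ p)))

  E-0 : E 0ℤ ≈ 1#
  E-0 = E-nat 0

  E-1 : E 1ℤ ≈ ζ
  E-1 = trans (E-nat 1) (*-identityʳ ζ)

  E-^ : ∀ x n → E x ^ n ≈ E (+ n ℤ.* x)
  E-^ x zero    = sym E-0
  E-^ x (suc n) = trans (*-congˡ {E x} (E-^ x n)) (trans (sym (E-+ x (+ n ℤ.* x)))
    (E-cong (M.reflexive (≡.sym (ℤ.suc-* (+ n) x)))))

  E-≈1 : ∀ {x} → E x ≈ 1# → x ≡ₚ 0ℤ
  E-≈1 {x} e = M.trans (%-≡ₚ x) (M.reflexive (≡.cong +_ (zero-exponent (x ℤ.%ℕ p) (ℤ.n%ℕd<d x p) e)))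
    where
    zero-exponent : ∀ r → r ℕ.< p → ζ ^ r ≈ 1# → r ≡ 0
    zero-exponent zero    _   _ = ≡.refl
    zero-exponent (suc r) r<p e = contradiction e (proj₂ primitiveζ (suc r) (s≤s z≤n) r<p)

  E-inverse : ∀ x → E x * E (ℤ.- x) ≈ 1#
  E-inverse x = trans (sym (E-+ x (ℤ.- x))) (trans (E-cong (M.reflexive (ℤ.+-inverseʳ x))) E-0)

  E-injective : ∀ {x y} → E x ≈ E y → x ≡ₚ y
  E-injective {x} {y} e = M.x-y≈0⇒x≈y (E-≈1 (trans (E-+ x (ℤ.- y)) (trans (*-congʳ e) (E-inverse y))))

  E^p : ∀ x → E x ^ p ≈ 1#
  E^p x = trans (E-^ x p) (trans (E-cong (∣⇒≡ₚ0 {+ p ℤ.* x} (≡.subst (p ℕ.∣_) (≡.sym (ℤ.abs-* (+ p) x)) (ℕ.m∣m*n ℤ.∣ x ∣)))) E-0)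

  E-sum-unit : ∀ x → Unit x → Σ< p (λ k → E (+ k ℤ.* x)) ≈ 0#
  E-sum-unit x ux = trans (Σ<-cong p (λ k _ → sym (E-^ x k)))
    ([ id , (λ e → contradiction (E-≈1 e) ux) ]′ (geometric (E x) (E^p x)))

  E-sum-zero : ∀ x → x ≡ₚ 0ℤ → Σ< p (λ k → E (+ k ℤ.* x)) ≈ ι (+ p)
  E-sum-zero x x≡0 = trans (Σ<-cong p (λ k _ → trans (E-cong (M.trans (M.*-congˡ {+ k} x≡0) (M.zeroʳ (+ k)))) E-0))
    (trans (Σ<-const p 1#) (*-identityʳ _))

  -- For each j the ratio of w to ζ^j is again a p-th root of unity, and `geometric` tells whether
  -- it is 1 or has vanishing power sum. Vanishing cannot occur for all j, since the total of these
  -- power sums is p.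
  root-of-unity : ∀ w → w ^ p ≈ 1# → ∃ λ (j : Fin p) → w ≈ E (+ toℕ j)
  root-of-unity w wᵖ = [ (λ none → contradiction (total none) (ℂ-nonzero p)) , found ]′
      (search λ j → geometric (w * E (ℤ.- + toℕ j)) (ratioᵖ j))
    where
    search : ∀ {n} {A B : Fin n → Set} → (∀ i → A i ⊎ B i) → (∀ i → A i) ⊎ ∃ B
    search {zero}  h = inj₁ λ ()
    search {suc n} h with h zero | search (h ∘ suc)
    ... | inj₂ b | _            = inj₂ (zero , b)
    ... | inj₁ a | inj₂ (i , b) = inj₂ (suc i , b)
    ... | inj₁ a | inj₁ as      = inj₁ λ { zero → a ; (suc i) → as i }
    ratioᵖ : ∀ (j : Fin p) → (w * E (ℤ.- + toℕ j)) ^ p ≈ 1#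
    ratioᵖ j = trans (*-^ w (E (ℤ.- + toℕ j)) p) (trans (*-cong wᵖ (E^p (ℤ.- + toℕ j))) (*-identityˡ 1#))
    found : (∃ λ (j : Fin p) → w * E (ℤ.- + toℕ j) ≈ 1#) → ∃ λ j → w ≈ E (+ toℕ j)
    found (j , e) = j , (begin
      w                       ≈⟨ sym (*-identityʳ w) ⟩
      w * 1#                  ≈⟨ *-congˡ {w} (sym (trans (*-comm (E (ℤ.- x)) (E x)) (E-inverse x))) ⟩
      w * (E (ℤ.- x) * E x)   ≈⟨ sym (*-assoc w (E (ℤ.- x)) (E x)) ⟩
      w * E (ℤ.- x) * E x     ≈⟨ *-congʳ e ⟩
      1# * E x                ≈⟨ *-identityˡ (E x) ⟩
      E x                     ∎)
      where x = + toℕ j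
    -- Interchanging the two sums isolates the term w⁰.
    total : (∀ (j : Fin p) → Σ< p (λ k → (w * E (ℤ.- + toℕ j)) ^ k) ≈ 0#) → ι (+ p) ≈ 0#
    total none = begin
      ι (+ p)                                                    ≈⟨ sym (trans (*-identityˡ _) (E-sum-zero 0ℤ M.refl)) ⟩
      1# * S 0                                                   ≈⟨ sym (others p p≡1+[p-1] ℕ.≤-refl) ⟩
      Σ< p (λ k → w ^ k * S k)                                   ≈⟨ Σ<-cong p (λ k _ → *-distribˡ-sum {p} (w ^ k) (λ j → E (+ toℕ j ℤ.* ℤ.- + k))) ⟩
      Σ< p (λ k → Σ< p (λ j → w ^ k * E (+ j ℤ.* ℤ.- + k)))      ≈⟨ ∑-comm {p} {p} (λ k j → w ^ toℕ k * E (+ toℕ j ℤ.* ℤ.- + toℕ k)) ⟩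
      Σ< p (λ j → Σ< p (λ k → w ^ k * E (+ j ℤ.* ℤ.- + k)))      ≈⟨ Σ<-cong p (λ j _ → Σ<-cong p (λ k _ → term j k)) ⟩
      Σ< p (λ j → Σ< p (λ k → (w * E (ℤ.- + j)) ^ k))            ≈⟨ sum-zero {p} _ none ⟩
      0#                                                         ∎
      where
      S : ℕ → ℂ
      S k = Σ< p (λ j → E (+ j ℤ.* ℤ.- + k))
      term : ∀ j k → w ^ k * E (+ j ℤ.* ℤ.- + k) ≈ (w * E (ℤ.- + j)) ^ k
      term j k = trans (*-congˡ {w ^ k} (trans (E-cong (M.solve 2 (λ j k → j M.:* M.:- k M.:= k M.:* M.:- j) M.refl (+ j) (+ k))) (sym (E-^ (ℤ.- + j) k)))) (sym (*-^ w (E (ℤ.- + j)) k))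
      unit : ∀ k → suc k ℕ.< p → Unit (ℤ.- + suc k)
      unit k k<p e = contradiction (≡ₚ-below k<p (ℕ.<-trans (s≤s z≤n) p>1) (M.trans (M.solve 1 (λ k → k M.:= M.:- (M.:- k)) M.refl (+ suc k)) (M.-‿cong e))) (λ ())
      others : ∀ m → m ≡ suc (p ∸ 1) → m ℕ.≤ p → Σ< m (λ k → w ^ k * S k) ≈ 1# * S 0
      others .(suc (p ∸ 1)) ≡.refl m≤p = trans (+-congˡ (sum-zero {p ∸ 1} _ (λ k → trans (*-congˡ {w ^ suc (toℕ k)}
        (E-sum-unit (ℤ.- + suc (toℕ k)) (unit (toℕ k) (suc<p k)))) (zeroʳ _)))) (+-identityʳ _)

  -- ζ times its conjugate is a p-th root of unity whose geometric sum has real part at least 1,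
  -- which leaves only the value 1. Conjugation therefore inverts ζ.
  conjugate-ζ : conjugate ζ ≈ E (ℤ.- 1ℤ)
  conjugate-ζ = begin
    conjugate ζ                          ≈⟨ sym (*-identityˡ _) ⟩
    1# * conjugate ζ                     ≈⟨ *-congʳ (sym (trans (*-comm (E (ℤ.- 1ℤ)) (E 1ℤ)) (E-inverse 1ℤ))) ⟩
    E (ℤ.- 1ℤ) * E 1ℤ * conjugate ζ      ≈⟨ *-congʳ {conjugate ζ} (*-congˡ {E (ℤ.- 1ℤ)} E-1) ⟩
    E (ℤ.- 1ℤ) * ζ * conjugate ζ         ≈⟨ *-assoc (E (ℤ.- 1ℤ)) ζ (conjugate ζ) ⟩
    E (ℤ.- 1ℤ) * (ζ * conjugate ζ)       ≈⟨ *-congˡ {E (ℤ.- 1ℤ)} norm ⟩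
    E (ℤ.- 1ℤ) * 1#                      ≈⟨ *-identityʳ _ ⟩
    E (ℤ.- 1ℤ)                           ∎
    where
    norm^p : (ζ * conjugate ζ) ^ p ≈ 1#
    norm^p = trans (*-^ ζ (conjugate ζ) p) (trans (*-cong (proj₁ primitiveζ)
      (trans (sym (conjugate-^ ζ p)) (trans (conjugate-cong (proj₁ primitiveζ)) conjugate-1))) (*-identityˡ 1#))
    norm : ζ * conjugate ζ ≈ 1#
    norm = [ (λ e → contradiction (≡.subst (λ m → Σ< m (λ k → (ζ * conjugate ζ) ^ k) ≈ 0#) p≡1+[p-1] e)
                      (norm-powers-nonzero ζ (p ∸ 1))) , id ]′ (geometric (ζ * conjugate ζ) norm^p)

  conjugate-E : ∀ x → conjugate (E x) ≈ E (ℤ.- x)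
  conjugate-E x = begin
    conjugate (ζ ^ r)          ≈⟨ conjugate-^ ζ r ⟩
    conjugate ζ ^ r            ≈⟨ ^-congˡ r conjugate-ζ ⟩
    E (ℤ.- 1ℤ) ^ r             ≈⟨ E-^ (ℤ.- 1ℤ) r ⟩
    E (+ r ℤ.* ℤ.- 1ℤ)         ≈⟨ E-cong (M.trans (M.*-congʳ {ℤ.- 1ℤ} (M.sym (%-≡ₚ x))) (M.solve 1 (λ x → x M.:* M.:- M.con 1ℤ M.:= M.:- x) M.refl x)) ⟩
    E (ℤ.- x)                  ∎
    where r = x ℤ.%ℕ p

  E-sum-generator : ∀ (u : ℤ) (uu : Unit u) → HasOrder u (p ∸ 1) → ∀ x → Unit x →
                    Σ< (p ∸ 1) (λ i → E (u M.^ i ℤ.* x)) ≈ - 1#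
  E-sum-generator u uu ord x ux = begin
    Σ< (p ∸ 1) (λ i → E (u M.^ i ℤ.* x))    ≈⟨ PrimitiveRoot.sum-over-units u uu ord ℂ-commutativeRing (λ c → E (c ℤ.* x)) (λ e → E-cong (M.*-congʳ e)) ⟩
    Σ< (p ∸ 1) (λ a → E (+ suc a ℤ.* x))    ≈⟨ solve 2 (λ s t → s := (t :+ s) :+ :- t) refl _ (E (0ℤ ℤ.* x)) ⟩
    Σ< (suc (p ∸ 1)) (λ a → E (+ a ℤ.* x)) + - E (0ℤ ℤ.* x)
                                            ≈⟨ +-cong (trans (reflexive (≡.cong (λ m → Σ< m (λ a → E (+ a ℤ.* x))) (≡.sym p≡1+[p-1]))) (E-sum-unit x ux)) (-‿cong (trans (E-cong (M.zeroˡ x)) E-0)) ⟩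
    0# + - 1#                               ≈⟨ +-identityˡ _ ⟩
    - 1#                                    ∎

  E-sum-generator-0 : ∀ u x → x ≡ₚ 0ℤ → Σ< (p ∸ 1) (λ i → E (u M.^ i ℤ.* x)) ≈ ι (+ (p ∸ 1))
  E-sum-generator-0 u x x≡0 = trans (Σ<-cong (p ∸ 1) (λ i _ → trans (E-cong (M.trans (M.*-congˡ {u M.^ i} x≡0) (M.zeroʳ (u M.^ i)))) E-0))
    (trans (Σ<-const (p ∸ 1) 1#) (*-identityʳ _))

-- Gaussian periods

private
  module ℕS = ℕ.+-*-Solver

%-≡⇒∣∸ : ∀ {x y n} .{{_ : NonZero n}} → x ℕ.% n ≡ y ℕ.% n → n ℕ.∣ x ∸ y
%-≡⇒∣∸ {x} {y} {n} e = ℕ.divides (x ℕ./ n ∸ y ℕ./ n) (begin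
  x ∸ y                                                       ≡⟨ ≡.cong₂ _∸_ (ℕ.m≡m%n+[m/n]*n x n) (ℕ.m≡m%n+[m/n]*n y n) ⟩
  (x ℕ.% n ℕ.+ x ℕ./ n ℕ.* n) ∸ (y ℕ.% n ℕ.+ y ℕ./ n ℕ.* n)   ≡⟨ ≡.cong (λ r → (r ℕ.+ x ℕ./ n ℕ.* n) ∸ (y ℕ.% n ℕ.+ y ℕ./ n ℕ.* n)) e ⟩
  (y ℕ.% n ℕ.+ x ℕ./ n ℕ.* n) ∸ (y ℕ.% n ℕ.+ y ℕ./ n ℕ.* n)   ≡⟨ ℕ.[m+n]∸[m+o]≡n∸o (y ℕ.% n) _ _ ⟩
  x ℕ./ n ℕ.* n ∸ y ℕ./ n ℕ.* n                               ≡⟨ ≡.sym (ℕ.*-distribʳ-∸ n (x ℕ./ n) (y ℕ./ n)) ⟩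
  (x ℕ./ n ∸ y ℕ./ n) ℕ.* n                                   ∎)
  where open ≡.≡-Reasoning

%-%-multiple : ∀ x m d n .{{_ : NonZero d}} .{{_ : NonZero n}} → n ≡ m ℕ.* d → x ℕ.% n ℕ.% d ≡ x ℕ.% d
%-%-multiple x m d n e = ≡.sym (begin
  x ℕ.% d                                    ≡⟨ ≡.cong (ℕ._% d) (ℕ.m≡m%n+[m/n]*n x n) ⟩
  (x ℕ.% n ℕ.+ x ℕ./ n ℕ.* n) ℕ.% d          ≡⟨ ≡.cong (λ k → (x ℕ.% n ℕ.+ x ℕ./ n ℕ.* k) ℕ.% d) e ⟩
  (x ℕ.% n ℕ.+ x ℕ./ n ℕ.* (m ℕ.* d)) ℕ.% d  ≡⟨ ≡.cong (λ k → (x ℕ.% n ℕ.+ k) ℕ.% d) (≡.sym (ℕ.*-assoc (x ℕ./ n) m d)) ⟩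
  (x ℕ.% n ℕ.+ x ℕ./ n ℕ.* m ℕ.* d) ℕ.% d    ≡⟨ ℕ.[m+kn]%n≡m%n (x ℕ.% n) (x ℕ./ n ℕ.* m) d ⟩
  x ℕ.% n ℕ.% d                              ∎)
  where open ≡.≡-Reasoning

module Periods (p : ℕ) (pr : Prime p) (ζ : ℂ) (primitiveζ : IsPrimitiveRootOfUnity p ζ)
               (u : ℤ) (uu : Congruence._≡ₚ_ p u 0ℤ → ⊥) (ord : Units.HasOrder p pr u (p ∸ 1)) where
  open Cyclotomic p pr ζ primitiveζ public
  open RingTheory ℂ-commutativeRing
  open RangeSums ℂ-commutativeRing
  private
    module M = ℤ/pR

  infixr 8 u^_
  u^_ : ℕ → ℤ
  u^ n = u M.^ n

  module _ (d m : ℕ) .{{_ : NonZero d}} .{{_ : NonZero m}} (md≡p-1 : m ℕ.* d ≡ p ∸ 1) where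

    η : ℕ → ℂ
    η k = Σ< m (λ j → E (u^ (k ℕ.+ j ℕ.* d)))

    u^-periodic : ∀ k → u^ (m ℕ.* d ℕ.+ k) ≡ₚ u^ k
    u^-periodic k = M.trans (M.^-homo-* u (m ℕ.* d) k)
      (M.trans (M.*-congʳ {u^ k} (M.trans (M.^-congʳ u md≡p-1) (proj₁ ord))) (M.*-identityˡ (u^ k)))

    u^-% : ∀ {x y} → u^ x ≡ₚ u^ y → x ℕ.% d ≡ y ℕ.% d
    u^-% {x} {y} e = ≡.trans (≡.sym (%-%-multiple x m d (p ∸ 1) (≡.sym md≡p-1)))
      (≡.trans (≡.cong (ℕ._% d) (order-%≡ {u} {p ∸ 1} uu ord {x} {y} e)) (%-%-multiple y m d (p ∸ 1) (≡.sym md≡p-1)))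

    -- A period is a sum over a coset of the group generated by u^d, and a cyclic sum may start
    -- anywhere.
    rotate : ∀ k i → η k ≈ Σ< m (λ j → E (u^ (k ℕ.+ (i ℕ.+ j) ℕ.* d)))
    rotate k i = sym (Σ<-rotate m (λ j → E (u^ (k ℕ.+ j ℕ.* d))) (λ j → E-cong (periodic j)) i)
      where
      index : ∀ j → k ℕ.+ (m ℕ.+ j) ℕ.* d ≡ m ℕ.* d ℕ.+ (k ℕ.+ j ℕ.* d)
      index j = ≡.trans (≡.cong (k ℕ.+_) (ℕ.*-distribʳ-+ d m j))
        (≡.trans (≡.sym (ℕ.+-assoc k (m ℕ.* d) (j ℕ.* d)))
          (≡.trans (≡.cong (ℕ._+ j ℕ.* d) (ℕ.+-comm k (m ℕ.* d))) (ℕ.+-assoc (m ℕ.* d) k (j ℕ.* d))))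
      periodic : ∀ j → u^ (k ℕ.+ (m ℕ.+ j) ℕ.* d) ≡ₚ u^ (k ℕ.+ j ℕ.* d)
      periodic j = M.trans (M.^-congʳ u (index j)) (u^-periodic (k ℕ.+ j ℕ.* d))

    conjugate-η : ∀ k → conjugate (η k) ≈ Σ< m (λ j → E (ℤ.- u^ (k ℕ.+ j ℕ.* d)))
    conjugate-η k = trans (conjugate-sum {m} (λ j → E (u^ (k ℕ.+ toℕ j ℕ.* d)))) (Σ<-cong m (λ j _ → conjugate-E (u^ (k ℕ.+ j ℕ.* d))))

    pairing : ℕ → ℕ → ℂ
    pairing a b = Σ< d (λ k → η (a ℕ.+ k) * conjugate (η (b ℕ.+ k)))

    private
      X : ℕ → ℕ → ℕ → ℤ
      X a b j = u^ (a ℕ.+ j ℕ.* d) ℤ.+ ℤ.- u^ b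

      split-+ : ∀ a k i j → a ℕ.+ k ℕ.+ (i ℕ.+ j) ℕ.* d ≡ k ℕ.+ i ℕ.* d ℕ.+ (a ℕ.+ j ℕ.* d)
      split-+ a k i j = ℕS.solve 5 (λ a k i j d → a ℕS.:+ k ℕS.:+ (i ℕS.:+ j) ℕS.:* d ℕS.:= k ℕS.:+ i ℕS.:* d ℕS.:+ (a ℕS.:+ j ℕS.:* d)) ≡.refl a k i j d

      exponent : ∀ a b k i j → u^ (a ℕ.+ k ℕ.+ (i ℕ.+ j) ℕ.* d) ℤ.+ ℤ.- u^ (b ℕ.+ k ℕ.+ i ℕ.* d) ≡ₚ u^ (k ℕ.+ i ℕ.* d) ℤ.* X a b j
      exponent a b k i j = M.trans
        (M.+-cong (M.trans (M.^-congʳ u (split-+ a k i j)) (M.^-homo-* u (k ℕ.+ i ℕ.* d) (a ℕ.+ j ℕ.* d)))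
          (M.-‿cong (M.trans (M.^-congʳ u (≡.trans (≡.trans (ℕ.+-assoc b k (i ℕ.* d)) (ℕ.+-comm b _)) ≡.refl)) (M.^-homo-* u (k ℕ.+ i ℕ.* d) b))))
        (M.solve 3 (λ x y z → x M.:* y M.:+ M.:- (x M.:* z) M.:= x M.:* (y M.:+ M.:- z)) M.refl (u^ (k ℕ.+ i ℕ.* d)) (u^ (a ℕ.+ j ℕ.* d)) (u^ b))

    -- Starting the first period at the index i of the second makes each exponent a multiple u^(k +
    -- i d) of `X a b j`. As k and i vary, k + i d runs once through the exponents below p - 1,
    -- which leaves one complete character sum for each j.
    pairing-expand : ∀ a b → pairing a b ≈ Σ< m (λ j → Σ< (p ∸ 1) (λ i → E (u^ i ℤ.* X a b j)))
    pairing-expand a b = begin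
      Σ< d (λ k → η (a ℕ.+ k) * conjugate (η (b ℕ.+ k)))
        ≈⟨ Σ<-cong d (λ k _ → expand k) ⟩
      Σ< d (λ k → Σ< m (λ i → Σ< m (λ j → E (u^ (k ℕ.+ i ℕ.* d) ℤ.* X a b j))))
        ≈⟨ ∑-comm {d} {m} (λ k i → Σ< m (λ j → E (u^ (toℕ k ℕ.+ toℕ i ℕ.* d) ℤ.* X a b j))) ⟩
      Σ< m (λ i → Σ< d (λ k → Σ< m (λ j → E (u^ (k ℕ.+ i ℕ.* d) ℤ.* X a b j))))
        ≈⟨ sym (Σ<-* m d (λ l → Σ< m (λ j → E (u^ l ℤ.* X a b j)))) ⟩
      Σ< (m ℕ.* d) (λ l → Σ< m (λ j → E (u^ l ℤ.* X a b j)))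
        ≈⟨ ∑-comm {m ℕ.* d} {m} (λ l j → E (u^ toℕ l ℤ.* X a b (toℕ j))) ⟩
      Σ< m (λ j → Σ< (m ℕ.* d) (λ l → E (u^ l ℤ.* X a b j)))
        ≡⟨ ≡.cong (λ n → Σ< m (λ j → Σ< n (λ l → E (u^ l ℤ.* X a b j)))) md≡p-1 ⟩
      Σ< m (λ j → Σ< (p ∸ 1) (λ i → E (u^ i ℤ.* X a b j))) ∎
      where
      expand : ∀ k → η (a ℕ.+ k) * conjugate (η (b ℕ.+ k)) ≈ Σ< m (λ i → Σ< m (λ j → E (u^ (k ℕ.+ i ℕ.* d) ℤ.* X a b j)))
      expand k = begin
        η (a ℕ.+ k) * conjugate (η (b ℕ.+ k))
          ≈⟨ *-congˡ {η (a ℕ.+ k)} (conjugate-η (b ℕ.+ k)) ⟩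
        η (a ℕ.+ k) * Σ< m (λ i → E (ℤ.- u^ (b ℕ.+ k ℕ.+ i ℕ.* d)))
          ≈⟨ *-distribˡ-sum {m} (η (a ℕ.+ k)) (λ i → E (ℤ.- u^ (b ℕ.+ k ℕ.+ toℕ i ℕ.* d))) ⟩
        Σ< m (λ i → η (a ℕ.+ k) * E (ℤ.- u^ (b ℕ.+ k ℕ.+ i ℕ.* d)))
          ≈⟨ Σ<-cong m (λ i _ → trans (*-congʳ {E (ℤ.- u^ (b ℕ.+ k ℕ.+ i ℕ.* d))} (rotate (a ℕ.+ k) i))
               (trans (*-distribʳ-sum {m} (E (ℤ.- u^ (b ℕ.+ k ℕ.+ i ℕ.* d))) (λ j → E (u^ (a ℕ.+ k ℕ.+ (i ℕ.+ toℕ j) ℕ.* d))))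
                 (Σ<-cong m λ j _ → trans (sym (E-+ (u^ (a ℕ.+ k ℕ.+ (i ℕ.+ j) ℕ.* d)) (ℤ.- u^ (b ℕ.+ k ℕ.+ i ℕ.* d)))) (E-cong (exponent a b k i j))))) ⟩
        Σ< m (λ i → Σ< m (λ j → E (u^ (k ℕ.+ i ℕ.* d) ℤ.* X a b j))) ∎

    pairing-off : ∀ a b → a ℕ.% d ≢ b ℕ.% d → pairing a b ≈ - ι (+ m)
    pairing-off a b a≢b = trans (pairing-expand a b) (trans (Σ<-cong m (λ j _ → E-sum-generator u uu ord (X a b j) (unit j)))
      (trans (Σ<-const m (- 1#)) (x*-1≈-x (ι (+ m)))))
      where
      unit : ∀ j → Unit (X a b j)
      unit j e = a≢b (≡.trans (≡.sym (ℕ.[m+kn]%n≡m%n a j d)) (u^-% {a ℕ.+ j ℕ.* d} {b} (M.x-y≈0⇒x≈y e)))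

    -- `X a a j` vanishes modulo p only for j = 0: one character sum equals p - 1 and the other m -
    -- 1 equal -1, in total p - m.
    pairing-diagonal : ∀ a → pairing a a ≈ ι (+ p) + - ι (+ m)
    pairing-diagonal a = trans (pairing-expand a a) (first m ≡.refl)
      where
      unit : ∀ j → suc j ℕ.< m → Unit (X a a (suc j))
      unit j j<m e = ℕ.<⇒≱ j<m (ℕ.∣⇒≤ (ℕ.*-cancelʳ-∣ {m} {suc j} d (≡.subst (ℕ._∣ suc j ℕ.* d) (≡.sym md≡p-1)
        (order-divides {u} {p ∸ 1} ord {suc j ℕ.* d} (unit-cancel {u^ a} {u^ (suc j ℕ.* d)} {1ℤ} (unit-^ a uu)
          (M.trans (M.sym (M.^-homo-* u a (suc j ℕ.* d))) (M.trans (M.x-y≈0⇒x≈y e) (M.sym (M.*-identityʳ (u^ a))))))))))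
      zero-term : X a a 0 ≡ₚ 0ℤ
      zero-term = M.trans (M.+-congʳ (M.^-congʳ u (ℕ.+-identityʳ a))) (M.x-x≈0 (u^ a))
      -- The number of terms is generalised so that it can be matched as a successor and the term j
      -- = 0 split off.
      first : ∀ n → n ≡ m → Σ< n (λ j → Σ< (p ∸ 1) (λ i → E (u^ i ℤ.* X a a j))) ≈ ι (+ p) + - ι (+ n)
      first zero    e = contradiction (≡.sym e) (ℕ.≢-nonZero⁻¹ m)
      first (suc n) ≡.refl = begin
        Σ< (suc n) (λ j → Σ< (p ∸ 1) (λ i → E (u^ i ℤ.* X a a j)))
          ≈⟨ +-cong (E-sum-generator-0 u (X a a 0) zero-term)
               (trans (Σ<-cong n (λ j j<n → E-sum-generator u uu ord (X a a (suc j)) (unit j (s≤s j<n)))) (trans (Σ<-const n (- 1#)) (x*-1≈-x (ι (+ n))))) ⟩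
        ι (+ (p ∸ 1)) + - ι (+ n)
          ≈⟨ solve 3 (λ o q n → q :+ :- n := (o :+ q) :+ :- (o :+ n)) refl 1# (ι (+ (p ∸ 1))) (ι (+ n)) ⟩
        (1# + ι (+ (p ∸ 1))) + - (1# + ι (+ n))
          ≈⟨ +-congʳ (reflexive (≡.cong (λ k → ι (+ k)) (≡.sym p≡1+[p-1]))) ⟩
        ι (+ p) + - ι (+ suc n) ∎

    -- If the shifted sequences agreed, the diagonal and the off-diagonal value of the pairing would
    -- coincide, which makes p equal to 0 in ℂ.
    η-distinct : ∀ {a b} → (∀ k → η (a ℕ.+ k) ≈ η (b ℕ.+ k)) → a ℕ.% d ≡ b ℕ.% d
    η-distinct {a} {b} h with a ℕ.% d ℕ.≟ b ℕ.% d
    ... | yes e = e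
    ... | no ne = contradiction (begin
      ι (+ p)                            ≈⟨ solve 2 (λ p m → p := (p :+ :- m) :+ m) refl (ι (+ p)) (ι (+ m)) ⟩
      ι (+ p) + - ι (+ m) + ι (+ m)      ≈⟨ +-congʳ (trans (sym (pairing-diagonal a)) (trans
                                              (Σ<-cong d (λ k _ → *-congˡ {η (a ℕ.+ k)} (conjugate-cong (h k)))) (pairing-off a b ne))) ⟩
      - ι (+ m) + ι (+ m)                ≈⟨ -‿inverseˡ (ι (+ m)) ⟩
      0#                                 ∎) (ℂ-nonzero p)

    η-periodic : ∀ k → η (d ℕ.+ k) ≈ η k
    η-periodic k = sym (trans (rotate k 1) (Σ<-cong m (λ j _ → E-cong (M.^-congʳ u (index j)))))
      where
      index : ∀ j → k ℕ.+ (d ℕ.+ j ℕ.* d) ≡ d ℕ.+ k ℕ.+ j ℕ.* d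
      index j = ≡.trans (≡.sym (ℕ.+-assoc k d (j ℕ.* d))) (≡.cong (ℕ._+ j ℕ.* d) (ℕ.+-comm k d))

    ι-p-md : ι (+ p) ≈ 1# + ι (+ d) * ι (+ m)
    ι-p-md = begin
      ι (+ p)                            ≡⟨ ≡.cong (λ k → ι (+ k)) p≡1+[p-1] ⟩
      1# + ι (+ (p ∸ 1))                 ≡⟨ ≡.cong (λ k → 1# + ι (+ k)) (≡.trans (≡.sym md≡p-1) (ℕ.*-comm m d)) ⟩
      1# + ι (+ (d ℕ.* m))               ≈⟨ +-congˡ (trans (reflexive (≡.cong ι (ℤ.pos-* d m))) (ι-homo-* (+ d) (+ m))) ⟩
      1# + ι (+ d) * ι (+ m)             ∎

    -- Pairing the relation with the period b gives p c_b = m Σ c; summing over b and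
    -- using p = 1 + d m shows Σ c = 0.
    η-independent : (c : Fin d → ℂ) → (∀ k → sum (λ a → c a * η (toℕ a ℕ.+ k)) ≈ 0#) → ∀ a → c a ≈ 0#
    η-independent c h b = ℂ-cancel p (trans (relation b) (trans (*-congˡ {ι (+ m)} C≈0) (zeroʳ (ι (+ m)))))
      where
      C : ℂ
      C = sum c
      relation : ∀ b → ι (+ p) * c b ≈ ι (+ m) * C
      relation b = x-y≈0⇒x≈y (begin
        ι (+ p) * c b + - (ι (+ m) * C)
          ≈⟨ +-cong (sym (trans (sum-single b (λ a → δ a * (ι (+ p) * c a)) off) (diag b))) (trans (-‿distribˡ-* (ι (+ m)) C) (*-distribˡ-sum {d} (- ι (+ m)) c)) ⟩
        sum (λ a → δ a * (ι (+ p) * c a)) + sum (λ a → - ι (+ m) * c a)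
          ≈⟨ sym (∑-distrib-+ {d} (λ a → δ a * (ι (+ p) * c a)) (λ a → - ι (+ m) * c a)) ⟩
        sum (λ a → δ a * (ι (+ p) * c a) + - ι (+ m) * c a)
          ≈⟨ sum-cong-≋ {d} (λ a → term a) ⟩
        sum (λ a → c a * pairing (toℕ a) (toℕ b))
          ≈⟨ sum-cong-≋ {d} (λ a → trans (*-distribˡ-sum {d} (c a) (λ k → η (toℕ a ℕ.+ toℕ k) * conjugate (η (toℕ b ℕ.+ toℕ k))))
               (sum-cong-≋ {d} (λ k → sym (*-assoc (c a) (η (toℕ a ℕ.+ toℕ k)) (conjugate (η (toℕ b ℕ.+ toℕ k))))))) ⟩
        sum (λ a → sum {d} (λ k → c a * η (toℕ a ℕ.+ toℕ k) * conjugate (η (toℕ b ℕ.+ toℕ k))))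
          ≈⟨ ∑-comm {d} {d} (λ a k → c a * η (toℕ a ℕ.+ toℕ k) * conjugate (η (toℕ b ℕ.+ toℕ k))) ⟩
        sum {d} (λ k → sum (λ a → c a * η (toℕ a ℕ.+ toℕ k) * conjugate (η (toℕ b ℕ.+ toℕ k))))
          ≈⟨ sum-zero {d} _ (λ k → trans (sym (*-distribʳ-sum {d} (conjugate (η (toℕ b ℕ.+ toℕ k))) (λ a → c a * η (toℕ a ℕ.+ toℕ k))))
               (trans (*-congʳ {conjugate (η (toℕ b ℕ.+ toℕ k))} (h (toℕ k))) (zeroˡ (conjugate (η (toℕ b ℕ.+ toℕ k)))))) ⟩
        0# ∎)
        where
        δ : Fin d → ℂ
        δ a with a Fin.≟ b
        ... | yes _ = 1#
        ... | no  _ = 0#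
        diag : ∀ a → δ b * (ι (+ p) * c a) ≈ ι (+ p) * c a
        diag a with b Fin.≟ b
        ... | yes _  = *-identityˡ (ι (+ p) * c a)
        ... | no b≢b = contradiction ≡.refl b≢b
        off : ∀ a → a ≢ b → δ a * (ι (+ p) * c a) ≈ 0#
        off a a≢b with a Fin.≟ b
        ... | yes a≡b = contradiction a≡b a≢b
        ... | no  _   = zeroˡ (ι (+ p) * c a)
        term : ∀ a → δ a * (ι (+ p) * c a) + - ι (+ m) * c a ≈ c a * pairing (toℕ a) (toℕ b)
        term a with a Fin.≟ b
        ... | yes ≡.refl = trans (+-congʳ (*-identityˡ _)) (trans (solve 3 (λ p m c → p :* c :+ :- m :* c := c :* (p :+ :- m)) refl (ι (+ p)) (ι (+ m)) (c a))
                             (*-congˡ {c a} (sym (pairing-diagonal (toℕ a)))))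
        ... | no  a≢b    = trans (solve 3 (λ p m c → con 0ℤ :* (p :* c) :+ :- m :* c := c :* :- m) refl (ι (+ p)) (ι (+ m)) (c a))
                             (*-congˡ {c a} (sym (pairing-off (toℕ a) (toℕ b) (λ e → a≢b (Fin.toℕ-injective
                               (≡.trans (≡.sym (ℕ.m<n⇒m%n≡m (Fin.toℕ<n a))) (≡.trans e (ℕ.m<n⇒m%n≡m (Fin.toℕ<n b)))))))))
      C≈0 : C ≈ 0#
      C≈0 = begin
        C                                          ≈⟨ solve 3 (λ C d m → C := (con 1ℤ :+ d :* m) :* C :+ :- (d :* (m :* C))) refl C (ι (+ d)) (ι (+ m)) ⟩
        (ι 1ℤ + ι (+ d) * ι (+ m)) * C + - (ι (+ d) * (ι (+ m) * C))
          ≈⟨ +-cong (*-congʳ {C} (trans (+-congʳ ι-1) (sym ι-p-md))) (-‿cong (sym (Σ<-const d (ι (+ m) * C)))) ⟩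
        ι (+ p) * C + - Σ< d (λ _ → ι (+ m) * C)    ≈⟨ +-cong (*-distribˡ-sum {d} (ι (+ p)) c) (-‿cong (sum-cong-≋ {d} (λ a → sym (relation a)))) ⟩
        sum (λ a → ι (+ p) * c a) + - sum (λ a → ι (+ p) * c a)  ≈⟨ x-x≈0 _ ⟩
        0#                                         ∎

    module _ (h m′ : ℕ) (d≡2h : d ≡ h ℕ.+ h) (m≡1+2m′ : m ≡ suc (m′ ℕ.+ m′)) where
      private
        -- Half of p - 1: with m = 1 + 2m′ and d = 2h, m d / 2 = h + m′ d. Its residue modulo d is
        -- h, which is how the parity of m enters.
        hm : ℕ
        hm = h ℕ.+ m′ ℕ.* d

        hm+hm : hm ℕ.+ hm ≡ p ∸ 1
        hm+hm = ≡.trans (ℕS.solve 3 (λ h m′ d → h ℕS.:+ m′ ℕS.:* d ℕS.:+ (h ℕS.:+ m′ ℕS.:* d) ℕS.:= (h ℕS.:+ h) ℕS.:+ (m′ ℕS.:+ m′) ℕS.:* d) ≡.refl h m′ d)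
          (≡.trans (≡.cong (ℕ._+ (m′ ℕ.+ m′) ℕ.* d) (≡.sym d≡2h)) (≡.trans (≡.cong (ℕ._* d) (≡.sym m≡1+2m′)) md≡p-1))

        0<h : 0 ℕ.< h
        0<h = positive h d≡2h
          where
          positive : ∀ h → d ≡ h ℕ.+ h → 0 ℕ.< h
          positive zero    e = contradiction e (ℕ.≢-nonZero⁻¹ d)
          positive (suc h) e = s≤s z≤n

        0<hm : 0 ℕ.< hm
        0<hm = ℕ.<-≤-trans 0<h (ℕ.m≤m+n h _)

        -1≡u^hm : ℤ.- 1ℤ ≡ₚ u^ hm
        -1≡u^hm = M.sym ([ (λ e → contradiction (M.x-y≈0⇒x≈y {u^ hm} {1ℤ} e) (proj₂ ord hm 0<hm hm<p-1)) , (λ e → M.x+y≈0⇒x≈-y {u^ hm} {1ℤ} e) ]′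
          (zero-divisor (u^ hm ℤ.+ ℤ.- 1ℤ) (u^ hm ℤ.+ 1ℤ)
            (M.trans (M.solve 1 (λ x → (x M.:+ M.:- M.con 1ℤ) M.:* (x M.:+ M.con 1ℤ) M.:= x M.:* x M.:+ M.:- M.con 1ℤ) M.refl (u^ hm))
              (M.x≈y⇒x-y≈0 (M.trans (M.sym (M.^-homo-* u hm hm)) (M.trans (M.^-congʳ u hm+hm) (proj₁ ord)))))))
          where
          hm<p-1 : hm ℕ.< p ∸ 1
          hm<p-1 = ≡.subst (hm ℕ.<_) hm+hm (ℕ.<-≤-trans (ℕ.n<1+n hm) (ℕ.+-monoˡ-≤ hm 0<hm))

      -- Negation is multiplication by u^hm. The part h of the exponent shifts the coset, and the
      -- part m′ d only moves the starting point inside it, which `rotate` absorbs.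
      conjugate-period : ∀ k → conjugate (η k) ≈ η (k ℕ.+ h)
      conjugate-period k = trans (conjugate-η k) (trans (Σ<-cong m (λ j _ → E-cong (negate j))) (sym (rotate (k ℕ.+ h) m′)))
        where
        negate : ∀ j → ℤ.- u^ (k ℕ.+ j ℕ.* d) ≡ₚ u^ (k ℕ.+ h ℕ.+ (m′ ℕ.+ j) ℕ.* d)
        negate j = M.trans (M.solve 1 (λ x → M.:- x M.:= M.:- M.con 1ℤ M.:* x) M.refl (u^ (k ℕ.+ j ℕ.* d)))
          (M.trans (M.*-congʳ {u^ (k ℕ.+ j ℕ.* d)} -1≡u^hm) (M.trans (M.sym (M.^-homo-* u hm (k ℕ.+ j ℕ.* d)))
            (M.^-congʳ u (ℕS.solve 5 (λ h m′ d k j → h ℕS.:+ m′ ℕS.:* d ℕS.:+ (k ℕS.:+ j ℕS.:* d) ℕS.:= k ℕS.:+ h ℕS.:+ (m′ ℕS.:+ j) ℕS.:* d) ≡.refl h m′ d k j))))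

      -- Otherwise the shift by h would fix the sequence of periods and d = 2h would divide h,
      -- although 0 < h < d.
      η-not-real : ∀ k → ¬ (∀ j → conjugate (η (k ℕ.+ j)) ≈ η (k ℕ.+ j))
      η-not-real k real = ℕ.<⇒≱ h<d (ℕ.∣⇒≤ {{ℕ.>-nonZero 0<h}} (≡.subst (d ℕ.∣_) (ℕ.m+n∸m≡n k h)
        (%-≡⇒∣∸ {k ℕ.+ h} {k} (η-distinct (λ j → trans (reflexive (≡.cong η (index j))) (trans (sym (conjugate-period (k ℕ.+ j))) (real j)))))))
        where
        h<d : h ℕ.< d
        h<d = ≡.subst (h ℕ.<_) (≡.sym d≡2h) (ℕ.<-≤-trans (ℕ.n<1+n h) (ℕ.+-monoˡ-≤ h 0<h))
        index : ∀ j → k ℕ.+ h ℕ.+ j ≡ k ℕ.+ j ℕ.+ h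
        index j = ≡.trans (ℕ.+-assoc k h j) (≡.trans (≡.cong (k ℕ.+_) (ℕ.+-comm h j)) (≡.sym (ℕ.+-assoc k j h)))

-- Spans

-- The coefficients are left abstract because both cases occur: rational spans for dimensions,
-- integral spans for integrality.
module Spans {C : Set} (κ : C → ℂ) (zeroC oneC : C) (_⊕_ _⊗_ : C → C → C)
             (κ-0 : κ zeroC ≈ᶜ 0ᶜ) (κ-1 : κ oneC ≈ᶜ 1ᶜ)
             (κ-+ : ∀ a b → κ (a ⊕ b) ≈ᶜ (κ a +ᶜ κ b)) (κ-* : ∀ a b → κ (a ⊗ b) ≈ᶜ (κ a *ᶜ κ b)) where
  open RingTheory ℂ-commutativeRing

  Span : ∀ {n} → (Fin n → ℂ) → ℂ → Set
  Span {n} b x = ∃ λ (c : Fin n → C) → x ≈ sum (λ i → κ (c i) * b i)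

  module _ {n} {b : Fin n → ℂ} where

    span-resp : ∀ {x y} → x ≈ y → Span b x → Span b y
    span-resp e (c , h) = c , trans (sym e) h

    span-0 : Span b 0#
    span-0 = (λ _ → zeroC) , sym (sum-zero {n} _ (λ i → trans (*-congʳ κ-0) (zeroˡ (b i))))

    span-+ : ∀ {x y} → Span b x → Span b y → Span b (x + y)
    span-+ {x} {y} (c , h) (d , k) = (λ i → c i ⊕ d i) , (begin
      x + y                                                  ≈⟨ +-cong h k ⟩
      sum (λ i → κ (c i) * b i) + sum (λ i → κ (d i) * b i)  ≈⟨ sym (∑-distrib-+ {n} (λ i → κ (c i) * b i) (λ i → κ (d i) * b i)) ⟩
      sum (λ i → κ (c i) * b i + κ (d i) * b i)
        ≈⟨ sum-cong-≋ {n} (λ i → trans (sym (distribʳ (b i) (κ (c i)) (κ (d i)))) (*-congʳ (sym (κ-+ (c i) (d i))))) ⟩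
      sum (λ i → κ (c i ⊕ d i) * b i)                        ∎)

    span-scale : ∀ a {x} → Span b x → Span b (κ a * x)
    span-scale a {x} (c , h) = (λ i → a ⊗ c i) , (begin
      κ a * x                              ≈⟨ *-congˡ {κ a} h ⟩
      κ a * sum (λ i → κ (c i) * b i)      ≈⟨ *-distribˡ-sum {n} (κ a) (λ i → κ (c i) * b i) ⟩
      sum (λ i → κ a * (κ (c i) * b i))
        ≈⟨ sum-cong-≋ {n} (λ i → trans (sym (*-assoc (κ a) (κ (c i)) (b i))) (*-congʳ (sym (κ-* a (c i))))) ⟩
      sum (λ i → κ (a ⊗ c i) * b i)        ∎)

    span-sum : ∀ {m} (f : Fin m → ℂ) → (∀ i → Span b (f i)) → Span b (sum f)
    span-sum {zero}  f h = span-0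
    span-sum {suc m} f h = span-+ (h zero) (span-sum (f ∘ suc) (h ∘ suc))

    span-combination : ∀ {m} (a : Fin m → C) (f : Fin m → ℂ) → (∀ i → Span b (f i)) → Span b (sum (λ i → κ (a i) * f i))
    span-combination a f h = span-sum (λ i → κ (a i) * f i) (λ i → span-scale (a i) (h i))

    span-basis : ∀ i → Span b (b i)
    span-basis i = indicator , sym (trans (sum-single i (λ j → κ (indicator j) * b j) off) on)
      where
      indicator : Fin n → C
      indicator j with j Fin.≟ i
      ... | yes _ = oneC
      ... | no  _ = zeroC
      off : ∀ j → j ≢ i → κ (indicator j) * b j ≈ 0#
      off j j≢i with j Fin.≟ i
      ... | yes j≡i = contradiction j≡i j≢i
      ... | no  _   = trans (*-congʳ κ-0) (zeroˡ (b j))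
      on : κ (indicator i) * b i ≈ b i
      on with i Fin.≟ i
      ... | yes _   = trans (*-congʳ κ-1) (*-identityˡ (b i))
      ... | no  i≢i = contradiction ≡.refl i≢i

  span-* : ∀ {m n k} {b : Fin m → ℂ} {d : Fin n → ℂ} {e : Fin k → ℂ} → (∀ i j → Span e (b i * d j)) →
           ∀ {x y} → Span b x → Span d y → Span e (x * y)
  span-* {m} {n} {b = b} {d} {e} h {x} {y} (c , hx) (c′ , hy) =
    span-resp (sym (trans (*-congʳ {y} hx) (trans (*-distribʳ-sum {m} y (λ i → κ (c i) * b i))
        (sum-cong-≋ {m} (λ i → *-assoc (κ (c i)) (b i) y)))))
      (span-combination c (λ i → b i * y) λ i →
        span-resp (sym (trans (*-congˡ {b i} hy) (trans (*-distribˡ-sum {n} (b i) (λ j → κ (c′ j) * d j))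
            (sum-cong-≋ {n} (λ j → solve 3 (λ b k d → b :* (k :* d) := k :* (b :* d)) refl (b i) (κ (c′ j)) (d j))))))
          (span-combination c′ (λ j → b i * d j) (h i)))

module ℚSpan = Spans ℚ→ℂ 0ℚ 1ℚ ℚ._+_ ℚ._*_ ℂR.refl ℂR.refl ℚ→ℂ-+ ℚ→ℂ-*
module ℤSpan = Spans ℂR.ι 0ℤ 1ℤ ℤ._+_ ℤ._*_ ℂR.refl ℂR.ι-1 ℂR.ι-homo-+ ℂR.ι-homo-*

-- Homomorphisms

module Homomorphisms (K : Subfield) where
  open Subfield K using (Element; rawRing; Member)
  open RingTheory ℂ-commutativeRing hiding (rawRing)
  private
    module K = RawRing rawRing
  open RingMorphisms rawRing ℂ-rawRing using (IsRingHomomorphism; IsRingMonomorphism)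

  record Hom (f : Element → ℂ) : Set where
    field
      cong   : ∀ {x y} → proj₁ x ≈ proj₁ y → f x ≈ f y
      homo-+ : ∀ x y → f (x K.+ y) ≈ f x + f y
      homo-* : ∀ x y → f (x K.* y) ≈ f x * f y
      homo-- : ∀ x → f (K.- x) ≈ - f x
      homo-0 : f K.0# ≈ 0#
      homo-1 : f K.1# ≈ 1#

  toHom : ∀ {f} → IsRingHomomorphism f → Hom f
  toHom h = record
    { cong = H.⟦⟧-cong ; homo-+ = H.+-homo ; homo-* = H.*-homo ; homo-- = H.-‿homo ; homo-0 = H.0#-homo ; homo-1 = H.1#-homo }
    where module H = IsRingHomomorphism h

  embedding⇒Hom : ∀ {f} → IsEmbedding K f → Hom f
  embedding⇒Hom h = toHom (IsRingMonomorphism.isRingHomomorphism h)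

  toEmbedding : ∀ {f} → Hom f → (∀ {x y} → f x ≈ f y → proj₁ x ≈ proj₁ y) → IsEmbedding K f
  toEmbedding h inj = record
    { isRingHomomorphism = record
      { isSemiringHomomorphism = record
        { isNearSemiringHomomorphism = record
          { +-isMonoidHomomorphism = record
            { isMagmaHomomorphism = record { isRelHomomorphism = record { cong = cong } ; homo = homo-+ }
            ; ε-homo = homo-0
            }
          ; *-homo = homo-*
          }
        ; 1#-homo = homo-1
        }
      ; -‿homo = homo--
      }
    ; injective = inj
    }
    where open Hom h

  naturalElement : ∀ n → Member (ι (+ n))
  naturalElement zero    = Subfield.0∈ K
  naturalElement (suc n) = Subfield.+∈ K (Subfield.1∈ K) (naturalElement n)

  integerElement : ∀ z → Member (ι z)
  integerElement (+ n)    = naturalElement n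
  integerElement -[1+ n ] = Subfield.-∈ K (naturalElement (suc n))

  rational-fraction : ∀ q → ι (+ ℚ.↧ₙ q) * ℚ→ℂ q ≈ ι (ℚ.↥ q)
  rational-fraction q@(ℚ.mkℚ z d _) = trans (*-congʳ (sym (ℚ→ℂ-ι (+ suc d)))) (trans (sym (ℚ→ℂ-* (ιℚ (+ suc d)) q))
    (trans (ℚ→ℂ-cong (≡.trans (ℚ.*-comm (ιℚ (+ suc d)) q) (≡.trans (≡.cong (ℚ._* ιℚ (+ suc d)) (≡.sym (ℚ.↥p/↧p≡p q))) (/-ι z d)))) (ℚ→ℂ-ι z)))

  rationalElement : ∀ q → Member (ℚ→ℂ q)
  rationalElement q@(ℚ.mkℚ z d _) = Subfield.resp K
    (begin
      ι z * v                              ≈⟨ *-congʳ (sym (rational-fraction q)) ⟩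
      ι (+ suc d) * ℚ→ℂ q * v              ≈⟨ solve 3 (λ n q v → n :* q :* v := v :* n :* q) refl (ι (+ suc d)) (ℚ→ℂ q) v ⟩
      v * ι (+ suc d) * ℚ→ℂ q              ≈⟨ *-congʳ (proj₂ (ℂ-invertible (suc d))) ⟩
      1# * ℚ→ℂ q                           ≈⟨ *-identityˡ _ ⟩
      ℚ→ℂ q                                ∎)
    (Subfield.*∈ K (integerElement z) (Subfield.inv∈ K (naturalElement (suc d)) (trans (*-comm (ι (+ suc d)) v) (proj₂ (ℂ-invertible (suc d))))))
    where
    v = proj₁ (ℂ-invertible (suc d))

  module _ {f : Element → ℂ} (h : Hom f) where
    open Hom h

    hom-natural : ∀ n → f (ι (+ n) , naturalElement n) ≈ ι (+ n)
    hom-natural zero    = homo-0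
    hom-natural (suc n) = trans (homo-+ K.1# (ι (+ n) , naturalElement n)) (+-cong homo-1 (hom-natural n))

    hom-integer : ∀ z → f (ι z , integerElement z) ≈ ι z
    hom-integer (+ n)    = hom-natural n
    hom-integer -[1+ n ] = trans (homo-- (ι (+ suc n) , naturalElement (suc n))) (-‿cong (hom-natural (suc n)))

    hom-rational : ∀ q → f (ℚ→ℂ q , rationalElement q) ≈ ℚ→ℂ q
    hom-rational q@(ℚ.mkℚ z d _) = x-y≈0⇒x≈y (ℂ-cancel (suc d) (begin
      n * (f q′ + - ℚ→ℂ q)                 ≈⟨ solve 3 (λ n a b → n :* (a :+ :- b) := n :* a :+ :- (n :* b)) refl n (f q′) (ℚ→ℂ q) ⟩
      n * f q′ + - (n * ℚ→ℂ q)             ≈⟨ +-cong (trans (*-congʳ {f q′} (sym (hom-natural (suc d)))) (trans (sym (homo-* (n , naturalElement (suc d)) q′))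
                                                (trans (cong {y = ι z , integerElement z} (rational-fraction q)) (hom-integer z)))) (-‿cong (rational-fraction q)) ⟩
      ι z + - ι z                          ≈⟨ x-x≈0 (ι z) ⟩
      0#                                   ∎))
      where
      n = ι (+ suc d)
      q′ : Element
      q′ = ℚ→ℂ q , rationalElement q

  linear : ∀ {n} (c : Fin n → ℚ) (e : Fin n → Element) → Member (sum (λ i → ℚ→ℂ (c i) * proj₁ (e i)))
  linear {zero}  c e = Subfield.0∈ K
  linear {suc n} c e = Subfield.+∈ K (Subfield.*∈ K (rationalElement (c zero)) (proj₂ (e zero))) (linear (c ∘ suc) (e ∘ suc))

  hom-linear : ∀ {f} → Hom f → ∀ {n} (c : Fin n → ℚ) (e : Fin n → Element) x → proj₁ x ≈ sum (λ i → ℚ→ℂ (c i) * proj₁ (e i)) →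
               f x ≈ sum (λ i → ℚ→ℂ (c i) * f (e i))
  hom-linear {f} h {n} c e x x≈ = trans (Hom.cong h {x} {_ , linear c e} x≈) (expand c e)
    where
    expand : ∀ {n} (c : Fin n → ℚ) (e : Fin n → Element) → f (_ , linear c e) ≈ sum (λ i → ℚ→ℂ (c i) * f (e i))
    expand {zero}  c e = Hom.homo-0 h
    expand {suc n} c e = trans (Hom.homo-+ h (_ , Subfield.*∈ K (rationalElement (c zero)) (proj₂ (e zero))) (_ , linear (c ∘ suc) (e ∘ suc)))
      (+-cong (trans (Hom.homo-* h (_ , rationalElement (c zero)) (e zero)) (*-congʳ {f (e zero)} (hom-rational h (c zero)))) (expand (c ∘ suc) (e ∘ suc)))

module _ {z : ℂ} where
  open Homomorphisms ℚ⟨ z ⟩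
  open RingTheory ℂ-commutativeRing

  inverse-unique : ∀ {x y y′} → x * y ≈ 1# → x * y′ ≈ 1# → y ≈ y′
  inverse-unique {x} {y} {y′} xy xy′ = begin
    y             ≈⟨ sym (*-identityʳ y) ⟩
    y * 1#        ≈⟨ *-congˡ {y} (sym xy′) ⟩
    y * (x * y′)  ≈⟨ solve 3 (λ x y y′ → y :* (x :* y′) := x :* y :* y′) refl x y y′ ⟩
    x * y * y′    ≈⟨ *-congʳ xy ⟩
    1# * y′       ≈⟨ *-identityˡ y′ ⟩
    y′            ∎

  -- Induction on the derivation that x is generated by z; the case of an inverse uses that inverses
  -- in ℂ are unique.
  hom-extensional : ∀ {f g} → Hom f → Hom g → f (generator z) ≈ g (generator z) → ∀ x → f x ≈ g x
  hom-extensional {f} {g} hf hg base (x , gx) = go gx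
    where
    module F = Hom hf
    module G = Hom hg
    go : ∀ {x} (gx : Generated z x) → f (x , gx) ≈ g (x , gx)
    go gen              = base
    go (resp e gx)      = trans (F.cong (sym e)) (trans (go gx) (G.cong e))
    go 0∈               = trans F.homo-0 (sym G.homo-0)
    go 1∈               = trans F.homo-1 (sym G.homo-1)
    go (+∈ gx gy)       = trans (F.homo-+ (_ , gx) (_ , gy)) (trans (+-cong (go gx) (go gy)) (sym (G.homo-+ (_ , gx) (_ , gy))))
    go (*∈ gx gy)       = trans (F.homo-* (_ , gx) (_ , gy)) (trans (*-cong (go gx) (go gy)) (sym (G.homo-* (_ , gx) (_ , gy))))
    go (-∈ gx)          = trans (F.homo-- (_ , gx)) (trans (-‿cong (go gx)) (sym (G.homo-- (_ , gx))))
    go (inv∈ {x} {y} gx xy) = inverse-unique {f (x , gx)}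
      (trans (sym (F.homo-* (x , gx) (y , inv∈ gx xy))) (trans (F.cong {y = _ , 1∈} xy) F.homo-1))
      (trans (*-congʳ (go gx)) (trans (sym (G.homo-* (x , gx) (y , inv∈ gx xy))) (trans (G.cong {y = _ , 1∈} xy) G.homo-1)))

-- The field ℚ(ζ)

module CyclotomicField (p : ℕ) (pr : Prime p) (ζ : ℂ) (primitiveζ : IsPrimitiveRootOfUnity p ζ) where
  open Cyclotomic p pr ζ primitiveζ
  open RingTheory ℂ-commutativeRing
  open ℚSpan
  open Homomorphisms ℚ⟨ ζ ⟩
  private
    module M = ℤ/pR

  roots : Fin p → ℂ
  roots i = E (+ toℕ i)

  index : ℤ → Fin p
  index z = Fin.fromℕ< (ℤ.n%ℕd<d z p)

  E-index : ∀ z → E z ≈ roots (index z)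
  E-index z = E-cong (M.trans (%-≡ₚ z) (M.reflexive (≡.cong +_ (≡.sym (Fin.toℕ-fromℕ< (ℤ.n%ℕd<d z p))))))

  E∈span : ∀ z → Span roots (E z)
  E∈span z = span-resp (sym (E-index z)) (span-basis (index z))

  roots-* : ∀ i j → Span roots (roots i * roots j)
  roots-* i j = span-resp (E-+ (+ toℕ i) (+ toℕ j)) (E∈span (+ toℕ i ℤ.+ + toℕ j))

  -- A linear dependence among the powers of x, divided by its lowest power of x,
  -- expresses the inverse of x as a polynomial in x.
  inverse∈span : ∀ {x y} → Span roots x → x * y ≈ 1# → Span roots y
  inverse∈span {x} {y} hx xy = extract c (proj₁ (proj₂ dependence)) relation
    where
    power : ∀ k → Span roots (x ^ k)
    power zero    = span-resp E-0 (E∈span 0ℤ)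
    power (suc k) = span-* roots-* hx (power k)
    A : Fin (suc p) → Fin p → ℚ
    A k = proj₁ (power (toℕ k))
    dependence = kernel (ℕ.n<1+n p) A
    c = proj₁ dependence
    relation : sum (λ k → ℚ→ℂ (c k) * x ^ toℕ k) ≈ 0#
    relation = begin
      sum (λ k → ℚ→ℂ (c k) * x ^ toℕ k)
        ≈⟨ sum-cong-≋ {suc p} (λ k → trans (*-congˡ {ℚ→ℂ (c k)} (proj₂ (power (toℕ k)))) (trans (*-distribˡ-sum {p} (ℚ→ℂ (c k)) (λ j → ℚ→ℂ (A k j) * roots j))
             (sum-cong-≋ {p} (λ j → trans (sym (*-assoc (ℚ→ℂ (c k)) (ℚ→ℂ (A k j)) (roots j))) (*-congʳ (sym (ℚ→ℂ-* (c k) (A k j)))))))) ⟩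
      sum {suc p} (λ k → sum {p} (λ j → ℚ→ℂ (c k ℚ.* A k j) * roots j))
        ≈⟨ ∑-comm {suc p} {p} (λ k j → ℚ→ℂ (c k ℚ.* A k j) * roots j) ⟩
      sum {p} (λ j → sum {suc p} (λ k → ℚ→ℂ (c k ℚ.* A k j) * roots j))
        ≈⟨ sum-zero {p} _ (λ j → trans (sym (*-distribʳ-sum {suc p} (roots j) (λ k → ℚ→ℂ (c k ℚ.* A k j))))
             (trans (*-congʳ {roots j} (trans (sym (ℚ→ℂ-sum {suc p} (λ k → c k ℚ.* A k j))) (ℚ→ℂ-cong (proj₂ (proj₂ dependence) j)))) (zeroˡ (roots j)))) ⟩
      0# ∎
    extract : ∀ {n} (c : Fin n → ℚ) → (∃ λ i → c i ≢ 0ℚ) → sum (λ k → ℚ→ℂ (c k) * x ^ toℕ k) ≈ 0# → Span roots y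
    extract {suc n} c nonzero rel = decide (c zero ℚ.≟ 0ℚ)
      where
      Q : ℂ
      Q = sum (λ k → ℚ→ℂ (c (suc k)) * x ^ toℕ k)
      tail≈ : sum (λ k → ℚ→ℂ (c (suc k)) * x ^ suc (toℕ k)) ≈ x * Q
      tail≈ = trans (sum-cong-≋ {n} (λ k → solve 3 (λ c x t → c :* (x :* t) := x :* (c :* t)) refl (ℚ→ℂ (c (suc k))) x (x ^ toℕ k)))
        (sym (*-distribˡ-sum {n} x (λ k → ℚ→ℂ (c (suc k)) * x ^ toℕ k)))
      split : ℚ→ℂ (c zero) + x * Q ≈ 0#
      split = trans (+-cong (sym (*-identityʳ _)) (sym tail≈)) rel
      yxQ : Q ≈ y * (x * Q)
      yxQ = sym (trans (solve 3 (λ x y q → y :* (x :* q) := x :* y :* q) refl x y Q) (trans (*-congʳ {Q} xy) (*-identityˡ Q)))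
      decide : Dec (c zero ≡ 0ℚ) → Span roots y
      decide (yes c₀≡0) = extract (c ∘ suc) nonzero′ (trans yxQ (trans (*-congˡ {y} (trans (sym (+-identityˡ (x * Q)))
          (trans (+-congʳ (sym (ℚ→ℂ-cong c₀≡0))) split))) (zeroʳ y)))
        where
        shift : (∃ λ i → c i ≢ 0ℚ) → ∃ λ i → c (suc i) ≢ 0ℚ
        shift (zero  , c≢0) = contradiction c₀≡0 c≢0
        shift (suc i , c≢0) = i , c≢0
        nonzero′ = shift nonzero
      decide (no c₀≢0) = span-resp y≈ (span-scale (ℚ.- v) (span-combination (c ∘ suc) (λ k → x ^ toℕ k) (λ k → power (toℕ k))))
        where
        v = (ℚ.1/ c zero) {{ℚ.≢-nonZero c₀≢0}}
        y≈ : ℚ→ℂ (ℚ.- v) * Q ≈ y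
        y≈ = begin
          ℚ→ℂ (ℚ.- v) * Q                     ≈⟨ *-cong (ℚ→ℂ-neg v) yxQ ⟩
          - ℚ→ℂ v * (y * (x * Q))             ≈⟨ *-congˡ { - ℚ→ℂ v} (*-congˡ {y} (trans (solve 2 (λ c t → t := (c :+ t) :+ :- c) refl (ℚ→ℂ (c zero)) (x * Q)) (trans (+-congʳ split) (+-identityˡ _)))) ⟩
          - ℚ→ℂ v * (y * - ℚ→ℂ (c zero))      ≈⟨ solve 3 (λ v y c → :- v :* (y :* :- c) := v :* c :* y) refl (ℚ→ℂ v) y (ℚ→ℂ (c zero)) ⟩
          ℚ→ℂ v * ℚ→ℂ (c zero) * y            ≈⟨ *-congʳ {y} (trans (sym (ℚ→ℂ-* v (c zero))) (ℚ→ℂ-cong (ℚ.*-inverseˡ (c zero) {{ℚ.≢-nonZero c₀≢0}}))) ⟩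
          1# * y                              ≈⟨ *-identityˡ y ⟩
          y                                   ∎

  -- The p roots sum to zero, so they are a spanning family and not a basis. Closure under inverses
  -- is the substantial case.
  generated⊆span : ∀ {x} → Generated ζ x → Span roots x
  generated⊆span gen         = span-resp E-1 (E∈span 1ℤ)
  generated⊆span (resp e g)  = span-resp e (generated⊆span g)
  generated⊆span 0∈          = span-0
  generated⊆span 1∈          = span-resp E-0 (E∈span 0ℤ)
  generated⊆span (+∈ g h)    = span-+ (generated⊆span g) (generated⊆span h)
  generated⊆span (*∈ g h)    = span-* roots-* (generated⊆span g) (generated⊆span h)
  generated⊆span (-∈ {x} g)  = span-resp (trans (*-congʳ {x} (ℚ→ℂ-neg 1ℚ)) (trans (sym (-‿distribˡ-* 1# x)) (-‿cong (*-identityˡ x))))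
                                 (span-scale (ℚ.- 1ℚ) (generated⊆span g))
  generated⊆span (inv∈ g e)  = inverse∈span (generated⊆span g) e

  power∈ : ∀ n → Generated ζ (ζ ^ n)
  power∈ zero    = 1∈
  power∈ (suc n) = *∈ gen (power∈ n)

  rootElement : ℤ → Subfield.Element ℚ⟨ ζ ⟩
  rootElement z = E z , power∈ (z ℤ.%ℕ p)

  hom-E : ∀ {f} → Hom f → ∀ y → f (generator ζ) ≈ E y → ∀ z → f (rootElement z) ≈ E (y ℤ.* z)
  hom-E {f} h y fζ z = trans (hom-power (z ℤ.%ℕ p)) (trans (^-congˡ (z ℤ.%ℕ p) fζ) (trans (E-^ y (z ℤ.%ℕ p))
    (E-cong (M.trans (M.*-congʳ {y} (M.sym (%-≡ₚ z))) (M.*-comm z y)))))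
    where
    hom-power : ∀ n → f (ζ ^ n , power∈ n) ≈ f (generator ζ) ^ n
    hom-power zero    = Hom.homo-1 h
    hom-power (suc n) = trans (Hom.homo-* h (generator ζ) (ζ ^ n , power∈ n)) (*-congˡ {f (generator ζ)} (hom-power n))

-- The degree of K and the trace

least : ∀ {P : ℕ → Set} → (∀ n → Dec (P n)) → ∀ n → P n → ∃ λ k → P k × (∀ j → j ℕ.< k → ¬ P j)
least {P} P? n Pn = [ (λ none → contradiction Pn (none n (ℕ.n<1+n n))) , id ]′ (search (suc n))
  where
  search : ∀ n → (∀ j → j ℕ.< n → ¬ P j) ⊎ (∃ λ k → P k × (∀ j → j ℕ.< k → ¬ P j))
  search zero    = inj₁ λ j ()
  search (suc n) = step (search n) (P? n)
    where
    step : (∀ j → j ℕ.< n → ¬ P j) ⊎ (∃ λ k → P k × (∀ j → j ℕ.< k → ¬ P j)) → Dec (P n) →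
           (∀ j → j ℕ.< suc n → ¬ P j) ⊎ (∃ λ k → P k × (∀ j → j ℕ.< k → ¬ P j))
    step (inj₂ found) _       = inj₂ found
    step (inj₁ none)  (yes q) = inj₂ (n , q , none)
    step (inj₁ none)  (no ¬q) = inj₁ λ j j<1+n → [ none j , (λ { ≡.refl → ¬q }) ]′ (ℕ.m≤n⇒m<n∨m≡n (ℕ.s≤s⁻¹ j<1+n))

module _ where
  open RingTheory ℂ-commutativeRing
  open ℚSpan

  dependent-combination : ∀ {m n} {b : Fin n → ℂ} {x : Fin m → ℂ} (c : Fin m → ℚ) (h : ∀ a → Span b (x a)) →
            (∀ j → ℚR.sum (λ a → c a ℚ.* proj₁ (h a) j) ≡ 0ℚ) → sum (λ a → ℚ→ℂ (c a) * x a) ≈ 0#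
  dependent-combination {m} {n} {b} {x} c h rel = begin
    sum (λ a → ℚ→ℂ (c a) * x a)
      ≈⟨ sum-cong-≋ {m} (λ a → trans (*-congˡ {ℚ→ℂ (c a)} (proj₂ (h a))) (trans (*-distribˡ-sum {n} (ℚ→ℂ (c a)) (λ j → ℚ→ℂ (proj₁ (h a) j) * b j))
           (sum-cong-≋ {n} (λ j → trans (sym (*-assoc (ℚ→ℂ (c a)) (ℚ→ℂ (proj₁ (h a) j)) (b j))) (*-congʳ (sym (ℚ→ℂ-* (c a) (proj₁ (h a) j)))))))) ⟩
    sum {m} (λ a → sum {n} (λ j → ℚ→ℂ (c a ℚ.* proj₁ (h a) j) * b j))
      ≈⟨ ∑-comm {m} {n} (λ a j → ℚ→ℂ (c a ℚ.* proj₁ (h a) j) * b j) ⟩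
    sum {n} (λ j → sum {m} (λ a → ℚ→ℂ (c a ℚ.* proj₁ (h a) j) * b j))
      ≈⟨ sum-zero {n} _ (λ j → trans (sym (*-distribʳ-sum {m} (b j) (λ a → ℚ→ℂ (c a ℚ.* proj₁ (h a) j))))
           (trans (*-congʳ {b j} (trans (sym (ℚ→ℂ-sum {m} (λ a → c a ℚ.* proj₁ (h a) j))) (ℚ→ℂ-cong (rel j)))) (zeroˡ (b j)))) ⟩
    0# ∎

module Galois
  (p : ℕ) (pr : Prime p) (ζ : ℂ) (primitiveζ : IsPrimitiveRootOfUnity p ζ)
  (u : ℤ) (uu : Congruence._≡ₚ_ p u 0ℤ → ⊥) (ord : Units.HasOrder p pr u (p ∸ 1))
  (σᵤ : Subfield.Element ℚ⟨ ζ ⟩ → Subfield.Element ℚ⟨ ζ ⟩) (automorphism : IsAutomorphism ℚ⟨ ζ ⟩ σᵤ)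
  (σᵤ-power : IsIntegerPower ζ u (proj₁ (σᵤ (generator ζ))))
  (K : Subfield) (K⊆L : K ⊆ ℚ⟨ ζ ⟩)
  (θ : Subfield.Element K → Subfield.Element K) (restriction : IsRestriction ℚ⟨ ζ ⟩ K σᵤ θ)
  (t : Subfield.Element K) (trace : IsTrace ℚ⟨ ζ ⟩ K (generator ζ) (proj₁ t)) where
  open Periods p pr ζ primitiveζ u uu ord public
  open CyclotomicField p pr ζ primitiveζ public
  open RingTheory ℂ-commutativeRing
  open RangeSums ℂ-commutativeRing
  open ℚSpan
  private
    module M = ℤ/pR
    module L = Homomorphisms ℚ⟨ ζ ⟩
    module KH = Homomorphisms K
    module T = IsTrace trace
    L-Element = Subfield.Element ℚ⟨ ζ ⟩
    K-Element = Subfield.Element K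
    module Aut = RingMorphisms.IsRingIsomorphism automorphism

  σᵤ-ζ : proj₁ (σᵤ (generator ζ)) ≈ E u
  σᵤ-ζ = power u σᵤ-power
    where
    power : ∀ u {w} → IsIntegerPower ζ u w → w ≈ E u
    power (+ n)    h = trans h (sym (E-nat n))
    power -[1+ n ] {w} h = inverse-unique {z = ζ} {x = ζ ^ suc n} (trans (*-comm (ζ ^ suc n) w) h)
      (trans (*-congʳ {E -[1+ n ]} (sym (E-nat (suc n)))) (E-inverse (+ suc n)))

  -- Powers of `σᵤ` read as maps into ℂ, so that they can be compared with the embeddings listed in
  -- the trace.
  Ψ : ℕ → L-Element → ℂ
  Ψ k x = proj₁ (iterate σᵤ x k)

  Ψ-Hom : ∀ k → L.Hom (Ψ k)
  Ψ-Hom zero    = record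
    { cong = id ; homo-+ = λ x y → refl ; homo-* = λ x y → refl ; homo-- = λ x → refl ; homo-0 = refl ; homo-1 = refl }
  Ψ-Hom (suc k) = record
    { cong   = λ {x} {y} e → H.cong {σᵤ x} {σᵤ y} (Aut.⟦⟧-cong e)
    ; homo-+ = λ x y → trans (H.cong (Aut.+-homo x y)) (H.homo-+ (σᵤ x) (σᵤ y))
    ; homo-* = λ x y → trans (H.cong (Aut.*-homo x y)) (H.homo-* (σᵤ x) (σᵤ y))
    ; homo-- = λ x → trans (H.cong (Aut.-‿homo x)) (H.homo-- (σᵤ x))
    ; homo-0 = trans (H.cong Aut.0#-homo) H.homo-0
    ; homo-1 = trans (H.cong Aut.1#-homo) H.homo-1
    }
    where module H = L.Hom (Ψ-Hom k)

  Ψ-injective : ∀ k {x y} → Ψ k x ≈ Ψ k y → proj₁ x ≈ proj₁ y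
  Ψ-injective zero    e = e
  Ψ-injective (suc k) {x} {y} e = Aut.injective (Ψ-injective k {σᵤ x} {σᵤ y} e)

  Ψ-ζ : ∀ k → Ψ k (generator ζ) ≈ E (u^ k)
  Ψ-ζ zero    = sym E-1
  Ψ-ζ (suc k) = trans (L.Hom.cong (Ψ-Hom k) {σᵤ (generator ζ)} {rootElement u} σᵤ-ζ)
    (trans (hom-E (Ψ-Hom k) (u^ k) (Ψ-ζ k) u) (E-cong (M.*-comm (u^ k) u)))

  Ψ-E : ∀ k z → Ψ k (rootElement z) ≈ E (u^ k ℤ.* z)
  Ψ-E k = hom-E (Ψ-Hom k) (u^ k) (Ψ-ζ k)

  inclusion : K-Element → L-Element
  inclusion (x , h) = x , K⊆L h

  ψ : ℕ → K-Element → ℂ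
  ψ k x = Ψ k (inclusion x)

  ψ-Hom : ∀ k → KH.Hom (ψ k)
  ψ-Hom k = record
    { cong   = H.cong
    -- The inclusion of a sum and the sum of the inclusions are the same complex number with
    -- different membership proofs; `H.cong refl` exchanges them.
    ; homo-+ = λ x y → trans (H.cong refl) (H.homo-+ (inclusion x) (inclusion y))
    ; homo-* = λ x y → trans (H.cong refl) (H.homo-* (inclusion x) (inclusion y))
    ; homo-- = λ x → trans (H.cong refl) (H.homo-- (inclusion x))
    ; homo-0 = trans (H.cong refl) H.homo-0
    ; homo-1 = trans (H.cong refl) H.homo-1
    }
    where module H = L.Hom (Ψ-Hom k)

  ψ-embedding : ∀ k → IsEmbedding K (ψ k)
  ψ-embedding k = KH.toEmbedding (ψ-Hom k) (λ {x} {y} → Ψ-injective k {inclusion x} {inclusion y})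

  iterate-θ : ∀ k {x y} → proj₁ x ≈ proj₁ y → Ψ k x ≈ proj₁ (iterate θ y k)
  iterate-θ zero    e = e
  iterate-θ (suc k) {x} {y} e = iterate-θ k {σᵤ x} {θ y} (restriction x y e)

  Fixes : ℕ → Set
  Fixes k = ∀ x → ψ k x ≈ proj₁ x

  Ψ-+ : ∀ a b x → Ψ (a ℕ.+ b) x ≈ Ψ b (iterate σᵤ x a)
  Ψ-+ zero    b x = refl
  Ψ-+ (suc a) b x = Ψ-+ a b (σᵤ x)

  fixes-+ : ∀ {a} → Fixes a → ∀ b x → ψ (a ℕ.+ b) x ≈ ψ b x
  fixes-+ {a} h b x = trans (Ψ-+ a b (inclusion x)) (L.Hom.cong (Ψ-Hom b) {iterate σᵤ (inclusion x) a} {inclusion x} (h x))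

  fixes-* : ∀ {a} → Fixes a → ∀ q → Fixes (q ℕ.* a)
  fixes-* h zero    x = refl
  fixes-* {a} h (suc q) x = trans (fixes-+ {a} h (q ℕ.* a) x) (fixes-* {a} h q x)

  Ψ-≡ₚ : ∀ {a b} → u^ a ≡ₚ u^ b → ∀ x → Ψ a x ≈ Ψ b x
  Ψ-≡ₚ {a} {b} e = hom-extensional (Ψ-Hom a) (Ψ-Hom b) (trans (Ψ-ζ a) (trans (E-cong e) (sym (Ψ-ζ b))))

  private
    φ-Hom : ∀ i → L.Hom (T.φ i)
    φ-Hom i = L.embedding⇒Hom (proj₁ (T.relative i))

    φζ-root : ∀ i → T.φ i (generator ζ) ^ p ≈ 1#
    φζ-root i = trans (power p) (trans (L.Hom.cong (φ-Hom i) {ζ ^ p , power∈ p} {_ , 1∈} (proj₁ primitiveζ)) (L.Hom.homo-1 (φ-Hom i)))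
      where
      power : ∀ n → T.φ i (generator ζ) ^ n ≈ T.φ i (ζ ^ n , power∈ n)
      power zero    = sym (L.Hom.homo-1 (φ-Hom i))
      power (suc n) = trans (*-congˡ {T.φ i (generator ζ)} (power n)) (sym (L.Hom.homo-* (φ-Hom i) (generator ζ) (ζ ^ n , power∈ n)))

    abstract
      -- The image of ζ is a p-th root of unity, and it is not 1 because an embedding is injective;
      -- its exponent is then a unit and has a discrete logarithm to the base u.
      φζ-exponent : ∀ i → ∃ λ k → k ℕ.< p ∸ 1 × T.φ i (generator ζ) ≈ E (u^ k)
      φζ-exponent i = toℕ (proj₁ log) , Fin.toℕ<n (proj₁ log) , trans (proj₂ root) (E-cong (M.sym (proj₂ log)))
        where
        module Log = PrimitiveRoot u uu ord
        root : ∃ λ (j : Fin p) → T.φ i (generator ζ) ≈ E (+ toℕ j)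
        root = root-of-unity (T.φ i (generator ζ)) (φζ-root i)
        unit : Unit (+ toℕ (proj₁ root))
        unit e = unit-1 (E-≈1 (trans E-1 (RingMorphisms.IsRingMonomorphism.injective (proj₁ (T.relative i)) {generator ζ} {1ᶜ , 1∈}
          (trans (proj₂ root) (trans (E-cong e) (trans E-0 (sym (L.Hom.homo-1 (φ-Hom i)))))))))
        log : ∃ λ (k : Fin (p ∸ 1)) → u^ toℕ k ≡ₚ + toℕ (proj₁ root)
        log = Log.logarithm (+ toℕ (proj₁ root)) unit

    κ : Fin T.m → ℕ
    κ i = proj₁ (φζ-exponent i)

    κ< : ∀ i → κ i ℕ.< p ∸ 1
    κ< i = proj₁ (proj₂ (φζ-exponent i))

    φζ : ∀ i → T.φ i (generator ζ) ≈ E (u^ κ i)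
    φζ i = proj₂ (proj₂ (φζ-exponent i))

    φ≗Ψ : ∀ i x → T.φ i x ≈ Ψ (κ i) x
    φ≗Ψ i = hom-extensional (φ-Hom i) (Ψ-Hom (κ i)) (trans (φζ i) (sym (Ψ-ζ (κ i))))

    fixes-κ : ∀ i → Fixes (κ i)
    fixes-κ i x = trans (sym (φ≗Ψ i (inclusion x))) (proj₂ (T.relative i) (inclusion x) (proj₂ x))

    fixing⇒κ : ∀ k → Fixes k → ∃ λ i → k ℕ.% (p ∸ 1) ≡ κ i
    fixing⇒κ k h =
      let i , e = T.complete (Ψ k) (L.toEmbedding (Ψ-Hom k) (λ {x} {y} → Ψ-injective k {x} {y}) , λ x x∈K →
                    trans (L.Hom.cong (Ψ-Hom k) {x} {inclusion (proj₁ x , x∈K)} refl) (h (proj₁ x , x∈K)))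
      in i , ≡.trans (order-%≡ {u} {p ∸ 1} uu ord {k} {κ i} (E-injective (trans (sym (Ψ-ζ k)) (trans (e (generator ζ)) (φζ i)))))
               (ℕ.m<n⇒m%n≡m (κ< i))

    κ⇒fixing : ∀ k i → k ℕ.% (p ∸ 1) ≡ κ i → Fixes k
    κ⇒fixing k i e x = trans (Ψ-≡ₚ {k} {κ i} congr (inclusion x)) (fixes-κ i x)
      where
      congr : u^ k ≡ₚ u^ κ i
      congr = M.trans (M.^-congʳ u (≡.trans (ℕ.m≡m%n+[m/n]*n k (p ∸ 1)) (≡.cong (ℕ._+ k ℕ./ (p ∸ 1) ℕ.* (p ∸ 1)) e)))
        (M.trans (M.^-homo-* u (κ i) (k ℕ./ (p ∸ 1) ℕ.* (p ∸ 1))) (M.trans (M.*-congˡ {u^ κ i} (^-multiple {u} {p ∸ 1} (proj₁ ord) (k ℕ./ (p ∸ 1)))) (M.*-identityʳ (u^ κ i))))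

    -- `Fixes k` quantifies over all of K. Completeness of the list in the trace turns it into a
    -- finite question: whether k modulo p - 1 is one of the exponents of the listed embeddings.
    fixes? : ∀ k → Dec (Fixes k)
    fixes? k with Fin.any? (λ i → k ℕ.% (p ∸ 1) ℕ.≟ κ i)
    ... | yes (i , e) = yes (κ⇒fixing k i e)
    ... | no  none    = no (λ h → none (fixing⇒κ k h))

    fixes-p-1 : Fixes (suc (p ∸ 1 ∸ 1))
    fixes-p-1 x = Ψ-≡ₚ {suc (p ∸ 1 ∸ 1)} {0} (≡.subst (λ n → u^ n ≡ₚ 1ℤ) (≡.sym (ℕ.m+[n∸m]≡n {1} {p ∸ 1} (ℕ.>-nonZero⁻¹ (p ∸ 1)))) (proj₁ ord)) (inclusion x)

    -- Kept abstract so that sums of length d do not unfold.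
    abstract
      minimal-period : ∃ λ d → NonZero d × Fixes d × (∀ j → 0 ℕ.< j → j ℕ.< d → ¬ Fixes j)
      minimal-period =
        let k , h , minimal = least {λ k → Fixes (suc k)} (λ k → fixes? (suc k)) (p ∸ 1 ∸ 1) fixes-p-1
        in suc k , _ , h , λ { (suc j) _ j<d → minimal j (ℕ.s≤s⁻¹ j<d) }

  d : ℕ
  d = proj₁ minimal-period

  instance
    d-nonZero : NonZero d
    d-nonZero = proj₁ (proj₂ minimal-period)

  fixes-d : Fixes d
  fixes-d = proj₁ (proj₂ (proj₂ minimal-period))

  -- Multiples of d fix K and can be split off, so the remainder of k modulo d fixes K too;
  -- minimality of d makes it zero.
  fixes⇒∣ : ∀ k → Fixes k → d ℕ.∣ k
  fixes⇒∣ k h = ℕ.m%n≡0⇒n∣m k d (zero-remainder (k ℕ.% d) (ℕ.m%n<n k d) λ x →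
      trans (sym (fixes-+ {k ℕ./ d ℕ.* d} (fixes-* {d} fixes-d (k ℕ./ d)) (k ℕ.% d) x))
        (trans (reflexive (≡.cong (λ n → ψ n x) (≡.trans (ℕ.+-comm (k ℕ./ d ℕ.* d) (k ℕ.% d)) (≡.sym (ℕ.m≡m%n+[m/n]*n k d))))) (h x)))
    where
    zero-remainder : ∀ r → r ℕ.< d → Fixes r → r ≡ 0
    zero-remainder zero    _   _ = ≡.refl
    zero-remainder (suc r) r<d h = contradiction h (proj₂ (proj₂ (proj₂ minimal-period)) (suc r) (s≤s z≤n) r<d)

  abstract
    d∣p-1 : d ℕ.∣ p ∸ 1
    d∣p-1 = fixes⇒∣ (p ∸ 1) (λ x → Ψ-≡ₚ {p ∸ 1} {0} (proj₁ ord) (inclusion x))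

  m : ℕ
  m = ℕ.quotient d∣p-1

  md≡p-1 : m ℕ.* d ≡ p ∸ 1
  md≡p-1 = ≡.sym (ℕ._∣_.equality d∣p-1)

  instance
    m-nonZero : NonZero m
    m-nonZero = ℕ.≢-nonZero λ m≡0 → ℕ.≢-nonZero⁻¹ (p ∸ 1) (≡.trans (≡.sym md≡p-1) (≡.cong (ℕ._* d) m≡0))

  period : ℕ → ℂ
  period = η d m md≡p-1

  -- The embeddings fixing K are exactly the powers of `σᵤ` with exponent a multiple of d below p -
  -- 1. Matching them with the list in the trace is a bijection, so the two sums of images of ζ
  -- agree.
  t≈period : proj₁ t ≈ period 0
  t≈period = trans T.trace (sym (trans (sum-cong-≋ {m} (λ j → trans (sym (Ψ-ζ (toℕ j ℕ.* d))) (proj₂ (matching j) (generator ζ))))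
      (sum-reindex (λ j → proj₁ (matching j)) injective surjective (λ i → T.φ i (generator ζ)))))
    where
    matching : ∀ (j : Fin m) → ∃ λ i → ∀ x → Ψ (toℕ j ℕ.* d) x ≈ T.φ i x
    matching j = T.complete (Ψ k) (L.toEmbedding (Ψ-Hom k) (λ {x} {y} → Ψ-injective k {x} {y}) , λ x x∈K →
                    trans (L.Hom.cong (Ψ-Hom k) {x} {inclusion (proj₁ x , x∈K)} refl) (fixes-* {d} fixes-d (toℕ j) (proj₁ x , x∈K)))
      where k = toℕ j ℕ.* d
    jd< : ∀ (j : Fin m) → toℕ j ℕ.* d ℕ.< p ∸ 1
    jd< j = ≡.subst (toℕ j ℕ.* d ℕ.<_) md≡p-1 (ℕ.*-monoˡ-< d (Fin.toℕ<n j))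
    injective : ∀ {i j} → proj₁ (matching i) ≡ proj₁ (matching j) → i ≡ j
    injective {i} {j} e = Fin.toℕ-injective (ℕ.*-cancelʳ-≡ (toℕ i) (toℕ j) d (≡.trans (≡.sym (ℕ.m<n⇒m%n≡m (jd< i)))
      (≡.trans (order-%≡ {u} {p ∸ 1} uu ord {toℕ i ℕ.* d} {toℕ j ℕ.* d} (E-injective (trans (sym (Ψ-ζ (toℕ i ℕ.* d))) (trans (proj₂ (matching i) (generator ζ))
        (trans (reflexive (≡.cong (λ l → T.φ l (generator ζ)) e)) (trans (sym (proj₂ (matching j) (generator ζ))) (Ψ-ζ (toℕ j ℕ.* d))))))))
        (ℕ.m<n⇒m%n≡m (jd< j)))))
    surjective : ∀ i → ∃ λ j → proj₁ (matching j) ≡ i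
    surjective i = j , T.distinct (proj₁ (matching j)) i (λ x → trans (sym (proj₂ (matching j) x))
        (trans (reflexive (≡.cong (λ k → Ψ k x) (≡.trans (≡.cong (ℕ._* d) (Fin.toℕ-fromℕ< q<m)) (≡.sym κ≡qd)))) (sym (φ≗Ψ i x))))
      where
      q = ℕ.quotient (fixes⇒∣ (κ i) (fixes-κ i))
      κ≡qd : κ i ≡ q ℕ.* d
      κ≡qd = ℕ._∣_.equality (fixes⇒∣ (κ i) (fixes-κ i))
      q<m : q ℕ.< m
      q<m = ℕ.*-cancelʳ-< d q m (≡.subst₂ ℕ._<_ κ≡qd (≡.sym md≡p-1) (κ< i))
      j = Fin.fromℕ< q<m

  conjugates : ℕ → K-Element
  conjugates k = iterate θ t k

  private
    one-sum : ∀ {n} (f : Fin n → ℂ) → sum (λ i → ℚ→ℂ 1ℚ * f i) ≈ sum f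
    one-sum {n} f = sum-cong-≋ {n} (λ i → *-identityˡ (f i))

  Ψ-period : ∀ k a x → proj₁ x ≈ period a → Ψ k x ≈ period (a ℕ.+ k)
  Ψ-period k a x e = trans (L.hom-linear (Ψ-Hom k) (λ _ → 1ℚ) (λ (j : Fin m) → rootElement (u^ (a ℕ.+ toℕ j ℕ.* d))) x
      (trans e (sym (one-sum {m} (λ j → E (u^ (a ℕ.+ toℕ j ℕ.* d)))))))
    (trans (one-sum {m} (λ j → Ψ k (rootElement (u^ (a ℕ.+ toℕ j ℕ.* d)))))
      (Σ<-cong m (λ j _ → trans (Ψ-E k (u^ (a ℕ.+ j ℕ.* d))) (E-cong (M.trans (M.sym (M.^-homo-* u k (a ℕ.+ j ℕ.* d))) (M.^-congʳ u (index′ j)))))))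
    where
    index′ : ∀ j → k ℕ.+ (a ℕ.+ j ℕ.* d) ≡ a ℕ.+ k ℕ.+ j ℕ.* d
    index′ j = ≡.trans (≡.sym (ℕ.+-assoc k a (j ℕ.* d))) (≡.cong (ℕ._+ j ℕ.* d) (ℕ.+-comm k a))

  conjugates≈period : ∀ k → proj₁ (conjugates k) ≈ period k
  conjugates≈period k = trans (sym (iterate-θ k {inclusion t} {t} refl)) (Ψ-period k 0 (inclusion t) t≈period)

  ψ-conjugates : ∀ k a → ψ k (conjugates a) ≈ period (a ℕ.+ k)
  ψ-conjugates k a = Ψ-period k a (inclusion (conjugates a)) (conjugates≈period a)

  private
    -- With fewer than d spanning elements the periods would satisfy a rational relation. Every
    -- `Ψ k` preserves it, which supplies the whole system of shifted relations that `η-independent`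
    -- asks for.
    rational-independence : ∀ {n} (b : Fin n → ℂ) (e : Fin d → K-Element) → (∀ a → proj₁ (e a) ≈ period (toℕ a)) →
                            (∀ a → Span b (proj₁ (e a))) → d ℕ.≤ n
    rational-independence {n} b e e≈ h = ℕ.≮⇒≥ λ n<d →
      let c , (i , cᵢ≢0) , rel = kernel n<d (λ a → proj₁ (h a))
      in cᵢ≢0 (ℚ→ℂ-zero (η-independent d m md≡p-1 (λ a → ℚ→ℂ (c a)) (λ k →
           trans (sum-cong-≋ {d} (λ a → *-congˡ {ℚ→ℂ (c a)} (sym (Ψ-period k (toℕ a) (inclusion (e a)) (e≈ a)))))
             (trans (sym (L.hom-linear (Ψ-Hom k) c (λ a → inclusion (e a)) (_ , 0∈) (sym (dependent-combination c h rel)))) (L.Hom.homo-0 (Ψ-Hom k)))) i))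

  periods : Fin d → ℂ
  periods a = period (toℕ a)

  period∈span : ∀ k → Span periods (period k)
  period∈span k = span-resp (trans (reflexive (≡.cong period (Fin.toℕ-fromℕ< (ℕ.m%n<n k d)))) (sym (trans (reflexive (≡.cong period
      (≡.trans (ℕ.m≡m%n+[m/n]*n k d) (ℕ.+-comm (k ℕ.% d) (k ℕ./ d ℕ.* d))))) (reduce (k ℕ./ d) (k ℕ.% d)))))
    (span-basis (Fin.fromℕ< (ℕ.m%n<n k d)))
    where
    reduce : ∀ q r → period (q ℕ.* d ℕ.+ r) ≈ period r
    reduce zero    r = refl
    reduce (suc q) r = trans (reflexive (≡.cong period (ℕ.+-assoc d (q ℕ.* d) r))) (trans (η-periodic d m md≡p-1 (q ℕ.* d ℕ.+ r)) (reduce q r))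

  period-sum : Σ< d period ≈ - 1#
  period-sum = trans (∑-comm {d} {m} (λ k j → E (u^ (toℕ k ℕ.+ toℕ j ℕ.* d))))
    (trans (sym (Σ<-* m d (λ i → E (u^ i)))) (trans (reflexive (≡.cong (λ n → Σ< n (λ i → E (u^ i))) md≡p-1))
      (trans (Σ<-cong (p ∸ 1) (λ i _ → E-cong (M.sym (M.*-identityʳ (u^ i))))) (E-sum-generator u uu ord 1ℤ unit-1))))

  1∈span : Span periods 1#
  1∈span = span-resp (trans (trans (*-congʳ {Σ< d period} (ℚ→ℂ-neg 1ℚ)) (*-congˡ { - 1#} period-sum))
      (trans (x*-1≈-x (- 1#)) (solve 1 (λ x → :- (:- x) := x) refl 1#)))
    (span-scale (ℚ.- 1ℚ) (span-sum periods span-basis))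

  -- Averaging over the group fixing K.
  K⊆span : ∀ x → Span periods (proj₁ x)
  K⊆span x = span-resp (trans (sym (*-assoc v (ι (+ m)) (proj₁ x))) (trans (*-congʳ {proj₁ x} (proj₂ (ℂ-invertible m))) (*-identityˡ (proj₁ x))))
      (span-scale _ (span-resp (sym average) (span-combination c (λ l → Σ< m (λ j → E (u^ (j ℕ.* d) ℤ.* + toℕ l))) orbit)))
    where
    v = proj₁ (ℂ-invertible m)
    c = proj₁ (generated⊆span (K⊆L (proj₂ x)))
    average : ι (+ m) * proj₁ x ≈ sum (λ l → ℚ→ℂ (c l) * Σ< m (λ j → E (u^ (j ℕ.* d) ℤ.* + toℕ l)))
    average = begin
      ι (+ m) * proj₁ x                      ≈⟨ sym (Σ<-const m (proj₁ x)) ⟩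
      Σ< m (λ _ → proj₁ x)                   ≈⟨ Σ<-cong m (λ j _ → trans (sym (fixes-* {d} fixes-d j x)) (trans
                                                  (L.hom-linear (Ψ-Hom (j ℕ.* d)) c (λ l → rootElement (+ toℕ l)) (inclusion x) (proj₂ (generated⊆span (K⊆L (proj₂ x)))))
                                                  (sum-cong-≋ {p} (λ l → *-congˡ {ℚ→ℂ (c l)} (Ψ-E (j ℕ.* d) (+ toℕ l)))))) ⟩
      Σ< m (λ j → sum {p} (λ l → ℚ→ℂ (c l) * E (u^ (j ℕ.* d) ℤ.* + toℕ l)))
        ≈⟨ ∑-comm {m} {p} (λ j l → ℚ→ℂ (c l) * E (u^ (toℕ j ℕ.* d) ℤ.* + toℕ l)) ⟩
      sum {p} (λ l → Σ< m (λ j → ℚ→ℂ (c l) * E (u^ (j ℕ.* d) ℤ.* + toℕ l)))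
        ≈⟨ sum-cong-≋ {p} (λ l → sym (*-distribˡ-sum {m} (ℚ→ℂ (c l)) (λ j → E (u^ (toℕ j ℕ.* d) ℤ.* + toℕ l)))) ⟩
      sum (λ l → ℚ→ℂ (c l) * Σ< m (λ j → E (u^ (j ℕ.* d) ℤ.* + toℕ l))) ∎
    -- The orbit sum of ζ^l is m when p divides l, and otherwise the period indexed by the discrete
    -- logarithm of l.
    orbit : ∀ l → Span periods (Σ< m (λ j → E (u^ (j ℕ.* d) ℤ.* + toℕ l)))
    orbit l = decide ((+ toℕ l) ≡ₚ? 0ℤ)
      where
      decide : Dec (+ toℕ l ≡ₚ 0ℤ) → Span periods (Σ< m (λ j → E (u^ (j ℕ.* d) ℤ.* + toℕ l)))
      decide (yes l≡0) = span-resp (Σ<-cong m (λ j _ → sym (trans (E-cong (M.trans (M.*-congˡ {u^ (j ℕ.* d)} l≡0) (M.zeroʳ (u^ (j ℕ.* d))))) E-0)))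
        (span-sum {m = m} (λ _ → 1#) (λ _ → 1∈span))
      decide (no ul) = span-resp (Σ<-cong m (λ j _ → E-cong (M.trans (M.^-homo-* u a (j ℕ.* d)) (M.trans (M.*-comm (u^ a) (u^ (j ℕ.* d)))
          (M.*-congˡ {u^ (j ℕ.* d)} (proj₂ log)))))) (period∈span a)
        where
        log = PrimitiveRoot.logarithm u uu ord (+ toℕ l) ul
        a = toℕ (proj₁ log)

  -- A family larger than a spanning family is dependent; this is applied to the given basis over
  -- the periods and to the periods over the given basis.
  degree : ∀ {s} → HasDegree K s → s ≡ d
  degree {s} (b , basis) = ℕ.≤-antisym (ℕ.≮⇒≥ λ d<s →
      let c , (i , cᵢ≢0) , rel = kernel d<s (λ i → proj₁ (coordinates i))
      in cᵢ≢0 (B.independent c (dependent-combination c coordinates rel) i))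
    (rational-independence b (λ a → conjugates (toℕ a)) (λ a → conjugates≈period (toℕ a)) (λ a → B.spanning (proj₁ (conjugates (toℕ a))) (proj₂ (conjugates (toℕ a)))))
    where
    module B = IsℚBasis basis
    coordinates : ∀ i → Span periods (b i)
    coordinates i = K⊆span (b i , B.members i)

  coordinates-value : ∀ {n} (a : Vector ℤ n) → proj₁ (fromCoordinates K θ t a) ≈ sum (λ i → ι (a i) * period (toℕ i))
  coordinates-value {n} a = trans (value a (λ i → conjugates (toℕ i))) (sum-cong-≋ {n} (λ i → *-congˡ {ι (a i)} (conjugates≈period (toℕ i))))
    where
    module KOps = RingOperations (Subfield.rawRing K)
    multiple : ∀ n (e : K-Element) → proj₁ ((+ n) KOps.· e) ≈ ι (+ n) * proj₁ e
    multiple zero    e = sym (zeroˡ (proj₁ e))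
    multiple (suc n) e = trans (+-cong (sym (*-identityˡ (proj₁ e))) (multiple n e)) (sym (distribʳ (proj₁ e) 1# (ι (+ n))))
    scalar : ∀ z (e : K-Element) → proj₁ (z KOps.· e) ≈ ι z * proj₁ e
    scalar (+ n)    e = multiple n e
    scalar -[1+ n ] e = trans (-‿cong (multiple (suc n) e)) (-‿distribˡ-* (ι (+ suc n)) (proj₁ e))
    value : ∀ {n} (a : Vector ℤ n) (e : Fin n → K-Element) → proj₁ (KOps.sum (λ i → a i KOps.· e i)) ≈ sum (λ i → ι (a i) * proj₁ (e i))
    value {zero}  a e = refl
    value {suc n} a e = +-cong (scalar (a zero) (e zero)) (value (a ∘ suc) (e ∘ suc))

  -- Multiplication by x maps the integral span of the roots of unity to itself, so x is a zero of
  -- the characteristic polynomial of an integer matrix. The root with exponent 0 is the entry 1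
  -- that `integral` requires.
  coordinates-integral : ∀ {n} (a : Vector ℤ n) → IsAlgebraicInteger (proj₁ (fromCoordinates K θ t a))
  coordinates-integral {n} a = eigenvector p (p ∸ 1) p≡1+[p-1] (λ i → E (+ i)) E-0 (λ i → proj₁ (action i)) (λ i → proj₂ (action i))
    where
    x : ℂ
    x = proj₁ (fromCoordinates K θ t a)
    integral-E : ∀ z → ℤSpan.Span roots (E z)
    integral-E z = ℤSpan.span-resp (sym (E-index z)) (ℤSpan.span-basis (index z))
    x∈ : ℤSpan.Span roots x
    x∈ = ℤSpan.span-resp (sym (coordinates-value a)) (ℤSpan.span-combination a (λ i → period (toℕ i))
      (λ i → ℤSpan.span-sum {m = m} (λ j → E (u^ (toℕ i ℕ.+ toℕ j ℕ.* d))) (λ j → integral-E (u^ (toℕ i ℕ.+ toℕ j ℕ.* d)))))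
    action : ∀ (i : Fin p) → ℤSpan.Span roots (x * E (+ toℕ i))
    action i = ℤSpan.span-* {d = roots} (λ i j → ℤSpan.span-resp (E-+ (+ toℕ i) (+ toℕ j)) (integral-E (+ toℕ i ℤ.+ + toℕ j))) x∈ (ℤSpan.span-basis i)
    -- The number p of roots is generalised to q so that it can be matched as a successor.
    eigenvector : ∀ q k → q ≡ suc k → (w : ℕ → ℂ) → w 0 ≈ 1# → (A : Fin q → Fin q → ℤ) →
      (∀ i → x * w (toℕ i) ≈ sum (λ j → ι (A i j) * w (toℕ j))) → IsAlgebraicInteger x
    eigenvector .(suc k) k ≡.refl w w₀ A h = Polynomials.integral ℂ-commutativeRing x (λ i → w (toℕ i)) w₀ A h

-- The canonical embedding

module _ where
  open import Data.Fin.Base using (splitAt; quotRem)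
  import Data.Product.Base as Product
  open RangeSums ℝ-commutativeRing
  open RingTheory ℝ-commutativeRing

  sum-splitAt : ∀ m {n} (g : Fin m ⊎ Fin n → ℝ) →
                sum (λ i → g (splitAt m i)) ≈ sum (λ i → g (inj₁ i)) + sum (λ j → g (inj₂ j))
  sum-splitAt zero    g = sym (+-identityˡ _)
  sum-splitAt (suc m) {n} g = trans (+-congˡ (trans (reflexive (sum-cong-≗ {m ℕ.+ n} (λ i → map-suc (splitAt m i)))) (sum-splitAt m g′)))
    (sym (+-assoc _ _ _))
    where
    g′ : Fin m ⊎ Fin n → ℝ
    g′ = [ (λ i → g (inj₁ (suc i))) , (λ j → g (inj₂ j)) ]′
    map-suc : ∀ s → g (Data.Sum.Base.map suc id s) ≡ g′ s
    map-suc (inj₁ i) = ≡.refl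
    map-suc (inj₂ j) = ≡.refl

  -- `concat` locates an index by `quotRem`, so this splits a sum over the canonical embedding into
  -- pairs of real and imaginary parts.
  sum-quotRem : ∀ m n (g : Fin n × Fin m → ℝ) → sum (λ i → g (quotRem {m} n i)) ≈ sum {m} (λ j → sum {n} (λ k → g (k , j)))
  sum-quotRem zero    n g = refl
  sum-quotRem (suc m) n g = trans (sum-splitAt n {m ℕ.* n} (λ s → g ([ (_, zero) , Product.map₂ suc ∘ quotRem {m} n ]′ s)))
    (+-congˡ (sum-quotRem m n (λ r → g (Product.map₂ suc r))))

  sum-injective : ∀ {m n} → m ≡ n → (κ : Fin m → Fin n) → (∀ {i j} → κ i ≡ κ j → i ≡ j) →
                  ∀ f → sum (λ i → f (κ i)) ≈ sum f
  sum-injective ≡.refl κ inj = sum-reindex κ inj (injective⇒surjective κ inj)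

re-ι : ∀ z → re (ℂR.ι z) ≡ ℝR.ι z
re-ι (+ n)    = natural n
  where
  natural : ∀ n → re (ℂR.ι (+ n)) ≡ ℝR.ι (+ n)
  natural zero    = ≡.refl
  natural (suc n) = ≡.cong (fromℚ 1ℚ +ᵣ_) (natural n)
re-ι -[1+ n ] = ≡.cong -ᵣ_ (re-ι (+ suc n))

re-sum : ∀ {n} (f : Vector ℂ n) → re (ℂR.sum f) ≡ ℝR.sum (λ i → re (f i))
re-sum {zero}  f = ≡.refl
re-sum {suc n} f = ≡.cong (re (f zero) +ᵣ_) (re-sum (f ∘ suc))

im-sum : ∀ {n} (f : Vector ℂ n) → im (ℂR.sum f) ≡ ℝR.sum (λ i → im (f i))
im-sum {zero}  f = ≡.refl
im-sum {suc n} f = ≡.cong (im (f zero) +ᵣ_) (im-sum (f ∘ suc))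

fromℤ≃ : ∀ z → fromℤ z ≃ fromℚ (ιℚ z)
fromℤ≃ z = pointwise (λ _ → /1≡ι z)

fromℤ≃ι : ∀ z → fromℤ z ≃ ℝR.ι z
fromℤ≃ι z = ℝR.trans (fromℤ≃ z) (ℝR.trans (re≃ (ℚ→ℂ-ι z)) (ℝR.reflexive (re-ι z)))

module Canonical
  (p : ℕ) (pr : Prime p) (ζ : ℂ) (primitiveζ : IsPrimitiveRootOfUnity p ζ)
  (u : ℤ) (uu : Congruence._≡ₚ_ p u 0ℤ → ⊥) (ord : Units.HasOrder p pr u (p ∸ 1))
  (σᵤ : Subfield.Element ℚ⟨ ζ ⟩ → Subfield.Element ℚ⟨ ζ ⟩) (automorphism : IsAutomorphism ℚ⟨ ζ ⟩ σᵤ)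
  (σᵤ-power : IsIntegerPower ζ u (proj₁ (σᵤ (generator ζ))))
  (K : Subfield) (K⊆L : K ⊆ ℚ⟨ ζ ⟩)
  (θ : Subfield.Element K → Subfield.Element K) (restriction : IsRestriction ℚ⟨ ζ ⟩ K σᵤ θ)
  (t : Subfield.Element K) (trace : IsTrace ℚ⟨ ζ ⟩ K (generator ζ) (proj₁ t))
  (s : ℕ) (E : CanonicalEmbedding K s) where
  open Galois p pr ζ primitiveζ u uu ord σᵤ automorphism σᵤ-power K K⊆L θ restriction t trace hiding (E)
  open CanonicalEmbedding E
  private
    module KH = Homomorphisms K
    K-Element = Subfield.Element K

  value : Fin r₂ ⊎ Fin r₂ → K-Element → ℂ
  value (inj₁ i) x = complex i x
  value (inj₂ i) x = conjugate (complex i x)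

  module _ (h m′ : ℕ) (s≡d : s ≡ d) (d≡2h : d ≡ h ℕ.+ h) (m≡1+2m′ : m ≡ suc (m′ ℕ.+ m′)) where
    open RingTheory ℝ-commutativeRing
    open RangeSums ℝ-commutativeRing

    private
      index-comm : ∀ j k → period (k ℕ.+ j) ≡ period (j ℕ.+ k)
      index-comm j k = ≡.cong period (ℕ.+-comm k j)

    not-real : ∀ k i → ¬ (∀ x → ψ k x ≈ᶜ real i x)
    not-real k i e = η-not-real d m md≡p-1 h m′ d≡2h m≡1+2m′ k λ j →
      ℂR.trans (conjugate-cong (link j)) (ℂR.trans (self-conjugate (conjugates j)) (ℂR.sym (link j)))
      where
      link : ∀ j → period (k ℕ.+ j) ≈ᶜ real i (conjugates j)
      link j = ℂR.trans (ℂR.reflexive (index-comm j k)) (ℂR.trans (ℂR.sym (ψ-conjugates k j)) (e (conjugates j)))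
      self-conjugate : ∀ x → conjugate (real i x) ≈ᶜ real i x
      self-conjugate x = mk≃ refl (trans (-‿cong im≃0) (trans (pointwise λ _ → ≡.refl) (sym im≃0)))
        where
        im≃0 : im (real i x) ≃ fromℚ 0ℚ
        im≃0 = wrap (real-real i x)

    slot : ∀ k → ∃ λ y → ∀ x → ψ k x ≈ᶜ value y x
    slot k = classify (complete (ψ k) (ψ-embedding k))
      where
      classify : (∃ λ i → ∀ x → ψ k x ≈ᶜ real i x) ⊎ (∃ λ i → ∀ x → ψ k x ≈ᶜ complex i x) ⊎
                 (∃ λ i → ∀ x → ψ k x ≈ᶜ conjugate (complex i x)) → ∃ λ y → ∀ x → ψ k x ≈ᶜ value y x
      classify (inj₁ (i , e))        = contradiction e (not-real k i)
      classify (inj₂ (inj₁ (i , e))) = inj₁ i , e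
      classify (inj₂ (inj₂ (i , e))) = inj₂ i , e

    position : Fin d → Fin (r₂ ℕ.+ r₂)
    position k = Fin.join r₂ r₂ (proj₁ (slot (toℕ k)))

    position-injective : ∀ {i j} → position i ≡ position j → i ≡ j
    position-injective {i} {j} e = Fin.toℕ-injective (≡.trans (≡.sym (ℕ.m<n⇒m%n≡m (Fin.toℕ<n i)))
        (≡.trans (η-distinct d m md≡p-1 {toℕ i} {toℕ j} same) (ℕ.m<n⇒m%n≡m (Fin.toℕ<n j))))
      where
      slots : proj₁ (slot (toℕ i)) ≡ proj₁ (slot (toℕ j))
      slots = ≡.trans (≡.sym (Fin.splitAt-join r₂ r₂ _)) (≡.trans (≡.cong (Fin.splitAt r₂) e) (Fin.splitAt-join r₂ r₂ _))
      same : ∀ k → period (toℕ i ℕ.+ k) ≈ᶜ period (toℕ j ℕ.+ k)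
      same k = ℂR.trans (ℂR.reflexive (index-comm k (toℕ i))) (ℂR.trans (ℂR.sym (ψ-conjugates (toℕ i) k))
        (ℂR.trans (proj₂ (slot (toℕ i)) (conjugates k)) (ℂR.trans (ℂR.reflexive (≡.cong (λ y → value y (conjugates k)) slots))
          (ℂR.trans (ℂR.sym (proj₂ (slot (toℕ j)) (conjugates k))) (ℂR.trans (ψ-conjugates (toℕ j) k) (ℂR.reflexive (≡.sym (index-comm k (toℕ j)))))))))

    private
      count : r₁ ℕ.+ (r₂ ℕ.+ r₂) ≡ d
      count = ≡.trans (≡.cong (λ n → r₁ ℕ.+ (r₂ ℕ.+ n)) (≡.sym (ℕ.+-identityʳ r₂))) (≡.trans (≡.sym degree′) s≡d)
        where degree′ = CanonicalEmbedding.degree E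

    -- `position` injects the d embeddings `ψ` into the 2r₂ complex slots, while r₁ + 2r₂ = d.
    r₁≡0 : r₁ ≡ 0
    r₁≡0 = ℕ.n≤0⇒n≡0 (ℕ.+-cancelʳ-≤ (r₂ ℕ.+ r₂) r₁ 0 (≡.subst (ℕ._≤ r₂ ℕ.+ r₂) (≡.sym count) (Fin.injective⇒≤ {f = position} position-injective)))

    d≡2r₂ : d ≡ r₂ ℕ.+ r₂
    d≡2r₂ = ≡.trans (≡.sym count) (≡.cong (ℕ._+ (r₂ ℕ.+ r₂)) r₁≡0)

    dimension : r₁ ℕ.+ r₂ ℕ.* 2 ≡ s
    dimension = ≡.trans (≡.cong (r₁ ℕ.+_) (ℕ.*-comm r₂ 2)) (≡.sym (CanonicalEmbedding.degree E))

    hermitian : ℂ → ℂ → ℝ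
    hermitian z w = re (z *ᶜ conjugate w)

    dot-σ : ∀ x y → dot (σ x) (σ y) ≃ sum (λ i → hermitian (complex i x) (complex i y))
    dot-σ x y = trans (sum-cong-≋ {r₁ ℕ.+ r₂ ℕ.* 2} (λ i → by-part (Fin.splitAt r₁ i)))
      (trans (sum-splitAt r₁ {r₂ ℕ.* 2} parts) (trans (+-cong (vacuous r₁ r₁≡0 (λ i → parts (inj₁ i)))
        (sum-quotRem r₂ 2 (λ kj → pair x (proj₂ kj) (proj₁ kj) * pair y (proj₂ kj) (proj₁ kj))))
        (trans (+-identityˡ _) (sum-cong-≋ {r₂} term))))
      where
      pair : K-Element → Fin r₂ → Vector ℝ 2
      pair x i = re (complex i x) ∷ im (complex i x) ∷ []
      part : K-Element → Fin r₁ ⊎ Fin (r₂ ℕ.* 2) → ℝ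
      part x = [ (λ i → re (real i x)) , Data.Vec.Functional.concat (pair x) ]′
      parts : Fin r₁ ⊎ Fin (r₂ ℕ.* 2) → ℝ
      parts y′ = part x y′ * part y y′
      by-part : ∀ s → part x s * part y s ≃ parts s
      by-part s = refl
      vacuous : ∀ n → n ≡ 0 → (f : Vector ℝ n) → sum f ≃ fromℚ 0ℚ
      vacuous .0 ≡.refl f = refl
      term : ∀ i → sum (λ k → pair x i k * pair y i k) ≃ hermitian (complex i x) (complex i y)
      term i = trans (+-congˡ (+-identityʳ _)) (solve 4 (λ a b c d → a :* c :+ b :* d := a :* c :+ :- (b :* :- d)) refl
        (re (complex i x)) (im (complex i x)) (re (complex i y)) (im (complex i y)))

    -- The canonical embedding keeps one of each conjugate pair, whereas the sum over all ψ counts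
    -- both, with equal real parts. This is the source of the factor ½ in every inner product below.
    double-dot : ∀ x y → dot (σ x) (σ y) + dot (σ x) (σ y) ≃ Σ< d (λ k → hermitian (ψ k x) (ψ k y))
    double-dot x y = sym (begin
      sum {d} (λ k → hermitian (ψ (toℕ k) x) (ψ (toℕ k) y))    ≈⟨ sum-cong-≋ {d} located ⟩
      sum {d} (λ k → F (Fin.splitAt r₂ (position k)))          ≈⟨ sum-injective d≡2r₂ position position-injective (λ i → F (Fin.splitAt r₂ i)) ⟩
      sum {r₂ ℕ.+ r₂} (λ i → F (Fin.splitAt r₂ i))             ≈⟨ sum-splitAt r₂ {r₂} F ⟩
      sum {r₂} (λ i → F (inj₁ i)) + sum {r₂} (λ i → F (inj₂ i))
        ≈⟨ +-congˡ {sum {r₂} (λ i → F (inj₁ i))} (sum-cong-≋ {r₂} (λ i → conjugated (complex i x) (complex i y))) ⟩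
      sum {r₂} (λ i → F (inj₁ i)) + sum {r₂} (λ i → F (inj₁ i)) ≈⟨ sym (+-cong (dot-σ x y) (dot-σ x y)) ⟩
      dot (σ x) (σ y) + dot (σ x) (σ y)                        ∎)
      where
      F : Fin r₂ ⊎ Fin r₂ → ℝ
      F s = hermitian (value s x) (value s y)
      hermitian-cong : ∀ {z z′ w w′} → z ≈ᶜ z′ → w ≈ᶜ w′ → hermitian z w ≃ hermitian z′ w′
      hermitian-cong e f = re≃ (ℂR.*-cong e (conjugate-cong f))
      located : ∀ k → hermitian (ψ (toℕ k) x) (ψ (toℕ k) y) ≃ F (Fin.splitAt r₂ (position k))
      located k = trans (hermitian-cong (proj₂ (slot (toℕ k)) x) (proj₂ (slot (toℕ k)) y))
        (reflexive (≡.cong F (≡.sym (Fin.splitAt-join r₂ r₂ (proj₁ (slot (toℕ k)))))))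
      conjugated : ∀ z w → hermitian (conjugate z) (conjugate w) ≃ hermitian z w
      conjugated (a +i b) (c +i d) = solve 4 (λ a b c d → a :* c :+ :- (:- b :* :- (:- d)) := a :* c :+ :- (b :* :- d)) refl a b c d

    conjugate-gram : ∀ a b → dot (σ (conjugates a)) (σ (conjugates b)) + dot (σ (conjugates a)) (σ (conjugates b)) ≃ re (pairing d m md≡p-1 a b)
    conjugate-gram a b = trans (double-dot (conjugates a) (conjugates b)) (trans
      (sum-cong-≋ {d} (λ k → re≃ (ℂR.*-cong (ψ-conjugates (toℕ k) a) (conjugate-cong (ψ-conjugates (toℕ k) b)))))
      (reflexive (≡.sym (re-sum {d} (λ k → period (a ℕ.+ toℕ k) *ᶜ conjugate (period (b ℕ.+ toℕ k)))))))

    gram-diagonal : ∀ a → dot (σ (conjugates a)) (σ (conjugates a)) + dot (σ (conjugates a)) (σ (conjugates a)) ≃ ι (+ p) + - ι (+ m)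
    gram-diagonal a = trans (conjugate-gram a a) (trans (re≃ (pairing-diagonal d m md≡p-1 a))
      (reflexive (≡.cong₂ (λ x y → x + - y) (re-ι (+ p)) (re-ι (+ m)))))

    gram-off : ∀ {a b} → a ℕ.< s → b ℕ.< s → a ≢ b →
               dot (σ (conjugates a)) (σ (conjugates b)) + dot (σ (conjugates a)) (σ (conjugates b)) ≃ - ι (+ m)
    gram-off {a} {b} a<s b<s a≢b = trans (conjugate-gram a b) (trans (re≃ (pairing-off d m md≡p-1 a b (λ e →
        a≢b (≡.trans (≡.sym (ℕ.m<n⇒m%n≡m (≡.subst (a ℕ.<_) s≡d a<s))) (≡.trans e (ℕ.m<n⇒m%n≡m (≡.subst (b ℕ.<_) s≡d b<s)))))))
      (reflexive (≡.cong -_ (re-ι (+ m)))))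

    e : Fin s → Vector ℝ (r₁ ℕ.+ r₂ ℕ.* 2)
    e i = σ (conjugates (toℕ i))

    σ-coordinates : ∀ (a : Vector ℤ s) x → proj₁ x ≈ᶜ proj₁ (fromCoordinates K θ t a) →
                    ∀ j → σ x j ≃ sum (λ i → fromℤ (a i) * e i j)
    σ-coordinates a x x≈ j = by-part (Fin.splitAt r₁ j)
      where
      expand : ∀ {f} → KH.Hom f → f x ≈ᶜ ℂR.sum (λ i → ℚ→ℂ (ιℚ (a i)) *ᶜ f (conjugates (toℕ i)))
      expand H = KH.hom-linear H (λ i → ιℚ (a i)) (λ i → conjugates (toℕ i)) x
        (ℂR.trans x≈ (ℂR.trans (coordinates-value a) (ℂR.sum-cong-≋ {s} (λ i →
          ℂR.*-cong (ℂR.sym (ℚ→ℂ-ι (a i))) (ℂR.sym (conjugates≈period (toℕ i)))))))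
      scale-re : ∀ z w → re (ℚ→ℂ (ιℚ z) *ᶜ w) ≃ fromℤ z * re w
      scale-re z w = trans (solve 3 (λ a b c → a :* b :+ :- (con 0ℤ :* c) := a :* b) refl (fromℚ (ιℚ z)) (re w) (im w)) (*-congʳ {re w} (sym (fromℤ≃ z)))
      scale-im : ∀ z w → im (ℚ→ℂ (ιℚ z) *ᶜ w) ≃ fromℤ z * im w
      scale-im z w = trans (solve 3 (λ a b c → a :* c :+ con 0ℤ :* b := a :* c) refl (fromℚ (ιℚ z)) (re w) (im w)) (*-congʳ {im w} (sym (fromℤ≃ z)))
      re-part : ∀ {f} → KH.Hom f → re (f x) ≃ sum (λ i → fromℤ (a i) * re (f (conjugates (toℕ i))))
      re-part {f} H = trans (re≃ (expand H)) (trans (reflexive (re-sum {s} (λ i → ℚ→ℂ (ιℚ (a i)) *ᶜ f (conjugates (toℕ i)))))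
        (sum-cong-≋ {s} (λ i → scale-re (a i) (f (conjugates (toℕ i))))))
      im-part : ∀ {f} → KH.Hom f → im (f x) ≃ sum (λ i → fromℤ (a i) * im (f (conjugates (toℕ i))))
      im-part {f} H = trans (im≃ (expand H)) (trans (reflexive (im-sum {s} (λ i → ℚ→ℂ (ιℚ (a i)) *ᶜ f (conjugates (toℕ i)))))
        (sum-cong-≋ {s} (λ i → scale-im (a i) (f (conjugates (toℕ i))))))
      part : K-Element → Fin r₁ ⊎ Fin (r₂ ℕ.* 2) → ℝ
      part x = [ (λ i → re (real i x)) , Data.Vec.Functional.concat (λ i → re (complex i x) ∷ im (complex i x) ∷ []) ]′
      pair : ∀ k i → (re (complex i x) ∷ im (complex i x) ∷ []) k ≃
                     sum (λ l → fromℤ (a l) * (re (complex i (conjugates (toℕ l))) ∷ im (complex i (conjugates (toℕ l))) ∷ []) k)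
      pair zero       i = re-part (KH.embedding⇒Hom (complex-emb i))
      pair (suc zero) i = im-part (KH.embedding⇒Hom (complex-emb i))
      by-part : ∀ y → part x y ≃ sum (λ i → fromℤ (a i) * part (conjugates (toℕ i)) y)
      by-part (inj₁ i) = re-part (KH.embedding⇒Hom (real-emb i))
      by-part (inj₂ y) = pair (proj₁ (Fin.quotRem {r₂} 2 y)) (proj₂ (Fin.quotRem {r₂} 2 y))

    module _ (α : ℤ) where
      Conditions : Vector ℤ s → Set
      Conditions a = ∀ i → i ℕ.≤ s ℕ./ 2 → + p ℤ.∣ dotℤ a (μ s α i)

      image⇒ : ∀ v → image (𝓜 p s K θ t α) v → ∃ λ a → v ≋ combination (λ i → fromℤ (a i)) e × Conditions a
      image⇒ v (x , (_ , a , x≈ , cond) , v≋) = a , (λ j → unwrap (trans {v j} {σ x j} (wrap (v≋ j)) (σ-coordinates a x x≈ j))) , cond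

      ⇒image : ∀ v a → v ≋ combination (λ i → fromℤ (a i)) e → Conditions a → image (𝓜 p s K θ t α) v
      ⇒image v a v≋ cond = x , (coordinates-integral a , a , ℂR.refl , cond) , λ j → unwrap (trans {v j} {combination (λ i → fromℤ (a i)) e j} (wrap (v≋ j)) (sym (σ-coordinates a x ℂR.refl j)))
        where
        x : K-Element
        x = fromCoordinates K θ t a

-- The code lattice

Σℤ : ∀ {n} → Vector ℤ n → ℤ
Σℤ = ℤR.sum

squares : ∀ {n} → Vector ℤ n → ℤ
squares a = Σℤ λ i → a i ℤ.* a i

0≤-square-ℤ : ∀ x → 0ℤ ℤ.≤ x ℤ.* x
0≤-square-ℤ (+ n)    = ≡.subst (0ℤ ℤ.≤_) (ℤ.pos-* n n) (ℤ.+≤+ z≤n)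
0≤-square-ℤ -[1+ n ] = ℤ.+≤+ z≤n

0≤-Σℤ : ∀ {n} (f : Vector ℤ n) → (∀ i → 0ℤ ℤ.≤ f i) → 0ℤ ℤ.≤ Σℤ f
0≤-Σℤ {zero}  f h = ℤ.≤-refl
0≤-Σℤ {suc n} f h = ℤ.+-mono-≤ (h zero) (0≤-Σℤ (f ∘ suc) (h ∘ suc))

term≤Σℤ : ∀ {n} (f : Vector ℤ n) → (∀ i → 0ℤ ℤ.≤ f i) → ∀ i → f i ℤ.≤ Σℤ f
term≤Σℤ {suc n} f h zero    = ≡.subst (ℤ._≤ Σℤ f) (ℤ.+-identityʳ (f zero)) (ℤ.+-monoʳ-≤ (f zero) (0≤-Σℤ (f ∘ suc) (h ∘ suc)))
term≤Σℤ {suc n} f h (suc i) = ≡.subst (ℤ._≤ Σℤ f) (ℤ.+-identityˡ (f (suc i))) (ℤ.+-mono-≤ (h zero) (term≤Σℤ (f ∘ suc) (h ∘ suc) i))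

-- Putting x in front of a′ increases the difference by the sum of the squares of a′ᵢ - x, one row
-- of Lagrange's identity.
cauchy-schwarz : ∀ {n} (a : Vector ℤ n) → 0ℤ ℤ.≤ + n ℤ.* squares a ℤ.+ ℤ.- (Σℤ a ℤ.* Σℤ a)
cauchy-schwarz {zero}  a = ℤ.≤-refl
cauchy-schwarz {suc n} a = ≡.subst (0ℤ ℤ.≤_) (≡.sym expand)
    (ℤ.+-mono-≤ (cauchy-schwarz a′) (0≤-Σℤ (λ i → (a′ i ℤ.+ ℤ.- x) ℤ.* (a′ i ℤ.+ ℤ.- x)) (λ i → 0≤-square-ℤ (a′ i ℤ.+ ℤ.- x))))
  where
  open ℤR using (solve; _:+_; _:*_; :-_; _:=_; con)
  x = a zero
  a′ : Vector ℤ n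
  a′ = a ∘ suc
  deviations : ∀ {n} (b : Vector ℤ n) → Σℤ (λ i → (b i ℤ.+ ℤ.- x) ℤ.* (b i ℤ.+ ℤ.- x)) ≡ + n ℤ.* (x ℤ.* x) ℤ.+ squares b ℤ.+ ℤ.- (+ 2 ℤ.* x ℤ.* Σℤ b)
  deviations {zero}  b = solve 1 (λ x → con 0ℤ := con 0ℤ :* (x :* x) :+ con 0ℤ :+ :- (con (+ 2) :* x :* con 0ℤ)) ≡.refl x
  deviations {suc n} b = ≡.trans (≡.cong (λ t → (b zero ℤ.+ ℤ.- x) ℤ.* (b zero ℤ.+ ℤ.- x) ℤ.+ t) (deviations (b ∘ suc)))
    (solve 5 (λ y x n S T → (y :+ :- x) :* (y :+ :- x) :+ (n :* (x :* x) :+ S :+ :- (con (+ 2) :* x :* T))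
                         := (con 1ℤ :+ n) :* (x :* x) :+ (y :* y :+ S) :+ :- (con (+ 2) :* x :* (y :+ T))) ≡.refl
        (b zero) x (+ n) (squares (b ∘ suc)) (Σℤ (b ∘ suc)))
  expand : + suc n ℤ.* squares a ℤ.+ ℤ.- (Σℤ a ℤ.* Σℤ a) ≡
           (+ n ℤ.* squares a′ ℤ.+ ℤ.- (Σℤ a′ ℤ.* Σℤ a′)) ℤ.+ Σℤ (λ i → (a′ i ℤ.+ ℤ.- x) ℤ.* (a′ i ℤ.+ ℤ.- x))
  expand = ≡.trans (solve 4 (λ n x S T → (con 1ℤ :+ n) :* (x :* x :+ S) :+ :- ((x :+ T) :* (x :+ T))
                              := (n :* S :+ :- (T :* T)) :+ (n :* (x :* x) :+ S :+ :- (con (+ 2) :* x :* T))) ≡.refl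
                      (+ n) x (squares a′) (Σℤ a′))
                   (≡.cong (λ t → (+ n ℤ.* squares a′ ℤ.+ ℤ.- (Σℤ a′ ℤ.* Σℤ a′)) ℤ.+ t) (≡.sym (deviations a′)))

module _ {n} (P : Vector ℤ n → Set) (P? : ∀ a → Dec (P a)) (q : Vector ℤ n → ℕ)
         (P-resp : ∀ {a b} → (∀ i → a i ≡ b i) → P a → P b) (q-resp : ∀ {a b} → (∀ i → a i ≡ b i) → q a ≡ q b)
         (box : ∀ a → P a → ∀ i → ℤ.∣ a i ∣ ℕ.≤ q a) where

  private
    bounded? : ∀ B {R : ℤ → Set} → (∀ x → Dec (R x)) → Dec (∃ λ x → ℤ.∣ x ∣ ℕ.≤ B × R x)
    bounded? B {R} R? with ℕ.anyUpTo? (λ k → R? (+ k)) (suc B) | ℕ.anyUpTo? (λ k → R? (ℤ.- + k)) (suc B)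
    ... | yes (k , k≤B , r) | _                 = yes (+ k , ℕ.s≤s⁻¹ k≤B , r)
    ... | no _              | yes (k , k≤B , r) = yes (ℤ.- + k , ≡.subst (ℕ._≤ B) (≡.sym (ℤ.∣-i∣≡∣i∣ (+ k))) (ℕ.s≤s⁻¹ k≤B) , r)
    ... | no none⁺          | no none⁻          = no λ
      { (+ k , k≤B , r)      → none⁺ (k , s≤s k≤B , r)
      ; (-[1+ k ] , k≤B , r) → none⁻ (suc k , s≤s k≤B , r)
      }

    box? : ∀ B {n} {R : Vector ℤ n → Set} → (∀ {a b} → (∀ i → a i ≡ b i) → R a → R b) → (∀ a → Dec (R a)) →
           Dec (∃ λ a → (∀ i → ℤ.∣ a i ∣ ℕ.≤ B) × R a)
    box? B {zero}  {R} R-resp R? with R? (λ ())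
    ... | yes r = yes ((λ ()) , (λ ()) , r)
    ... | no ¬r = no λ (a , _ , r) → ¬r (R-resp (λ ()) r)
    box? B {suc n} {R} R-resp R?
      with bounded? B (λ x → box? B {n} {λ a → R (x ∷ a)} (λ e → R-resp (λ { zero → ≡.refl ; (suc i) → e i })) (λ a → R? (x ∷ a)))
    ... | yes (x , x≤B , a , a≤B , r) = yes (x ∷ a , (λ { zero → x≤B ; (suc i) → a≤B i }) , r)
    ... | no none = no λ (a , a≤B , r) → none (a zero , a≤B zero , a ∘ suc , a≤B ∘ suc , R-resp (λ { zero → ≡.refl ; (suc i) → ≡.refl }) r)

  -- By `box` the vectors with value k have entries of absolute value at most k, so whether k is
  -- attained is a finite search, and the least attained k is taken. Vectors are functions without
  -- extensionality, hence the demand that P and q respect pointwise equality.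
  minimum : ∀ a → P a → ∃ λ b → P b × (∀ c → P c → q b ℕ.≤ q c)
  minimum a Pa = extract (least attained? (q a) (a , box a Pa , Pa , ≡.refl))
    where
    Attained : ℕ → Set
    Attained k = ∃ λ a → (∀ i → ℤ.∣ a i ∣ ℕ.≤ k) × P a × q a ≡ k
    attained? : ∀ k → Dec (Attained k)
    attained? k = box? k {n} {λ a → P a × q a ≡ k} (λ e (r , eq) → P-resp e r , ≡.trans (≡.sym (q-resp e)) eq) both?
      where
      both? : ∀ a → Dec (P a × q a ≡ k)
      both? a with P? a | q a ℕ.≟ k
      ... | yes r | yes e = yes (r , e)
      ... | no ¬r | _     = no (¬r ∘ proj₁)
      ... | yes _ | no ¬e = no (¬e ∘ proj₂)
    extract : (∃ λ k → Attained k × (∀ j → j ℕ.< k → ¬ Attained j)) → ∃ λ b → P b × (∀ c → P c → q b ℕ.≤ q c)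
    extract (k , (b , _ , Pb , qb≡k) , minimal) = b , Pb , λ c Pc →
      ℕ.≮⇒≥ λ qc<qb → minimal (q c) (≡.subst (q c ℕ.<_) qb≡k qc<qb) (c , box c Pc , Pc , ≡.refl)

-- Unitriangular systems over the integers

-- A diagonal of ones lets the substitution run without division, so the solution stays integral.
triangular-solve : ∀ {n} (N : Fin n → Fin n → ℤ) → (∀ {k j} → k Fin.< j → N k j ≡ 0ℤ) → (∀ k → N k k ≡ 1ℤ) →
                   ∀ (a : Vector ℤ n) → ∃ λ (c : Vector ℤ n) → ∀ j → a j ≡ Σℤ (λ k → c k ℤ.* N k j)
triangular-solve {zero}  N tri unit a = a , λ ()
triangular-solve {suc n} N tri unit a = c , λ { zero → first ; (suc j) → later j }
  where
  rest = triangular-solve (λ k j → N (suc k) (suc j)) (λ k<j → tri (s≤s k<j)) (λ k → unit (suc k)) (a ∘ suc)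
  r = Σℤ (λ k → proj₁ rest k ℤ.* N (suc k) zero)
  c : Vector ℤ (suc n)
  c = (a zero ℤ.+ ℤ.- r) ∷ proj₁ rest
  first : a zero ≡ (a zero ℤ.+ ℤ.- r) ℤ.* N zero zero ℤ.+ r
  first = ≡.sym (≡.trans (≡.cong (λ t → (a zero ℤ.+ ℤ.- r) ℤ.* t ℤ.+ r) (unit zero))
    (ℤR.solve 2 (λ a r → (a ℤR.:+ ℤR.:- r) ℤR.:* ℤR.con 1ℤ ℤR.:+ r ℤR.:= a) ≡.refl (a zero) r))
  later : ∀ j → a (suc j) ≡ (a zero ℤ.+ ℤ.- r) ℤ.* N zero (suc j) ℤ.+ Σℤ (λ k → proj₁ rest k ℤ.* N (suc k) (suc j))
  later j = ≡.trans (proj₂ rest j) (≡.sym (≡.trans (≡.cong (λ t → (a zero ℤ.+ ℤ.- r) ℤ.* t ℤ.+ S) (tri {zero} {suc j} (s≤s z≤n)))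
    (ℤR.solve 2 (λ a S → a ℤR.:* ℤR.con 0ℤ ℤR.:+ S ℤR.:= S) ≡.refl (a zero ℤ.+ ℤ.- r) S)))
    where S = Σℤ (λ k → proj₁ rest k ℤ.* N (suc k) (suc j))

module CodeLattice (p : ℕ) (pr : Prime p) (s h m m′ : ℕ) (s≡2h : s ≡ h ℕ.+ h) (ms≡p-1 : m ℕ.* s ≡ p ∸ 1)
                   (m≡1+2m′ : m ≡ suc (m′ ℕ.+ m′)) (α : ℤ) (ord : Units.HasOrder p pr α s) where
  open Units p pr
  private
    module M = ℤ/pR
    module F = RangeSums ℤ/p

  instance
    s-nonZero : NonZero s
    s-nonZero = ℕ.≢-nonZero λ s≡0 → ℕ.≢-nonZero⁻¹ (p ∸ 1) (≡.trans (≡.sym ms≡p-1) (≡.trans (≡.cong (m ℕ.*_) s≡0) (ℕ.*-zeroʳ m)))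

  α-unit : Unit α
  α-unit = order-unit {α} {s} (proj₁ ord)

  p≡1+ms : + p ≡ 1ℤ ℤ.+ + m ℤ.* + s
  p≡1+ms = ≡.trans (≡.cong +_ p≡1+[p-1]) (≡.cong (λ t → 1ℤ ℤ.+ t) (≡.trans (≡.cong +_ (≡.sym ms≡p-1)) (ℤ.pos-* m s)))

  Q : Vector ℤ s → ℤ
  Q a = + p ℤ.* squares a ℤ.+ ℤ.- (+ m ℤ.* (Σℤ a ℤ.* Σℤ a))

  -- Since p = 1 + m s, Q is the sum of squares plus m times the Cauchy-Schwarz defect. This gives
  -- both the positivity of Q and the bound on entries that makes the search for a shortest vector
  -- finite.
  squares≤Q : ∀ a → squares a ℤ.≤ Q a
  squares≤Q a = ≡.subst₂ ℤ._≤_ (ℤ.+-identityʳ (squares a)) (≡.sym expand)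
      (ℤ.+-monoʳ-≤ (squares a) (≡.subst (ℤ._≤ + m ℤ.* D) (ℤ.*-zeroʳ (+ m)) (ℤ.*-monoˡ-≤-nonNeg (+ m) (cauchy-schwarz a))))
    where
    open ℤR using (solve; _:+_; _:*_; :-_; _:=_; con)
    D = + s ℤ.* squares a ℤ.+ ℤ.- (Σℤ a ℤ.* Σℤ a)
    expand : Q a ≡ squares a ℤ.+ + m ℤ.* D
    expand = ≡.trans (≡.cong (λ k → k ℤ.* squares a ℤ.+ ℤ.- (+ m ℤ.* (Σℤ a ℤ.* Σℤ a))) p≡1+ms)
      (solve 4 (λ m s S T → (con 1ℤ :+ m :* s) :* S :+ :- (m :* T) := S :+ m :* (s :* S :+ :- T)) ≡.refl (+ m) (+ s) (squares a) (Σℤ a ℤ.* Σℤ a))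

  entry≤Q : ∀ a i → ℤ.∣ a i ∣ ℕ.≤ ℤ.∣ Q a ∣
  entry≤Q a i = ℕ.≤-trans (n≤n² ℤ.∣ a i ∣) (≡.subst₂ ℕ._≤_ (ℤ.abs-* (a i) (a i)) ≡.refl
    (absolute (0≤-square-ℤ (a i)) (ℤ.≤-trans (term≤Σℤ (λ i → a i ℤ.* a i) (λ i → 0≤-square-ℤ (a i)) i) (squares≤Q a))))
    where
    n≤n² : ∀ n → n ℕ.≤ n ℕ.* n
    n≤n² zero    = z≤n
    n≤n² (suc n) = ℕ.m≤m+n (suc n) _
    absolute : ∀ {x y} → 0ℤ ℤ.≤ x → x ℤ.≤ y → ℤ.∣ x ∣ ℕ.≤ ℤ.∣ y ∣
    absolute {+ x} {+ y} _ (ℤ.+≤+ x≤y) = x≤y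

  -- The discrete Fourier transform modulo p

  spectrum : Vector ℤ s → ℕ → ℤ
  spectrum a i = Σℤ λ j → a j ℤ.* α M.^ (toℕ j ℕ.* i)

  Conditions : Vector ℤ s → Set
  Conditions a = ∀ i → i ℕ.≤ h → spectrum a i ≡ₚ 0ℤ

  private
    -- Represents α^((j - l) k), with s - k in place of -k so that all exponents are natural
    -- numbers.
    kernel-term : ℕ → ℕ → ℕ → ℤ
    kernel-term j l k = α M.^ (j ℕ.* k) ℤ.* α M.^ (l ℕ.* (s ∸ k))

    α^s : ∀ j → α M.^ (j ℕ.* s) ≡ₚ 1ℤ
    α^s = ^-multiple {α} {s} (proj₁ ord)

    kernel-diagonal : ∀ j → F.Σ< s (kernel-term j j) ≡ₚ + s
    kernel-diagonal j = M.trans (F.Σ<-cong s (λ k k<s → M.trans (M.sym (M.^-homo-* α (j ℕ.* k) (j ℕ.* (s ∸ k))))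
        (M.trans (M.^-congʳ α (≡.trans (≡.sym (ℕ.*-distribˡ-+ j k (s ∸ k))) (≡.cong (j ℕ.*_) (ℕ.m+[n∸m]≡n (ℕ.<⇒≤ k<s))))) (α^s j))))
      (M.trans (F.Σ<-const s 1ℤ) (M.trans (M.*-identityʳ (M.ι (+ s))) (M.reflexive (ι-ℤ s))))
      where
      ι-ℤ : ∀ n → M.ι (+ n) ≡ + n
      ι-ℤ zero    = ≡.refl
      ι-ℤ (suc n) = ≡.cong (λ t → 1ℤ ℤ.+ t) (ι-ℤ n)

    -- Shifting the summation index exchanges a factor α^l for a factor α^j, and the two ends of the
    -- range agree because α^s = 1. So α^l - α^j annihilates the sum, and it is a unit because α has
    -- order s.
    kernel-off : ∀ j l → j ℕ.< s → l ℕ.< s → j ≢ l → F.Σ< s (kernel-term j l) ≡ₚ 0ℤ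
    kernel-off j l j<s l<s j≢l = unit-cancel {α M.^ l ℤ.+ ℤ.- α M.^ j} {T} {0ℤ} difference-unit
        (M.trans (M.trans (M.distribʳ T (α M.^ l) (ℤ.- α M.^ j)) (M.trans (M.+-cong shifted (M.sym (M.-‿distribˡ-* (α M.^ j) T))) (M.x-x≈0 (α M.^ j ℤ.* T))))
          (M.sym (M.zeroʳ (α M.^ l ℤ.+ ℤ.- α M.^ j))))
      where
      T = F.Σ< s (kernel-term j l)
      difference-unit : Unit (α M.^ l ℤ.+ ℤ.- α M.^ j)
      difference-unit e = j≢l (≡.trans (≡.sym (ℕ.m<n⇒m%n≡m j<s)) (≡.trans (≡.sym (order-%≡ {α} {s} α-unit ord {l} {j} (M.x-y≈0⇒x≈y e))) (ℕ.m<n⇒m%n≡m l<s)))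
      step : ∀ k → k ℕ.< s → α M.^ l ℤ.* kernel-term j l (suc k) ≡ₚ α M.^ j ℤ.* kernel-term j l k
      step k k<s = M.trans (M.solve 3 (λ x y z → x M.:* (y M.:* z) M.:= y M.:* (x M.:* z)) M.refl (α M.^ l) (α M.^ (j ℕ.* suc k)) (α M.^ (l ℕ.* (s ∸ suc k))))
        (M.trans (M.*-cong (M.trans (M.^-congʳ α (ℕ.*-suc j k)) (M.^-homo-* α j (j ℕ.* k)))
            (M.trans (M.sym (M.^-homo-* α l (l ℕ.* (s ∸ suc k)))) (M.^-congʳ α (≡.trans (≡.sym (ℕ.*-suc l (s ∸ suc k))) (≡.cong (l ℕ.*_) (≡.sym (ℕ.+-∸-assoc 1 k<s)))))))
          (M.*-assoc (α M.^ j) (α M.^ (j ℕ.* k)) (α M.^ (l ℕ.* (s ∸ k)))))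
      ends : kernel-term j l s ≡ₚ kernel-term j l 0
      ends = M.trans (M.*-cong (α^s j) (M.^-congʳ α (≡.trans (≡.cong (l ℕ.*_) (ℕ.n∸n≡0 s)) (ℕ.*-zeroʳ l))))
        (M.sym (M.*-cong (M.^-congʳ α (ℕ.*-zeroʳ j)) (α^s l)))
      shift : F.Σ< s (λ k → kernel-term j l (suc k)) ≡ₚ T
      shift = M.trans (M.solve 2 (λ x y → x M.:= (y M.:+ x) M.:+ M.:- y) M.refl (F.Σ< s (λ k → kernel-term j l (suc k))) (kernel-term j l 0))
        (M.trans (M.+-cong (F.Σ<-last s (kernel-term j l)) (M.-‿cong (M.sym ends)))
          (M.solve 2 (λ x y → (x M.:+ y) M.:+ M.:- y M.:= x) M.refl T (kernel-term j l s)))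
      shifted : α M.^ l ℤ.* T ≡ₚ α M.^ j ℤ.* T
      shifted = M.trans (M.*-congˡ {α M.^ l} (M.sym shift)) (M.trans (M.*-distribˡ-sum {s} (α M.^ l) (λ k → kernel-term j l (suc (toℕ k))))
        (M.trans (F.Σ<-cong s step) (M.sym (M.*-distribˡ-sum {s} (α M.^ j) (λ k → kernel-term j l (toℕ k))))))

  -- Parseval's identity in bilinear form: modulo p the opposite frequency s - k takes the place of
  -- complex conjugation.
  parseval : ∀ a → F.Σ< s (λ k → spectrum a k ℤ.* spectrum a (s ∸ k)) ≡ₚ + s ℤ.* squares a
  parseval a = M.begin
    F.Σ< s (λ k → spectrum a k ℤ.* spectrum a (s ∸ k))                                M.≈⟨ F.Σ<-cong s (λ k _ → product k) ⟩
    F.Σ< s (λ k → M.sum {s} λ j → M.sum {s} λ l → term k j l)                          M.≈⟨ M.∑-comm {s} {s} (λ k j → M.sum {s} λ l → term (toℕ k) j l) ⟩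
    M.sum {s} (λ j → F.Σ< s (λ k → M.sum {s} λ l → term k j l))                        M.≈⟨ M.sum-cong-≋ {s} (λ j → M.∑-comm {s} {s} (λ k l → term (toℕ k) j l)) ⟩
    M.sum {s} (λ j → M.sum {s} λ l → F.Σ< s (λ k → term k j l))
      M.≈⟨ M.sum-cong-≋ {s} (λ j → M.sum-cong-≋ {s} (λ l → M.sym (M.*-distribˡ-sum {s} (a j ℤ.* a l) (λ k → kernel-term (toℕ j) (toℕ l) (toℕ k))))) ⟩
    M.sum {s} (λ j → M.sum {s} λ l → (a j ℤ.* a l) ℤ.* F.Σ< s (kernel-term (toℕ j) (toℕ l)))
      M.≈⟨ M.sum-cong-≋ {s} (λ j → M.trans (M.sum-single j (λ l → (a j ℤ.* a l) ℤ.* F.Σ< s (kernel-term (toℕ j) (toℕ l))) (off j))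
             (M.trans (M.*-congˡ {a j ℤ.* a j} (kernel-diagonal (toℕ j))) (M.*-comm (a j ℤ.* a j) (+ s)))) ⟩
    M.sum {s} (λ j → + s ℤ.* (a j ℤ.* a j))                                            M.≈⟨ M.sym (M.*-distribˡ-sum {s} (+ s) (λ j → a j ℤ.* a j)) ⟩
    + s ℤ.* squares a                                                                  M.∎
    where
    term : ℕ → Fin s → Fin s → ℤ
    term k j l = (a j ℤ.* a l) ℤ.* kernel-term (toℕ j) (toℕ l) k
    product : ∀ k → spectrum a k ℤ.* spectrum a (s ∸ k) ≡ₚ M.sum {s} (λ j → M.sum {s} λ l → term k j l)
    product k = M.trans (M.*-distribʳ-sum {s} (spectrum a (s ∸ k)) (λ j → a j ℤ.* α M.^ (toℕ j ℕ.* k)))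
      (M.sum-cong-≋ {s} (λ j → M.trans (M.*-distribˡ-sum {s} (a j ℤ.* α M.^ (toℕ j ℕ.* k)) (λ l → a l ℤ.* α M.^ (toℕ l ℕ.* (s ∸ k))))
        (M.sum-cong-≋ {s} (λ l → M.solve 4 (λ a x b y → a M.:* x M.:* (b M.:* y) M.:= (a M.:* b) M.:* (x M.:* y)) M.refl
          (a j) (α M.^ (toℕ j ℕ.* k)) (a l) (α M.^ (toℕ l ℕ.* (s ∸ k)))))))
    off : ∀ j l → l ≢ j → (a j ℤ.* a l) ℤ.* F.Σ< s (kernel-term (toℕ j) (toℕ l)) ≡ₚ 0ℤ
    off j l l≢j = M.trans (M.*-congˡ {a j ℤ.* a l} (kernel-off (toℕ j) (toℕ l) (Fin.toℕ<n j) (Fin.toℕ<n l) (λ e → l≢j (≡.sym (Fin.toℕ-injective e))))) (M.zeroʳ (a j ℤ.* a l))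

  squares≡0 : ∀ a → Conditions a → squares a ≡ₚ 0ℤ
  squares≡0 a cond = unit-cancel {+ s} {squares a} {0ℤ} s-unit
    (M.trans (M.sym (parseval a)) (M.trans (M.sum-zero {s} _ (λ k → vanish (toℕ k) (Fin.toℕ<n k))) (M.sym (M.zeroʳ (+ s)))))
    where
    -- Modulo p the relation p = 1 + m s says that m s = -1.
    s-unit : Unit (+ s)
    s-unit e = unit-1 (M.trans (M.reflexive (≡.sym p-ms)) (M.+-cong p≡ₚ0 (M.-‿cong (M.trans (M.*-congˡ {+ m} e) (M.zeroʳ (+ m))))))
      where
      p-ms : + p ℤ.+ ℤ.- (+ m ℤ.* + s) ≡ 1ℤ
      p-ms = ≡.trans (≡.cong (λ t → t ℤ.+ ℤ.- (+ m ℤ.* + s)) p≡1+ms) (ℤR.solve 1 (λ t → (ℤR.con 1ℤ ℤR.:+ t) ℤR.:+ ℤR.:- t ℤR.:= ℤR.con 1ℤ) ≡.refl (+ m ℤ.* + s))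
    -- k and s - k add up to 2h, so one of them is at most h and falls under the conditions.
    vanish : ∀ k → k ℕ.< s → spectrum a k ℤ.* spectrum a (s ∸ k) ≡ₚ 0ℤ
    vanish k k<s = [ (λ k≤h → M.trans (M.*-congʳ {spectrum a (s ∸ k)} (cond k k≤h)) (M.zeroˡ (spectrum a (s ∸ k))))
                   , (λ h≤k → M.trans (M.*-congˡ {spectrum a k} (cond (s ∸ k) (ℕ.m≤n+o⇒m∸n≤o s k (≡.subst (ℕ._≤ k ℕ.+ h) (≡.sym s≡2h) (ℕ.+-monoˡ-≤ h h≤k))))) (M.zeroʳ (spectrum a k))) ]′ (ℕ.≤-total k h)

  sum≡0 : ∀ a → Conditions a → Σℤ a ≡ₚ 0ℤ
  sum≡0 a cond = M.trans (M.sum-cong-≋ {s} (λ j → M.sym (M.trans (M.*-congˡ {a j} (M.^-congʳ α (ℕ.*-zeroʳ (toℕ j)))) (M.*-identityʳ (a j))))) (cond 0 z≤n)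

  -- Q = p² (B - m A²) with Σ a = p A and Σ a² = p B, and B ≡ A ≡ m A² modulo 2.
  Q-divisible : ∀ a → Conditions a → ∃ λ k → Q a ≡ + 2 ℤ.* (+ p ℤ.* + p) ℤ.* k
  Q-divisible a cond = divide (sum≡0 a cond) (squares≡0 a cond)
    where
    module C2 = Congruence 2
    module M2 = C2.ℤ/pR
    open ℤR using (solve; _:+_; _:*_; :-_; _:=_; con)
    double : ∀ k → + (k ℕ.+ k) C2.≡ₚ 0ℤ
    double k = C2.congruent (+ k) (≡.trans (ℤ.pos-+ k k) (solve 1 (λ k → k :+ k := con 0ℤ :+ k :* con (+ 2)) ≡.refl (+ k)))
    odd≡1 : ∀ {n} k → n ≡ suc (k ℕ.+ k) → + n C2.≡ₚ 1ℤ
    odd≡1 k ≡.refl = M2.+-congˡ {1ℤ} (double k)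
    p-odd : p ≡ suc (m ℕ.* h ℕ.+ m ℕ.* h)
    p-odd = ≡.trans p≡1+[p-1] (≡.cong suc (≡.trans (≡.sym ms≡p-1) (≡.trans (≡.cong (m ℕ.*_) s≡2h) (ℕ.*-distribˡ-+ m h h))))
    square≡ : ∀ x → x ℤ.* x C2.≡ₚ x
    square≡ (+ n)    = natural n
      where
      natural : ∀ n → + n ℤ.* + n C2.≡ₚ + n
      natural zero    = M2.refl
      natural (suc n) = M2.trans (M2.solve 1 (λ n → (M2.con 1ℤ M2.:+ n) M2.:* (M2.con 1ℤ M2.:+ n) M2.:= M2.con 1ℤ M2.:+ n M2.:* n M2.:+ M2.con (+ 2) M2.:* n) M2.refl (+ n))
        (M2.trans (M2.+-cong (M2.+-congˡ {1ℤ} (natural n)) (M2.trans (M2.*-congʳ {+ n} (double 1)) (M2.zeroˡ (+ n)))) (M2.+-identityʳ (+ suc n)))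
    square≡ -[1+ n ] = M2.trans (square≡ (+ suc n)) (C2.congruent (+ suc n) (solve 1 (λ x → x := :- x :+ x :* con (+ 2)) ≡.refl (+ suc n)))
    divide : Σℤ a ≡ₚ 0ℤ → squares a ≡ₚ 0ℤ → ∃ λ k → Q a ≡ + 2 ℤ.* (+ p ℤ.* + p) ℤ.* k
    divide (congruent A eA) (congruent B eB) = quotient even , (≡.trans (≡.cong₂ (λ S T → + p ℤ.* S ℤ.+ ℤ.- (+ m ℤ.* (T ℤ.* T))) eB eA)
        (≡.trans (solve 4 (λ p m A B → p :* (con 0ℤ :+ B :* p) :+ :- (m :* ((con 0ℤ :+ A :* p) :* (con 0ℤ :+ A :* p))) := p :* p :* (B :+ :- (m :* (A :* A)))) ≡.refl (+ p) (+ m) A B)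
          (≡.trans (≡.cong (λ t → + p ℤ.* + p ℤ.* t) (C2._≡ₚ_.equality even))
            (solve 2 (λ p k → p :* p :* (con 0ℤ :+ k :* con (+ 2)) := con (+ 2) :* (p :* p) :* k) ≡.refl (+ p) (quotient even)))))
      where
      open C2._≡ₚ_ using (quotient)
      p≡1 : + p C2.≡ₚ 1ℤ
      p≡1 = odd≡1 (m ℕ.* h) p-odd
      times-p : ∀ X Y → Y ≡ 0ℤ ℤ.+ X ℤ.* + p → X C2.≡ₚ Y
      times-p X Y e = M2.trans (M2.sym (M2.trans (M2.*-congˡ {X} p≡1) (M2.*-identityʳ X))) (M2.trans (M2.sym (M2.+-identityˡ (X ℤ.* + p))) (M2.reflexive (≡.sym e)))
      even : B ℤ.+ ℤ.- (+ m ℤ.* (A ℤ.* A)) C2.≡ₚ 0ℤ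
      even = M2.x≈y⇒x-y≈0 (M2.begin
        B                      M2.≈⟨ times-p B (squares a) eB ⟩
        squares a              M2.≈⟨ M2.sum-cong-≋ {s} (λ i → square≡ (a i)) ⟩
        Σℤ a                   M2.≈⟨ M2.sym (times-p A (Σℤ a) eA) ⟩
        A                      M2.≈⟨ M2.sym (square≡ A) ⟩
        A ℤ.* A                M2.≈⟨ M2.sym (M2.*-identityˡ (A ℤ.* A)) ⟩
        1ℤ ℤ.* (A ℤ.* A)       M2.≈⟨ M2.*-congʳ {A ℤ.* A} (M2.sym (odd≡1 m′ m≡1+2m′)) ⟩
        + m ℤ.* (A ℤ.* A)      M2.∎)

  -- Positivity and the shortest vector

  NonZeroVector : Vector ℤ s → Set
  NonZeroVector a = ∃ λ i → a i ≢ 0ℤ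

  Q-positive : ∀ a → NonZeroVector a → 0ℤ ℤ.< Q a
  Q-positive a (i , aᵢ≢0) = ℤ.<-≤-trans (square-positive (a i) aᵢ≢0)
      (ℤ.≤-trans (term≤Σℤ (λ i → a i ℤ.* a i) (λ i → 0≤-square-ℤ (a i)) i) (squares≤Q a))
    where
    square-positive : ∀ x → x ≢ 0ℤ → 0ℤ ℤ.< x ℤ.* x
    square-positive (+ zero)  x≢0 = contradiction ≡.refl x≢0
    square-positive (+ suc n) _   = ℤ.+<+ (s≤s z≤n)
    square-positive -[1+ n ]  _   = ℤ.+<+ (s≤s z≤n)

  Q-lower-bound : ∀ a → Conditions a → NonZeroVector a → + 2 ℤ.* (+ p ℤ.* + p) ℤ.≤ Q a
  Q-lower-bound a cond nz = bound (Q-divisible a cond)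
    where
    c = + 2 ℤ.* (+ p ℤ.* + p)
    0≤c : 0ℤ ℤ.≤ c
    0≤c = ≡.subst (0ℤ ℤ.≤_) (≡.sym (≡.trans (≡.cong (+ 2 ℤ.*_) (≡.sym (ℤ.pos-* p p))) (≡.sym (ℤ.pos-* 2 (p ℕ.* p))))) (ℤ.+≤+ z≤n)
    bound : (∃ λ k → Q a ≡ c ℤ.* k) → c ℤ.≤ Q a
    bound (+ zero , e)   = contradiction (≡.subst (0ℤ ℤ.<_) (≡.trans e (ℤ.*-zeroʳ c)) (Q-positive a nz)) (ℤ.<-irrefl ≡.refl)
    bound (+ suc k , e)  = ≡.subst₂ ℤ._≤_ (ℤ.*-identityʳ c) (≡.sym e) (ℤ.*-monoˡ-≤-nonNeg c {{ℤ.nonNegative 0≤c}} {1ℤ} {+ suc k} (ℤ.+≤+ (s≤s z≤n)))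
    bound (-[1+ k ] , e) = contradiction (ℤ.<-≤-trans (≡.subst (0ℤ ℤ.<_) e (Q-positive a nz))
      (≡.subst (c ℤ.* -[1+ k ] ℤ.≤_) (ℤ.*-zeroʳ c) (ℤ.*-monoˡ-≤-nonNeg c {{ℤ.nonNegative 0≤c}} { -[1+ k ]} {0ℤ} ℤ.-≤+))) (ℤ.<-irrefl ≡.refl)

  conditions-resp : ∀ {a b} → (∀ i → a i ≡ b i) → Conditions a → Conditions b
  conditions-resp {a} {b} e cond i i≤h = M.trans (M.sum-cong-≋ {s} (λ j → M.reflexive (≡.cong (ℤ._* α M.^ (toℕ j ℕ.* i)) (≡.sym (e j))))) (cond i i≤h)

  conditions? : ∀ a → Dec (Conditions a)
  conditions? a with ℕ.allUpTo? (λ i → spectrum a i ≡ₚ? 0ℤ) (suc h)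
  ... | yes all = yes (λ i i≤h → all (s≤s i≤h))
  ... | no ¬all = no (λ cond → ¬all (λ {i} i<1+h → cond i (ℕ.s≤s⁻¹ i<1+h)))

  nonZeroVector? : ∀ a → Dec (NonZeroVector a)
  nonZeroVector? a = Fin.any? (λ i → ¬? (a i ℤ.≟ 0ℤ))

  zeroVector : ∀ {a} → ¬ NonZeroVector a → ∀ i → a i ≡ 0ℤ
  zeroVector {a} h i with a i ℤ.≟ 0ℤ
  ... | yes e = e
  ... | no ¬e = contradiction (i , ¬e) h

  shortest : ∃ λ a → (Conditions a × NonZeroVector a) × (∀ b → Conditions b × NonZeroVector b → ℤ.∣ Q a ∣ ℕ.≤ ℤ.∣ Q b ∣)
  shortest = minimum (λ a → Conditions a × NonZeroVector a) both? (λ a → ℤ.∣ Q a ∣)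
      (λ e (cond , i , nz) → conditions-resp e cond , i , λ z → nz (≡.trans (e i) z))
      (λ {a} {b} e → ≡.cong ℤ.∣_∣ (≡.cong₂ (λ S T → + p ℤ.* S ℤ.+ ℤ.- (+ m ℤ.* (T ℤ.* T)))
        (ℤR.sum-cong-≋ {s} (λ i → ≡.cong₂ ℤ._*_ (e i) (e i))) (ℤR.sum-cong-≋ {s} e)))
      (λ a _ → entry≤Q a)
      -- The constant vector p satisfies every congruence and is nonzero, so the search has
      -- somewhere to start.
      (λ _ → + p) ((λ i _ → multiple i) , constant-nonzero)
    where
    both? : ∀ a → Dec (Conditions a × NonZeroVector a)
    both? a with conditions? a | nonZeroVector? a
    ... | yes c | yes n = yes (c , n)
    ... | no ¬c | _     = no (¬c ∘ proj₁)
    ... | yes _ | no ¬n = no (¬n ∘ proj₂)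
    multiple : ∀ i → spectrum (λ _ → + p) i ≡ₚ 0ℤ
    multiple i = M.sum-zero {s} _ (λ j → M.trans (M.*-congʳ {α M.^ (toℕ j ℕ.* i)} p≡ₚ0) (M.zeroˡ (α M.^ (toℕ j ℕ.* i))))
    constant-nonzero : NonZeroVector (λ _ → + p)
    constant-nonzero = Fin.fromℕ< (ℕ.>-nonZero⁻¹ s) , λ e → ℕ.≢-nonZero⁻¹ p (ℤ.+-injective e)

  -- Newton polynomials N_k = Π_{i<k} (X - αⁱ); the rows p N_k (k ≤ h) and N_k (k > h) form a basis.
  node : ℕ → ℤ
  node k = α M.^ k

  newton : ℕ → ℕ → ℤ
  newton zero    zero    = 1ℤ
  newton zero    (suc j) = 0ℤ
  newton (suc k) zero    = ℤ.- (node k ℤ.* newton k zero)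
  newton (suc k) (suc j) = newton k j ℤ.+ ℤ.- (node k ℤ.* newton k (suc j))

  newton-above : ∀ {k j} → k ℕ.< j → newton k j ≡ 0ℤ
  newton-above {zero}  {suc j} _         = ≡.refl
  newton-above {suc k} {suc j} (s≤s k<j) = ≡.trans (≡.cong₂ (λ x y → x ℤ.+ ℤ.- (node k ℤ.* y)) (newton-above k<j) (newton-above {k} {suc j} (ℕ.m<n⇒m<1+n k<j)))
    (ℤR.solve 1 (λ x → ℤR.con 0ℤ ℤR.:+ ℤR.:- (x ℤR.:* ℤR.con 0ℤ) ℤR.:= ℤR.con 0ℤ) ≡.refl (node k))

  newton-leading : ∀ k → newton k k ≡ 1ℤ
  newton-leading zero    = ≡.refl
  newton-leading (suc k) = ≡.trans (≡.cong₂ (λ x y → x ℤ.+ ℤ.- (node k ℤ.* y)) (newton-leading k) (newton-above (ℕ.n<1+n k)))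
    (ℤR.solve 1 (λ x → ℤR.con 1ℤ ℤR.:+ ℤR.:- (x ℤR.:* ℤR.con 0ℤ) ℤR.:= ℤR.con 1ℤ) ≡.refl (node k))

  nodal : ℕ → ℤ → ℤ
  nodal zero    y = 1ℤ
  nodal (suc k) y = (y ℤ.+ ℤ.- node k) ℤ.* nodal k y

  nodal-zero : ∀ {i k} → i ℕ.< k → nodal k (node i) ≡ₚ 0ℤ
  nodal-zero {i} {suc k} i<1+k = [ (λ i<k → M.trans (M.*-congˡ {node i ℤ.+ ℤ.- node k} (nodal-zero i<k)) (M.zeroʳ (node i ℤ.+ ℤ.- node k)))
      , (λ { ≡.refl → M.trans (M.*-congʳ {nodal k (node i)} (M.x-x≈0 (node i))) (M.zeroˡ (nodal k (node i))) }) ]′ (ℕ.m≤n⇒m<n∨m≡n (ℕ.s≤s⁻¹ i<1+k))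

  -- The powers of α below s are distinct modulo p, so every factor is a unit.
  nodal-unit : ∀ {i} k → k ℕ.≤ i → i ℕ.< s → Unit (nodal k (node i))
  nodal-unit     zero    _   _   = unit-1
  nodal-unit {i} (suc k) k<i i<s = unit-* {node i ℤ.+ ℤ.- node k} {nodal k (node i)}
    (λ e → ℕ.<⇒≢ k<i (≡.sym (≡.trans (≡.sym (ℕ.m<n⇒m%n≡m i<s)) (≡.trans (order-%≡ {α} {s} α-unit ord {i} {k} (M.x-y≈0⇒x≈y e)) (ℕ.m<n⇒m%n≡m (ℕ.<-trans k<i i<s))))))
    (nodal-unit k (ℕ.<⇒≤ k<i) i<s)

  newton-value : ∀ n k y → k ℕ.< n → F.Σ< n (λ j → newton k j ℤ.* y M.^ j) ≡ₚ nodal k y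
  newton-value (suc n) zero    y _ = M.trans (M.+-congˡ {1ℤ ℤ.* 1ℤ} (M.sum-zero {n} _ (λ j → M.zeroˡ (y M.^ suc (toℕ j))))) M.refl
  newton-value (suc n) (suc k) y (s≤s k<n) = M.begin
    ℤ.- (x ℤ.* newton k 0) ℤ.* 1ℤ ℤ.+ F.Σ< n (λ j → (newton k j ℤ.+ ℤ.- (x ℤ.* newton k (suc j))) ℤ.* y M.^ suc j)
      M.≈⟨ M.+-congˡ {ℤ.- (x ℤ.* newton k 0) ℤ.* 1ℤ} (M.trans (F.Σ<-cong n (λ j _ → M.solve 5 (λ a x b y t → (a M.:+ M.:- (x M.:* b)) M.:* (y M.:* t) M.:= y M.:* (a M.:* t) M.:+ M.:- x M.:* (b M.:* (y M.:* t))) M.refl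
             (newton k j) x (newton k (suc j)) y (y M.^ j)))
           (M.sum-linear {n} y (ℤ.- x) (λ j → newton k (toℕ j) ℤ.* y M.^ toℕ j) (λ j → newton k (suc (toℕ j)) ℤ.* y M.^ suc (toℕ j)))) ⟩
    ℤ.- (x ℤ.* newton k 0) ℤ.* 1ℤ ℤ.+ (y ℤ.* S ℤ.+ ℤ.- x ℤ.* T)
      M.≈⟨ M.solve 5 (λ x a y S T → M.:- (x M.:* a) M.:* M.con 1ℤ M.:+ (y M.:* S M.:+ M.:- x M.:* T) M.:= y M.:* S M.:+ M.:- (x M.:* (a M.:* M.con 1ℤ M.:+ T))) M.refl x (newton k 0) y S T ⟩
    y ℤ.* S ℤ.+ ℤ.- (x ℤ.* (newton k 0 ℤ.* 1ℤ ℤ.+ T))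
      M.≈⟨ M.+-cong (M.*-congˡ {y} (newton-value n k y k<n)) (M.-‿cong (M.*-congˡ {x} (newton-value (suc n) k y (ℕ.m<n⇒m<1+n k<n)))) ⟩
    y ℤ.* nodal k y ℤ.+ ℤ.- (x ℤ.* nodal k y)
      M.≈⟨ M.solve 3 (λ y x t → y M.:* t M.:+ M.:- (x M.:* t) M.:= (y M.:+ M.:- x) M.:* t) M.refl y x (nodal k y) ⟩
    (y ℤ.+ ℤ.- x) ℤ.* nodal k y M.∎
    where
    x = node k
    S = F.Σ< n (λ j → newton k j ℤ.* y M.^ j)
    T = F.Σ< n (λ j → newton k (suc j) ℤ.* y M.^ suc j)

  -- The spectrum of a coefficient vector at i is the value of its polynomial at αⁱ, so in Newton
  -- coordinates the conditions become a triangular system.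
  newton-spectrum : ∀ (c : Vector ℤ s) i → spectrum (λ j → Σℤ (λ k → c k ℤ.* newton (toℕ k) (toℕ j))) i ≡ₚ Σℤ (λ k → c k ℤ.* nodal (toℕ k) (node i))
  newton-spectrum c i = M.begin
    Σℤ {s} (λ j → Σℤ {s} (λ k → c k ℤ.* newton (toℕ k) (toℕ j)) ℤ.* α M.^ (toℕ j ℕ.* i))
      M.≈⟨ M.sum-cong-≋ {s} (λ j → M.trans (M.*-distribʳ-sum {s} (α M.^ (toℕ j ℕ.* i)) (λ k → c k ℤ.* newton (toℕ k) (toℕ j)))
             (M.sum-cong-≋ {s} (λ k → M.trans (M.*-assoc (c k) (newton (toℕ k) (toℕ j)) (α M.^ (toℕ j ℕ.* i)))
               (M.*-congˡ {c k} (M.*-congˡ {newton (toℕ k) (toℕ j)} (M.trans (M.^-congʳ α (ℕ.*-comm (toℕ j) i)) (M.sym (M.^-assocʳ α i (toℕ j))))))))) ⟩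
    M.sum {s} (λ j → M.sum {s} (λ k → c k ℤ.* (newton (toℕ k) (toℕ j) ℤ.* node i M.^ toℕ j)))
      M.≈⟨ M.∑-comm {s} {s} (λ j k → c k ℤ.* (newton (toℕ k) (toℕ j) ℤ.* node i M.^ toℕ j)) ⟩
    M.sum {s} (λ k → M.sum {s} (λ j → c k ℤ.* (newton (toℕ k) (toℕ j) ℤ.* node i M.^ toℕ j)))
      M.≈⟨ M.sum-cong-≋ {s} (λ k → M.trans (M.sym (M.*-distribˡ-sum {s} (c k) (λ j → newton (toℕ k) (toℕ j) ℤ.* node i M.^ toℕ j)))
             (M.*-congˡ {c k} (newton-value s (toℕ k) (node i) (Fin.toℕ<n k)))) ⟩
    Σℤ {s} (λ k → c k ℤ.* nodal (toℕ k) (node i)) M.∎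

  scale : ℕ → ℤ
  scale k with k ℕ.≤? h
  ... | yes _ = + p
  ... | no  _ = 1ℤ

  basis : Fin s → Fin s → ℤ
  basis k j = scale (toℕ k) ℤ.* newton (toℕ k) (toℕ j)

  basis-above : ∀ {k j} → k Fin.< j → basis k j ≡ 0ℤ
  basis-above {k} {j} k<j = ≡.trans (≡.cong (scale (toℕ k) ℤ.*_) (newton-above k<j)) (ℤ.*-zeroʳ (scale (toℕ k)))

  basis-diagonal : ∀ k → basis k k ≡ scale (toℕ k)
  basis-diagonal k = ≡.trans (≡.cong (scale (toℕ k) ℤ.*_) (newton-leading (toℕ k))) (ℤ.*-identityʳ (scale (toℕ k)))

  private
    rescale : ∀ (c c′ : Vector ℤ s) → (∀ k → c k ≡ c′ k ℤ.* scale (toℕ k)) → ∀ j →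
              Σℤ (λ k → c k ℤ.* newton (toℕ k) (toℕ j)) ≡ Σℤ (λ k → c′ k ℤ.* basis k j)
    rescale c c′ e j = ℤR.sum-cong-≋ {s} (λ k → ≡.trans (≡.cong (ℤ._* newton (toℕ k) (toℕ j)) (e k)) (ℤ.*-assoc (c′ k) (scale (toℕ k)) (newton (toℕ k) (toℕ j))))

  basis-conditions : ∀ c → Conditions (λ j → Σℤ (λ k → c k ℤ.* basis k j))
  basis-conditions c′ = conditions-resp (rescale c c′ (λ k → ≡.refl)) λ i i≤h →
      M.trans (newton-spectrum c i) (M.sum-zero {s} _ (λ k → vanish i i≤h (toℕ k) (c′ k)))
    where
    c : Vector ℤ s
    c k = c′ k ℤ.* scale (toℕ k)
    vanish : ∀ i → i ℕ.≤ h → ∀ k x → x ℤ.* scale k ℤ.* nodal k (node i) ≡ₚ 0ℤ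
    vanish i i≤h k x with k ℕ.≤? h
    ... | yes _  = congruent (x ℤ.* nodal k (node i)) (ℤR.solve 3 (λ x p n → x ℤR.:* p ℤR.:* n ℤR.:= ℤR.con 0ℤ ℤR.:+ x ℤR.:* n ℤR.:* p) ≡.refl x (+ p) (nodal k (node i)))
    ... | no k≰h = M.trans (M.*-congˡ {x ℤ.* 1ℤ} (nodal-zero (ℕ.≤-<-trans i≤h (ℕ.≰⇒> k≰h)))) (M.zeroʳ (x ℤ.* 1ℤ))

  -- The Newton coordinates of a are integers. Evaluating at the node k removes all polynomials
  -- beyond k, and N_k has a unit value there, so p divides the coordinates up to h one after the
  -- other; the quotients are the coordinates in `basis`.
  basis-generates : ∀ a → Conditions a → ∃ λ (c : Vector ℤ s) → ∀ j → a j ≡ Σℤ (λ k → c k ℤ.* basis k j)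
  basis-generates a cond = (λ k → proj₁ (divide k)) , λ j → ≡.trans (a≡ j) (rescale c (λ k → proj₁ (divide k)) (λ k → proj₂ (divide k)) j)
    where
    expansion = triangular-solve (λ k j → newton (toℕ k) (toℕ j)) newton-above (λ k → newton-leading (toℕ k)) a
    c = proj₁ expansion
    a≡ = proj₂ expansion
    relation : ∀ i → i ℕ.≤ h → Σℤ (λ k → c k ℤ.* nodal (toℕ k) (node i)) ≡ₚ 0ℤ
    relation i i≤h = M.trans (M.sym (newton-spectrum c i)) (conditions-resp a≡ cond i i≤h)
    -- n is the fuel of a strong induction on the index of k.
    vanish : ∀ n (k : Fin s) → toℕ k ℕ.< n → toℕ k ℕ.≤ h → c k ≡ₚ 0ℤ
    vanish (suc n) k (s≤s k≤n) k≤h = [ id , (λ e → contradiction e (nodal-unit (toℕ k) ℕ.≤-refl (Fin.toℕ<n k))) ]′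
        (zero-divisor (c k) (nodal (toℕ k) (node (toℕ k)))
          (M.trans (M.sym (M.sum-single k (λ l → c l ℤ.* nodal (toℕ l) (node (toℕ k))) off)) (relation (toℕ k) k≤h)))
      where
      off : ∀ l → l ≢ k → c l ℤ.* nodal (toℕ l) (node (toℕ k)) ≡ₚ 0ℤ
      off l l≢k with ℕ.<-cmp (toℕ l) (toℕ k)
      ... | tri< l<k _ _ = M.trans (M.*-congʳ {nodal (toℕ l) (node (toℕ k))} (vanish n l (ℕ.<-≤-trans l<k k≤n) (ℕ.≤-trans (ℕ.<⇒≤ l<k) k≤h))) (M.zeroˡ (nodal (toℕ l) (node (toℕ k))))
      ... | tri≈ _ e _   = contradiction (Fin.toℕ-injective e) l≢k
      ... | tri> _ _ k<l = M.trans (M.*-congˡ {c l} (nodal-zero k<l)) (M.zeroʳ (c l))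
    divide : ∀ k → ∃ λ x → c k ≡ x ℤ.* scale (toℕ k)
    divide k = by-size (vanish (suc (toℕ k)) k (ℕ.n<1+n (toℕ k)))
      where
      -- The congruence is passed as an argument so that repeating the test on k unfolds `scale` in
      -- the goal.
      by-size : (toℕ k ℕ.≤ h → c k ≡ₚ 0ℤ) → ∃ λ x → c k ≡ x ℤ.* scale (toℕ k)
      by-size v with toℕ k ℕ.≤? h
      ... | yes k≤h = _≡ₚ_.quotient (v k≤h) , ≡.trans (_≡ₚ_.equality (v k≤h)) (ℤ.+-identityˡ _)
      ... | no  _   = c k , ≡.sym (ℤ.*-identityʳ (c k))

-- Gram determinants

module GramDeterminant (R : CommutativeRing 0ℓ 0ℓ) where
  open RingTheory R

  dotR : ∀ {n} → Vector Carrier n → Vector Carrier n → Carrier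
  dotR v w = sum λ i → v i * w i

  dot-congʳ : ∀ {n} (v : Vector Carrier n) {w w′} → (∀ i → w i ≈ w′ i) → dotR v w ≈ dotR v w′
  dot-congʳ {n} v h = sum-cong-≋ {n} (λ i → *-congˡ {v i} (h i))

  dot-linearʳ : ∀ {n} (v : Vector Carrier n) a b w w′ → dotR v (λ i → a * w i + b * w′ i) ≈ a * dotR v w + b * dotR v w′
  dot-linearʳ {n} v a b w w′ = trans (sum-cong-≋ {n} (λ i → solve 5 (λ v a b x y → v :* (a :* x :+ b :* y) := a :* (v :* x) :+ b :* (v :* y)) refl (v i) a b (w i) (w′ i)))
    (sum-linear {n} a b (λ i → v i * w i) (λ i → v i * w′ i))

  dot-sumʳ : ∀ {m n} (v : Vector Carrier n) (a : Fin m → Carrier) (w : Fin m → Vector Carrier n) →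
             dotR v (λ x → sum (λ i → a i * w i x)) ≈ sum (λ i → a i * dotR v (w i))
  dot-sumʳ {m} {n} v a w = begin
    sum {n} (λ x → v x * sum {m} (λ i → a i * w i x))
      ≈⟨ sum-cong-≋ {n} (λ x → trans (*-distribˡ-sum {m} (v x) (λ i → a i * w i x)) (sum-cong-≋ {m} (λ i → solve 3 (λ v a w → v :* (a :* w) := a :* (v :* w)) refl (v x) (a i) (w i x)))) ⟩
    sum {n} (λ x → sum {m} (λ i → a i * (v x * w i x)))
      ≈⟨ ∑-comm {n} {m} (λ x i → a i * (v x * w i x)) ⟩
    sum {m} (λ i → sum {n} (λ x → a i * (v x * w i x)))
      ≈⟨ sum-cong-≋ {m} (λ i → sym (*-distribˡ-sum {n} (a i) (λ x → v x * w i x))) ⟩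
    sum {m} (λ i → a i * dotR v (w i)) ∎

  dot-comm : ∀ {n} (v w : Vector Carrier n) → dotR v w ≈ dotR w v
  dot-comm {n} v w = sum-cong-≋ {n} (λ i → *-comm (v i) (w i))

  dot-sumˡ : ∀ {m n} (w : Vector Carrier n) (a : Fin m → Carrier) (v : Fin m → Vector Carrier n) →
             dotR (λ x → sum (λ i → a i * v i x)) w ≈ sum (λ i → a i * dotR (v i) w)
  dot-sumˡ {m} w a v = trans (dot-comm _ w) (trans (dot-sumʳ w a v) (sum-cong-≋ {m} (λ i → *-congˡ {a i} (dot-comm w (v i)))))

  -- With b fixed, the inner product is linear in each argument c j, so alternation is inherited
  -- from the columns of the determinant.
  gram-alternating : ∀ {k n} (b : Fin k → Vector Carrier n) → Alternating (λ (c : Fin k → Vector Carrier n) → det (λ i j → dotR (b i) (c j)))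
  gram-alternating b = record
    { cong     = λ h → C.cong (λ j i → dot-congʳ (b i) (h j))
    ; linear   = λ j c c′ c″ x y hj h′ h″ → C.linear j _ _ _ x y
        (λ i → trans (dot-congʳ (b i) (hj)) (dot-linearʳ (b i) x y (c′ j) (c″ j)))
        (λ l l≢j i → dot-congʳ (b i) (h′ l l≢j)) (λ l l≢j i → dot-congʳ (b i) (h″ l l≢j))
    ; adjacent = λ adj c e → C.adjacent adj _ (λ i → dot-congʳ (b i) e)
    }
    where module C = Alternating columns-alternating

  -- The same alternating form, products against b, is evaluated at two triangular substitutions of
  -- e, namely b and f. Eliminating its value at e leaves the matrix of products b i with f j, which
  -- is triangular, so the Gram determinant is a quotient of products of diagonals.
  gram-determinant : ∀ {k n} (e b f : Fin k → Vector Carrier n) (B U : Fin k → Fin k → Carrier) →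
    (∀ {i j} → i Fin.< j → B i j ≈ 0#) → (∀ i x → b i x ≈ sum (λ j → B i j * e j x)) →
    (∀ {i j} → j Fin.< i → U i j ≈ 0#) → (∀ j x → f j x ≈ sum (λ i → U i j * e i x)) →
    (∀ {i j} → i Fin.< j → dotR (b i) (f j) ≈ 0#) →
    product (λ i → U i i) * det (λ i j → dotR (b i) (b j)) ≈ product (λ i → B i i) * product (λ i → dotR (b i) (f i))
  gram-determinant {k} e b f B U B-lower b≈ U-upper f≈ T-lower = begin
    u * det (λ i j → dotR (b i) (b j))   ≈⟨ *-congˡ {u} (triangular-substitution (gram-alternating b) e b (λ i j → B j i) B-lower b≈) ⟩
    u * (β * G)                          ≈⟨ solve 3 (λ u β G → u :* (β :* G) := β :* (u :* G)) refl u β G ⟩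
    β * (u * G)                          ≈⟨ *-congˡ {β} (sym (triangular-substitution (gram-alternating b) e f U U-upper f≈)) ⟩
    β * det (λ i j → dotR (b i) (f j))   ≈⟨ *-congˡ {β} (det-lower (λ i j → dotR (b i) (f j)) T-lower) ⟩
    β * product (λ i → dotR (b i) (f i)) ∎
    where
    u = product (λ i → U i i)
    β = product (λ i → B i i)
    G = det (λ i j → dotR (b i) (e j))

  -- Column k + 1 does not involve the first coordinate, so the later coordinates vanish by
  -- induction, and column 0 then leaves only the first one.
  triangular-kernel : ∀ {n} (T : Fin n → Fin n → Carrier) → (∀ {i k} → i Fin.< k → T i k ≈ 0#) → (∀ k → ∃ λ v → v * T k k ≈ 1#) →
    (c : Fin n → Carrier) → (∀ k → sum (λ i → c i * T i k) ≈ 0#) → ∀ i → c i ≈ 0#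
  triangular-kernel {suc n} T lower inv c h = λ { zero → first ; (suc i) → later i }
    where
    later : ∀ i → c (suc i) ≈ 0#
    later = triangular-kernel (λ i k → T (suc i) (suc k)) (λ i<k → lower (s≤s i<k)) (λ k → inv (suc k)) (c ∘ suc) λ k →
      trans (sym (trans (+-congʳ (trans (*-congˡ {c zero} (lower {zero} {suc k} (s≤s z≤n))) (zeroʳ (c zero)))) (+-identityˡ _))) (h (suc k))
    first : c zero ≈ 0#
    first = unitˡ-cancel {proj₁ (inv zero)} {T zero zero} (proj₂ (inv zero)) (trans (*-comm (T zero zero) (c zero))
      (trans (sym (trans (+-congˡ (sum-zero {n} _ (λ i → trans (*-congʳ {T (suc i) zero} (later i)) (zeroˡ (T (suc i) zero))))) (+-identityʳ _))) (h zero)))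

  product-cong : ∀ {n} {f g : Fin n → Carrier} → (∀ i → f i ≈ g i) → product f ≈ product g
  product-cong {zero}  h = refl
  product-cong {suc n} h = *-cong (h zero) (product-cong (h ∘ suc))

  product-* : ∀ {n} (f g : Fin n → Carrier) → product (λ i → f i * g i) ≈ product f * product g
  product-* {zero}  f g = sym (*-identityˡ 1#)
  product-* {suc n} f g = trans (*-congˡ {f zero * g zero} (product-* (f ∘ suc) (g ∘ suc)))
    (solve 4 (λ a b c d → a :* b :* (c :* d) := a :* c :* (b :* d)) refl (f zero) (g zero) (product (f ∘ suc)) (product (g ∘ suc)))

  product-const : ∀ n x → product {n} (λ _ → x) ≈ x ^ n
  product-const zero    x = refl
  product-const (suc n) x = *-congˡ {x} (product-const n x)

  ι-sum : ∀ {n} (f : Vector ℤ n) → ι (Σℤ f) ≈ sum (λ i → ι (f i))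
  ι-sum {zero}  f = refl
  ι-sum {suc n} f = trans (ι-homo-+ (f zero) (Σℤ (f ∘ suc))) (+-congˡ (ι-sum (f ∘ suc)))

-- fₖ = (p - m k) eₖ + m Σ_{i<k} eᵢ is orthogonal to e₀, …, e_{k-1}.
orthogonaliser : ℤ → ℤ → ∀ {n} → Fin n → Fin n → ℤ
orthogonaliser q m zero    zero    = q
orthogonaliser q m (suc i) zero    = 0ℤ
orthogonaliser q m zero    (suc k) = m
orthogonaliser q m (suc i) (suc k) = orthogonaliser (q ℤ.+ ℤ.- m) m i k

orthogonaliser-below : ∀ q m {n} {i k : Fin n} → k Fin.< i → orthogonaliser q m i k ≡ 0ℤ
orthogonaliser-below q m {i = suc i} {zero}  _         = ≡.refl
orthogonaliser-below q m {i = suc i} {suc k} (s≤s k<i) = orthogonaliser-below (q ℤ.+ ℤ.- m) m k<i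

orthogonaliser-above : ∀ q m {n} {i k : Fin n} → i Fin.< k → orthogonaliser q m i k ≡ m
orthogonaliser-above q m {i = zero}  {suc k} _         = ≡.refl
orthogonaliser-above q m {i = suc i} {suc k} (s≤s i<k) = orthogonaliser-above (q ℤ.+ ℤ.- m) m i<k

orthogonaliser-column : ∀ q m {n} (k : Fin n) → Σℤ (λ i → orthogonaliser q m i k) ≡ q
orthogonaliser-column q m {suc n} zero    = ≡.trans (≡.cong (λ t → q ℤ.+ t) (ℤR.sum-zero {n} (λ _ → 0ℤ) (λ _ → ≡.refl))) (ℤ.+-identityʳ q)
orthogonaliser-column q m {suc n} (suc k) = ≡.trans (≡.cong (λ t → m ℤ.+ t) (orthogonaliser-column (q ℤ.+ ℤ.- m) m k))
  (ℤR.solve 2 (λ q m → m ℤR.:+ (q ℤR.:+ ℤR.:- m) ℤR.:= q) ≡.refl q m)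

pivot : ℤ → ℤ → ∀ {n} → Fin n → ℤ
pivot q m k = orthogonaliser q m k k

pivot-shift : ∀ q m {n} (k : Fin n) → pivot q m k ℤ.+ ℤ.- m ≡ pivot (q ℤ.+ ℤ.- m) m k
pivot-shift q m zero    = ≡.refl
pivot-shift q m (suc k) = pivot-shift (q ℤ.+ ℤ.- m) m k

-- The pivots are q - m k with k < r, and q = 1 + m r leaves room for one more m with remainder at
-- least 1.
pivot-positive : ∀ m r {q} → q ≡ + suc (m ℕ.* r) → ∀ (k : Fin r) → (∃ λ j → pivot q (+ m) k ≡ + suc j) × (∃ λ j → pivot q (+ m) k ℤ.+ ℤ.- + m ≡ + suc j)
pivot-positive m (suc r) {q} q≡ k = by-index k
  where
  shifted : q ℤ.+ ℤ.- + m ≡ + suc (m ℕ.* r)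
  shifted = ≡.trans (≡.cong (λ t → t ℤ.+ ℤ.- + m) (≡.trans q≡ (≡.cong (λ t → + suc t) (ℕ.*-suc m r))))
    (≡.trans (≡.cong (λ t → 1ℤ ℤ.+ t ℤ.+ ℤ.- + m) (ℤ.pos-+ m (m ℕ.* r)))
      (ℤR.solve 2 (λ m t → (ℤR.con 1ℤ ℤR.:+ (m ℤR.:+ t)) ℤR.:+ ℤR.:- m ℤR.:= ℤR.con 1ℤ ℤR.:+ t) ≡.refl (+ m) (+ (m ℕ.* r))))
  by-index : ∀ k → (∃ λ j → pivot q (+ m) k ≡ + suc j) × (∃ λ j → pivot q (+ m) k ℤ.+ ℤ.- + m ≡ + suc j)
  by-index zero    = (m ℕ.* suc r , q≡) , (m ℕ.* r , shifted)
  by-index (suc k) = pivot-positive m r shifted k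

module _ where
  open ℚR using (product)

  -- The shifted pivots are q - m, q - 2m, ... and the original ones q, q - m, ...; the products
  -- share all but the first and the last factor. For q = p and n = s the last factor is p - m s =
  -- 1.
  pivot-telescope : ∀ n q m → product {n} (λ k → ιℚ (pivot (q ℤ.+ ℤ.- m) m k)) ℚ.* ιℚ q ≡
                              product {n} (λ k → ιℚ (pivot q m k)) ℚ.* (ιℚ (q ℤ.+ ℤ.- (m ℤ.* + n)))
  pivot-telescope zero    q m = ≡.cong (λ t → 1ℚ ℚ.* ιℚ t) (ℤR.solve 2 (λ q m → q ℤR.:= q ℤR.:+ ℤR.:- (m ℤR.:* ℤR.con 0ℤ)) ≡.refl q m)
  pivot-telescope (suc n) q m = ≡.trans (solve 3 (λ a b c → a :* b :* c := c :* (b :* a)) ≡.refl (ιℚ q₁) (product {n} (λ k → ιℚ (pivot (q₁ ℤ.+ ℤ.- m) m k))) (ιℚ q))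
    (≡.trans (≡.cong (ιℚ q ℚ.*_) (pivot-telescope n q₁ m))
      (≡.trans (≡.sym (ℚ.*-assoc (ιℚ q) _ _)) (≡.cong (λ t → ιℚ q ℚ.* product {n} (λ k → ιℚ (pivot q₁ m k)) ℚ.* ιℚ t)
        (ℤR.solve 3 (λ q m n → (q ℤR.:+ ℤR.:- m) ℤR.:+ ℤR.:- (m ℤR.:* n) ℤR.:= q ℤR.:+ ℤR.:- (m ℤR.:* (ℤR.con 1ℤ ℤR.:+ n))) ≡.refl q m (+ n)))))
    where
    q₁ = q ℤ.+ ℤ.- m
    open ℚR using (solve; _:*_; _:=_)

  product-positive : ∀ {n} (f : Fin n → ℚ) → (∀ i → 0ℚ ℚ.< f i) → 0ℚ ℚ.< product f
  product-positive {zero}  f h = 0<1ℚ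
  product-positive {suc n} f h = 0<-* (h zero) (product-positive (f ∘ suc) (h ∘ suc))

fromℚ-product : ∀ {n} (f : Fin n → ℚ) → ℝR.product (λ i → fromℚ (f i)) ≃ fromℚ (ℚR.product f)
fromℚ-product {zero}  f = ℝR.refl
fromℚ-product {suc n} f = ℝR.trans (ℝR.*-congˡ {fromℚ (f zero)} (fromℚ-product (f ∘ suc))) (pointwise λ _ → ≡.refl)

fromℚ-cong : ∀ {a b} → a ≡ b → fromℚ a ≃ fromℚ b
fromℚ-cong e = ℝR.reflexive (≡.cong fromℚ e)

fromℚ-recip : ∀ {q} → 0ℚ ℚ.< q → ∃ λ v → v *ᵣ fromℚ q ≃ fromℚ 1ℚ
fromℚ-recip {q} 0<q = let v , _ , qv = recip q 0<q in fromℚ v , pointwise λ _ → ≡.trans (ℚ.*-comm v q) qv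

ι≃ : ∀ z → ℝR.ι z ≃ fromℚ (ιℚ z)
ι≃ z = ℝR.trans (ℝR.sym (fromℤ≃ι z)) (fromℤ≃ z)

halve : ∀ {x y} → x +ᵣ x ≃ y → x ≃ fromℚ ½ *ᵣ y
halve {x} {y} e = ℝR.trans (pointwise λ n → ≡.sym (≡.trans (ℚ.*-distribˡ-+ ½ (seq x n) (seq x n)) (½+½ (seq x n)))) (ℝR.*-congˡ {fromℚ ½} e)

module Volume (p : ℕ) (pr : Prime p) (s h m m′ : ℕ) (s≡2h : s ≡ h ℕ.+ h) (ms≡p-1 : m ℕ.* s ≡ p ∸ 1)
              (m≡1+2m′ : m ≡ suc (m′ ℕ.+ m′)) (α : ℤ) (ord : Units.HasOrder p pr α s)
              (n : ℕ) (e : Fin s → Vector ℝ n)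
              (diagonal : ∀ i → dot (e i) (e i) +ᵣ dot (e i) (e i) ≃ ℝR.ι (+ p) +ᵣ -ᵣ ℝR.ι (+ m))
              (off-diagonal : ∀ {i j} → i ≢ j → dot (e i) (e j) +ᵣ dot (e i) (e j) ≃ -ᵣ ℝR.ι (+ m)) where
  open CodeLattice p pr s h m m′ s≡2h ms≡p-1 m≡1+2m′ α ord public
  open Units p pr using (p≡1+[p-1]; p-nonZero)
  open RingTheory ℝ-commutativeRing
  open GramDeterminant ℝ-commutativeRing

  U : Fin s → Fin s → ℤ
  U = orthogonaliser (+ p) (+ m)

  f : Fin s → Vector ℝ n
  f k x = sum (λ i → ι (U i k) * e i x)

  b : Fin s → Vector ℝ n
  b k = combination (λ j → fromℤ (basis k j)) e

  private
    double-gram : ∀ l (c : Vector ℤ s) → sum (λ i → ι (c i) * dot (e l) (e i)) + sum (λ i → ι (c i) * dot (e l) (e i)) ≃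
                  ι (+ p ℤ.* c l ℤ.+ ℤ.- (+ m ℤ.* Σℤ c))
    double-gram l c = begin
      sum (λ i → ι (c i) * dot (e l) (e i)) + sum (λ i → ι (c i) * dot (e l) (e i))
        ≈⟨ sym (∑-distrib-+ {s} (λ i → ι (c i) * dot (e l) (e i)) (λ i → ι (c i) * dot (e l) (e i))) ⟩
      sum {s} (λ i → ι (c i) * dot (e l) (e i) + ι (c i) * dot (e l) (e i))
        ≈⟨ sum-cong-≋ {s} (λ i → trans (sym (distribˡ (ι (c i)) (dot (e l) (e i)) (dot (e l) (e i)))) (trans (*-congˡ {ι (c i)} (entry i)) (distribˡ (ι (c i)) (D i) (- ι (+ m))))) ⟩
      sum {s} (λ i → ι (c i) * D i + ι (c i) * - ι (+ m))
        ≈⟨ ∑-distrib-+ {s} (λ i → ι (c i) * D i) (λ i → ι (c i) * - ι (+ m)) ⟩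
      sum {s} (λ i → ι (c i) * D i) + sum {s} (λ i → ι (c i) * - ι (+ m))
        ≈⟨ +-cong (trans (sum-single l (λ i → ι (c i) * D i) off) (*-congˡ {ι (c l)} D-l))
             (trans (sym (*-distribʳ-sum {s} (- ι (+ m)) (λ i → ι (c i)))) (*-congʳ { - ι (+ m)} (sym (ι-sum c)))) ⟩
      ι (c l) * ι (+ p) + ι (Σℤ c) * - ι (+ m)
        ≈⟨ solve 4 (λ c p S m → c :* p :+ S :* :- m := p :* c :+ :- (m :* S)) refl (ι (c l)) (ι (+ p)) (ι (Σℤ c)) (ι (+ m)) ⟩
      ι (+ p) * ι (c l) + - (ι (+ m) * ι (Σℤ c))
        ≈⟨ sym (trans (ι-homo-+ (+ p ℤ.* c l) (ℤ.- (+ m ℤ.* Σℤ c))) (+-cong (ι-homo-* (+ p) (c l)) (trans (ι-homo-- (+ m ℤ.* Σℤ c)) (-‿cong (ι-homo-* (+ m) (Σℤ c)))))) ⟩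
      ι (+ p ℤ.* c l ℤ.+ ℤ.- (+ m ℤ.* Σℤ c)) ∎
      where
      D : Fin s → ℝ
      D i with i Fin.≟ l
      ... | yes _ = ι (+ p)
      ... | no  _ = 0#
      D-l : D l ≃ ι (+ p)
      D-l with l Fin.≟ l
      ... | yes _  = refl
      ... | no l≢l = contradiction ≡.refl l≢l
      off : ∀ i → i ≢ l → ι (c i) * D i ≃ 0#
      off i i≢l with i Fin.≟ l
      ... | yes i≡l = contradiction i≡l i≢l
      ... | no  _   = zeroʳ (ι (c i))
      entry : ∀ i → dot (e l) (e i) + dot (e l) (e i) ≃ D i + - ι (+ m)
      entry i with i Fin.≟ l
      ... | yes ≡.refl = diagonal i
      ... | no  i≢l    = trans (off-diagonal (λ l≡i → i≢l (≡.sym l≡i))) (sym (+-identityˡ (- ι (+ m))))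

  quadratic-form : ∀ (a : Vector ℤ s) → dot (combination (λ i → fromℤ (a i)) e) (combination (λ i → fromℤ (a i)) e) ≃ fromℚ (½ ℚ.* ιℚ (Q a))
  quadratic-form a = trans (halve (begin
      D + D
        ≈⟨ +-cong expand expand ⟩
      S + S
        ≈⟨ sym (∑-distrib-+ {s} (λ l → ι (a l) * row l) (λ l → ι (a l) * row l)) ⟩
      sum {s} (λ l → ι (a l) * row l + ι (a l) * row l)
        ≈⟨ sum-cong-≋ {s} (λ l → trans (sym (distribˡ (ι (a l)) (row l) (row l))) (trans (*-congˡ {ι (a l)} (double-gram l a)) (sym (ι-homo-* (a l) (entry l))))) ⟩
      sum {s} (λ l → ι (a l ℤ.* entry l))
        ≈⟨ sym (ι-sum (λ l → a l ℤ.* entry l)) ⟩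
      ι (Σℤ (λ l → a l ℤ.* entry l))
        ≡⟨ ≡.cong ι collect ⟩
      ι (Q a)
        ≈⟨ ι≃ (Q a) ⟩
      fromℚ (ιℚ (Q a)) ∎)) (pointwise λ _ → ≡.refl)
    where
    v : Vector ℝ n
    v = combination (λ i → fromℤ (a i)) e
    D = dot v v
    row : Fin s → ℝ
    row l = sum (λ i → ι (a i) * dot (e l) (e i))
    S = sum (λ l → ι (a l) * row l)
    entry : Fin s → ℤ
    entry l = + p ℤ.* a l ℤ.+ ℤ.- (+ m ℤ.* Σℤ a)
    expand : D ≃ S
    expand = trans (dot-sumˡ v (λ i → fromℤ (a i)) e) (sum-cong-≋ {s} (λ l → *-cong (fromℤ≃ι (a l))
      (trans (dot-sumʳ (e l) (λ i → fromℤ (a i)) e) (sum-cong-≋ {s} (λ i → *-congʳ {dot (e l) (e i)} (fromℤ≃ι (a i)))))))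
    collect : Σℤ (λ l → a l ℤ.* entry l) ≡ Q a
    collect = ≡.trans (ℤR.sum-cong-≋ {s} (λ l → ℤR.solve 4 (λ a p m S → a ℤR.:* (p ℤR.:* a ℤR.:+ ℤR.:- (m ℤR.:* S)) ℤR.:= p ℤR.:* (a ℤR.:* a) ℤR.:+ ℤR.:- (m ℤR.:* S) ℤR.:* a) ≡.refl
                 (a l) (+ p) (+ m) (Σℤ a)))
      (≡.trans (ℤR.sum-linear {s} (+ p) (ℤ.- (+ m ℤ.* Σℤ a)) (λ l → a l ℤ.* a l) a)
        (ℤR.solve 4 (λ p m X S → p ℤR.:* X ℤR.:+ ℤR.:- (m ℤR.:* S) ℤR.:* S ℤR.:= p ℤR.:* X ℤR.:+ ℤR.:- (m ℤR.:* (S ℤR.:* S))) ≡.refl (+ p) (+ m) (squares a) (Σℤ a)))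

  private
    -- The columns of `U` sum to p, so twice the product is p U - m p = p (U - m). It vanishes above
    -- the diagonal, where the entries of `U` are m.
    e·f : ∀ l k → dot (e l) (f k) ≃ fromℚ (½ ℚ.* ιℚ (+ p ℤ.* (U l k ℤ.+ ℤ.- + m)))
    e·f l k = trans (dot-sumʳ (e l) (λ i → ι (U i k)) e) (trans (halve (trans (double-gram l (λ i → U i k))
      (trans (reflexive (≡.cong ι (≡.trans (≡.cong (λ t → + p ℤ.* U l k ℤ.+ ℤ.- (+ m ℤ.* t)) (orthogonaliser-column (+ p) (+ m) k))
        (ℤR.solve 3 (λ p m u → p ℤR.:* u ℤR.:+ ℤR.:- (m ℤR.:* p) ℤR.:= p ℤR.:* (u ℤR.:+ ℤR.:- m)) ≡.refl (+ p) (+ m) (U l k)))))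
        (ι≃ (+ p ℤ.* (U l k ℤ.+ ℤ.- + m)))))) (pointwise λ _ → ≡.refl))

    e·f-zero : ∀ {l k} → l Fin.< k → dot (e l) (f k) ≃ 0#
    e·f-zero {l} {k} l<k = trans (e·f l k) (fromℚ-cong (≡.trans (≡.cong (λ t → ½ ℚ.* ιℚ t)
      (≡.trans (≡.cong (λ t → + p ℤ.* (t ℤ.+ ℤ.- + m)) (orthogonaliser-above (+ p) (+ m) l<k))
        (ℤR.solve 2 (λ p m → p ℤR.:* (m ℤR.:+ ℤR.:- m) ℤR.:= ℤR.con 0ℤ) ≡.refl (+ p) (+ m)))) (ℚ.*-zeroʳ ½)))

    b·f : ∀ i k → dot (b i) (f k) ≃ sum (λ l → fromℤ (basis i l) * dot (e l) (f k))
    b·f i k = dot-sumˡ (f k) (λ l → fromℤ (basis i l)) e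

    fromℤ-zero : ∀ {z} x → z ≡ 0ℤ → fromℤ z * x ≃ 0#
    fromℤ-zero x e = trans (*-congʳ {x} (trans (reflexive (≡.cong fromℤ e)) (fromℤ≃ 0ℤ))) (zeroˡ x)

  b·f-lower : ∀ {i k} → i Fin.< k → dot (b i) (f k) ≃ 0#
  b·f-lower {i} {k} i<k = trans (b·f i k) (sum-zero {s} _ term)
    where
    term : ∀ l → fromℤ (basis i l) * dot (e l) (f k) ≃ 0#
    term l with toℕ l ℕ.<? toℕ k
    ... | yes l<k = trans (*-congˡ {fromℤ (basis i l)} (e·f-zero l<k)) (zeroʳ (fromℤ (basis i l)))
    ... | no  l≮k = fromℤ-zero (dot (e l) (f k)) (basis-above {i} {l} (ℕ.<-≤-trans i<k (ℕ.≮⇒≥ l≮k)))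

  V : Fin s → ℚ
  V k = ιℚ (pivot (+ p ℤ.+ ℤ.- + m) (+ m) k)

  scaleℚ : Fin s → ℚ
  scaleℚ k = ιℚ (scale (toℕ k))

  b·f-diagonal : ∀ k → dot (b k) (f k) ≃ fromℚ (scaleℚ k ℚ.* ((½ ℚ.* ιℚ (+ p)) ℚ.* V k))
  b·f-diagonal k = trans (b·f k k) (trans (sum-single k (λ l → fromℤ (basis k l) * dot (e l) (f k)) term)
      (trans (*-cong (trans (fromℤ≃ (basis k k)) (fromℚ-cong (≡.cong ιℚ (basis-diagonal k)))) (e·f k k))
        (pointwise λ _ → ≡.cong (scaleℚ k ℚ.*_) (≡.trans (≡.cong (½ ℚ.*_) (≡.trans (ℚR.ι-homo-* (+ p) (U k k ℤ.+ ℤ.- + m)) (≡.cong (λ t → ιℚ (+ p) ℚ.* ιℚ t) (pivot-shift (+ p) (+ m) k))))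
          (≡.sym (ℚ.*-assoc ½ (ιℚ (+ p)) (V k)))))))
    where
    term : ∀ l → l ≢ k → fromℤ (basis k l) * dot (e l) (f k) ≃ 0#
    term l l≢k with ℕ.<-cmp (toℕ l) (toℕ k)
    ... | tri< l<k _ _ = trans (*-congˡ {fromℤ (basis k l)} (e·f-zero l<k)) (zeroʳ (fromℤ (basis k l)))
    ... | tri≈ _ eq _  = contradiction (Fin.toℕ-injective eq) l≢k
    ... | tri> _ _ k<l = fromℤ-zero (dot (e l) (f k)) (basis-above {k} {l} k<l)

  0<P : 0ℚ ℚ.< ιℚ (+ p)
  0<P = 0<ι′ p

  private
    positive-ι : ∀ {z} → (∃ λ j → z ≡ + suc j) → 0ℚ ℚ.< ιℚ z
    positive-ι (j , ≡.refl) = 0<ι j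

    p≡1+m*s : + p ≡ + suc (m ℕ.* s)
    p≡1+m*s = ≡.cong +_ (≡.trans p≡1+[p-1] (≡.cong suc (≡.sym ms≡p-1)))

    V-positive : ∀ k → 0ℚ ℚ.< V k
    V-positive k = ≡.subst (λ t → 0ℚ ℚ.< ιℚ t) (pivot-shift (+ p) (+ m) k) (positive-ι (proj₂ (pivot-positive m s p≡1+m*s k)))

    U-positive : ∀ k → 0ℚ ℚ.< ιℚ (pivot (+ p) (+ m) k)
    U-positive k = positive-ι (proj₁ (pivot-positive m s p≡1+m*s k))

    scale-positive : ∀ k → 0ℚ ℚ.< ιℚ (scale k)
    scale-positive k with k ℕ.≤? h
    ... | yes _ = 0<P
    ... | no  _ = 0<1ℚ

  pivot-inverse : ∀ k → ∃ λ v → v * dot (b k) (f k) ≃ 1#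
  pivot-inverse k =
    let v , vq = fromℚ-recip {scaleℚ k ℚ.* ((½ ℚ.* ιℚ (+ p)) ℚ.* V k)} (0<-* (scale-positive (toℕ k)) (0<-* (0<-* 0<½ 0<P) (V-positive k)))
    in v , trans (*-congˡ {v} (b·f-diagonal k)) vq

  independent : ∀ (c : Vector ℝ s) → (combination c b ≋ λ _ → fromℕ 0) → ∀ i → c i ≈ᵣ fromℕ 0
  independent c h i = unwrap (triangular-kernel (λ i k → dot (b i) (f k)) b·f-lower pivot-inverse c
    (λ k → trans (sym (dot-sumˡ (f k) c b)) (trans (sum-cong-≋ {n} (λ x → *-congʳ {f k x} (wrap (h x)))) (sum-zero {n} _ (λ x → zeroˡ (f k x))))) i)

  open ℚR using () renaming (_^_ to _^ℚ_; product to productℚ)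

  -- The rational part of the volume, which is κ √p.
  κ : ℚ
  κ = ιℚ (+ p) ^ℚ s ℚ.* ½ ^ℚ h

  private
    module G = GramDeterminant ℚ.+-*-commutativeRing
    P = ιℚ (+ p)

    -- One factor p for each of the h + 1 congruences: the index of the code lattice in all integer
    -- vectors.
    scale-product : productℚ scaleℚ ≡ P ^ℚ suc h
    scale-product = count s (suc h) s≡1+h+ (λ k → ιℚ (scale k)) small large
      where
      0<h : 0 ℕ.< h
      0<h = positive h s≡2h
        where
        positive : ∀ h → s ≡ h ℕ.+ h → 0 ℕ.< h
        positive zero    eq = contradiction eq (ℕ.≢-nonZero⁻¹ s)
        positive (suc h) eq = s≤s z≤n
      s≡1+h+ : suc h ℕ.≤ s
      s≡1+h+ = ≡.subst (suc h ℕ.≤_) (≡.sym s≡2h) (ℕ.+-monoˡ-≤ h 0<h)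
      small : ∀ k → k ℕ.< suc h → ιℚ (scale k) ≡ P
      small k k<1+h with k ℕ.≤? h
      ... | yes _  = ≡.refl
      ... | no k≰h = contradiction (ℕ.s≤s⁻¹ k<1+h) k≰h
      large : ∀ k → suc h ℕ.≤ k → ιℚ (scale k) ≡ 1ℚ
      large k h<k with k ℕ.≤? h
      ... | yes k≤h = contradiction k≤h (ℕ.<⇒≱ h<k)
      ... | no  _   = ≡.refl
      count : ∀ n r → r ℕ.≤ n → (g : ℕ → ℚ) → (∀ k → k ℕ.< r → g k ≡ P) → (∀ k → r ℕ.≤ k → g k ≡ 1ℚ) → productℚ {n} (λ k → g (toℕ k)) ≡ P ^ℚ r
      count n zero _ g _ one = ≡.trans (G.product-cong {n} (λ k → one (toℕ k) z≤n)) (≡.trans (G.product-const n 1ℚ) (ℚR.1^ n))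
      count (suc n) (suc r) (s≤s r≤n) g small large = ≡.cong₂ ℚ._*_ (small 0 (s≤s z≤n))
        (count n r r≤n (g ∘ suc) (λ k k<r → small (suc k) (s≤s k<r)) (λ k r≤k → large (suc k) (s≤s r≤k)))

    Πw : ℚ
    Πw = productℚ {s} (λ k → scaleℚ k ℚ.* ((½ ℚ.* P) ℚ.* V k))

    ΠU : ℚ
    ΠU = productℚ {s} (λ k → ιℚ (pivot (+ p) (+ m) k))

    ΠU≡ : productℚ V ℚ.* P ≡ ΠU
    ΠU≡ = ≡.trans (pivot-telescope s (+ p) (+ m)) (≡.trans (≡.cong (λ t → ΠU ℚ.* ιℚ t)
      (≡.trans (≡.cong (λ t → t ℤ.+ ℤ.- (+ m ℤ.* + s)) p≡1+ms) (ℤR.solve 1 (λ t → (ℤR.con 1ℤ ℤR.:+ t) ℤR.:+ ℤR.:- t ℤR.:= ℤR.con 1ℤ) ≡.refl (+ m ℤ.* + s))))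
      (≡.trans (≡.cong (ΠU ℚ.*_) (ℚ.+-identityʳ 1ℚ)) (ℚ.*-identityʳ ΠU)))

    -- The index occurs twice and contributes P^(2h + 2) = P^s P². By `ΠU≡` one factor P turns the
    -- product of the `V k` into `ΠU`; the other is the P under the root of the volume.
    volume-identity : productℚ scaleℚ ℚ.* Πw ≡ ΠU ℚ.* (κ ℚ.* κ ℚ.* P)
    volume-identity = ℚR.begin
      productℚ scaleℚ ℚ.* Πw
        ℚR.≡⟨ ≡.cong₂ ℚ._*_ scale-product (≡.trans (G.product-* {s} scaleℚ (λ k → (½ ℚ.* P) ℚ.* V k)) (≡.cong₂ ℚ._*_ scale-product
             (≡.trans (G.product-* {s} (λ _ → ½ ℚ.* P) V) (≡.cong (ℚ._* productℚ V) (≡.trans (G.product-* {s} (λ _ → ½) (λ _ → P)) (≡.cong₂ ℚ._*_ (G.product-const s ½) (G.product-const s P))))))) ⟩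
      (P ℚ.* P ^ℚ h) ℚ.* ((P ℚ.* P ^ℚ h) ℚ.* ((½ ^ℚ s ℚ.* P ^ℚ s) ℚ.* productℚ V))
        ℚR.≡⟨ ≡.cong (λ t → (P ℚ.* P ^ℚ h) ℚ.* ((P ℚ.* P ^ℚ h) ℚ.* ((t ℚ.* P ^ℚ s) ℚ.* productℚ V))) (power-s ½) ⟩
      (P ℚ.* P ^ℚ h) ℚ.* ((P ℚ.* P ^ℚ h) ℚ.* ((½ ^ℚ h ℚ.* ½ ^ℚ h ℚ.* P ^ℚ s) ℚ.* productℚ V))
        ℚR.≡⟨ ℚR.solve 5 (λ P a b c v → (P ℚR.:* a) ℚR.:* ((P ℚR.:* a) ℚR.:* ((b ℚR.:* b ℚR.:* c) ℚR.:* v)) ℚR.:= (v ℚR.:* P) ℚR.:* (c ℚR.:* b ℚR.:* ((a ℚR.:* a) ℚR.:* b) ℚR.:* P)) ≡.refl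
             P (P ^ℚ h) (½ ^ℚ h) (P ^ℚ s) (productℚ V) ⟩
      (productℚ V ℚ.* P) ℚ.* (P ^ℚ s ℚ.* ½ ^ℚ h ℚ.* ((P ^ℚ h ℚ.* P ^ℚ h) ℚ.* ½ ^ℚ h) ℚ.* P)
        ℚR.≡⟨ ≡.cong₂ (λ x y → x ℚ.* (P ^ℚ s ℚ.* ½ ^ℚ h ℚ.* (y ℚ.* ½ ^ℚ h) ℚ.* P)) ΠU≡ (≡.sym (power-s P)) ⟩
      ΠU ℚ.* (κ ℚ.* κ ℚ.* P) ℚR.∎
      where
      power-s : ∀ x → x ^ℚ s ≡ x ^ℚ h ℚ.* x ^ℚ h
      power-s x = ≡.trans (≡.cong (x ^ℚ_) s≡2h) (ℚR.^-homo-* x h h)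

  -- The determinant identity is divided by `ΠU`, which is invertible since every pivot is positive.
  gram-value : det (λ i j → dot (b i) (b j)) ≃ fromℚ (κ ℚ.* κ ℚ.* ιℚ (+ p))
  gram-value = x-y≈0⇒x≈y (unitˡ-cancel {proj₁ inverse} {fromℚ ΠU} (proj₂ inverse) (begin
    fromℚ ΠU * (det (λ i j → dot (b i) (b j)) + - fromℚ (κ ℚ.* κ ℚ.* P))
      ≈⟨ solve 3 (λ u a b → u :* (a :+ :- b) := u :* a :+ :- (u :* b)) refl (fromℚ ΠU) (det (λ i j → dot (b i) (b j))) (fromℚ (κ ℚ.* κ ℚ.* P)) ⟩
    fromℚ ΠU * det (λ i j → dot (b i) (b j)) + - (fromℚ ΠU * fromℚ (κ ℚ.* κ ℚ.* P))
      ≈⟨ x≈y⇒x-y≈0 (trans relation (pointwise λ _ → volume-identity)) ⟩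
    0# ∎))
    where
    inverse = fromℚ-recip {ΠU} (product-positive {s} (λ k → ιℚ (pivot (+ p) (+ m) k)) U-positive)
    relation : fromℚ ΠU * det (λ i j → dot (b i) (b j)) ≃ fromℚ (productℚ scaleℚ) * fromℚ Πw
    relation = begin
      fromℚ ΠU * det (λ i j → dot (b i) (b j))
        ≈⟨ *-congʳ {det (λ i j → dot (b i) (b j))} (sym (trans (product-cong {s} (λ k → ι≃ (U k k))) (fromℚ-product {s} (λ k → ιℚ (U k k))))) ⟩
      product {s} (λ k → ι (U k k)) * det (λ i j → dot (b i) (b j))
        ≈⟨ gram-determinant e b f (λ i j → fromℤ (basis i j)) (λ i k → ι (U i k))
             (λ {i} {j} i<j → trans (reflexive (≡.cong fromℤ (basis-above {i} {j} i<j))) (fromℤ≃ 0ℤ)) (λ i x → refl)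
             (λ {i} {j} j<i → reflexive (≡.cong ι (orthogonaliser-below (+ p) (+ m) j<i))) (λ j x → refl) b·f-lower ⟩
      product {s} (λ i → fromℤ (basis i i)) * product {s} (λ i → dot (b i) (f i))
        ≈⟨ *-cong (trans (product-cong {s} (λ k → trans (fromℤ≃ (basis k k)) (fromℚ-cong (≡.cong ιℚ (basis-diagonal k))))) (fromℚ-product scaleℚ))
             (trans (product-cong {s} b·f-diagonal) (fromℚ-product {s} (λ k → scaleℚ k ℚ.* ((½ ℚ.* P) ℚ.* V k)))) ⟩
      fromℚ (productℚ scaleℚ) * fromℚ Πw ∎

-- Center density

module _ where
  open ℚR using (_^_)

  ^-mono-≤ : ∀ n {a b} → 0ℚ ℚ.≤ a → a ℚ.≤ b → a ^ n ℚ.≤ b ^ n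
  ^-mono-≤ zero    _   _   = ℚ.≤-refl
  ^-mono-≤ (suc n) {a} {b} 0≤a a≤b = ℚ.≤-trans
    (ℚ.*-monoʳ-≤-nonNeg (a ^ n) {{ℚ.nonNegative (0≤^ n)}} a≤b)
    (ℚ.*-monoˡ-≤-nonNeg b {{ℚ.nonNegative (ℚ.≤-trans 0≤a a≤b)}} (^-mono-≤ n 0≤a a≤b))
    where
    0≤^ : ∀ n → 0ℚ ℚ.≤ a ^ n
    0≤^ zero    = ℚ.<⇒≤ 0<1ℚ
    0≤^ (suc n) = 0≤-* 0≤a (0≤^ n)

  0<-^ : ∀ n {a} → 0ℚ ℚ.< a → 0ℚ ℚ.< a ^ n
  0<-^ zero    0<a = 0<1ℚ
  0<-^ (suc n) 0<a = 0<-* 0<a (0<-^ n 0<a)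

^-ℝ : ∀ x n → x ℝ-Ops.^ n ≡ x ℝR.^ n
^-ℝ x zero    = ≡.refl
^-ℝ x (suc n) = ≡.cong (x *ᵣ_) (^-ℝ x n)

fromℚ-^ : ∀ q n → fromℚ q ℝR.^ n ≃ fromℚ (q ℚR.^ n)
fromℚ-^ q zero    = ℝR.refl
fromℚ-^ q (suc n) = ℝR.trans (ℝR.*-congˡ {fromℚ q} (fromℚ-^ q n)) (pointwise λ _ → ≡.refl)

module Density (p : ℕ) (pr : Prime p) (s h m m′ : ℕ) (s≡2h : s ≡ h ℕ.+ h) (ms≡p-1 : m ℕ.* s ≡ p ∸ 1)
               (m≡1+2m′ : m ≡ suc (m′ ℕ.+ m′)) (α : ℤ) (ord : Units.HasOrder p pr α s)
               (e : Fin s → Vector ℝ s)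
               (diagonal : ∀ i → dot (e i) (e i) +ᵣ dot (e i) (e i) ≃ ℝR.ι (+ p) +ᵣ -ᵣ ℝR.ι (+ m))
               (off-diagonal : ∀ {i j} → i ≢ j → dot (e i) (e j) +ᵣ dot (e i) (e j) ≃ -ᵣ ℝR.ι (+ m))
               (Λ : Vector ℝ s → Set) where
  open Volume p pr s h m m′ s≡2h ms≡p-1 m≡1+2m′ α ord s e diagonal off-diagonal
  open RingTheory ℝ-commutativeRing
  open ℚR using () renaming (_^_ to _^ℚ_)

  embed : Vector ℤ s → Vector ℝ s
  embed a = combination (λ i → fromℤ (a i)) e

  module _ (Λ⇒ : ∀ v → Λ v → ∃ λ a → v ≋ embed a × Conditions a)
           (⇒Λ : ∀ v a → v ≋ embed a → Conditions a → Λ v) where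

    private
      module Qs = ℚ.+-*-Solver
      P = ιℚ (+ p)

      embed-basis : ∀ (a c : Vector ℤ s) → (∀ j → a j ≡ Σℤ (λ k → c k ℤ.* basis k j)) → ∀ x → embed a x ≃ combination (λ k → fromℤ (c k)) b x
      embed-basis a c a≡ x = begin
        sum {s} (λ j → fromℤ (a j) * e j x)
          ≈⟨ sum-cong-≋ {s} (λ j → trans (*-congʳ {e j x} (coefficient j)) (*-distribʳ-sum {s} (e j x) (λ k → fromℤ (c k) * fromℤ (basis k j)))) ⟩
        sum {s} (λ j → sum {s} (λ k → fromℤ (c k) * fromℤ (basis k j) * e j x))
          ≈⟨ ∑-comm {s} {s} (λ j k → fromℤ (c k) * fromℤ (basis k j) * e j x) ⟩
        sum {s} (λ k → sum {s} (λ j → fromℤ (c k) * fromℤ (basis k j) * e j x))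
          ≈⟨ sum-cong-≋ {s} (λ k → trans (sum-cong-≋ {s} (λ j → *-assoc (fromℤ (c k)) (fromℤ (basis k j)) (e j x))) (sym (*-distribˡ-sum {s} (fromℤ (c k)) (λ j → fromℤ (basis k j) * e j x)))) ⟩
        sum {s} (λ k → fromℤ (c k) * b k x) ∎
        where
        coefficient : ∀ j → fromℤ (a j) ≃ sum {s} (λ k → fromℤ (c k) * fromℤ (basis k j))
        coefficient j = trans (fromℤ≃ι (a j)) (trans (reflexive (≡.cong ι (a≡ j))) (trans (GramDeterminant.ι-sum ℝ-commutativeRing (λ k → c k ℤ.* basis k j))
          (sum-cong-≋ {s} (λ k → trans (ι-homo-* (c k) (basis k j)) (*-cong (sym (fromℤ≃ι (c k))) (sym (fromℤ≃ι (basis k j))))))))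

    latticeBasis : IsLatticeBasis Λ b
    latticeBasis = record
      { generates   = λ v → mk⇔ (to v) (from v)
      ; independent = independent
      }
      where
      to : ∀ v → Λ v → ∃ λ (c : Vector ℤ s) → v ≋ combination (λ i → fromℤ (c i)) b
      to v v∈ =
        let a , v≋ , cond = Λ⇒ v v∈
            c , a≡ = basis-generates a cond
        in c , λ x → unwrap (trans {v x} {embed a x} (wrap (v≋ x)) (embed-basis a c a≡ x))
      from : ∀ v → (∃ λ (c : Vector ℤ s) → v ≋ combination (λ i → fromℤ (c i)) b) → Λ v
      from v (c , v≋) = ⇒Λ v a (λ x → unwrap (trans {v x} {combination (λ i → fromℤ (c i)) b x} (wrap (v≋ x)) (sym (embed-basis a c (λ j → ≡.refl) x)))) (basis-conditions c)
        where
        a : Vector ℤ s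
        a j = Σℤ (λ k → c k ℤ.* basis k j)

    √p : ℝ
    √p = √ p

    √p² : √p * √p ≃ fromℚ P
    √p² = trans (wrap (proj₂ (√-isSqrt p))) (fromℤ≃ (+ p))

    0≤√p : fromℕ 0 ≤ᵣ √p
    0≤√p = proj₁ (√-isSqrt p)

    vol : ℝ
    vol = fromℚ κ * √p

    0<κ : 0ℚ ℚ.< κ
    0<κ = 0<-* (0<-^ s 0<P) (0<-^ h 0<½)

    nonneg-scale : ∀ {q r} → 0ℚ ℚ.≤ q → fromℕ 0 ≤ᵣ r → fromℕ 0 ≤ᵣ fromℚ q * r
    nonneg-scale {q} {r} 0≤q 0≤r = ≤ᵣ-resp {fromℚ 0ℚ * r} {fromℕ 0} {fromℚ q * r} {fromℚ q * r} (zeroˡ r) refl (≤ᵣ-scale {0ℚ} {q} {r} 0≤q 0≤r)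

    isVolume : IsVolume Λ vol
    isVolume = b , latticeBasis , nonneg-scale {κ} {√p} (ℚ.<⇒≤ 0<κ) 0≤√p , unwrap (begin
      fromℚ κ * √p * (fromℚ κ * √p)         ≈⟨ solve 2 (λ k r → k :* r :* (k :* r) := k :* k :* (r :* r)) refl (fromℚ κ) √p ⟩
      fromℚ κ * fromℚ κ * (√p * √p)         ≈⟨ *-congˡ {fromℚ κ * fromℚ κ} √p² ⟩
      fromℚ κ * fromℚ κ * fromℚ P           ≈⟨ pointwise (λ _ → ≡.refl) ⟩
      fromℚ (κ ℚ.* κ ℚ.* P)                 ≈⟨ sym gram-value ⟩
      det (λ i j → dot (b i) (b j))         ≡⟨ ≡.sym (det-ℝ (gram b)) ⟩
      ℝ-Ops.det (gram b)                    ∎)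

    0<vol : fromℕ 0 <ᵣ vol
    -- √p is at least 1, so its terms are eventually above ½ and those of the volume above κ/2.
    0<vol = κ ℚ.* ½ , 0<-* 0<κ 0<½ , N , λ n N≤n → ≡.subst (ℚ._< seq vol n) (≡.sym (ℚ.+-identityˡ (κ ℚ.* ½)))
        (ℚ.*-monoʳ-<-pos κ {{ℚ.positive 0<κ}} (½<√p n N≤n))
      where
      1≤√p : fromℕ 1 ≤ᵣ √p
      1≤√p = sqrt-mono {fromℕ 1} {fromℕ p} {fromℕ 1} {√p} (≤ᵣ-pointwise {fromℕ 1} {fromℕ p} (λ _ → ≡.subst (1ℚ ℚ.≤_) (≡.sym (/1≡ι (+ p))) (ι-mono-≤ (ℤ.+≤+ (ℕ.>-nonZero⁻¹ p)))))
        (≤ᵣ-pointwise {fromℕ 0} {fromℕ 1} (λ _ → ℚ.<⇒≤ 0<1ℚ) , unwrap {fromℕ 1 * fromℕ 1} {fromℕ 1} (pointwise λ _ → ≡.refl)) (√-isSqrt p)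
        where
        instance
          _ : NonZero p
          _ = prime⇒nonZero pr
      N = proj₁ (1≤√p ½ 0<½)
      ½<√p : ∀ n → N ℕ.≤ n → ½ ℚ.< seq √p n
      ½<√p n N≤n = 0<⇒< (≡.subst (0ℚ ℚ.<_) (Qs.solve 1 (λ x → (x Qs.:+ Qs.con ½) Qs.:- Qs.con 1ℚ Qs.:= x Qs.:- Qs.con ½) ≡.refl (seq √p n))
        (<⇒0< (proj₂ (1≤√p ½ 0<½) n N≤n)))

    private
      a₀ : Vector ℤ s
      a₀ = proj₁ shortest

      a₀∈ : Conditions a₀
      a₀∈ = proj₁ (proj₁ (proj₂ shortest))

      a₀≢0 : NonZeroVector a₀
      a₀≢0 = proj₂ (proj₁ (proj₂ shortest))

      N₀ : ℕ
      N₀ = ℤ.∣ Q a₀ ∣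

      Q-absolute : ∀ a → NonZeroVector a → + ℤ.∣ Q a ∣ ≡ Q a
      Q-absolute a nz = ℤ.0≤i⇒+∣i∣≡i (ℤ.<⇒≤ (Q-positive a nz))

    -- The square of half the root of 2 Q is Q / 2.
    minimalNorm : ℝ
    minimalNorm = fromℚ ½ * √ (2 ℕ.* N₀)

    minimalNorm² : minimalNorm * minimalNorm ≃ fromℚ (½ ℚ.* ιℚ (Q a₀))
    minimalNorm² = begin
      fromℚ ½ * r * (fromℚ ½ * r)             ≈⟨ solve 2 (λ k r → k :* r :* (k :* r) := k :* k :* (r :* r)) refl (fromℚ ½) r ⟩
      fromℚ ½ * fromℚ ½ * (r * r)             ≈⟨ *-congˡ {fromℚ ½ * fromℚ ½} (trans (wrap (proj₂ (√-isSqrt (2 ℕ.* N₀)))) (fromℤ≃ (+ (2 ℕ.* N₀)))) ⟩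
      fromℚ ½ * fromℚ ½ * fromℚ (ιℚ (+ (2 ℕ.* N₀))) ≈⟨ pointwise (λ _ → value) ⟩
      fromℚ (½ ℚ.* ιℚ (Q a₀))                 ∎
      where
      r = √ (2 ℕ.* N₀)
      value : ½ ℚ.* ½ ℚ.* ιℚ (+ (2 ℕ.* N₀)) ≡ ½ ℚ.* ιℚ (Q a₀)
      value = ≡.trans (≡.cong (λ t → ½ ℚ.* ½ ℚ.* t) (≡.trans (≡.cong ιℚ (ℤ.pos-* 2 N₀)) (≡.trans (ℚR.ι-homo-* (+ 2) (+ N₀)) (≡.cong (λ t → ιℚ (+ 2) ℚ.* ιℚ t) (Q-absolute a₀ a₀≢0)))))
        (Qs.solve 1 (λ x → Qs.con ½ Qs.:* Qs.con ½ Qs.:* (Qs.con (ιℚ (+ 2)) Qs.:* x) Qs.:= Qs.con ½ Qs.:* x) ≡.refl (ιℚ (Q a₀)))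

    private
      dot-cong : ∀ {v w : Vector ℝ s} → v ≋ w → dot v v ≃ dot w w
      dot-cong {v} {w} h = sum-cong-≋ {s} (λ i → *-cong {v i} {w i} {v i} {w i} (wrap (h i)) (wrap (h i)))

      embed-norm : ∀ {v a} → v ≋ embed a → dot v v ≃ fromℚ (½ ℚ.* ιℚ (Q a))
      embed-norm {v} {a} h = trans (dot-cong {v} {embed a} h) (quadratic-form a)

      minimal-isNorm : ∀ {v} → v ≋ embed a₀ → IsNorm v minimalNorm
      minimal-isNorm {v} h = nonneg-scale {½} {√ (2 ℕ.* N₀)} (ℚ.<⇒≤ 0<½) (proj₁ (√-isSqrt (2 ℕ.* N₀))) , unwrap (trans minimalNorm² (sym (embed-norm {v} {a₀} h)))

    isMinimalNorm : IsMinimalNorm Λ minimalNorm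
    isMinimalNorm = (embed a₀ , ⇒Λ (embed a₀) a₀ reflexivity a₀∈ , nonzero , minimal-isNorm {embed a₀} reflexivity) , lower
      where
      reflexivity : embed a₀ ≋ embed a₀
      reflexivity x = unwrap (refl {embed a₀ x})
      nonzero : IsNonZero (embed a₀)
      nonzero h = ℚ.<⇒≢ (0<-* 0<½ (≡.subst (λ t → 0ℚ ℚ.< ιℚ t) (Q-absolute a₀ a₀≢0) (0<ι′ N₀))) (≡.sym (fromℚ-zero (trans (sym (quadratic-form a₀))
          (sum-zero {s} _ (λ i → trans (*-congʳ {embed a₀ i} (wrap (h i))) (zeroˡ (embed a₀ i)))))))
        where
        instance
          N₀-nonZero : NonZero N₀
          N₀-nonZero = ℕ.≢-nonZero (λ N₀≡0 → ℤ.<-irrefl ≡.refl (≡.subst (0ℤ ℤ.<_) (≡.trans (≡.sym (Q-absolute a₀ a₀≢0)) (≡.cong +_ N₀≡0)) (Q-positive a₀ a₀≢0)))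
      lower : ∀ w r → Λ w → IsNonZero w → IsNorm w r → minimalNorm ≤ᵣ r
      lower w r w∈ w≢0 norm =
        let a , w≋ , cond = Λ⇒ w w∈
        in compare a w≋ cond (nonZeroVector? a)
        where
        compare : ∀ a → w ≋ embed a → Conditions a → Dec (NonZeroVector a) → minimalNorm ≤ᵣ r
        compare a w≋ cond (no none) = contradiction (λ x → unwrap (trans {w x} {embed a x} {fromℕ 0} (wrap (w≋ x))
          (sum-zero {s} _ (λ i → trans (*-congʳ {e i x} (trans (reflexive (≡.cong fromℤ (zeroVector none i))) (fromℤ≃ 0ℤ))) (zeroˡ (e i x)))))) w≢0
        compare a w≋ cond (yes nz) = sqrt-mono {dot (embed a₀) (embed a₀)} {dot w w} {minimalNorm} {r}
          (≤ᵣ-resp {fromℚ (½ ℚ.* ιℚ (Q a₀))} {dot (embed a₀) (embed a₀)} {fromℚ (½ ℚ.* ιℚ (Q a))} {dot w w} (sym (quadratic-form a₀)) (sym (embed-norm {w} {a} w≋))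
            (≤ᵣ-pointwise {fromℚ (½ ℚ.* ιℚ (Q a₀))} {fromℚ (½ ℚ.* ιℚ (Q a))} (λ _ → ℚ.*-monoˡ-≤-nonNeg ½ {{ℚ.nonNegative (ℚ.<⇒≤ 0<½)}}
              (ι-mono-≤ (≡.subst₂ ℤ._≤_ (Q-absolute a₀ a₀≢0) (Q-absolute a nz) (ℤ.+≤+ (proj₂ (proj₂ shortest) a (cond , nz))))))))
          (minimal-isNorm {embed a₀} reflexivity) norm

    ρ : ℝ
    ρ = fromℚ ½ * minimalNorm

    isPackingRadius : IsPackingRadius Λ ρ
    isPackingRadius = minimalNorm , isMinimalNorm , unwrap (refl {ρ})

    -- The square of ρ, that is Q/8 at the shortest vector. It is rational, and since s = 2h the
    -- power ρ^s is rational as well.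
    y : ℚ
    y = (½ ℚ.* ½) ℚ.* (½ ℚ.* ιℚ (Q a₀))

    ρ^s : (ρ ℝ-Ops.^ s) ≃ fromℚ (y ^ℚ h)
    ρ^s = begin
      ρ ℝ-Ops.^ s      ≡⟨ ^-ℝ ρ s ⟩
      ρ ^ s            ≡⟨ ≡.cong (ρ ^_) s≡2h ⟩
      ρ ^ (h ℕ.+ h)    ≈⟨ ^-homo-* ρ h h ⟩
      ρ ^ h * ρ ^ h    ≈⟨ sym (*-^ ρ ρ h) ⟩
      (ρ * ρ) ^ h      ≈⟨ ^-congˡ h ρ² ⟩
      fromℚ y ^ h      ≈⟨ fromℚ-^ y h ⟩
      fromℚ (y ^ℚ h)   ∎
      where
      ρ² : ρ * ρ ≃ fromℚ y
      ρ² = trans (solve 2 (λ k r → k :* r :* (k :* r) := k :* k :* (r :* r)) refl (fromℚ ½) minimalNorm)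
        (trans (*-congˡ {fromℚ ½ * fromℚ ½} minimalNorm²) (pointwise λ _ → ≡.refl))

    private
      κ⁻¹ = proj₁ (recip κ 0<κ)
      0<κ⁻¹ = proj₁ (proj₂ (recip κ 0<κ))
      κκ⁻¹ = proj₂ (proj₂ (recip κ 0<κ))
      P⁻¹ = proj₁ (recip P 0<P)
      0<P⁻¹ = proj₁ (proj₂ (recip P 0<P))
      PP⁻¹ = proj₂ (proj₂ (recip P 0<P))

    -- ρ^s divided by κ √p with the denominator rationalised: y^h / (κ p) times √p.
    coefficient : ℚ
    coefficient = y ^ℚ h ℚ.* κ⁻¹ ℚ.* P⁻¹

    δ : ℝ
    δ = fromℚ coefficient * √p

    isCenterDensity : IsCenterDensity Λ δ
    isCenterDensity = ρ , vol , isPackingRadius , isVolume , 0<vol , unwrap (begin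
      fromℚ coefficient * √p * (fromℚ κ * √p)   ≈⟨ solve 3 (λ c r k → c :* r :* (k :* r) := c :* k :* (r :* r)) refl (fromℚ coefficient) √p (fromℚ κ) ⟩
      fromℚ coefficient * fromℚ κ * (√p * √p)   ≈⟨ *-congˡ {fromℚ coefficient * fromℚ κ} √p² ⟩
      fromℚ coefficient * fromℚ κ * fromℚ P     ≈⟨ pointwise (λ _ → cancel) ⟩
      fromℚ (y ^ℚ h)                            ≈⟨ sym ρ^s ⟩
      ρ ℝ-Ops.^ s                               ∎)
      where
      cancel : coefficient ℚ.* κ ℚ.* P ≡ y ^ℚ h
      cancel = ≡.trans (ℚR.solve 5 (λ y k′ p′ k p → y ℚR.:* k′ ℚR.:* p′ ℚR.:* k ℚR.:* p ℚR.:= y ℚR.:* (k ℚR.:* k′) ℚR.:* (p ℚR.:* p′)) ≡.refl (y ^ℚ h) κ⁻¹ P⁻¹ κ P)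
        (≡.trans (≡.cong₂ (λ a b → y ^ℚ h ℚ.* a ℚ.* b) κκ⁻¹ PP⁻¹) (≡.trans (ℚ.*-identityʳ _) (ℚ.*-identityʳ _)))

    private
      -- From Q ≥ 2p² follows y ≥ (p/2)², and ((p/2)²)^h / κ = ½^h because the powers of p cancel
      -- and one of the two factors ½^h remains.
      coefficient-bound : ½ ^ℚ h ℚ.* P⁻¹ ℚ.≤ coefficient
      coefficient-bound = ℚ.*-monoʳ-≤-nonNeg P⁻¹ {{ℚ.nonNegative (ℚ.<⇒≤ 0<P⁻¹)}}
          (≡.subst (ℚ._≤ y ^ℚ h ℚ.* κ⁻¹) identity (ℚ.*-monoʳ-≤-nonNeg κ⁻¹ {{ℚ.nonNegative (ℚ.<⇒≤ 0<κ⁻¹)}} (^-mono-≤ h 0≤y₀ y₀≤y)))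
        where
        y₀ = (½ ℚ.* P) ℚ.* (½ ℚ.* P)
        0≤y₀ : 0ℚ ℚ.≤ y₀
        0≤y₀ = 0≤-square (½ ℚ.* P)
        y₀≤y : y₀ ℚ.≤ y
        y₀≤y = ≡.subst (ℚ._≤ y) lhs (ℚ.*-monoˡ-≤-nonNeg (½ ℚ.* ½) {{ℚ.nonNegative (0≤-* {½} {½} (ℚ.<⇒≤ 0<½) (ℚ.<⇒≤ 0<½))}} (ℚ.*-monoˡ-≤-nonNeg ½ {{ℚ.nonNegative (ℚ.<⇒≤ 0<½)}} (ι-mono-≤ (Q-lower-bound a₀ a₀∈ a₀≢0))))
          where
          lhs : (½ ℚ.* ½) ℚ.* (½ ℚ.* ιℚ (+ 2 ℤ.* (+ p ℤ.* + p))) ≡ y₀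
          lhs = ≡.trans (≡.cong (λ t → (½ ℚ.* ½) ℚ.* (½ ℚ.* t)) (≡.trans (ℚR.ι-homo-* (+ 2) (+ p ℤ.* + p)) (≡.cong (ιℚ (+ 2) ℚ.*_) (ℚR.ι-homo-* (+ p) (+ p)))))
            (Qs.solve 1 (λ P → (Qs.con ½ Qs.:* Qs.con ½) Qs.:* (Qs.con ½ Qs.:* (Qs.con (ιℚ (+ 2)) Qs.:* (P Qs.:* P))) Qs.:= (Qs.con ½ Qs.:* P) Qs.:* (Qs.con ½ Qs.:* P)) ≡.refl P)
        identity : y₀ ^ℚ h ℚ.* κ⁻¹ ≡ ½ ^ℚ h
        identity = ≡.trans (≡.cong (ℚ._* κ⁻¹) (≡.trans (ℚR.*-^ (½ ℚ.* P) (½ ℚ.* P) h) (≡.cong (λ t → t ℚ.* t) (ℚR.*-^ ½ P h))))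
          (≡.trans (ℚR.solve 3 (λ a b k → (a ℚR.:* b) ℚR.:* (a ℚR.:* b) ℚR.:* k ℚR.:= a ℚR.:* ((b ℚR.:* b) ℚR.:* a ℚR.:* k)) ≡.refl (½ ^ℚ h) (P ^ℚ h) κ⁻¹)
            (≡.trans (≡.cong (λ t → ½ ^ℚ h ℚ.* (t ℚ.* ½ ^ℚ h ℚ.* κ⁻¹)) (≡.sym (≡.trans (≡.cong (P ^ℚ_) s≡2h) (ℚR.^-homo-* P h h))))
              (≡.trans (≡.cong (½ ^ℚ h ℚ.*_) κκ⁻¹) (ℚ.*-identityʳ (½ ^ℚ h)))))

    -- Any such c equals (½^h / p) √p after rationalising, so c and δ are rational multiples of the
    -- same √p and only the coefficients need comparing.
    density-bound : ∀ r c → IsSqrt (fromℕ p) r → IsQuotient (fromℕ 1) (fromℕ (2 ℕ.^ h) *ᵣ r) c → c ≤ᵣ δ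
    density-bound r c sqrt (_ , quotient) = ≤ᵣ-resp {fromℚ (½ ^ℚ h ℚ.* P⁻¹) * √p} {c} {δ} {δ} c≃ refl (≤ᵣ-scale {½ ^ℚ h ℚ.* P⁻¹} {coefficient} {√p} coefficient-bound 0≤√p)
      where
      T = ιℚ (+ (2 ℕ.^ h))
      r≃√p : r ≃ √p
      r≃√p = sqrt-unique {fromℕ p} {r} {√p} sqrt (√-isSqrt p)
      ½T : ∀ h → ½ ^ℚ h ℚ.* ιℚ (+ (2 ℕ.^ h)) ≡ 1ℚ
      ½T zero    = ≡.refl
      ½T (suc h) = ≡.trans (≡.cong (½ ^ℚ suc h ℚ.*_) (≡.trans (≡.cong ιℚ (ℤ.pos-* 2 (2 ℕ.^ h))) (ℚR.ι-homo-* (+ 2) (+ (2 ℕ.^ h)))))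
        (≡.trans (ℚR.solve 4 (λ a b c d → a ℚR.:* b ℚR.:* (c ℚR.:* d) ℚR.:= (a ℚR.:* c) ℚR.:* (b ℚR.:* d)) ≡.refl ½ (½ ^ℚ h) (ιℚ (+ 2)) (ιℚ (+ (2 ℕ.^ h))))
          (≡.trans (≡.cong ((½ ℚ.* ιℚ (+ 2)) ℚ.*_) (½T h)) ≡.refl))
      cTr≃1 : c * (fromℚ T * √p) ≃ 1#
      cTr≃1 = trans (*-congˡ {c} (*-cong {fromℚ T} {fromℕ (2 ℕ.^ h)} (sym (fromℤ≃ (+ (2 ℕ.^ h)))) (sym r≃√p))) (trans (wrap {c * (fromℕ (2 ℕ.^ h) * r)} {fromℕ 1} quotient) (pointwise λ _ → ≡.refl))
      c≃ : fromℚ (½ ^ℚ h ℚ.* P⁻¹) * √p ≃ c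
      c≃ = begin
        k * √p                            ≈⟨ sym (*-identityʳ (k * √p)) ⟩
        k * √p * 1#                       ≈⟨ *-congˡ {k * √p} (sym cTr≃1) ⟩
        k * √p * (c * (fromℚ T * √p))     ≈⟨ solve 4 (λ k r c t → k :* r :* (c :* (t :* r)) := k :* t :* (r :* r) :* c) refl k √p c (fromℚ T) ⟩
        k * fromℚ T * (√p * √p) * c       ≈⟨ *-congʳ {c} (trans (*-congˡ {k * fromℚ T} √p²) (pointwise λ _ → cancel)) ⟩
        1# * c                            ≈⟨ *-identityˡ c ⟩
        c                                 ∎
        where
        k = fromℚ (½ ^ℚ h ℚ.* P⁻¹)
        cancel : ½ ^ℚ h ℚ.* P⁻¹ ℚ.* T ℚ.* P ≡ 1ℚ
        cancel = ≡.trans (ℚR.solve 4 (λ a p′ t p → a ℚR.:* p′ ℚR.:* t ℚR.:* p ℚR.:= (a ℚR.:* t) ℚR.:* (p ℚR.:* p′)) ≡.refl (½ ^ℚ h) P⁻¹ T P) (≡.cong₂ ℚ._*_ (½T h) PP⁻¹)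

-- The canonical embedding lands in dimension r₁ + 2r₂, which equals s only by a proof. Leaving the
-- dimension n free until that proof is matched avoids transporting vectors. The conditions are
-- likewise abstract, and are here translated between divisibility of dot products and congruences
-- of spectra.
density : ∀ (p : ℕ) (pr : Prime p) (s h m m′ : ℕ) → s ≡ h ℕ.+ h → m ℕ.* s ≡ p ∸ 1 → m ≡ suc (m′ ℕ.+ m′) →
  (α : ℤ) (ord : Units.HasOrder p pr α s) →
  ∀ {n} → n ≡ s → (e : Fin s → Vector ℝ n) →
  (∀ i → dot (e i) (e i) +ᵣ dot (e i) (e i) ≃ ℝR.ι (+ p) +ᵣ -ᵣ ℝR.ι (+ m)) →
  (∀ {i j} → i ≢ j → dot (e i) (e j) +ᵣ dot (e i) (e j) ≃ -ᵣ ℝR.ι (+ m)) →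
  (Λ : Vector ℝ n → Set) (Conditions : Vector ℤ s → Set) →
  (∀ a → Conditions a → ∀ i → i ℕ.≤ h → + p ℤ.∣ dotℤ a (μ s α i)) →
  (∀ a → (∀ i → i ℕ.≤ h → + p ℤ.∣ dotℤ a (μ s α i)) → Conditions a) →
  (∀ v → Λ v → ∃ λ a → v ≋ combination (λ i → fromℤ (a i)) e × Conditions a) →
  (∀ v a → v ≋ combination (λ i → fromℤ (a i)) e → Conditions a → Λ v) →
  ∃ λ δ → IsCenterDensity Λ δ ×
    (∀ r c → IsSqrt (fromℕ p) r → IsQuotient (fromℕ 1) (fromℕ (2 ℕ.^ h) *ᵣ r) c → c ≤ᵣ δ)
density p pr s h m m′ s≡2h ms≡p-1 m≡1+2m′ α ord ≡.refl e diagonal off-diagonal Λ Conditions cond⇒ ⇒cond Λ⇒ ⇒Λ =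
  D.δ to from , D.isCenterDensity to from , D.density-bound to from
  where
  module D = Density p pr s h m m′ s≡2h ms≡p-1 m≡1+2m′ α ord e diagonal off-diagonal Λ
  module C = CodeLattice p pr s h m m′ s≡2h ms≡p-1 m≡1+2m′ α ord
  open Units p pr using (^≡; ∣⇒≡ₚ0; ≡ₚ0⇒∣)
  spectrum≡ : ∀ a i → dotℤ a (μ s α i) ≡ C.spectrum a i
  spectrum≡ a i = ℤR.sum-cong-≋ {s} (λ j → ≡.cong (a j ℤ.*_) (^≡ α (toℕ j ℕ.* i)))
  to : ∀ v → Λ v → ∃ λ a → v ≋ D.embed a × C.Conditions a
  to v v∈ =
    let a , v≋ , cond = Λ⇒ v v∈
    in a , v≋ , λ i i≤h → ∣⇒≡ₚ0 {C.spectrum a i} (≡.subst (+ p ℤ.∣_) (spectrum≡ a i) (cond⇒ a cond i i≤h))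
  from : ∀ v a → v ≋ D.embed a → C.Conditions a → Λ v
  from v a v≋ cond = ⇒Λ v a v≋ (⇒cond a λ i i≤h → ≡.subst (+ p ℤ.∣_) (≡.sym (spectrum≡ a i)) (≡ₚ0⇒∣ {C.spectrum a i} (cond i i≤h)))

odd-decomposition : ∀ m → ¬ 2 ℕ.∣ m → m ≡ suc (m ℕ./ 2 ℕ.+ m ℕ./ 2)
odd-decomposition m odd = by-remainder (m ℕ.% 2) ≡.refl (ℕ.m%n<n m 2)
  where
  by-remainder : ∀ r → m ℕ.% 2 ≡ r → r ℕ.< 2 → m ≡ suc (m ℕ./ 2 ℕ.+ m ℕ./ 2)
  by-remainder zero          e _ = contradiction (ℕ.m%n≡0⇒n∣m m 2 e) odd
  by-remainder (suc zero)    e _ = ≡.trans (ℕ.m≡m%n+[m/n]*n m 2) (≡.cong₂ ℕ._+_ e (twice (m ℕ./ 2)))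
    where
    twice : ∀ n → n ℕ.* 2 ≡ n ℕ.+ n
    twice n = ≡.trans (ℕ.*-comm n 2) (≡.cong (n ℕ.+_) (ℕ.+-identityʳ n))
  by-remainder (suc (suc r)) _ (s≤s (s≤s ()))

open import Data.Nat.Base using (_^_)
open import Data.Nat.DivMod using (_/_)
open import Data.Nat.Divisibility using (_∣_)

mainTheorem5 : ∀ (p s : ℕ) .{{_ : NonZero s}} → Prime p →
    s ∣ p ∸ 1 → 2 ∣ s → ¬ (2 ∣ (p ∸ 1) / s) →
    (ζ : ℂ) → IsPrimitiveRootOfUnity p ζ →
    (K : Subfield) → K ⊆ ℚ⟨ ζ ⟩ → HasDegree K s →
    (u : ℤ) → GeneratesUnits p u →
    (σᵤ : Subfield.Element ℚ⟨ ζ ⟩ → Subfield.Element ℚ⟨ ζ ⟩) → IsAutomorphism ℚ⟨ ζ ⟩ σᵤ →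
    IsIntegerPower ζ u (proj₁ (σᵤ (generator ζ))) →
    (θ : Subfield.Element K → Subfield.Element K) → IsRestriction ℚ⟨ ζ ⟩ K σᵤ θ →
    (t : Subfield.Element K) → IsTrace ℚ⟨ ζ ⟩ K (generator ζ) (proj₁ t) →
    (β : ℤ) → HasOrderModulo p β (p ∸ 1) →
    (E : CanonicalEmbedding K s) →
    ∃ λ (δ : ℝ) →
    IsCenterDensity (CanonicalEmbedding.image E (𝓜 p s K θ t (β ℤ.^ ((p ∸ 1) / s)))) δ
    × (∀ (r c : ℝ) → IsSqrt (fromℕ p) r → IsQuotient (fromℕ 1) (fromℕ (2 ^ (s / 2)) *ᵣ r) c → c ≤ᵣ δ)
mainTheorem5 p s pr s∣p-1 2∣s m-odd ζ primitiveζ K K⊆L hasDegree u (p∤u , generates) σᵤ automorphism σᵤ-power θ restriction t trace β (p∣βⁿ-1 , minimal) E =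
  density p pr s h G.m m′ s≡2h ms≡p-1 m≡1+2m′ α α-order (C.dimension h m′ s≡d d≡2h m≡1+2m′) (C.e h m′ s≡d d≡2h m≡1+2m′)
    (λ i → C.gram-diagonal h m′ s≡d d≡2h m≡1+2m′ (toℕ i))
    (λ {i} {j} i≢j → C.gram-off h m′ s≡d d≡2h m≡1+2m′ (Fin.toℕ<n i) (Fin.toℕ<n j) (λ e → i≢j (Fin.toℕ-injective e)))
    (CanonicalEmbedding.image E (𝓜 p s K θ t α)) (C.Conditions h m′ s≡d d≡2h m≡1+2m′ α) (λ a cond → cond) (λ a cond → cond)
    (C.image⇒ h m′ s≡d d≡2h m≡1+2m′ α) (C.⇒image h m′ s≡d d≡2h m≡1+2m′ α)
  where
  open Units p pr
  module M = ℤ/pR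
  h = s / 2
  m = (p ∸ 1) / s
  α = β ℤ.^ m
  m*s≡p-1 : m ℕ.* s ≡ p ∸ 1
  m*s≡p-1 = ℕ.m/n*n≡m s∣p-1
  β-order : HasOrder β (p ∸ 1)
  β-order = M.trans (M.reflexive (≡.sym (^≡ β (p ∸ 1)))) (∣⇒≡ₚ {β ℤ.^ (p ∸ 1)} {1ℤ} p∣βⁿ-1)
    , λ j 0<j j<n e → minimal j 0<j j<n (≡ₚ⇒∣ {β ℤ.^ j} {1ℤ} (M.trans (M.reflexive (^≡ β j)) e))
  u-unit : Unit u
  u-unit e = p∤u (≡ₚ0⇒∣ {u} e)
  u-order : HasOrder u (p ∸ 1)
  u-order = generator-order {β} {u} (order-unit {β} {p ∸ 1} (proj₁ β-order)) β-order u-unit λ a ua →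
    let j , d = generates a (λ p∣a → ua (∣⇒≡ₚ0 {a} p∣a))
    in j , M.trans (∣⇒≡ₚ {a} {u ℤ.^ j} d) (M.reflexive (^≡ u j))
  α^ : ∀ j → α M.^ j ≡ₚ β M.^ (m ℕ.* j)
  α^ j = M.trans (M.^-congˡ j (M.reflexive (^≡ β m))) (M.^-assocʳ β m j)
  0<m : 0 ℕ.< m
  0<m = ℕ.n≢0⇒n>0 λ m≡0 → ℕ.≢-nonZero⁻¹ (p ∸ 1) (≡.trans (≡.sym m*s≡p-1) (≡.cong (ℕ._* s) m≡0))
  α-order : HasOrder α s
  α-order = M.trans (α^ s) (M.trans (M.^-congʳ β m*s≡p-1) (proj₁ β-order)) , λ j 0<j j<s e →
    proj₂ β-order (m ℕ.* j) (ℕ.*-mono-< 0<m 0<j)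
      (≡.subst (m ℕ.* j ℕ.<_) m*s≡p-1 (ℕ.*-monoʳ-< m {{ℕ.>-nonZero 0<m}} j<s)) (M.trans (M.sym (α^ j)) e)
  module G = Galois p pr ζ primitiveζ u u-unit u-order σᵤ automorphism σᵤ-power K K⊆L θ restriction t trace
  module C = Canonical p pr ζ primitiveζ u u-unit u-order σᵤ automorphism σᵤ-power K K⊆L θ restriction t trace s E
  -- Identifies the least period found by Galois theory with the degree, so that results about `G.d`
  -- and `G.m` become results about s and (p - 1)/s.
  s≡d : s ≡ G.d
  s≡d = G.degree hasDegree
  ms≡p-1 : G.m ℕ.* s ≡ p ∸ 1
  ms≡p-1 = ≡.trans (≡.cong (G.m ℕ.*_) s≡d) G.md≡p-1
  Gm≡m : G.m ≡ m
  Gm≡m = ℕ.*-cancelʳ-≡ G.m m s (≡.trans ms≡p-1 (≡.sym m*s≡p-1))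
  m′ = m / 2
  m≡1+2m′ : G.m ≡ suc (m′ ℕ.+ m′)
  m≡1+2m′ = ≡.trans Gm≡m (odd-decomposition m m-odd)
  s≡2h : s ≡ h ℕ.+ h
  s≡2h = ≡.trans (≡.sym (ℕ.m/n*n≡m 2∣s)) (≡.trans (ℕ.*-comm h 2) (≡.cong (h ℕ.+_) (ℕ.+-identityʳ h)))
  d≡2h : G.d ≡ h ℕ.+ h
  d≡2h = ≡.trans (≡.sym s≡d) s≡2h
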